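{- Let $G$ be a simple planar graph with at most one triangle that contains a vertex of degree at least $2$ whose neighborhood is an independent set. Then $G$ admits an adynamic $3$-coloring.
   Context: A triangle is a subgraph isomorphic to $K_3$. An adynamic coloring of a graph $G$ is a proper vertex coloring of $G$ such that for at least one vertex of degree at least $2$, all of its neighbors receive the same color. An adynamic $3$-coloring is an adynamic coloring using at most $3$ colors. -}

module Defs where

open import Data.Nat using (ℕ; zero; suc; _+_; _*_; _≤_; _<_; _≤ᵇ_; _<ᵇ_)
open import Data.Fin using (Fin; toℕ)
open import Data.Bool using (Bool; true; false; _∧_; _∨_; not; if_then_else_)
open import Data.List using (List; []; _∷_; length; filterᵇ; cartesianProduct; upTo; allFin; map)
open import Data.Bool.ListAction using (all; any)
open import Data.Nat.ListAction using (sum)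
open import Data.Product using (_×_; _,_; Σ; ∃; ∃-syntax)
open import Relation.Binary.PropositionalEquality using (_≡_; _≢_)
open import Function using (_∘_)

record SimpleGraph (n : ℕ) : Set where
  field
    adj    : Fin n → Fin n → Bool
    sym    : ∀ u v → adj u v ≡ adj v u
    irrefl : ∀ v → adj v v ≡ false
open SimpleGraph public

countᵇ : {A : Set} → (A → Bool) → List A → ℕ
countᵇ p xs = length (filterᵇ p xs)

iterate : {A : Set} → ℕ → (A → A) → A → A
iterate zero    f x = x
iterate (suc k) f x = f (iterate k f x)

module _ {n : ℕ} (G : SimpleGraph n) where

  vertices : List (Fin n)
  vertices = allFin n

  pairs : List (Fin n × Fin n)
  pairs = cartesianProduct vertices vertices

  deg : Fin n → ℕ
  deg v = countᵇ (adj G v) vertices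

  numEdges : ℕ
  numEdges = countᵇ (λ { (u , v) → adj G u v ∧ (toℕ u <ᵇ toℕ v) }) pairs

  reach : ℕ → Fin n → Fin n → Bool
  reach zero    u v = toℕ u Data.Nat.≡ᵇ toℕ v
  reach (suc k) u v = reach k u v ∨ any (λ w → reach k u w ∧ adj G w v) vertices

  isComponentRep : Fin n → Bool
  isComponentRep v = all (λ u → not (reach n v u) ∨ (toℕ v ≤ᵇ toℕ u)) vertices

  eulerTarget : ℕ
  eulerTarget = sum (map (λ v → if isComponentRep v
                                 then (if deg v Data.Nat.≡ᵇ 0 then 1 else 2)
                                 else 0) vertices)

  -- Combinatorial embeddings (rotation systems)
  -- ρ u v is the neighbour of u following v in the cyclic order around u.
  IsRotationSystem : (Fin n → Fin n → Fin n) → Set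
  IsRotationSystem ρ =
    (∀ u v → adj G u v ≡ true → adj G u (ρ u v) ≡ true) ×
    (∀ u v w → adj G u v ≡ true → adj G u w ≡ true →
       ∃[ k ] iterate k (ρ u) v ≡ w)

  faceStep : (Fin n → Fin n → Fin n) → Fin n × Fin n → Fin n × Fin n
  faceStep ρ (u , v) = (v , ρ v u)

  dartKey : Fin n × Fin n → ℕ
  dartKey (u , v) = toℕ u * n + toℕ v

  -- a dart is the minimal dart of its face orbit (orbits have length ≤ n * n)
  isOrbitMin : (Fin n → Fin n → Fin n) → Fin n × Fin n → Bool
  isOrbitMin ρ d = all (λ k → dartKey d ≤ᵇ dartKey (iterate k (faceStep ρ) d)) (upTo (n * n))

  numFaces : (Fin n → Fin n → Fin n) → ℕ
  numFaces ρ = countᵇ (λ { (u , v) → adj G u v ∧ isOrbitMin ρ (u , v) }) pairs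

  -- G is planar iff it has a rotation system of genus 0 on every component, i.e.
  -- V - E + F = 2·(#components with an edge) + (#isolated vertices)
  Planar : Set
  Planar = Σ (Fin n → Fin n → Fin n) λ ρ →
             IsRotationSystem ρ × (n + numFaces ρ ≡ numEdges + eulerTarget)

  -- Triangles: subgraphs isomorphic to K₃, i.e. 3 pairwise adjacent vertices,
  -- listed in increasing order so that each triangle is represented once.
  IsTriangle : Fin n × Fin n × Fin n → Set
  IsTriangle (a , b , c) =
    toℕ a < toℕ b × toℕ b < toℕ c ×
    adj G a b ≡ true × adj G b c ≡ true × adj G a c ≡ true

  AtMostOneTriangle : Set
  AtMostOneTriangle = ∀ t s → IsTriangle t → IsTriangle s → t ≡ s

  HasIndependentNbhdVertex : Set
  HasIndependentNbhdVertex = ∃[ v ] (2 ≤ deg v ×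
    (∀ u w → adj G v u ≡ true → adj G v w ≡ true → adj G u w ≡ false))

  IsProperColoring : {k : ℕ} → (Fin n → Fin k) → Set
  IsProperColoring c = ∀ u v → adj G u v ≡ true → c u ≢ c v

  IsAdynamicColoring : {k : ℕ} → (Fin n → Fin k) → Set
  IsAdynamicColoring c = IsProperColoring c ×
    ∃[ v ] (2 ≤ deg v × (∀ u w → adj G v u ≡ true → adj G v w ≡ true → c u ≡ c w))

  HasAdynamic3Coloring : Set
  HasAdynamic3Coloring = Σ (Fin n → Fin 3) IsAdynamicColoring

-- Induction on the number of edges.  Two facts drive the proof: in a triangle-free planar graph the
-- neighbourhood of a vertex of degree at most 3 can be made monochromatic, and every colouring of a
-- 4-cycle of a planar graph with at most one triangle extends to the graph.  Together they settle
-- triangle-free graphs and graphs with a separating 4-cycle; in a 4-cycle bounding a face two opposite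
-- corners can be identified without creating a second triangle.
-- Without 4-cycles, consider the potential 5|A| - 3e(A).  By the Kostochka-Yancey bound for 4-critical
-- graphs, a colouring of R that does not extend forces a superset of much smaller potential, while
-- Euler's formula bounds potentials from below.  This settles vertices of degree 2 off the triangle.
-- If there are none, discharging yields a 5-face with four consecutive vertices of degree 3; if neither
-- of its two outer cubic vertices can be given a monochromatic neighbourhood, each of them yields a set
-- of small potential, and submodularity applied to the two sets contradicts the lower bound.
-- Planarity is used in an algebraic form (faces as classes of darts, cycles as boundaries) that is
-- stable under deletions and identifications; it is extracted from the rotation system by splitting
-- the edges into a spanning forest and a cotree, which Euler's formula makes independent in the dual.

module Submission where

open import Defs renaming (sym to adj-sym; irrefl to adj-irr)
open import Algebra.Bundles using (CommutativeRing)
import Algebra.Properties.CommutativeMonoid.Sum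
open import Data.Bool using (Bool; true; false; _∧_; _∨_; not; if_then_else_; _xor_) renaming (T to IsTrue)
open import Data.Bool.ListAction using () renaming (all to allᵇ; any to anyᵇ)
import Data.Bool.Properties
open import Data.Empty using (⊥; ⊥-elim)
open import Data.Fin using (Fin; zero; suc; toℕ; fromℕ<; combine; remQuot; _≟_)
import Data.Fin.Properties
open import Data.List using (List; []; _∷_; length; filterᵇ; allFin; tabulate; map; _++_; cartesianProduct; upTo)
open import Data.List.Membership.Propositional using (_∈_)
open import Data.List.Membership.Propositional.Properties using (∈-upTo⁺)
open import Data.List.Relation.Unary.All using (All; []; _∷_)
import Data.List.Relation.Unary.All
open import Data.List.Relation.Unary.AllPairs using (AllPairs; []; _∷_)
open import Data.List.Relation.Unary.Any using (Any; here; there)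
open import Data.Nat using (ℕ; zero; suc; _+_; _*_; _≤_; _<_; z≤n; s≤s; _≤?_; _<ᵇ_; _≤ᵇ_; _≡ᵇ_)
import Data.Nat.Base
open import Data.Nat.DivMod using (_%_; _/_; m≡m%n+[m/n]*n; m%n<n)
open import Data.Nat.ListAction using () renaming (sum to sumᴸ)
import Data.Nat.Properties
open import Data.Nat.Tactic.RingSolver using (solve-∀)
open import Data.Product using (Σ; ∃; _×_; _,_; proj₁; proj₂)
open import Data.Sum using (_⊎_; inj₁; inj₂)
open import Data.Unit using (⊤; tt)
open import Function using (_∘_; id; case_of_)
open import Relation.Binary.Definitions using (tri<; tri≈; tri>)
open import Relation.Binary.PropositionalEquality using (_≡_; _≢_; refl; sym; trans; cong; cong₂; subst; subst₂; _≗_)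
open import Relation.Nullary using (¬_; Dec; yes; no; does)
open import Relation.Nullary.Decidable using (map′; _×-dec_; _⊎-dec_; _→-dec_; ¬?; decidable-stable)

-- Write p(A) = 5|A| - 3e(A). By the Kostochka-Yancey bound a graph that is not 3-colourable
-- contains a set with p at most 2, and a colouring of R that does not extend costs at least 3.
-- Against this, Euler's formula gives p at least 10 for planar graphs of girth 5 on four or more
-- vertices; a single triangle lowers this to 7, because one edge is deleted to destroy it. A star
-- with d leaves has p = 5 + 2d, so a failure to give its leaves one colour leads to p at most 2 +
-- 2d. For d = 3 this is 8 < 10, enough without triangles; for d = 2 it is 6 < 7, enough with one
-- triangle; for d = 3 and one triangle it is too large. This gap is the obstacle behind the
-- pentagon: two failing stars give two sets with p at most 8, both containing the triangle, and an
-- edge between their differences makes submodularity strict by 3, so that 8 + 8 - 3 < 7 + 7. In the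
-- code all of this is doubled: 2, 3, 7, 10 become 4, 6, 14, 20.

module ℕₚ = Data.Nat.Properties
module Finₚ = Data.Fin.Properties
module Boolₚ = Data.Bool.Properties
module Allₚ = Data.List.Relation.Unary.All
module NatSum = Algebra.Properties.CommutativeMonoid.Sum ℕₚ.+-0-commutativeMonoid
module XorSum = Algebra.Properties.CommutativeMonoid.Sum (CommutativeRing.+-commutativeMonoid Boolₚ.xor-∧-commutativeRing)

-- Finite sums and counting

-- Linear arithmetic by certificates: `A ≤ B` is a nonnegative combination of known inequalities,
-- `k` is the slack, and the remaining identity is left to the ring solver. With `x = 1` and `y = 0`
-- the combination is refuted. The numbered identities (`ky-1`, `len-1`, `dis-1` and so on) are such
-- certificates.
farkas : ∀ {x y A B} k → A ≤ B → x + B + k ≡ y + A → x ≤ y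
farkas {x} {y} {A} {B} k h e = ℕₚ.+-cancelʳ-≤ A x y (ℕₚ.≤-trans (ℕₚ.+-monoʳ-≤ x h)
  (ℕₚ.≤-trans (ℕₚ.m≤m+n (x + B) k) (ℕₚ.≤-reflexive e)))

∧-t : ∀ {a b} → a ∧ b ≡ true → (a ≡ true) × (b ≡ true)
∧-t {true} {true} _ = refl , refl

∧-i : ∀ {a b} → a ≡ true → b ≡ true → a ∧ b ≡ true
∧-i refl refl = refl

∨-t : ∀ {a b} → a ∨ b ≡ true → (a ≡ true) ⊎ (b ≡ true)
∨-t {true} _ = inj₁ refl
∨-t {false} e = inj₂ e

∨-il : ∀ {a b} → a ≡ true → a ∨ b ≡ true
∨-il refl = refl

∨-ir : ∀ {a b} → b ≡ true → a ∨ b ≡ true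
∨-ir {true} refl = refl
∨-ir {false} refl = refl

∨-f : ∀ {a b} → a ≡ false → b ≡ false → a ∨ b ≡ false
∨-f refl refl = refl

bcase : ∀ b → (b ≡ true) ⊎ (b ≡ false)
bcase true = inj₁ refl
bcase false = inj₂ refl

tf : ∀ {b} {A : Set} → b ≡ true → b ≡ false → A
tf refl ()

not-t→f : ∀ {b} → ¬ (b ≡ true) → b ≡ false
not-t→f {true} h = ⊥-elim (h refl)
not-t→f {false} h = refl

b-ext : ∀ {a b} → (a ≡ true → b ≡ true) → (b ≡ true → a ≡ true) → a ≡ b
b-ext {true} {b} f g = sym (f refl)
b-ext {false} {true} f g = g refl
b-ext {false} {false} f g = refl

_≟b_ : (a b : Bool) → Dec (a ≡ b)
_≟b_ = Data.Bool.Properties._≟_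

𝟙 : Bool → ℕ
𝟙 true = 1
𝟙 false = 0

𝟙-mono : ∀ {a b} → (a ≡ true → b ≡ true) → 𝟙 a ≤ 𝟙 b
𝟙-mono {false} h = z≤n
𝟙-mono {true} h rewrite h refl = ℕₚ.≤-refl

infix 7 _==_
_==_ : ∀ {n} → Fin n → Fin n → Bool
zero == zero = true
zero == suc j = false
suc i == zero = false
suc i == suc j = i == j

==-refl : ∀ {n} (i : Fin n) → (i == i) ≡ true
==-refl zero = refl
==-refl (suc i) = ==-refl i

==→≡ : ∀ {n} {i j : Fin n} → (i == j) ≡ true → i ≡ j
==→≡ {i = zero} {zero} e = refl
==→≡ {i = suc i} {suc j} e = cong suc (==→≡ e)

≢→== : ∀ {n} {i j : Fin n} → i ≢ j → (i == j) ≡ false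
≢→== h = not-t→f (h ∘ ==→≡)

==-sym : ∀ {n} (i j : Fin n) → (i == j) ≡ (j == i)
==-sym i j = b-ext (λ e → trans (cong (j ==_) (==→≡ e)) (==-refl j)) (λ e → trans (cong (i ==_) (==→≡ e)) (==-refl i))

∑ : ∀ {n} → (Fin n → ℕ) → ℕ
∑ = NatSum.sum

∑₂ : ∀ {m n} → (Fin m → Fin n → ℕ) → ℕ
∑₂ f = ∑ λ u → ∑ (f u)

∑-cong : ∀ {n} {f g : Fin n → ℕ} → (∀ i → f i ≡ g i) → ∑ f ≡ ∑ g
∑-cong = NatSum.sum-cong-≗

∑-mono : ∀ {n} {f g : Fin n → ℕ} → (∀ i → f i ≤ g i) → ∑ f ≤ ∑ g
∑-mono {zero} h = z≤n
∑-mono {suc n} h = ℕₚ.+-mono-≤ (h zero) (∑-mono (h ∘ suc))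

∑-+ : ∀ {n} (f g : Fin n → ℕ) → ∑ (λ i → f i + g i) ≡ ∑ f + ∑ g
∑-+ = NatSum.∑-distrib-+

∑-* : ∀ {n} c (f : Fin n → ℕ) → ∑ (λ i → c * f i) ≡ c * ∑ f
∑-* {zero} c f = sym (ℕₚ.*-zeroʳ c)
∑-* {suc n} c f = trans (cong (c * f zero +_) (∑-* c (f ∘ suc))) (sym (ℕₚ.*-distribˡ-+ c (f zero) _))

∑-0 : ∀ n → ∑ {n} (λ _ → 0) ≡ 0
∑-0 = NatSum.sum-replicate-zero

∑-z : ∀ {n} {f : Fin n → ℕ} → (∀ i → f i ≡ 0) → ∑ f ≡ 0
∑-z {n} h = trans (∑-cong h) (∑-0 n)

∑-swap : ∀ {m n} (f : Fin m → Fin n → ℕ) → ∑₂ f ≡ ∑₂ (λ v u → f u v)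
∑-swap = NatSum.∑-comm

∑₂-cong : ∀ {m n} {f g : Fin m → Fin n → ℕ} → (∀ i j → f i j ≡ g i j) → ∑₂ f ≡ ∑₂ g
∑₂-cong h = ∑-cong λ i → ∑-cong (h i)

∑₂-mono : ∀ {m n} {f g : Fin m → Fin n → ℕ} → (∀ i j → f i j ≤ g i j) → ∑₂ f ≤ ∑₂ g
∑₂-mono h = ∑-mono λ i → ∑-mono (h i)

∑₂-+ : ∀ {m n} (f g : Fin m → Fin n → ℕ) → ∑₂ (λ i j → f i j + g i j) ≡ ∑₂ f + ∑₂ g
∑₂-+ f g = trans (∑-cong λ i → ∑-+ (f i) (g i)) (∑-+ (λ i → ∑ (f i)) (λ i → ∑ (g i)))

infixl 6 _∖_
_∖_ : ∀ {n} → (Fin n → ℕ) → Fin n → Fin n → ℕ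
(f ∖ x) i = if i == x then 0 else f i

∑-split : ∀ {n} (f : Fin n → ℕ) x → ∑ f ≡ f x + ∑ (f ∖ x)
∑-split f zero = refl
∑-split f (suc x) = trans (cong (f zero +_) (∑-split (f ∘ suc) x)) (lem (f zero) (f (suc x)) _)
  where lem : ∀ a b c → a + (b + c) ≡ b + (a + c)
        lem = solve-∀

∑-δ : ∀ {n} (c : ℕ) (x : Fin n) → ∑ (λ i → if i == x then c else 0) ≡ c
∑-δ c x = trans (∑-split (λ i → if i == x then c else 0) x) (trans (cong₂ _+_ (h (x == x) (==-refl x)) (∑-z k)) (ℕₚ.+-identityʳ c))
  where h : ∀ b → b ≡ true → (if b then c else 0) ≡ c
        h true _ = refl
        k : ∀ i → (if i == x then 0 else (if i == x then c else 0)) ≡ 0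
        k i with i == x
        ... | true = refl
        ... | false = refl

∑-≥ : ∀ {n} (f : Fin n → ℕ) x → f x ≤ ∑ f
∑-≥ f x = ℕₚ.≤-trans (ℕₚ.m≤m+n (f x) _) (ℕₚ.≤-reflexive (sym (∑-split f x)))

∑L : ∀ {A : Set} → (A → ℕ) → List A → ℕ
∑L f [] = 0
∑L f (x ∷ xs) = f x + ∑L f xs

Unique : ∀ {n} → List (Fin n) → Set
Unique = AllPairs _≢_

∑-pick : ∀ {n} (f : Fin n → ℕ) {xs} → Unique xs → ∑L f xs ≤ ∑ f
∑-pick f [] = z≤n
∑-pick f {x ∷ xs} (h ∷ hs) = ℕₚ.≤-trans (ℕₚ.+-monoʳ-≤ (f x) (ℕₚ.≤-trans (ℕₚ.≤-reflexive (same h)) (∑-pick (f ∖ x) hs)))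
    (ℕₚ.≤-reflexive (sym (∑-split f x)))
  where same : ∀ {ys} → All (x ≢_) ys → ∑L f ys ≡ ∑L (f ∖ x) ys
        same [] = refl
        same {y ∷ ys} (p ∷ ps) rewrite ≢→== (p ∘ sym) = cong (f y +_) (same ps)

Pair : ℕ → Set
Pair n = Fin n × Fin n

Apart : ∀ {n} → Pair n → Pair n → Set
Apart (a , b) (c , d) = ¬ (c ≡ a × d ≡ b) × ¬ (c ≡ b × d ≡ a)

isE : ∀ {n} → Fin n → Fin n → Fin n → Fin n → Bool
isE a b u v = (u == a ∧ v == b) ∨ (u == b ∧ v == a)

isE-t : ∀ {n} (a b u v : Fin n) → isE a b u v ≡ true → (u ≡ a × v ≡ b) ⊎ (u ≡ b × v ≡ a)
isE-t a b u v e with ∨-t {u == a ∧ v == b} e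
... | inj₁ p = inj₁ (==→≡ {i = u} {a} (proj₁ (∧-t {u == a} p)) , ==→≡ {i = v} {b} (proj₂ (∧-t {u == a} p)))
... | inj₂ p = inj₂ (==→≡ {i = u} {b} (proj₁ (∧-t {u == b} p)) , ==→≡ {i = v} {a} (proj₂ (∧-t {u == b} p)))

∑E : ∀ {n} → (Fin n → Fin n → ℕ) → List (Pair n) → ℕ
∑E h = ∑L (λ { (a , b) → h a b + h b a })

∑₂-δ : ∀ {m n} (c : ℕ) (x : Fin m) (y : Fin n) → ∑₂ (λ i j → if i == x then (if j == y then c else 0) else 0) ≡ c
∑₂-δ {n = n} c x y = trans (∑-cong λ i → h i) (∑-δ c x)
  where h : ∀ i → ∑ (λ j → if i == x then (if j == y then c else 0) else 0) ≡ (if i == x then c else 0)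
        h i with i == x
        ... | true = ∑-δ c y
        ... | false = ∑-0 n

-- The two orientations of `ab` and all other pairs are disjoint supports, represented by `f1`, `f2`
-- and `f3`; `a ≢ b` keeps the orientations apart.
∑₂-splitE : ∀ {n} (h : Fin n → Fin n → ℕ) a b → a ≢ b →
  h a b + h b a + ∑₂ (λ u v → if isE a b u v then 0 else h u v) ≤ ∑₂ h
∑₂-splitE h a b ne = ℕₚ.≤-trans (ℕₚ.≤-reflexive (sym eq)) (∑₂-mono pt)
  where
  f1 = λ i j → if i == a then (if j == b then h a b else 0) else 0
  f2 = λ i j → if i == b then (if j == a then h b a else 0) else 0
  f3 = λ u v → if isE a b u v then 0 else h u v
  eq : ∑₂ (λ u v → f1 u v + f2 u v + f3 u v) ≡ h a b + h b a + ∑₂ f3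
  eq = trans (∑₂-+ (λ u v → f1 u v + f2 u v) f3) (cong (_+ ∑₂ f3) (trans (∑₂-+ f1 f2) (cong₂ _+_ (∑₂-δ _ a b) (∑₂-δ _ b a))))
  pt : ∀ u v → f1 u v + f2 u v + f3 u v ≤ h u v
  pt u v with u ≟ a | u ≟ b
  ... | yes refl | yes refl = ⊥-elim (ne refl)
  pt u v | yes refl | no q rewrite ==-refl u | ≢→== q with v ≟ b
  ... | yes refl rewrite ==-refl v = ℕₚ.≤-reflexive (trans (ℕₚ.+-identityʳ _) (ℕₚ.+-identityʳ _))
  ... | no r rewrite ≢→== r = ℕₚ.≤-refl
  pt u v | no p | yes refl rewrite ==-refl u | ≢→== p with v ≟ a
  ... | yes refl rewrite ==-refl v = ℕₚ.≤-reflexive (ℕₚ.+-identityʳ _)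
  ... | no r rewrite ≢→== r = ℕₚ.≤-refl
  pt u v | no p | no q rewrite ≢→== p | ≢→== q = ℕₚ.≤-refl

∑-pickE : ∀ {n} (h : Fin n → Fin n → ℕ) {es} → All (λ e → proj₁ e ≢ proj₂ e) es → AllPairs Apart es → ∑E h es ≤ ∑₂ h
∑-pickE h [] [] = z≤n
∑-pickE h {(a , b) ∷ es} (p ∷ ps) (q ∷ qs) = ℕₚ.≤-trans (ℕₚ.+-monoʳ-≤ (h a b + h b a)
   (ℕₚ.≤-trans (ℕₚ.≤-reflexive (same q)) (∑-pickE _ ps qs))) (∑₂-splitE h a b p)
  where
  h' = λ u v → if isE a b u v then 0 else h u v
  off : ∀ u v → Apart (a , b) (u , v) → h u v ≡ h' u v
  off u v (x , y) with isE a b u v in eq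
  ... | false = refl
  ... | true with isE-t a b u v eq
  ... | inj₁ e = ⊥-elim (x e)
  ... | inj₂ e = ⊥-elim (y e)
  same : ∀ {xs} → All (Apart (a , b)) xs → ∑E h xs ≡ ∑E h' xs
  same [] = refl
  same {(u , v) ∷ xs} (r ∷ rs) = cong₂ _+_ (cong₂ _+_ (off u v r) (off v u ((λ { (e , f) → proj₂ r (f , e) }) , (λ { (e , f) → proj₁ r (f , e) })))) (same rs)

-- Parities

opaque
  ⊕ : ∀ {n} → (Fin n → Bool) → Bool
  ⊕ = XorSum.sum

  ⊕-cong : ∀ {n} {f g : Fin n → Bool} → (∀ i → f i ≡ g i) → ⊕ f ≡ ⊕ g
  ⊕-cong = XorSum.sum-cong-≗

  ⊕-xor : ∀ {n} (f g : Fin n → Bool) → ⊕ (λ i → f i xor g i) ≡ ⊕ f xor ⊕ g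
  ⊕-xor = XorSum.∑-distrib-+

  ⊕-swap : ∀ {m n} (f : Fin m → Fin n → Bool) → ⊕ (λ u → ⊕ (f u)) ≡ ⊕ (λ v → ⊕ (λ u → f u v))
  ⊕-swap = XorSum.∑-comm

  ⊕-0 : ∀ {n} {f : Fin n → Bool} → (∀ i → f i ≡ false) → ⊕ f ≡ false
  ⊕-0 {n} h = trans (⊕-cong h) (XorSum.sum-replicate-zero n)

  ⊕-split : ∀ {n} (f : Fin n → Bool) x → ⊕ f ≡ f x xor ⊕ (λ i → not (i == x) ∧ f i)
  ⊕-split f zero = refl
  ⊕-split f (suc x) = trans (cong (f zero xor_) (⊕-split (f ∘ suc) x)) (lem (f zero) (f (suc x)) _)
    where lem : ∀ a b c → a xor (b xor c) ≡ b xor (a xor c)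
          lem a b c = trans (sym (Boolₚ.xor-assoc a b c)) (trans (cong (_xor c) (Boolₚ.xor-comm a b)) (Boolₚ.xor-assoc b a c))

  -- Transposition pairs equal summands, and the diagonal contributes nothing.
  ⊕-sym : ∀ {n} (f : Fin n → Fin n → Bool) → (∀ i j → f i j ≡ f j i) → (∀ i → f i i ≡ false) → ⊕ (λ i → ⊕ (f i)) ≡ false
  ⊕-sym {zero} f s z = refl
  ⊕-sym {suc n} f s z =
    trans (cong₂ _xor_ (cong (_xor ⊕ (λ j → f zero (suc j))) (z zero)) (⊕-xor (λ i → f (suc i) zero) (λ i → ⊕ (λ j → f (suc i) (suc j)))))
    (trans (cong (⊕ (λ j → f zero (suc j)) xor_) (cong₂ _xor_ (⊕-cong (λ i → s (suc i) zero)) (⊕-sym (λ i j → f (suc i) (suc j)) (λ i j → s _ _) (λ i → z _))))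
     (lem (⊕ (λ j → f zero (suc j)))))
    where lem : ∀ a → a xor (a xor false) ≡ false
          lem true = refl
          lem false = refl

⊕-1 : ∀ {n} (f : Fin n → Bool) x → (∀ i → i ≢ x → f i ≡ false) → ⊕ f ≡ f x
⊕-1 f x h = trans (⊕-split f x) (trans (cong (f x xor_) (⊕-0 k)) (Boolₚ.xor-identityʳ _))
  where k : ∀ i → not (i == x) ∧ f i ≡ false
        k i with i == x in eq
        ... | true = refl
        ... | false = h i λ { refl → tf (==-refl i) eq }

xor-f : ∀ a b → a xor b ≡ false → a ≡ b
xor-f true true _ = refl
xor-f false b e = sym e

xor-t : ∀ a b → a xor b ≡ true → a ≡ not b
xor-t true false _ = refl
xor-t false true _ = refl

⊕-2 : ∀ {n} (f : Fin n → Bool) x y → x ≢ y → (∀ i → i ≢ x → i ≢ y → f i ≡ false) → ⊕ f ≡ f x xor f y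
⊕-2 f x y ne h = trans (⊕-split f x) (cong (f x xor_) (trans (⊕-1 _ y k) l))
  where k : ∀ i → i ≢ y → not (i == x) ∧ f i ≡ false
        k i q with i == x in eq
        ... | true = refl
        ... | false = h i (λ { refl → tf (==-refl i) eq }) q
        l : not (y == x) ∧ f y ≡ f y
        l rewrite ≢→== (ne ∘ sym) = refl

-- Parity forbids a single true entry. This is how the boundary of a face is continued past a
-- vertex.
⊕-other : ∀ {n} (f : Fin n → Bool) x → ⊕ f ≡ false → f x ≡ true → ∃ λ y → y ≢ x × f y ≡ true
⊕-other f x e fx with Finₚ.any? (λ y → ¬? (y ≟ x) ×-dec (f y ≟b true))
... | yes (y , p) = y , p
... | no h = tf (trans (⊕-1 f x (λ i p → not-t→f (λ q → h (i , p , q)))) fx) e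

-- Subsets, degrees and edge counts

Sub : ℕ → Set
Sub n = Fin n → Bool

∣_∣ : ∀ {n} → Sub n → ℕ
∣ S ∣ = ∑ (𝟙 ∘ S)

_⊆_ : ∀ {n} → Sub n → Sub n → Set
A ⊆ B = ∀ u → A u ≡ true → B u ≡ true

card-mono : ∀ {n} {A B : Sub n} → A ⊆ B → ∣ A ∣ ≤ ∣ B ∣
card-mono h = ∑-mono λ u → 𝟙-mono (h u)

del : ∀ {n} → Sub n → Fin n → Sub n
del S x u = not (u == x) ∧ S u

ins : ∀ {n} → Sub n → Fin n → Sub n
ins S x u = (u == x) ∨ S u

card-del : ∀ {n} (S : Sub n) x → S x ≡ true → ∣ S ∣ ≡ suc ∣ del S x ∣
card-del S x h = trans (∑-split (𝟙 ∘ S) x) (cong₂ _+_ (cong 𝟙 h) (∑-cong k))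
  where k : ∀ i → (if i == x then 0 else 𝟙 (S i)) ≡ 𝟙 (not (i == x) ∧ S i)
        k i with i == x
        ... | true = refl
        ... | false = refl

card-ins : ∀ {n} (S : Sub n) x → S x ≡ false → ∣ ins S x ∣ ≡ suc ∣ S ∣
card-ins S x h = trans (card-del (ins S x) x (∨-il (==-refl x))) (cong suc (∑-cong k))
  where k : ∀ i → 𝟙 (not (i == x) ∧ ((i == x) ∨ S i)) ≡ 𝟙 (S i)
        k i with i == x in eq
        ... | true = cong 𝟙 (sym (subst (λ z → S z ≡ false) (sym (==→≡ {i = i} {x} eq)) h))
        ... | false = refl

card-strict : ∀ {n} {A B : Sub n} x → A ⊆ B → A x ≡ false → B x ≡ true → suc ∣ A ∣ ≤ ∣ B ∣
card-strict {A = A} {B} x h a b = ℕₚ.≤-trans (s≤s (card-mono k)) (ℕₚ.≤-reflexive (sym (card-del B x b)))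
  where k : A ⊆ del B x
        k u e with u == x in eq
        ... | true = tf (subst (λ z → A z ≡ true) (==→≡ {i = u} {x} eq) e) a
        ... | false = h u e

card-list : ∀ {n} (S : Sub n) {xs} → Unique xs → All (λ x → S x ≡ true) xs → length xs ≤ ∣ S ∣
card-list S {xs} u a = ℕₚ.≤-trans (ℕₚ.≤-reflexive (k a)) (∑-pick (𝟙 ∘ S) u)
  where k : ∀ {ys} → All (λ x → S x ≡ true) ys → length ys ≡ ∑L (𝟙 ∘ S) ys
        k [] = refl
        k (p ∷ ps) rewrite p = cong suc (k ps)

fromList : ∀ {n} → List (Fin n) → Sub n
fromList [] u = false
fromList (x ∷ xs) u = (u == x) ∨ fromList xs u

fromList∈ : ∀ {n} {xs : List (Fin n)} {u} → u ∈ xs → fromList xs u ≡ true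
fromList∈ {u = u} (here refl) = ∨-il (==-refl u)
fromList∈ (there p) = ∨-ir (fromList∈ p)

∈fromList : ∀ {n} (xs : List (Fin n)) {u} → fromList xs u ≡ true → u ∈ xs
∈fromList (x ∷ xs) {u} e with ∨-t {u == x} e
... | inj₁ p = here (==→≡ p)
... | inj₂ p = there (∈fromList xs p)

card-fromList : ∀ {n} (xs : List (Fin n)) → ∣ fromList xs ∣ ≤ length xs
card-fromList {n} [] = ℕₚ.≤-reflexive (∑-0 n)
card-fromList (x ∷ xs) with fromList xs x in eq
... | false = ℕₚ.≤-trans (ℕₚ.≤-reflexive (card-ins (fromList xs) x eq)) (s≤s (card-fromList xs))
... | true = ℕₚ.≤-trans (card-mono k) (ℕₚ.≤-trans (card-fromList xs) (ℕₚ.n≤1+n _))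
  where k : fromList (x ∷ xs) ⊆ fromList xs
        k u e with ∨-t {u == x} e
        ... | inj₁ p = subst (λ z → fromList xs z ≡ true) (sym (==→≡ {i = u} {x} p)) eq
        ... | inj₂ p = p

Graph : ℕ → Set
Graph = SimpleGraph

E : ∀ {n} → Graph n → Fin n → Fin n → Set
E G u v = adj G u v ≡ true

E-sym : ∀ {n} (G : Graph n) {u v} → E G u v → E G v u
E-sym G {u} {v} e = trans (adj-sym G v u) e

E-irr : ∀ {n} (G : Graph n) {u v} → E G u v → u ≢ v
E-irr G {u} e refl = tf e (adj-irr G u)

E? : ∀ {n} (G : Graph n) u v → Dec (E G u v)
E? G u v = adj G u v ≟b true

_⊑_ : ∀ {n} → Graph n → Graph n → Set
H ⊑ G = ∀ u v → E H u v → E G u v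

-- Edges are counted as ordered pairs, so this is twice their number. The potential 5|A| - 3e(A)
-- therefore appears doubled, as `10 * ∣ A ∣` against `3 * e2 (G ↾ A)`.
e2 : ∀ {n} → Graph n → ℕ
e2 G = ∑₂ λ u v → 𝟙 (adj G u v)

dg : ∀ {n} → Graph n → Fin n → ℕ
dg G u = ∑ (𝟙 ∘ adj G u)

e2-mono : ∀ {n} {H G : Graph n} → H ⊑ G → e2 H ≤ e2 G
e2-mono h = ∑₂-mono λ u v → 𝟙-mono (h u v)

dg-mono : ∀ {n} {H G : Graph n} → H ⊑ G → ∀ u → dg H u ≤ dg G u
dg-mono h u = ∑-mono λ v → 𝟙-mono (h u v)

e2-strict : ∀ {n} {H G : Graph n} → H ⊑ G → ∀ a b → E G a b → ¬ E H a b → 2 + e2 H ≤ e2 G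
e2-strict {H = H} {G} h a b e ne = ℕₚ.≤-trans (ℕₚ.≤-trans (ℕₚ.≤-reflexive (cong₂ (λ x y → x + y + e2 H) (sym (cong 𝟙 e)) (sym (cong 𝟙 (E-sym G e)))))
    (ℕₚ.+-monoʳ-≤ (𝟙 (adj G a b) + 𝟙 (adj G b a)) (∑₂-mono k))) (∑₂-splitE (λ u v → 𝟙 (adj G u v)) a b (E-irr G e))
  where k : ∀ u v → 𝟙 (adj H u v) ≤ (if isE a b u v then 0 else 𝟙 (adj G u v))
        k u v with isE a b u v in eq
        ... | false = 𝟙-mono (h u v)
        ... | true with adj H u v in eq'
        ... | false = z≤n
        ... | true with isE-t a b u v eq
        ... | inj₁ (refl , refl) = ⊥-elim (ne eq')
        ... | inj₂ (refl , refl) = ⊥-elim (ne (E-sym H eq'))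

-- The vertex type does not change; vertices outside `S` merely become isolated. Deletions thus
-- never renumber vertices, and inductions run on `∣ S ∣` or on the number of edges.
_↾_ : ∀ {n} → Graph n → Sub n → Graph n
adj (G ↾ S) u v = (S u ∧ S v) ∧ adj G u v
adj-sym (G ↾ S) u v = cong₂ _∧_ (Boolₚ.∧-comm (S u) (S v)) (adj-sym G u v)
adj-irr (G ↾ S) u rewrite adj-irr G u = Boolₚ.∧-zeroʳ _

↾-E : ∀ {n} {G : Graph n} {S u v} → E (G ↾ S) u v → S u ≡ true × S v ≡ true × E G u v
↾-E {S = S} {u} {v} e = proj₁ (∧-t {S u} (proj₁ p)) , proj₂ (∧-t {S u} (proj₁ p)) , proj₂ p
  where p = ∧-t {S u ∧ S v} e

↾-i : ∀ {n} (G : Graph n) {S u v} → S u ≡ true → S v ≡ true → E G u v → E (G ↾ S) u v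
↾-i G a b e = ∧-i (∧-i a b) e

↾-⊑ : ∀ {n} (G : Graph n) S → (G ↾ S) ⊑ G
↾-⊑ G S u v e = proj₂ (proj₂ (↾-E {G = G} {S} e))

↾-mono : ∀ {n} (G : Graph n) {S S'} → S ⊆ S' → (G ↾ S) ⊑ (G ↾ S')
↾-mono G {S} h u v e = let (a , b , c) = ↾-E {G = G} {S} e in ↾-i G (h u a) (h v b) c

-- Neighbour lists

filt-∈ : ∀ {A : Set} (p : A → Bool) {xs x} → x ∈ xs → p x ≡ true → x ∈ filterᵇ p xs
filt-∈ p {y ∷ ys} (here refl) e rewrite e = here refl
filt-∈ p {y ∷ ys} (there i) e with p y
... | true = there (filt-∈ p i e)
... | false = filt-∈ p i e

∈-filt : ∀ {A : Set} (p : A → Bool) xs {x} → x ∈ filterᵇ p xs → p x ≡ true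
∈-filt p (y ∷ ys) i with p y in eq
∈-filt p (y ∷ ys) (here refl) | true = eq
∈-filt p (y ∷ ys) (there i) | true = ∈-filt p ys i
∈-filt p (y ∷ ys) i | false = ∈-filt p ys i

filt-All : ∀ {A : Set} {P : A → Set} (p : A → Bool) {xs} → All P xs → All P (filterᵇ p xs)
filt-All p [] = []
filt-All p {y ∷ ys} (h ∷ hs) with p y
... | true = h ∷ filt-All p hs
... | false = filt-All p hs

filt-unique : ∀ {n} (p : Fin n → Bool) {xs} → Unique xs → Unique (filterᵇ p xs)
filt-unique p [] = []
filt-unique p {y ∷ ys} (h ∷ hs) with p y
... | true = filt-All p h ∷ filt-unique p hs
... | false = filt-unique p hs

count-tab : ∀ {A : Set} {n} (p : A → Bool) (f : Fin n → A) → countᵇ p (tabulate f) ≡ ∑ (𝟙 ∘ p ∘ f)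
count-tab {n = zero} p f = refl
count-tab {n = suc n} p f with p (f zero)
... | true = cong suc (count-tab p (f ∘ suc))
... | false = count-tab p (f ∘ suc)

∈-tab : ∀ {A : Set} {n} (f : Fin n → A) i → f i ∈ tabulate f
∈-tab f zero = here refl
∈-tab f (suc i) = there (∈-tab (f ∘ suc) i)

tab-All : ∀ {A : Set} {P : A → Set} {n} (f : Fin n → A) → (∀ i → P (f i)) → All P (tabulate f)
tab-All {n = zero} f h = []
tab-All {n = suc n} f h = h zero ∷ tab-All (f ∘ suc) (h ∘ suc)

tab-unique : ∀ {m n} (f : Fin n → Fin m) → (∀ i j → f i ≡ f j → i ≡ j) → Unique (tabulate f)
tab-unique {n = zero} f inj = []
tab-unique {n = suc n} f inj = tab-All (f ∘ suc) (λ i e → Finₚ.0≢1+n (inj zero (suc i) e)) ∷ tab-unique (f ∘ suc) (λ i j e → Finₚ.suc-injective (inj _ _ e))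

nbrs : ∀ {n} → Graph n → Fin n → List (Fin n)
nbrs {n} G u = filterᵇ (adj G u) (allFin n)

nbrs-unique : ∀ {n} (G : Graph n) u → Unique (nbrs G u)
nbrs-unique G u = filt-unique (adj G u) (tab-unique id (λ i j e → e))

nbrs-∈ : ∀ {n} (G : Graph n) {u v} → E G u v → v ∈ nbrs G u
nbrs-∈ G {u} {v} e = filt-∈ (adj G u) (∈-tab id v) e

∈-nbrs : ∀ {n} (G : Graph n) {u v} → v ∈ nbrs G u → E G u v
∈-nbrs {n} G {u} i = ∈-filt (adj G u) (allFin n) i

deg≡dg : ∀ {n} (G : Graph n) u → deg G u ≡ dg G u
deg≡dg G u = count-tab (adj G u) id

dg-≥ : ∀ {n} (G : Graph n) u {xs} → Unique xs → All (E G u) xs → length xs ≤ dg G u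
dg-≥ G u = card-list (adj G u)

record Nb2 {n} (G : Graph n) (u : Fin n) : Set where
  constructor nb2
  field a b : Fin n
        a≢b : a ≢ b
        ua : E G u a
        ub : E G u b
        only : ∀ v → E G u v → (v ≡ a) ⊎ (v ≡ b)

record Nb3 {n} (G : Graph n) (u a b : Fin n) : Set where
  constructor nb3
  field c : Fin n
        c≢a : c ≢ a
        c≢b : c ≢ b
        uc : E G u c
        only : ∀ v → E G u v → (v ≡ a) ⊎ (v ≡ b) ⊎ (v ≡ c)

two-nbrs : ∀ {n} (G : Graph n) u → dg G u ≡ 2 → Nb2 G u
two-nbrs G u d with nbrs G u in eq | nbrs-unique G u | deg≡dg G u | (λ v → nbrs-∈ G {u} {v}) | (λ v → ∈-nbrs G {u} {v})
... | [] | _ | l | _ | _ = case trans l d of λ ()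
... | _ ∷ [] | _ | l | _ | _ = case trans l d of λ ()
... | _ ∷ _ ∷ _ ∷ _ | _ | l | _ | _ = case trans l d of λ ()
... | a ∷ b ∷ [] | (ab ∷ []) ∷ _ | _ | i | o = nb2 a b ab (o a (here refl)) (o b (there (here refl))) k
  where k : ∀ v → E G u v → (v ≡ a) ⊎ (v ≡ b)
        k v e with i v e
        ... | here p = inj₁ p
        ... | there (here p) = inj₂ p

third-nbr : ∀ {n} (G : Graph n) u a b → dg G u ≡ 3 → a ≢ b → E G u a → E G u b → Nb3 G u a b
third-nbr G u a b d ab ua ub with Finₚ.any? (λ c → ¬? (c ≟ a) ×-dec (¬? (c ≟ b) ×-dec E? G u c))
... | yes (c , ca , cb , uc) = nb3 c ca cb uc k
  where k : ∀ v → E G u v → (v ≡ a) ⊎ (v ≡ b) ⊎ (v ≡ c)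
        k v e with v ≟ a | v ≟ b | v ≟ c
        ... | yes p | _ | _ = inj₁ p
        ... | _ | yes p | _ = inj₂ (inj₁ p)
        ... | _ | _ | yes p = inj₂ (inj₂ p)
        ... | no p | no q | no r = ⊥-elim (ℕₚ.<-irrefl refl (ℕₚ.≤-trans (dg-≥ G u ((ab ∷ (ca ∘ sym) ∷ (p ∘ sym) ∷ []) ∷ ((cb ∘ sym) ∷ (q ∘ sym) ∷ []) ∷ ((r ∘ sym) ∷ []) ∷ [] ∷ []) (ua ∷ ub ∷ uc ∷ e ∷ [])) (ℕₚ.≤-reflexive d)))
... | no h = ⊥-elim (ℕₚ.<-irrefl refl (ℕₚ.≤-trans (ℕₚ.≤-reflexive (cong suc (sym (ℕₚ.+-identityʳ 2)))) (ℕₚ.≤-trans (ℕₚ.≤-reflexive (sym d)) (ℕₚ.≤-trans (card-mono {A = adj G u} {B = fromList (a ∷ b ∷ [])} k) (card-fromList (a ∷ b ∷ []))))))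
  where k : adj G u ⊆ fromList (a ∷ b ∷ [])
        k v e with v ≟ a | v ≟ b
        ... | yes refl | _ = fromList∈ {xs = a ∷ b ∷ []} (here refl)
        ... | no _ | yes refl = fromList∈ {xs = a ∷ b ∷ []} (there (here refl))
        ... | no p | no q = ⊥-elim (h (v , p , q , e))

two-of : ∀ {n} (G : Graph n) u → 2 ≤ dg G u → ∃ λ a → ∃ λ b → a ≢ b × E G u a × E G u b
two-of G u d with nbrs G u | nbrs-unique G u | deg≡dg G u | (λ v → ∈-nbrs G {u} {v})
... | [] | _ | l | _ = case ℕₚ.≤-trans d (ℕₚ.≤-reflexive (sym l)) of λ ()
... | _ ∷ [] | _ | l | _ = case ℕₚ.≤-trans d (ℕₚ.≤-reflexive (sym l)) of λ { (s≤s ()) }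
... | a ∷ b ∷ _ | (ab ∷ _) ∷ _ | _ | o = a , b , ab , o a (here refl) , o b (there (here refl))

third-of : ∀ {n} (G : Graph n) u a b → 3 ≤ dg G u → ∃ λ c → c ≢ a × c ≢ b × E G u c
third-of G u a b d with Finₚ.any? (λ c → ¬? (c ≟ a) ×-dec (¬? (c ≟ b) ×-dec E? G u c))
... | yes p = p
... | no h = ⊥-elim (ℕₚ.<-irrefl refl (ℕₚ.≤-trans d (ℕₚ.≤-trans (card-mono {A = adj G u} {B = fromList (a ∷ b ∷ [])} k) (card-fromList (a ∷ b ∷ [])))))
  where k : adj G u ⊆ fromList (a ∷ b ∷ [])
        k v e with v ≟ a | v ≟ b
        ... | yes refl | _ = fromList∈ {xs = a ∷ b ∷ []} (here refl)
        ... | no _ | yes refl = fromList∈ {xs = a ∷ b ∷ []} (there (here refl))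
        ... | no p | no q = ⊥-elim (h (v , p , q , e))

nbr-of : ∀ {n} (G : Graph n) u → 1 ≤ dg G u → ∃ λ a → E G u a
nbr-of G u d with Finₚ.any? (λ c → E? G u c)
... | yes p = p
... | no h = ⊥-elim (ℕₚ.<-irrefl refl (ℕₚ.≤-trans d (ℕₚ.≤-reflexive (∑-z (λ v → cong 𝟙 (not-t→f (λ e → h (v , e))))))))

-- Colourings

Colouring : ℕ → Set
Colouring n = Fin n → Fin 3

Proper : ∀ {n} → Graph n → Colouring n → Set
Proper G c = IsProperColoring G c

Col : ∀ {n} → Graph n → Set
Col G = ∃ (Proper G)

Extends : ∀ {n} → Graph n → Sub n → Colouring n → Set
Extends G R ψ = ∃ λ φ → Proper G φ × (∀ u → R u ≡ true → φ u ≡ ψ u)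

vcons : ∀ {A : Set} {n} → A → (Fin n → A) → Fin (suc n) → A
vcons a f zero = a
vcons a f (suc i) = f i

-- The recursion rebuilds a colouring from its first value and the rest. The result agrees with the
-- original only pointwise, so the predicate has to respect pointwise equality.
search : ∀ n {P : Colouring n → Set} → (∀ c → Dec (P c)) → (∀ {c d} → c ≗ d → P c → P d) → Dec (∃ P)
search zero P? ext = map′ (λ p → none , p) (λ { (c , p) → ext (λ ()) p }) (P? none)
  where none : Colouring 0
        none ()
search (suc n) {P} P? ext = map′ (λ { (i , c , p) → vcons i c , p }) (λ { (c , p) → c zero , c ∘ suc , ext (λ { zero → refl ; (suc i) → refl }) p })
  (Finₚ.any? λ i → search n {λ c → P (vcons i c)} (λ c → P? (vcons i c)) (λ e → ext (λ { zero → refl ; (suc j) → e j })))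

Proper? : ∀ {n} (G : Graph n) c → Dec (Proper G c)
Proper? G c = Finₚ.all? λ u → Finₚ.all? λ v → E? G u v →-dec ¬? (c u ≟ c v)

Proper-ext : ∀ {n} (G : Graph n) {c d : Colouring n} → c ≗ d → Proper G c → Proper G d
Proper-ext G e p u v a q = p u v a (trans (e u) (trans q (sym (e v))))

Col? : ∀ {n} (G : Graph n) → Dec (Col G)
Col? {n} G = search n (Proper? G) (Proper-ext G)

Extends? : ∀ {n} (G : Graph n) R ψ → Dec (Extends G R ψ)
Extends? {n} G R ψ = search n (λ c → Proper? G c ×-dec Finₚ.all? λ u → (R u ≟b true) →-dec (c u ≟ ψ u))
  (λ { e (p , q) → Proper-ext G e p , λ u r → trans (sym (e u)) (q u r) })

Proper-⊑ : ∀ {n} {H G : Graph n} → H ⊑ G → ∀ {c} → Proper G c → Proper H c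
Proper-⊑ h p u v e = p u v (h u v e)

Col-⊑ : ∀ {n} {H G : Graph n} → H ⊑ G → Col G → Col H
Col-⊑ {H = H} {G} h (c , p) = c , Proper-⊑ {H = H} {G} h p

upd : ∀ {n} → Colouring n → Fin n → Fin 3 → Colouring n
upd c x k u = if u == x then k else c u

upd-same : ∀ {n} (c : Colouring n) x k → upd c x k x ≡ k
upd-same c x k rewrite ==-refl x = refl

upd-other : ∀ {n} (c : Colouring n) {x} k {u} → u ≢ x → upd c x k u ≡ c u
upd-other c k h rewrite ≢→== h = refl

extend-vertex : ∀ {n} (G : Graph n) (x : Fin n) c k →
  (∀ u v → u ≢ x → v ≢ x → E G u v → c u ≢ c v) → (∀ v → E G x v → c v ≢ k) → Proper G (upd c x k)
extend-vertex G x c k p q u v e with u ≟ x | v ≟ x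
... | yes refl | yes refl = ⊥-elim (E-irr G e refl)
... | yes refl | no h rewrite ==-refl u | ≢→== h = λ z → q v e (sym z)
... | no h | yes refl rewrite ==-refl v | ≢→== h = q u (E-sym G e)
... | no h | no h' rewrite ≢→== h | ≢→== h' = p u v h h' e

-- Statements about three colours range over a finite domain; they are proved by evaluating their
-- decision procedure.
decide : ∀ {A : Set} (d : Dec A) → does d ≡ true → A
decide (yes a) _ = a

abstract
  avoid2 : ∀ (a b : Fin 3) → ∃ λ k → a ≢ k × b ≢ k
  avoid2 = decide (Finₚ.all? λ a → Finₚ.all? λ b → Finₚ.any? λ k → ¬? (a ≟ k) ×-dec ¬? (b ≟ k)) refl

abstract
  -- For two adjacent vertices that see a common colour `a` and different second colours. If `a`
  -- equals `b` or `b'`, one of the vertices has a choice; otherwise both colours are forced, and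
  -- they differ because `b` and `b'` do.
  avoid-adjacent : ∀ (a b b' : Fin 3) → b ≢ b' → ∃ λ p → ∃ λ q → a ≢ p × b ≢ p × a ≢ q × b' ≢ q × p ≢ q
  avoid-adjacent = decide (Finₚ.all? λ a → Finₚ.all? λ b → Finₚ.all? λ b' → ¬? (b ≟ b') →-dec
    Finₚ.any? λ p → Finₚ.any? λ q → ¬? (a ≟ p) ×-dec ¬? (b ≟ p) ×-dec ¬? (a ≟ q) ×-dec ¬? (b' ≟ q) ×-dec ¬? (p ≟ q)) refl

abstract
  small-nbrs : ∀ {n} (G : Graph n) x → dg G x ≤ 2 → (c : Colouring n) → ∃ λ k → ∀ v → E G x v → c v ≢ k
  small-nbrs G x d c with nbrs G x | deg≡dg G x | (λ v → nbrs-∈ G {x} {v})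
  ... | [] | _ | i = zero , λ v e → case i v e of λ ()
  ... | a ∷ [] | _ | i = let (k , p , q) = avoid2 (c a) (c a) in k , λ v e → case i v e of λ { (here refl) → p }
  ... | a ∷ b ∷ [] | _ | i = let (k , p , q) = avoid2 (c a) (c b) in k , λ v e → case i v e of λ { (here refl) → p ; (there (here refl)) → q }
  ... | _ ∷ _ ∷ _ ∷ _ | l | _ = case ℕₚ.≤-trans (ℕₚ.≤-reflexive l) d of λ { (s≤s (s≤s ())) }

swp : Fin 3 → Fin 3 → Fin 3 → Fin 3
swp a b x = if x == a then b else (if x == b then a else x)

abstract
  swp-inj : ∀ a b x y → swp a b x ≡ swp a b y → x ≡ y
  swp-inj = decide (Finₚ.all? λ a → Finₚ.all? λ b → Finₚ.all? λ x → Finₚ.all? λ y → (swp a b x ≟ swp a b y) →-dec (x ≟ y)) refl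

abstract
  swp-l : ∀ a b → swp a b a ≡ b
  swp-l = decide (Finₚ.all? λ a → Finₚ.all? λ b → swp a b a ≟ b) refl

abstract
  -- The first transposition moves `p` to `p'`. The second moves the image of `q` to `q'` and fixes
  -- `p'`, since neither of its two colours is `p'`.
  perm2 : ∀ (p q p' q' : Fin 3) → p ≢ q → p' ≢ q' → ∃ λ (π : Fin 3 → Fin 3) → (∀ x y → π x ≡ π y → x ≡ y) × π p ≡ p' × π q ≡ q'
  perm2 p q p' q' ne ne' = swp (swp p p' q) q' ∘ swp p p' , (λ x y e → swp-inj p p' x y (swp-inj (swp p p' q) q' _ _ e)) , lem p q p' q' ne ne' , swp-l (swp p p' q) q'
    where lem : ∀ (p q p' q' : Fin 3) → p ≢ q → p' ≢ q' → swp (swp p p' q) q' (swp p p' p) ≡ p'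
          lem = decide (Finₚ.all? λ p → Finₚ.all? λ q → Finₚ.all? λ p' → Finₚ.all? λ q' → ¬? (p ≟ q) →-dec (¬? (p' ≟ q') →-dec (swp (swp p p' q) q' (swp p p' p) ≟ p'))) refl

abstract
  perm3 : ∀ (a b c : Fin 3) → a ≢ b → a ≢ c → b ≢ c → ∃ λ (σ : Fin 3 → Fin 3) → (∀ x y → σ x ≡ σ y → x ≡ y) × σ a ≡ zero × σ b ≡ suc zero × σ c ≡ suc (suc zero)
  perm3 a b c p q r = σ a b , l1 a b c p q r
    where
    σ : Fin 3 → Fin 3 → Fin 3 → Fin 3
    σ a b x = if x == a then zero else (if x == b then suc zero else suc (suc zero))
    l1 : ∀ (a b c : Fin 3) → a ≢ b → a ≢ c → b ≢ c → (∀ x y → σ a b x ≡ σ a b y → x ≡ y) × σ a b a ≡ zero × σ a b b ≡ suc zero × σ a b c ≡ suc (suc zero)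
    l1 = decide (Finₚ.all? λ a → Finₚ.all? λ b → Finₚ.all? λ c → ¬? (a ≟ b) →-dec (¬? (a ≟ c) →-dec (¬? (b ≟ c) →-dec
      ((Finₚ.all? λ x → Finₚ.all? λ y → (σ a b x ≟ σ a b y) →-dec (x ≟ y)) ×-dec (σ a b a ≟ zero) ×-dec (σ a b b ≟ suc zero) ×-dec (σ a b c ≟ suc (suc zero)))))) refl

Proper-∘ : ∀ {n} (G : Graph n) {c} {π : Fin 3 → Fin 3} → (∀ x y → π x ≡ π y → x ≡ y) → Proper G c → Proper G (π ∘ c)
Proper-∘ G inj p u v e q = p u v e (inj _ _ q)

-- Collapsing a coloured vertex set onto a triangle

_∪_ : ∀ {n} → Sub n → Sub n → Sub n
(A ∪ B) u = A u ∨ B u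

Disjoint : ∀ {n} → Sub n → Sub n → Set
Disjoint A B = ∀ u → A u ≡ true → B u ≡ false

card-∪ : ∀ {n} (A B : Sub n) → Disjoint A B → ∣ A ∪ B ∣ ≡ ∣ A ∣ + ∣ B ∣
card-∪ A B d = trans (∑-cong k) (∑-+ (𝟙 ∘ A) (𝟙 ∘ B))
  where k : ∀ u → 𝟙 (A u ∨ B u) ≡ 𝟙 (A u) + 𝟙 (B u)
        k u with A u in eq
        ... | true rewrite d u eq = refl
        ... | false = refl

cross : ∀ {n} → Graph n → Sub n → Sub n → ℕ
cross G A B = ∑₂ λ u v → 𝟙 ((A u ∧ B v) ∧ adj G u v)

cross-sym : ∀ {n} (G : Graph n) A B → cross G A B ≡ cross G B A
cross-sym G A B = trans (∑-swap (λ u v → 𝟙 ((A u ∧ B v) ∧ adj G u v))) (∑₂-cong λ v u → cong 𝟙 (cong₂ _∧_ (Boolₚ.∧-comm (A u) (B v)) (adj-sym G u v)))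

e2-∪ : ∀ {n} (G : Graph n) A B → Disjoint A B → e2 (G ↾ (A ∪ B)) ≡ e2 (G ↾ A) + 2 * cross G A B + e2 (G ↾ B)
e2-∪ G A B d = trans (∑₂-cong pt) (trans (∑₂-+ (λ u v → f1 u v + f2 u v + f3 u v) f4) (trans (cong (_+ ∑₂ f4) (trans (∑₂-+ (λ u v → f1 u v + f2 u v) f3) (cong (_+ ∑₂ f3) (∑₂-+ f1 f2))))
   (trans (cong (λ z → ∑₂ f1 + ∑₂ f2 + z + ∑₂ f4) (cross-sym G B A)) (lem (∑₂ f1) (∑₂ f2) (∑₂ f4)))))
  where
  f1 = λ u v → 𝟙 ((A u ∧ A v) ∧ adj G u v)
  f2 = λ u v → 𝟙 ((A u ∧ B v) ∧ adj G u v)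
  f3 = λ u v → 𝟙 ((B u ∧ A v) ∧ adj G u v)
  f4 = λ u v → 𝟙 ((B u ∧ B v) ∧ adj G u v)
  lem : ∀ a b c → a + b + b + c ≡ a + 2 * b + c
  lem = solve-∀
  b4 : ∀ a b c d e → (a ≡ true → b ≡ false) → (c ≡ true → d ≡ false) → 𝟙 (((a ∨ b) ∧ (c ∨ d)) ∧ e) ≡ 𝟙 ((a ∧ c) ∧ e) + 𝟙 ((a ∧ d) ∧ e) + 𝟙 ((b ∧ c) ∧ e) + 𝟙 ((b ∧ d) ∧ e)
  b4 true true c d e h h' = tf refl (h refl)
  b4 a b true true e h h' = tf refl (h' refl)
  b4 true false true false true h h' = refl
  b4 true false true false false h h' = refl
  b4 true false false true true h h' = refl
  b4 true false false true false h h' = refl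
  b4 true false false false e h h' = refl
  b4 false true true false true h h' = refl
  b4 false true true false false h h' = refl
  b4 false true false true true h h' = refl
  b4 false true false true false h h' = refl
  b4 false true false false e h h' = refl
  b4 false false c d e h h' = refl
  pt : ∀ u v → 𝟙 (((A u ∨ B u) ∧ (A v ∨ B v)) ∧ adj G u v) ≡ f1 u v + f2 u v + f3 u v + f4 u v
  pt u v = b4 (A u) (B u) (A v) (B v) (adj G u v) (d u) (d v)

-- The Kostochka-Yancey bound 3e ≥ 5v - 2 for 4-critical graphs, doubled, for a non-colourable part
-- of `S`. The size is recorded because the lower bounds from Euler's formula hold only from some
-- size on.
Low : ∀ {n} → Graph n → Sub n → Set
Low G S = ∃ λ A → A ⊆ S × ¬ Col (G ↾ A) × 4 ≤ ∣ A ∣ × 10 * ∣ A ∣ ≤ 3 * e2 (G ↾ A) + 4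

triangle-e2 : (Fin 3 → Bool) → ℕ
triangle-e2 Z = ∑₂ λ i j → 𝟙 ((Z i ∧ Z j) ∧ not (i == j))

-- How many colour vertices an obstruction contains. K₁, K₂, K₃ have doubled potentials 10, 14, 12;
-- minus the 4 of `Low` these are 6, 10, 8. Hence the gain 6 for one colour vertex and 8 for
-- several.
data Occupancy (Z : Fin 3 → Bool) : Set where
  vacant : (∀ i → Z i ≡ false) → Occupancy Z
  single : ∀ i → (∀ j → j ≢ i → Z j ≡ false) → ∑ (𝟙 ∘ Z) ≡ 1 → triangle-e2 Z ≡ 0 → Occupancy Z
  several : ∀ {z q} → ∑ (𝟙 ∘ Z) ≡ z → triangle-e2 Z ≡ q → 3 * q + 4 + 8 ≤ 10 * z → Occupancy Z

occupancy : ∀ Z → Occupancy Z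
occupancy Z with Z zero in z0 | Z (suc zero) in z1 | Z (suc (suc zero)) in z2
... | false | false | false = vacant λ { zero → z0 ; (suc zero) → z1 ; (suc (suc zero)) → z2 }
... | true | false | false = single zero (λ { zero h → ⊥-elim (h refl) ; (suc zero) h → z1 ; (suc (suc zero)) h → z2 }) ez eq
  where ez : ∑ (𝟙 ∘ Z) ≡ 1
        ez rewrite z0 | z1 | z2 = refl
        eq : triangle-e2 Z ≡ 0
        eq rewrite z0 | z1 | z2 = refl
... | false | true | false = single (suc zero) (λ { zero h → z0 ; (suc zero) h → ⊥-elim (h refl) ; (suc (suc zero)) h → z2 }) ez eq
  where ez : ∑ (𝟙 ∘ Z) ≡ 1
        ez rewrite z0 | z1 | z2 = refl
        eq : triangle-e2 Z ≡ 0
        eq rewrite z0 | z1 | z2 = refl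
... | false | false | true = single (suc (suc zero)) (λ { zero h → z0 ; (suc zero) h → z1 ; (suc (suc zero)) h → ⊥-elim (h refl) }) ez eq
  where ez : ∑ (𝟙 ∘ Z) ≡ 1
        ez rewrite z0 | z1 | z2 = refl
        eq : triangle-e2 Z ≡ 0
        eq rewrite z0 | z1 | z2 = refl
... | true | true | true = several ez eq ℕₚ.≤-refl
  where ez : ∑ (𝟙 ∘ Z) ≡ 3
        ez rewrite z0 | z1 | z2 = refl
        eq : triangle-e2 Z ≡ 6
        eq rewrite z0 | z1 | z2 = refl
... | true | true | false = several ez eq (ℕₚ.m≤m+n 18 2)
  where ez : ∑ (𝟙 ∘ Z) ≡ 2
        ez rewrite z0 | z1 | z2 = refl
        eq : triangle-e2 Z ≡ 2
        eq rewrite z0 | z1 | z2 = refl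
... | true | false | true = several ez eq (ℕₚ.m≤m+n 18 2)
  where ez : ∑ (𝟙 ∘ Z) ≡ 2
        ez rewrite z0 | z1 | z2 = refl
        eq : triangle-e2 Z ≡ 2
        eq rewrite z0 | z1 | z2 = refl
... | false | true | true = several ez eq (ℕₚ.m≤m+n 18 2)
  where ez : ∑ (𝟙 ∘ Z) ≡ 2
        ez rewrite z0 | z1 | z2 = refl
        eq : triangle-e2 Z ≡ 2
        eq rewrite z0 | z1 | z2 = refl

module Collapse {n : ℕ} (G : Graph n) (O R : Sub n) (ψ : Colouring n) (disj : Disjoint O R) (prop : Proper (G ↾ R) ψ) where

  cls? : ∀ i u → Dec (∃ λ w → R w ≡ true × ψ w ≡ i × E G w u)
  cls? i u = Finₚ.any? λ w → (R w ≟b true) ×-dec (ψ w ≟ i) ×-dec E? G w u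

  cls : Fin 3 → Fin n → Bool
  cls i u with cls? i u
  ... | yes _ = true
  ... | no _ = false

  cls-t : ∀ i u → cls i u ≡ true → ∃ λ w → R w ≡ true × ψ w ≡ i × E G w u
  cls-t i u e with cls? i u
  ... | yes p = p

  cls-i : ∀ i u w → R w ≡ true → ψ w ≡ i → E G w u → cls i u ≡ true
  cls-i i u w a b c with cls? i u
  ... | yes p = refl
  ... | no h = ⊥-elim (h (w , a , b , c))

  ι : Fin 3 → Fin (3 + n)
  ι zero = zero
  ι (suc zero) = suc zero
  ι (suc (suc zero)) = suc (suc zero)

  κ : Fin n → Fin (3 + n)
  κ u = suc (suc (suc u))

  view : Fin (3 + n) → Fin 3 ⊎ Fin n
  view zero = inj₁ zero
  view (suc zero) = inj₁ (suc zero)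
  view (suc (suc zero)) = inj₁ (suc (suc zero))
  view (suc (suc (suc u))) = inj₂ u

  view-ι : ∀ i → view (ι i) ≡ inj₁ i
  view-ι zero = refl
  view-ι (suc zero) = refl
  view-ι (suc (suc zero)) = refl

  ya : Fin 3 ⊎ Fin n → Fin 3 ⊎ Fin n → Bool
  ya (inj₁ i) (inj₁ j) = not (i == j)
  ya (inj₁ i) (inj₂ u) = cls i u
  ya (inj₂ u) (inj₁ i) = cls i u
  ya (inj₂ u) (inj₂ v) = adj G u v

  ya-sym : ∀ x y → ya x y ≡ ya y x
  ya-sym (inj₁ i) (inj₁ j) = cong not (==-sym i j)
  ya-sym (inj₁ i) (inj₂ u) = refl
  ya-sym (inj₂ u) (inj₁ i) = refl
  ya-sym (inj₂ u) (inj₂ v) = adj-sym G u v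

  ya-irr : ∀ x → ya x x ≡ false
  ya-irr (inj₁ i) = cong not (==-refl i)
  ya-irr (inj₂ u) = adj-irr G u

  -- In place of `R` there is one vertex per colour, the three mutually adjacent; colour vertex `i`
  -- inherits the edges of all vertices of `R` coloured `i`. Up to a permutation of colours, a
  -- colouring of `Y` on `SY` is an extension of `ψ`.
  Y : Graph (3 + n)
  adj Y x y = ya (view x) (view y)
  adj-sym Y x y = ya-sym (view x) (view y)
  adj-irr Y x = ya-irr (view x)

  sy : Fin 3 ⊎ Fin n → Bool
  sy (inj₁ i) = true
  sy (inj₂ u) = O u

  SY : Sub (3 + n)
  SY x = sy (view x)

  card-SY : ∣ SY ∣ ≡ 3 + ∣ O ∣
  card-SY = refl

  whole : Sub n
  whole = O ∪ R

  Y-col : Col (Y ↾ SY) → Extends (G ↾ whole) R ψ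
  Y-col (c , p) = φ , φp , λ u r → φR u r
    where
    cY : ∀ x y → SY x ≡ true → SY y ≡ true → E Y x y → c x ≢ c y
    cY x y a b e = p x y (↾-i Y {SY} {x} {y} a b e)
    pp = perm3 (c zero) (c (suc zero)) (c (suc (suc zero))) (cY _ _ refl refl refl) (cY _ _ refl refl refl) (cY _ _ refl refl refl)
    σ = proj₁ pp
    σ-inj = proj₁ (proj₂ pp)
    σι : ∀ i → σ (c (ι i)) ≡ i
    σι zero = proj₁ (proj₂ (proj₂ pp))
    σι (suc zero) = proj₁ (proj₂ (proj₂ (proj₂ pp)))
    σι (suc (suc zero)) = proj₂ (proj₂ (proj₂ (proj₂ pp)))
    φ : Colouring n
    φ u = if R u then ψ u else σ (c (κ u))
    φR : ∀ u → R u ≡ true → φ u ≡ ψ u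
    φR u r rewrite r = refl
    φO : ∀ u → O u ≡ true → φ u ≡ σ (c (κ u))
    φO u o rewrite disj u o = refl
    mixed : ∀ u v → R u ≡ true → O v ≡ true → E G u v → φ u ≢ φ v
    mixed u v r o e q = cY (ι (ψ u)) (κ v) (cong sy (view-ι (ψ u))) o (trans (cong (λ z → ya z (inj₂ v)) (view-ι (ψ u))) (cls-i (ψ u) v u r refl e))
       (σ-inj _ _ (trans (σι (ψ u)) (trans (sym (φR u r)) (trans q (φO v o)))))
    φp : Proper (G ↾ whole) φ
    φp u v e with ↾-E {G = G} {whole} {u} {v} e
    ... | a , b , d with ∨-t {O u} a | ∨-t {O v} b
    ... | inj₁ x | inj₁ y = λ q → cY (κ u) (κ v) x y d (σ-inj _ _ (trans (sym (φO u x)) (trans q (φO v y))))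
    ... | inj₁ x | inj₂ y = λ q → mixed v u y x (E-sym G d) (sym q)
    ... | inj₂ x | inj₁ y = mixed u v x y d
    ... | inj₂ x | inj₂ y = λ q → prop u v (↾-i G x y d) (trans (sym (φR u x)) (trans q (φR v y)))

  module Part (A : Sub (3 + n)) (A⊆ : A ⊆ SY) (nc : ¬ Col (Y ↾ A)) where
    O' : Sub n
    O' u = A (κ u)

    Z : Fin 3 → Bool
    Z i = A (ι i)

    O'⊆O : O' ⊆ O
    O'⊆O u e = A⊆ (κ u) e

    disj' : Disjoint O' R
    disj' u e = disj u (O'⊆O u e)

    -- From an extension of `ψ`, giving each colour vertex its own colour would produce a colouring
    -- of `Y ↾ A`.
    noext : ¬ Extends (G ↾ (O' ∪ R)) R ψ
    noext (φ , p , q) = nc (c , cp)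
      where
      cv : Fin 3 ⊎ Fin n → Fin 3
      cv (inj₁ i) = i
      cv (inj₂ u) = φ u
      c : Colouring (3 + n)
      c x = cv (view x)
      touch : ∀ i u → O' u ≡ true → cls i u ≡ true → i ≢ φ u
      touch i u o e q' with cls-t i u e
      ... | w , r , refl , f = p w u (↾-i G {O' ∪ R} (∨-ir {O' w} r) (∨-il o) f) (trans (q w r) q')
      ok : ∀ x y → (∀ u → x ≡ inj₂ u → O' u ≡ true) → (∀ u → y ≡ inj₂ u → O' u ≡ true) → ya x y ≡ true → cv x ≢ cv y
      ok (inj₁ i) (inj₁ j) a b e refl = tf e (cong not (==-refl i))
      ok (inj₁ i) (inj₂ u) a b e q' = touch i u (b u refl) e q'
      ok (inj₂ u) (inj₁ i) a b e q' = touch i u (a u refl) e (sym q')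
      ok (inj₂ u) (inj₂ v) a b e = p u v (↾-i G {O' ∪ R} (∨-il (a u refl)) (∨-il (b v refl)) e)
      inO : ∀ x → A x ≡ true → ∀ u → view x ≡ inj₂ u → O' u ≡ true
      inO (suc (suc (suc u))) a .u refl = a
      cp : Proper (Y ↾ A) c
      cp x y e with ↾-E {G = Y} {A} {x} {y} e
      ... | a , b , f = ok (view x) (view y) (inO x a) (inO y b) f

    none : (∀ i → Z i ≡ false) → ¬ Col (G ↾ O')
    none z (φ , p) = nc (c , cp)
      where
      cv : Fin 3 ⊎ Fin n → Fin 3
      cv (inj₁ i) = i
      cv (inj₂ u) = φ u
      c : Colouring (3 + n)
      c x = cv (view x)
      k : ∀ x → A x ≡ true → ∃ λ u → x ≡ κ u
      k zero e = tf e (z zero)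
      k (suc zero) e = tf e (z (suc zero))
      k (suc (suc zero)) e = tf e (z (suc (suc zero)))
      k (suc (suc (suc u))) e = u , refl
      cp : Proper (Y ↾ A) c
      cp x y e with ↾-E {G = Y} {A} {x} {y} e
      ... | a , b , f with k x a | k y b
      ... | u , refl | v , refl = p u v (↾-i G a b f)

    split3 : (f : Fin (3 + n) → ℕ) → ∑ f ≡ ∑ (f ∘ ι) + ∑ (f ∘ κ)
    split3 f = lem (f zero) (f (suc zero)) (f (suc (suc zero))) _
      where lem : ∀ a b c d → a + (b + (c + d)) ≡ a + (b + (c + 0)) + d
            lem = solve-∀

    k3 x : ℕ
    k3 = ∑₂ λ i j → 𝟙 ((Z i ∧ Z j) ∧ not (i == j))
    x = ∑₂ λ u i → 𝟙 ((O' u ∧ Z i) ∧ cls i u)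

    e2-Y : e2 (Y ↾ A) ≡ k3 + 2 * x + e2 (G ↾ O')
    e2-Y = trans (split3 (λ a → ∑ (F a))) (trans (cong₂ _+_ (trans (∑-cong λ i → split3 (F (ι i))) (∑-+ (λ i → ∑ (λ j → F (ι i) (ι j))) (λ i → ∑ (λ j → F (ι i) (κ j))))) (trans (∑-cong λ u → split3 (F (κ u))) (∑-+ (λ u → ∑ (λ j → F (κ u) (ι j))) (λ u → ∑ (λ j → F (κ u) (κ j))))))
       (trans (cong₂ _+_ (cong₂ _+_ b1 b2) (cong₂ _+_ b3 refl)) (lem k3 x (e2 (G ↾ O')))))
      where
      F : Fin (3 + n) → Fin (3 + n) → ℕ
      F a b = 𝟙 (adj (Y ↾ A) a b)
      lem : ∀ a b c → a + b + (b + c) ≡ a + 2 * b + c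
      lem = solve-∀
      b1 : ∑₂ (λ i j → F (ι i) (ι j)) ≡ k3
      b1 = ∑₂-cong λ i j → cong (λ z → 𝟙 ((Z i ∧ Z j) ∧ z)) (cong₂ ya (view-ι i) (view-ι j))
      b3 : ∑₂ (λ u i → F (κ u) (ι i)) ≡ x
      b3 = ∑₂-cong λ u i → cong (λ z → 𝟙 ((O' u ∧ Z i) ∧ z)) (cong (ya (inj₂ u)) (view-ι i))
      b2 : ∑₂ (λ i u → F (ι i) (κ u)) ≡ x
      b2 = trans (∑₂-cong λ i u → cong 𝟙 (adj-sym (Y ↾ A) (ι i) (κ u))) (trans (∑-swap (λ i u → F (κ u) (ι i))) b3)

    xG : ℕ
    xG = cross G O' R

    -- An edge of `Y` between `u` and colour vertex `i` comes from an edge between `u` and some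
    -- vertex of `R` coloured `i`, and different `i` use different edges.
    x-row : ∀ u i → 𝟙 ((O' u ∧ Z i) ∧ cls i u) ≤ ∑ (λ w → if i == ψ w then 𝟙 ((O' u ∧ R w) ∧ adj G u w) else 0)
    x-row u i with (O' u ∧ Z i) ∧ cls i u in eq
    ... | false = z≤n
    ... | true with cls-t i u (proj₂ (∧-t {O' u ∧ Z i} eq))
    ... | w , r , refl , e = ℕₚ.≤-trans (ℕₚ.≤-reflexive (sym k)) (∑-≥ _ w)
      where k : (if ψ w == ψ w then 𝟙 ((O' u ∧ R w) ∧ adj G u w) else 0) ≡ 1
            k rewrite ==-refl (ψ w) | proj₁ (∧-t {O' u} (proj₁ (∧-t {O' u ∧ Z (ψ w)} eq))) | r | E-sym G e = refl

    xG-rows : ∑₂ (λ u i → ∑ (λ w → if i == ψ w then 𝟙 ((O' u ∧ R w) ∧ adj G u w) else 0)) ≡ xG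
    xG-rows = ∑-cong λ u → trans (∑-swap (λ i w → if i == ψ w then 𝟙 ((O' u ∧ R w) ∧ adj G u w) else 0)) (∑-cong λ w → ∑-δ _ (ψ w))

    x≤xG : x ≤ xG
    x≤xG = ℕₚ.≤-trans (∑₂-mono x-row) (ℕₚ.≤-reflexive xG-rows)

    -- An edge into a colour class whose vertex is missing from `A` is counted by `xG` but not by
    -- `x`.
    x<xG : ∀ u w → O' u ≡ true → R w ≡ true → E G u w → Z (ψ w) ≡ false → suc x ≤ xG
    x<xG u₀ w₀ o r e zf = ℕₚ.≤-trans (ℕₚ.≤-reflexive (sym (trans (∑₂-+ d (λ u i → 𝟙 ((O' u ∧ Z i) ∧ cls i u))) (cong (_+ x) (∑₂-δ 1 u₀ (ψ w₀))))))
        (ℕₚ.≤-trans (∑₂-mono k) (ℕₚ.≤-reflexive xG-rows))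
      where
      d : Fin n → Fin 3 → ℕ
      d u i = if u == u₀ then (if i == ψ w₀ then 1 else 0) else 0
      g : Fin n → Fin 3 → Fin n → ℕ
      g u i w = if i == ψ w then 𝟙 ((O' u ∧ R w) ∧ adj G u w) else 0
      k : ∀ u i → d u i + 𝟙 ((O' u ∧ Z i) ∧ cls i u) ≤ ∑ (g u i)
      k u i with u ≟ u₀ | i ≟ ψ w₀
      ... | no h | _ rewrite ≢→== h = x-row u i
      ... | yes refl | no h rewrite ==-refl u | ≢→== h = x-row u i
      ... | yes refl | yes refl rewrite ==-refl u | ==-refl (ψ w₀) | zf | Boolₚ.∧-zeroʳ (O' u) = ℕₚ.≤-trans (ℕₚ.≤-reflexive (sym l)) (∑-≥ (g u (ψ w₀)) w₀)
        where l : g u (ψ w₀) w₀ ≡ 1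
              l rewrite ==-refl (ψ w₀) | o | r | e = refl

    R' : Sub n
    R' = O' ∪ R

  -- A drop of the doubled potential by `k` from `R` to `R'`, rearranged to avoid subtraction.
  Gain : Sub n → ℕ → Set
  Gain R' k = 10 * ∣ R' ∣ + 3 * e2 (G ↾ R) + k ≤ 10 * ∣ R ∣ + 3 * e2 (G ↾ R')

  -- The sharper gain 12 in `one` serves `proper-dense₁₂`: an edge to a vertex of `R` of another
  -- colour is absent from the obstruction in `Y` but present in `O' ∪ R`, and is worth 6.
  data Kind (O' : Sub n) : Set where
    avoids : ¬ Col (G ↾ O') → Kind O'
    one : ∀ i → Gain (O' ∪ R) 6 → (∀ u w → O' u ≡ true → R w ≡ true → E G u w → ψ w ≢ i → Gain (O' ∪ R) 12) → Kind O'
    many : Gain (O' ∪ R) 8 → Kind O'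

  record Result : Set where
    field
      O' : Sub n
      O'⊆O : O' ⊆ O
      noext : ¬ Extends (G ↾ (O' ∪ R)) R ψ
      kind : Kind O'

  abstract
    -- The bound enters as a hypothesis on sets of at most `3 + ∣ O ∣` vertices: within the proof of
    -- the Kostochka-Yancey bound it is the induction hypothesis, afterwards it is the theorem.
    collapse : (∀ (A : Sub (3 + n)) → ∣ A ∣ ≤ 3 + ∣ O ∣ → ¬ Col (Y ↾ A) → Low Y A) → ¬ Extends (G ↾ whole) R ψ → Result
    collapse ky ne with ky SY (ℕₚ.≤-reflexive card-SY) (ne ∘ Y-col)
    ... | A , A⊆ , nc , _ , low = record { O' = O' ; O'⊆O = O'⊆O ; noext = noext ; kind = kd }
      where
      open Part A A⊆ nc
      o r eO eR : ℕ
      o = ∣ O' ∣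
      r = ∣ R ∣
      eO = e2 (G ↾ O')
      eR = e2 (G ↾ R)
      low' : 10 * (∑ (𝟙 ∘ Z) + o) ≤ 3 * (k3 + 2 * x + eO) + 4
      low' = subst₂ (λ a b → 10 * a ≤ 3 * b + 4) (split3 (𝟙 ∘ A)) e2-Y low
      -- Replacing the colour vertices by `R` trades their potential `10 * z`, less `3 * q` for
      -- edges among them, for the potential of `R`; `x'` counts edges to `R` that the obstruction
      -- does not see.
      gain : ∀ k {z q x'} → ∑ (𝟙 ∘ Z) ≡ z → k3 ≡ q → 3 * q + 4 + k ≤ 10 * z → x' + x ≤ xG → Gain (O' ∪ R) (k + 6 * x')
      gain k {z} {q} {x'} ez eq h hx = subst₂ (λ a b → 10 * a + 3 * eR + (k + 6 * x') ≤ 10 * r + 3 * b) (sym (card-∪ O' R disj')) (sym (e2-∪ G O' R disj'))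
         (farkas 0 (ℕₚ.+-mono-≤ (ℕₚ.+-mono-≤ h (ℕₚ.*-monoʳ-≤ 6 hx)) (subst₂ (λ a b → 10 * (a + o) ≤ 3 * (b + 2 * x + eO) + 4) ez eq low'))
            (lem o r eR k x' q z x xG eO))
        where lem : ∀ o r eR k x' q z x xG eO → 10 * (o + r) + 3 * eR + (k + 6 * x') + (10 * z + 6 * xG + (3 * (q + 2 * x + eO) + 4)) + 0
                      ≡ 10 * r + 3 * (eO + 2 * xG + eR) + (3 * q + 4 + k + 6 * (x' + x) + 10 * (z + o))
              lem = solve-∀
      strict : ∀ {z} i → (∀ j → j ≢ i → Z j ≡ false) → ∑ (𝟙 ∘ Z) ≡ z → k3 ≡ 0 → 4 + 6 ≤ 10 * z → ∀ u w → O' u ≡ true → R w ≡ true → E G u w → ψ w ≢ i → Gain (O' ∪ R) 12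
      strict i oth ez eq h u w a b c d = gain 6 {x' = 1} ez eq h (x<xG u w a b c (oth (ψ w) d))
      n10 : 10 ≤ 10 * 1
      n10 = ℕₚ.≤-refl
      kd : Kind O'
      kd = go (occupancy Z)
        where
        go : Occupancy Z → Kind O'
        go (vacant z) = avoids (none z)
        go (single i oth ez eq) = one i (gain 6 {x' = 0} ez eq n10 x≤xG) (strict i oth ez eq n10)
        go (several ez eq h) = many (gain 8 {x' = 0} ez eq h x≤xG)

-- Edge counts under insertion, identification and gluing

ky-1 : ∀ a l s c → a + 2 * l + 2 * c + s ≡ s + 2 * c + a + 2 * l
ky-1 = solve-∀

ky-2 : ∀ a b c d → a + (c + d + (b + 10)) + 6 ≡ d + 10 + (a + b + 6 + c)
ky-2 = solve-∀

ky-3 : ∀ a b c d → a + (c + d + (b + 10)) + 0 ≡ d + 4 + (a + b + 6 + c)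
ky-3 = solve-∀

ky-4 : ∀ a b c → a + (3 * b + 4 + 3 * (c + 2)) + 0 ≡ 3 * c + 10 + (a + 3 * b)
ky-4 = solve-∀

ky-5 : ∀ a b c d k → a + (4 + k + (c + d + (b + 12))) + 0 ≡ d + 4 + (12 + (a + b + k + c))
ky-5 = solve-∀

ky-6 : ∀ a b c d → a + (c + d + (b + 12)) + 4 ≡ d + 10 + (a + b + 6 + c)
ky-6 = solve-∀

ky-7 : ∀ e s → 5 + (10 * s + 3 * e) + 0 ≡ s + (suc (3 * e + 4) + 3 * (3 * s))
ky-7 = solve-∀

ky-8 : ∀ a b c d → 40 + 3 * (b + (c + d)) + 3 * a ≡ 3 * d + 10 + 3 * (a + 2 + (b + 4 + (c + 4)))
ky-8 = solve-∀

ky-9 : ∀ a m e f → 10 * (2 + a) + (3 * m + 4 + 3 * (e + f)) + 0 ≡ 3 * f + 12 + (10 * a + 3 * (m + (e + 4)))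
ky-9 = solve-∀

ky-10 : ∀ s d → 20 + s + (d + 5 * d) + 0 ≡ 6 * d + (s + 5 * 4)
ky-10 = solve-∀

ky-11 : ∀ e s x → suc (20 * s) + (2 * (10 * s) + (6 * e + x)) + 9 ≡ 20 * s + ((2 * suc (3 * e + 4)) + (20 * s + x)) 
ky-11 = solve-∀

∑-δ' : ∀ {n} (f : Fin n → ℕ) (x : Fin n) → ∑ (λ i → if i == x then f i else 0) ≡ f x
∑-δ' f x = trans (∑-cong k) (∑-δ (f x) x)
  where k : ∀ i → (if i == x then f i else 0) ≡ (if i == x then f x else 0)
        k i with i ≟ x
        ... | yes refl = refl
        ... | no h rewrite ≢→== h = refl

card-empty : ∀ {n} → ∣_∣ {n} (λ _ → false) ≡ 0
card-empty {n} = ∑-0 n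

card-pos : ∀ {n} (S : Sub n) → 1 ≤ ∣ S ∣ → ∃ λ u → S u ≡ true
card-pos S h with Finₚ.any? (λ u → S u ≟b true)
... | yes p = p
... | no q = ⊥-elim (ℕₚ.<-irrefl refl (ℕₚ.≤-trans h (ℕₚ.≤-reflexive (∑-z λ u → cong 𝟙 (not-t→f (λ e → q (u , e)))))))

card-outside : ∀ {n} (S : Sub n) xs → suc (length xs) ≤ ∣ S ∣ → ∃ λ u → S u ≡ true × fromList xs u ≡ false
card-outside S xs h with Finₚ.any? (λ u → (S u ≟b true) ×-dec (fromList xs u ≟b false))
... | yes p = p
... | no q = ⊥-elim (ℕₚ.<-irrefl refl (ℕₚ.≤-trans h (ℕₚ.≤-trans (card-mono k) (card-fromList xs))))
  where k : S ⊆ fromList xs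
        k u e with fromList xs u in eq
        ... | true = refl
        ... | false = ⊥-elim (q (u , e , eq))

del-⊆ : ∀ {n} (S : Sub n) x → del S x ⊆ S
del-⊆ S x u e = proj₂ (∧-t {not (u == x)} e)

del-≢ : ∀ {n} (S : Sub n) {x u} → del S x u ≡ true → u ≢ x
del-≢ S {x} {u} e refl rewrite ==-refl u = case e of λ ()

del-i : ∀ {n} (S : Sub n) {x u} → u ≢ x → S u ≡ true → del S x u ≡ true
del-i S h e rewrite ≢→== h = e

del-x : ∀ {n} (S : Sub n) x → del S x x ≡ false
del-x S x rewrite ==-refl x = refl

⊆-f : ∀ {n} {A B : Sub n} {x} → A ⊆ B → B x ≡ false → A x ≡ false
⊆-f {A = A} {x = x} h b = not-t→f λ e → tf (h x e) b

Proper-↾ : ∀ {n} (G : Graph n) (A B : Sub n) → A ⊆ B → ∀ {c} → Proper (G ↾ B) c → Proper (G ↾ A) c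
Proper-↾ G A B h = Proper-⊑ {H = G ↾ A} {G ↾ B} (↾-mono G {A} {B} h)

Col-↾ : ∀ {n} (G : Graph n) (A B : Sub n) → A ⊆ B → Col (G ↾ B) → Col (G ↾ A)
Col-↾ G A B h = Col-⊑ {H = G ↾ A} {G ↾ B} (↾-mono G {A} {B} h)

e2-↾ : ∀ {n} (G : Graph n) (A B : Sub n) → A ⊆ B → e2 (G ↾ A) ≤ e2 (G ↾ B)
e2-↾ G A B h = e2-mono {H = G ↾ A} {G ↾ B} (↾-mono G {A} {B} h)

grow : ∀ {n} (G : Graph n) R v {xs} → R v ≡ false → Unique xs → All (λ w → R w ≡ true × E G v w) xs →
  e2 (G ↾ R) + 2 * length xs ≤ e2 (G ↾ ins R v)
grow G R v {xs} rv u a = ℕₚ.≤-trans (farkas (e2 (G ↾ sg)) (ℕₚ.*-monoʳ-≤ 2 k) (ky-1 (e2 (G ↾ R)) (length xs) (e2 (G ↾ sg)) (cross G sg R)))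
    (ℕₚ.≤-reflexive (sym (e2-∪ G sg R d)))
  where
  sg : Sub _
  sg u = u == v
  d : Disjoint sg R
  d u e = subst (λ z → R z ≡ false) (sym (==→≡ {i = u} {v} e)) rv
  k : length xs ≤ cross G sg R
  k = ℕₚ.≤-trans (card-list (λ w → R w ∧ adj G v w) u (Allₚ.map (λ { (p , q) → ∧-i p q }) a))
     (ℕₚ.≤-trans (ℕₚ.≤-reflexive (∑-cong λ w → cong (λ z → 𝟙 ((z ∧ R w) ∧ adj G v w)) (sym (==-refl v))))
       (∑-≥ (λ u → ∑ λ w → 𝟙 ((sg u ∧ R w) ∧ adj G u w)) v))

module _ {n} (G : Graph n) (p q : Fin n) (p≢q : p ≢ q) where
  addE : Graph n
  adj addE u v = adj G u v ∨ isE p q u v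
  adj-sym addE u v = cong₂ _∨_ (adj-sym G u v) (k u v)
    where k : ∀ u v → isE p q u v ≡ isE p q v u
          k u v = trans (Boolₚ.∨-comm (u == p ∧ v == q) (u == q ∧ v == p)) (cong₂ _∨_ (Boolₚ.∧-comm (u == q) (v == p)) (Boolₚ.∧-comm (u == p) (v == q)))
  adj-irr addE u rewrite adj-irr G u = not-t→f λ e → case isE-t p q u u e of λ { (inj₁ (a , b)) → p≢q (trans (sym a) b) ; (inj₂ (a , b)) → p≢q (trans (sym b) a) }

  addE-i : ∀ {u v} → E G u v → E addE u v
  addE-i e = ∨-il e

  addE-new : E addE p q
  addE-new = ∨-ir {adj G p q} (∨-il (∧-i (==-refl p) (==-refl q)))

  e2-addE : ∀ R → e2 (addE ↾ R) ≤ e2 (G ↾ R) + 2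
  e2-addE R = ℕₚ.≤-trans (∑₂-mono pt) (ℕₚ.≤-reflexive (trans (∑₂-+ _ (λ u v → d p q u v + d q p u v)) (cong (e2 (G ↾ R) +_) (trans (∑₂-+ (d p q) (d q p)) (cong₂ _+_ (∑₂-δ 1 p q) (∑₂-δ 1 q p))))))
    where
    d : Fin n → Fin n → Fin n → Fin n → ℕ
    d a b u v = if u == a then (if v == b then 1 else 0) else 0
    pt : ∀ u v → 𝟙 ((R u ∧ R v) ∧ (adj G u v ∨ isE p q u v)) ≤ 𝟙 ((R u ∧ R v) ∧ adj G u v) + (d p q u v + d q p u v)
    pt u v with R u ∧ R v | adj G u v
    ... | false | _ = z≤n
    ... | true | true = s≤s z≤n
    ... | true | false with u == p | v == q | u == q | v == p
    ... | true | true | _ | _ = s≤s z≤n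
    ... | true | false | true | true = s≤s z≤n
    ... | true | false | true | false = z≤n
    ... | true | false | false | _ = z≤n
    ... | false | _ | true | true = s≤s z≤n
    ... | false | _ | true | false = z≤n
    ... | false | _ | false | _ = z≤n

-- The vertex b is identified with a by moving its edges to a; b stays as an isolated vertex.
module _ {n} (G : Graph n) (a b : Fin n) (ab : ¬ E G a b) where
  merge : Graph n
  adj merge u v = (not (u == b) ∧ not (v == b)) ∧ (adj G u v ∨ ((u == a ∧ adj G b v) ∨ (v == a ∧ adj G b u)))
  adj-sym merge u v = cong₂ _∧_ (Boolₚ.∧-comm (not (u == b)) (not (v == b))) (cong₂ _∨_ (adj-sym G u v) (Boolₚ.∨-comm (u == a ∧ adj G b v) (v == a ∧ adj G b u)))
  adj-irr merge u = not-t→f λ e → k (proj₂ (∧-t {not (u == b) ∧ not (u == b)} e))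
    where
    l : u == a ∧ adj G b u ≡ true → ⊥
    l p = ab (E-sym G (subst (E G b) (==→≡ {i = u} {a} (proj₁ (∧-t {u == a} p))) (proj₂ (∧-t {u == a} p))))
    k : adj G u u ∨ ((u == a ∧ adj G b u) ∨ (u == a ∧ adj G b u)) ≡ true → ⊥
    k e with ∨-t {adj G u u} e
    ... | inj₁ p = tf p (adj-irr G u)
    ... | inj₂ p with ∨-t {u == a ∧ adj G b u} p
    ... | inj₁ r = l r
    ... | inj₂ r = l r

  data MergeE (u v : Fin n) : Set where
    m-old : E G u v → MergeE u v
    m-left : u ≡ a → E G b v → MergeE u v
    m-right : v ≡ a → E G b u → MergeE u v

  merge-t : ∀ {u v} → E merge u v → u ≢ b × v ≢ b × MergeE u v
  merge-t {u} {v} e with ∧-t {not (u == b) ∧ not (v == b)} e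
  ... | p , q = (λ { refl → bad {u} (proj₁ (∧-t {not (u == u)} p)) }) , (λ { refl → bad {v} (proj₂ (∧-t {not (u == v)} p)) }) , k q
    where
    bad : ∀ {x : Fin n} → not (x == x) ≡ true → ⊥
    bad {x} e rewrite ==-refl x = case e of λ ()
    k : adj G u v ∨ ((u == a ∧ adj G b v) ∨ (v == a ∧ adj G b u)) ≡ true → MergeE u v
    k e with ∨-t {adj G u v} e
    ... | inj₁ r = m-old r
    ... | inj₂ r with ∨-t {u == a ∧ adj G b v} r
    ... | inj₁ s = m-left (==→≡ {i = u} {a} (proj₁ (∧-t {u == a} s))) (proj₂ (∧-t {u == a} s))
    ... | inj₂ s = m-right (==→≡ {i = v} {a} (proj₁ (∧-t {v == a} s))) (proj₂ (∧-t {v == a} s))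

  merge-old : ∀ {u v} → u ≢ b → v ≢ b → E G u v → E merge u v
  merge-old h h' e rewrite ≢→== h | ≢→== h' = ∨-il e

  merge-new : ∀ {v} → a ≢ b → E G b v → E merge a v
  merge-new {v} h e rewrite ≢→== h | ≢→== (E-irr G e ∘ sym) | ==-refl a | e = ∨-ir {adj G a v} refl

  -- The edges at `b` reappear at `a`: `g2` and `g3` are the row and column of `b` moved to `a`,
  -- `k2` and `k3` the originals, with the same sums. Edges that coincide only lower the count.
  e2-merge : e2 merge ≤ e2 G
  e2-merge = ℕₚ.≤-trans (∑₂-mono pt) (ℕₚ.≤-trans (ℕₚ.≤-reflexive tot) (∑₂-mono pt'))
    where
    α : Fin n → Fin n → ℕ
    α u v = 𝟙 (adj G u v)
    X : ℕ
    X = ∑ λ v → if v == b then 0 else α b v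
    g1 g2 g3 k2 k3 : Fin n → Fin n → ℕ
    g1 u v = if u == b then 0 else (if v == b then 0 else α u v)
    g2 u v = if u == a then (if v == b then 0 else α b v) else 0
    g3 u v = if v == a then (if u == b then 0 else α b u) else 0
    k2 u v = if u == b then (if v == b then 0 else α u v) else 0
    k3 u v = if v == b then (if u == b then 0 else α v u) else 0
    pull : ∀ (c : Bool) (f : Fin n → ℕ) → ∑ (λ v → if c then f v else 0) ≡ (if c then ∑ f else 0)
    pull true f = refl
    pull false f = ∑-0 n
    G2 : ∑₂ g2 ≡ X
    G2 = trans (∑-cong λ u → pull (u == a) _) (∑-δ X a)
    G3 : ∑₂ g3 ≡ X
    G3 = trans (∑-swap g3) (trans (∑-cong λ v → pull (v == a) _) (∑-δ X a))
    K2 : ∑₂ k2 ≡ X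
    K2 = trans (∑-cong λ u → pull (u == b) _) (∑-δ' (λ u → ∑ λ v → if v == b then 0 else α u v) b)
    K3 : ∑₂ k3 ≡ X
    K3 = trans (∑-swap k3) (trans (∑-cong λ v → pull (v == b) _) (∑-δ' (λ v → ∑ λ u → if u == b then 0 else α v u) b))
    tot : ∑₂ (λ u v → g1 u v + (g2 u v + g3 u v)) ≡ ∑₂ (λ u v → g1 u v + (k2 u v + k3 u v))
    tot = trans (trans (∑₂-+ g1 _) (cong (∑₂ g1 +_) (trans (∑₂-+ g2 g3) (trans (cong₂ _+_ G2 G3) (sym (cong₂ _+_ K2 K3))))))
        (sym (trans (∑₂-+ g1 _) (cong (∑₂ g1 +_) (∑₂-+ k2 k3))))
    pt : ∀ u v → 𝟙 (adj merge u v) ≤ g1 u v + (g2 u v + g3 u v)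
    pt u v with u == b | v == b
    ... | true | _ = z≤n
    ... | false | true = z≤n
    ... | false | false with adj G u v | u == a | adj G b v | v == a | adj G b u
    ... | true | _ | _ | _ | _ = s≤s z≤n
    ... | false | true | true | _ | _ = s≤s z≤n
    ... | false | true | false | true | true = s≤s z≤n
    ... | false | true | false | true | false = z≤n
    ... | false | true | false | false | _ = z≤n
    ... | false | false | _ | true | true = s≤s z≤n
    ... | false | false | _ | true | false = z≤n
    ... | false | false | _ | false | _ = z≤n
    pt' : ∀ u v → g1 u v + (k2 u v + k3 u v) ≤ α u v
    pt' u v with u == b | v == b
    ... | true | true = z≤n
    ... | true | false = ℕₚ.≤-reflexive (ℕₚ.+-identityʳ _)
    ... | false | true = ℕₚ.≤-reflexive (cong 𝟙 (adj-sym G v u))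
    ... | false | false = ℕₚ.≤-reflexive (ℕₚ.+-identityʳ _)

attached : ∀ {n} → Graph n → Sub n → Sub n → Fin n → Sub n
attached G S R p u = S u ∧ (not (R u) ∨ (u == p))

-- All edges out of `R` start at `p`, so it suffices that the two colourings agree there, which a
-- transposition of colours achieves.
glue : ∀ {n} (G : Graph n) S R p → R p ≡ true → S p ≡ true → (∀ u v → R u ≡ true → S v ≡ true → R v ≡ false → E G u v → u ≡ p) →
  ∀ c1 → Proper (G ↾ R) c1 → ∀ c2 → Proper (G ↾ attached G S R p) c2 → Col (G ↾ S)
glue {n} G S R p rp sp uniq c1 c1p c2 c2p = φ , φp
  where
  π = swp (c2 p) (c1 p)
  π-inj = swp-inj (c2 p) (c1 p)
  φ : Colouring n
  φ u = if R u then c1 u else π (c2 u)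
  φ1 : ∀ {u} → R u ≡ true → φ u ≡ c1 u
  φ1 e rewrite e = refl
  φ2 : ∀ {u} → R u ≡ false → φ u ≡ π (c2 u)
  φ2 e rewrite e = refl
  inT : ∀ {u} → S u ≡ true → R u ≡ false → attached G S R p u ≡ true
  inT s r rewrite s | r = refl
  pT : attached G S R p p ≡ true
  pT rewrite sp | ==-refl p = ∨-ir {not (R p)} refl
  mix : ∀ {u v} → R u ≡ true → R v ≡ false → S v ≡ true → E G u v → φ u ≢ φ v
  mix {u} {v} ru rv sv e q with uniq u v ru sv rv e
  ... | refl = c2p u v (↾-i G pT (inT sv rv) e) (π-inj _ _ (trans (swp-l (c2 u) (c1 u)) (trans (sym (φ1 ru)) (trans q (φ2 rv)))))
  φp : Proper (G ↾ S) φ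
  φp u v e with ↾-E {G = G} {S} {u} {v} e
  ... | su , sv , f with bcase (R u) | bcase (R v)
  ... | inj₁ ru | inj₁ rv = λ q → c1p u v (↾-i G ru rv f) (trans (sym (φ1 ru)) (trans q (φ1 rv)))
  ... | inj₁ ru | inj₂ rv = mix ru rv sv f
  ... | inj₂ ru | inj₁ rv = λ q → mix rv ru su (E-sym G f) (sym q)
  ... | inj₂ ru | inj₂ rv = λ q → c2p u v (↾-i G (inT su ru) (inT sv rv) f) (π-inj _ _ (trans (sym (φ2 ru)) (trans q (φ2 rv))))

-- The Kostochka–Yancey bound

-- A smallest counterexample to the bound: `S` is vertex-critical and by `big` too sparse. The
-- induction hypothesis covers all graphs, because the collapsed graph `Y` lives on another vertex
-- type.
module Critical {n : ℕ} (G : Graph n) (S : Sub n)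
  (IH : ∀ {m} (H : Graph m) (A : Sub m) → suc ∣ A ∣ ≤ ∣ S ∣ → ¬ Col (H ↾ A) → Low H A)
  (crit : ∀ u → S u ≡ true → Col (G ↾ del S u))
  (nc : ¬ Col (G ↾ S)) (big : suc (3 * e2 (G ↾ S) + 4) ≤ 10 * ∣ S ∣) where

  H : Graph n
  H = G ↾ S

  H→S : ∀ {u v} → E H u v → S u ≡ true
  H→S {u} {v} e = proj₁ (↾-E {G = G} {S} {u} {v} e)

  H→G : ∀ {u v} → E H u v → E G u v
  H→G {u} {v} = ↾-⊑ G S u v

  degree3 : ∀ u → S u ≡ true → 3 ≤ dg H u
  degree3 u su with 3 ≤? dg H u
  ... | yes h = h
  ... | no h = ⊥-elim (nc (upd c u k , extend-vertex H u c k a kp))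
    where
    c = proj₁ (crit u su)
    sk = small-nbrs H u (ℕₚ.≤-pred (ℕₚ.≰⇒> h)) c
    k = proj₁ sk
    kp = proj₂ sk
    a : ∀ x y → x ≢ u → y ≢ u → E H x y → c x ≢ c y
    a x y p q e with ↾-E {G = G} {S} {x} {y} e
    ... | r , s , t = proj₂ (crit u su) x y (↾-i G (del-i S p r) (del-i S q s) t)

  abstract
    part-col : ∀ {R x} → R ⊆ S → S x ≡ true → R x ≡ false → Col (G ↾ R)
    part-col {R} {x} h sx rx = Col-↾ G R (del S x) k (crit x sx)
      where k : R ⊆ del S x
            k u e = del-i S (λ { refl → tf e rx }) (h u e)

  full : ∀ {R} → R ⊆ S → S ⊆ R → 10 * ∣ R ∣ ≤ 3 * e2 (G ↾ R) + 4 → ⊥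
  full {R} h h' b = ℕₚ.<-irrefl refl (ℕₚ.≤-trans big (ℕₚ.≤-trans (ℕₚ.*-monoʳ-≤ 10 (card-mono h'))
    (ℕₚ.≤-trans b (ℕₚ.+-monoˡ-≤ 4 (ℕₚ.*-monoʳ-≤ 3 (e2-↾ G R S h))))))

  outside? : ∀ R → (∃ λ y → S y ≡ true × R y ≡ false) ⊎ (S ⊆ R)
  outside? R with Finₚ.any? (λ y → (S y ≟b true) ×-dec (R y ≟b false))
  ... | yes p = inj₁ p
  ... | no h = inj₂ λ u e → case bcase (R u) of λ { (inj₁ p) → p ; (inj₂ q) → ⊥-elim (h (u , e , q)) }

  -- No colouring of `R` extends to `S`, so each can be collapsed; the resulting set `O' ∪ R` is
  -- strictly larger than `R`.
  module Col-R (R : Sub n) (R⊆ : R ⊆ S) (r4 : 4 ≤ ∣ R ∣) (c : Colouring n) (cp : Proper (G ↾ R) c) where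
    O : Sub n
    O u = not (R u) ∧ S u
    disj : Disjoint O R
    disj u e with R u
    ... | false = refl
    S⊆ : S ⊆ (O ∪ R)
    S⊆ u e with R u
    ... | true = ∨-ir {false} refl
    ... | false = ∨-il e
    open Collapse G O R c disj cp public
    size : ∣ S ∣ ≡ ∣ O ∣ + ∣ R ∣
    size = trans (∑-cong λ u → cong 𝟙 (b-ext (S⊆ u) (λ e → case ∨-t {O u} e of λ { (inj₁ p) → proj₂ (∧-t {not (R u)} p) ; (inj₂ p) → R⊆ u p }))) (card-∪ O R disj)
    abstract
      res : Result
      -- `R` has at least 4 vertices and is replaced by 3, so the collapsed set is smaller than `S`.
      res = collapse (λ A h → IH Y A (ℕₚ.≤-trans (s≤s h) (ℕₚ.≤-trans (ℕₚ.≤-reflexive (ℕₚ.+-comm 4 ∣ O ∣)) (ℕₚ.≤-trans (ℕₚ.+-monoʳ-≤ ∣ O ∣ r4) (ℕₚ.≤-reflexive (sym size))))))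
         (λ { (φ , p , _) → nc (φ , Proper-↾ G S (O ∪ R) S⊆ p) })
    open Result res public using (O'; O'⊆O; noext; kind)
    R'⊆S : (O' ∪ R) ⊆ S
    R'⊆S u e with ∨-t {O' u} e
    ... | inj₁ p = proj₂ (∧-t {not (R u)} (O'⊆O u p))
    ... | inj₂ p = R⊆ u p
    bigger : suc ∣ R ∣ ≤ ∣ O' ∪ R ∣
    bigger with Finₚ.any? (λ u → O' u ≟b true)
    ... | yes (u , p) = card-strict u (λ v e → ∨-ir {O' v} e) (disj u (O'⊆O u p)) (∨-il p)
    ... | no h = ⊥-elim (noext (c , Proper-↾ G (O' ∪ R) R (λ u e → case ∨-t {O' u} e of λ { (inj₁ p) → ⊥-elim (h (u , p)) ; (inj₂ q) → q }) cp , λ u r → refl))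
    inO : S ⊆ (O' ∪ R) → ∀ {y} → S y ≡ true → R y ≡ false → O' y ≡ true
    inO s {y} sy ry = case ∨-t {O' y} (s y sy) of λ { (inj₁ z) → z ; (inj₂ z) → tf z ry }
    nonavoid : ¬ Col (G ↾ O') → ⊥
    nonavoid q with card-pos R (ℕₚ.≤-trans (s≤s z≤n) r4)
    ... | r , e = q (part-col {O'} {r} (λ u z → R'⊆S u (∨-il {O' u} z)) (R⊆ r e) (not-t→f λ z → tf e (disj r (O'⊆O r z))))

  -- A colouring of `R` cannot extend to `S`, so on a strictly larger set the doubled potential
  -- drops by 6, from 10 to at most 4. If this set is all of `S` it contradicts `big`; otherwise the
  -- argument is repeated, and `f` bounds the number of vertices left.
  proper-dense-within : ∀ f R → R ⊆ S → ∣ S ∣ ≤ ∣ R ∣ + f → ∀ {x} → S x ≡ true → R x ≡ false → 4 ≤ ∣ R ∣ → 10 * ∣ R ∣ ≤ 3 * e2 (G ↾ R) + 10 → ⊥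
  proper-dense-within zero R h fu sx rx r4 b = ℕₚ.<-irrefl refl (ℕₚ.≤-trans (card-strict _ h rx sx) (ℕₚ.≤-trans fu (ℕₚ.≤-reflexive (ℕₚ.+-identityʳ _))))
  proper-dense-within (suc f) R h fu {x} sx rx r4 b = go kind
    where
    pc = part-col h sx rx
    open Col-R R h r4 (proj₁ pc) (proj₂ pc)
    fin : Gain (O' ∪ R) 6 → ⊥
    fin g with outside? (O' ∪ R)
    ... | inj₁ (y , sy , ry) = proper-dense-within f (O' ∪ R) R'⊆S (ℕₚ.≤-trans fu (ℕₚ.≤-trans (ℕₚ.≤-reflexive (ℕₚ.+-suc ∣ R ∣ f)) (ℕₚ.+-monoˡ-≤ f bigger))) sy ry
         (ℕₚ.≤-trans r4 (ℕₚ.≤-trans (ℕₚ.n≤1+n _) bigger)) (farkas 6 (ℕₚ.+-mono-≤ g b) (ky-2 (10 * ∣ O' ∪ R ∣) (3 * e2 (G ↾ R)) (10 * ∣ R ∣) (3 * e2 (G ↾ (O' ∪ R)))))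
    ... | inj₂ s = full R'⊆S s (farkas 0 (ℕₚ.+-mono-≤ g b) (ky-3 (10 * ∣ O' ∪ R ∣) (3 * e2 (G ↾ R)) (10 * ∣ R ∣) (3 * e2 (G ↾ (O' ∪ R)))))
    go : Kind O' → ⊥
    go (avoids q) = nonavoid q
    go (one i g _) = fin g
    go (many g) = fin (ℕₚ.≤-trans (ℕₚ.+-monoʳ-≤ (10 * ∣ O' ∪ R ∣ + 3 * e2 (G ↾ R)) (ℕₚ.m≤m+n 6 2)) g)

  proper-dense : ∀ {R x} → R ⊆ S → S x ≡ true → R x ≡ false → 4 ≤ ∣ R ∣ → 10 * ∣ R ∣ ≤ 3 * e2 (G ↾ R) + 10 → ⊥
  proper-dense {R} h = proper-dense-within ∣ S ∣ R h (ℕₚ.m≤n+m ∣ S ∣ ∣ R ∣)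

  any-dense : ∀ {R} → R ⊆ S → 4 ≤ ∣ R ∣ → 10 * ∣ R ∣ ≤ 3 * e2 (G ↾ R) + 4 → ⊥
  any-dense {R} h r4 b with outside? R
  ... | inj₁ (y , sy , ry) = proper-dense h sy ry r4 (ℕₚ.≤-trans b (ℕₚ.+-monoʳ-≤ (3 * e2 (G ↾ R)) (ℕₚ.m≤m+n 4 6)))
  ... | inj₂ s = full h s b

  -- An extra edge inside a proper subset keeps it colourable, since dense proper subsets do not exist.
  abstract
    col-addE : ∀ {R x} p q (ne : p ≢ q) → R ⊆ S → S x ≡ true → R x ≡ false → Col (addE G p q ne ↾ R)
    col-addE {R} {x} p q ne h sx rx with Col? (addE G p q ne ↾ R)
    ... | yes c = c
    ... | no nc' with IH (addE G p q ne) R (card-strict x h rx sx) nc'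
    ... | A , A⊆ , _ , a4 , low = ⊥-elim (proper-dense {x = x} (λ u e → h u (A⊆ u e)) sx (⊆-f A⊆ rx) a4
       (farkas 0 (ℕₚ.+-mono-≤ low (ℕₚ.*-monoʳ-≤ 3 (e2-addE G p q ne A))) (ky-4 (10 * ∣ A ∣) (e2 (addE G p q ne ↾ A)) (e2 (G ↾ A)))))

  Boundary : Sub n → Fin n → Set
  Boundary R p = R p ≡ true × ∃ λ u → S u ≡ true × R u ≡ false × E G p u

  boundary? : ∀ R p → Dec (Boundary R p)
  boundary? R p = (R p ≟b true) ×-dec Finₚ.any? λ u → (S u ≟b true) ×-dec (R u ≟b false) ×-dec E? G p u

  -- Otherwise colourings of R and of its complement glue along at most one vertex.
  two-boundary′ : ∀ {R x} → R ⊆ S → S x ≡ true → R x ≡ false → 4 ≤ ∣ R ∣ → ∃ λ p → ∃ λ q → p ≢ q × Boundary R p × Boundary R q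
  two-boundary′ {R} {x} h sx rx r4 with Finₚ.any? (λ p → Finₚ.any? λ q → ¬? (p ≟ q) ×-dec boundary? R p ×-dec boundary? R q)
  ... | yes r = r
  ... | no none = ⊥-elim (nc (glue G S R p rp (h p rp) (λ u v ru sv rv e → uniq u (ru , v , sv , rv , e)) (proj₁ c1) (proj₂ c1) (proj₁ c2) (proj₂ c2)))
    where
    base : ∃ λ p → R p ≡ true × (∀ q → Boundary R q → q ≡ p)
    base with Finₚ.any? (boundary? R)
    ... | yes (p , bp) = p , proj₁ bp , λ q bq → decidable-stable (q ≟ p) (λ ne → none (q , p , ne , bq , bp))
    ... | no hh = let (r , e) = card-pos R (ℕₚ.≤-trans (s≤s z≤n) r4) in r , e , λ q bq → ⊥-elim (hh (q , bq))
    p = proj₁ base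
    rp = proj₁ (proj₂ base)
    uniq = proj₂ (proj₂ base)
    ot = card-outside R (p ∷ []) (ℕₚ.≤-trans (s≤s (s≤s z≤n)) r4)
    Tr : attached G S R p (proj₁ ot) ≡ false
    Tr = not-t→f λ e → case ∨-t {not (R (proj₁ ot))} (proj₂ (∧-t {S (proj₁ ot)} e)) of λ
       { (inj₁ z) → case trans (sym z) (cong not (proj₁ (proj₂ ot))) of λ () ; (inj₂ z) → tf (∨-il z) (proj₂ (proj₂ ot)) }
    c1 = part-col h sx rx
    c2 = part-col {attached G S R p} (λ u e → proj₁ (∧-t {S u} e)) (h _ (proj₁ (proj₂ ot))) Tr

  abstract
    two-boundary : ∀ {R x} → R ⊆ S → S x ≡ true → R x ≡ false → 4 ≤ ∣ R ∣ → ∃ λ p → ∃ λ q → p ≢ q × Boundary R p × Boundary R q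
    two-boundary = two-boundary′

  -- An extra edge makes the colours of two boundary vertices differ. If the next set is all of `S`
  -- and the obstruction has one colour vertex, one of the two carries another colour, and its edge
  -- out of `R` raises the gain from 6 to 12.
  proper-dense₁₂ : ∀ {R x} → R ⊆ S → S x ≡ true → R x ≡ false → 4 ≤ ∣ R ∣ → 10 * ∣ R ∣ ≤ 3 * e2 (G ↾ R) + 12 → ⊥
  proper-dense₁₂ {R} {x} h sx rx r4 b with two-boundary {R} h sx rx r4
  ... | p , q , ne , (rp , p' , sp' , rp' , ep) , (rq , q' , sq' , rq' , eq) with col-addE {R} {x} p q ne h sx rx
  ... | c , cp = go kind
    where
    cp' : Proper (G ↾ R) c
    cp' u v e with ↾-E {G = G} {R} {u} {v} e
    ... | r , s , t = cp u v (↾-i (addE G p q ne) r s (addE-i G p q ne t))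
    c≢ : c p ≢ c q
    c≢ = cp p q (↾-i (addE G p q ne) rp rq (addE-new G p q ne))
    open Col-R R h r4 c cp'
    fin : ∀ k → 12 ≤ 4 + k → Gain (O' ∪ R) k → 10 * ∣ O' ∪ R ∣ ≤ 3 * e2 (G ↾ (O' ∪ R)) + 4
    fin k hk g = farkas 0 (ℕₚ.+-mono-≤ hk (ℕₚ.+-mono-≤ g b)) (ky-5 (10 * ∣ O' ∪ R ∣) (3 * e2 (G ↾ R)) (10 * ∣ R ∣) (3 * e2 (G ↾ (O' ∪ R))) k)
    r'4 : 4 ≤ ∣ O' ∪ R ∣
    r'4 = ℕₚ.≤-trans r4 (ℕₚ.≤-trans (ℕₚ.n≤1+n _) bigger)
    go : Kind O' → ⊥
    go (avoids z) = nonavoid z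
    go (many g) = any-dense R'⊆S r'4 (fin 8 ℕₚ.≤-refl g)
    go (one i g ex) with outside? (O' ∪ R)
    ... | inj₁ (y , sy , ry) = proper-dense R'⊆S sy ry r'4 (farkas 4 (ℕₚ.+-mono-≤ g b) (ky-6 (10 * ∣ O' ∪ R ∣) (3 * e2 (G ↾ R)) (10 * ∣ R ∣) (3 * e2 (G ↾ (O' ∪ R)))))
    ... | inj₂ s with c p ≟ i
    ... | no hi = any-dense R'⊆S r'4 (fin 12 (ℕₚ.m≤m+n 12 4) (ex p' p (inO s sp' rp') rp (E-sym G ep) hi))
    ... | yes refl = any-dense R'⊆S r'4 (fin 12 (ℕₚ.m≤m+n 12 4) (ex q' q (inO s sq' rq') rq (E-sym G eq) (c≢ ∘ sym)))

  -- Minimum degree 3 gives `9 * ∣ S ∣ ≤ 3 * e2 H`, so the excess of 5 in `big` forces a fifth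
  -- vertex. K₄ meets the bound with equality.
  size5 : 5 ≤ ∣ S ∣
  size5 = farkas 0 (ℕₚ.+-mono-≤ big (ℕₚ.*-monoʳ-≤ 3 k)) (ky-7 (e2 H) ∣ S ∣)
    where
    k : 3 * ∣ S ∣ ≤ e2 H
    k = ℕₚ.≤-trans (ℕₚ.≤-reflexive (sym (∑-* 3 (𝟙 ∘ S)))) (∑-mono l)
      where l : ∀ u → 3 * 𝟙 (S u) ≤ dg H u
            l u with S u in eq
            ... | false = z≤n
            ... | true = subst (λ z → 3 ≤ ∑ λ v → 𝟙 ((z ∧ S v) ∧ adj G u v)) eq (degree3 u eq)

  -- Four vertices with five edges have doubled potential 40 - 30 = 10, and `size5` makes them a
  -- proper subset.
  no-diamond : ∀ {x y z w} → E H x y → E H x z → E H y z → E H x w → E H y w → z ≢ w → ⊥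
  no-diamond {x} {y} {z} {w} xy xz yz xw yw zw = proper-dense {R4} {proj₁ out} sub (proj₁ (proj₂ out)) ro (ℕₚ.≤-reflexive (sym card)) den
    where
    R0 R1 R2 R3 R4 : Sub n
    R0 _ = false
    R1 = ins R0 z
    R2 = ins R1 x
    R3 = ins R2 y
    R4 = ins R3 w
    nx : z ≢ x
    nx e = E-irr H xz (sym e)
    f1 : R1 x ≡ false
    f1 rewrite ≢→== (E-irr H xz) = refl
    f2 : R2 y ≡ false
    f2 rewrite ≢→== (E-irr H xy ∘ sym) | ≢→== (E-irr H yz) = refl
    f3 : R3 w ≡ false
    f3 rewrite ≢→== (E-irr H yw ∘ sym) | ≢→== (E-irr H xw ∘ sym) | ≢→== (zw ∘ sym) = refl
    card : ∣ R4 ∣ ≡ 4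
    card = trans (card-ins R3 w f3) (cong suc (trans (card-ins R2 y f2) (cong suc (trans (card-ins R1 x f1) (cong suc (trans (card-ins R0 z refl) (cong suc (card-empty {n}))))))))
    z1 : R1 z ≡ true
    z1 = ∨-il (==-refl z)
    x2 : R2 x ≡ true
    x2 = ∨-il (==-refl x)
    g1 = grow G R1 x {z ∷ []} f1 ([] ∷ []) ((z1 , H→G xz) ∷ [])
    g2 = grow G R2 y {x ∷ z ∷ []} f2 ((E-irr H xz ∷ []) ∷ [] ∷ []) ((x2 , H→G (E-sym H xy)) ∷ (∨-ir {z == x} z1 , H→G yz) ∷ [])
    g3 = grow G R3 w {x ∷ y ∷ []} f3 ((E-irr H xy ∷ []) ∷ [] ∷ []) ((∨-ir {x == y} x2 , H→G (E-sym H xw)) ∷ (∨-il (==-refl y) , H→G (E-sym H yw)) ∷ [])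
    den : 10 * ∣ R4 ∣ ≤ 3 * e2 (G ↾ R4) + 10
    den rewrite card = farkas (3 * e2 (G ↾ R1)) (ℕₚ.*-monoʳ-≤ 3 (ℕₚ.+-mono-≤ g1 (ℕₚ.+-mono-≤ g2 g3))) (ky-8 (e2 (G ↾ R1)) (e2 (G ↾ R2)) (e2 (G ↾ R3)) (e2 (G ↾ R4)))
    sub : R4 ⊆ S
    sub u e with ∨-t {u == w} e
    ... | inj₁ p rewrite ==→≡ {i = u} {w} p = H→S (E-sym H xw)
    ... | inj₂ e with ∨-t {u == y} e
    ... | inj₁ p rewrite ==→≡ {i = u} {y} p = H→S yz
    ... | inj₂ e with ∨-t {u == x} e
    ... | inj₁ p rewrite ==→≡ {i = u} {x} p = H→S xz
    ... | inj₂ e with ∨-t {u == z} e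
    ... | inj₁ p rewrite ==→≡ {i = u} {z} p = H→S (E-sym H xz)
    out = card-outside S (w ∷ y ∷ x ∷ z ∷ []) size5
    ro : R4 (proj₁ out) ≡ false
    ro = proj₂ (proj₂ out)

  -- Delete `x` and `y`, join their third neighbours `x'` and `y'` by an edge, and colour;
  -- `avoid-adjacent` then puts `x` and `y` back. If `x'` and `y'` coincide there is a diamond.
  no-cubic-edge-in-triangle : ∀ {x y z} → E H x y → E H x z → E H y z → dg H x ≡ 3 → dg H y ≡ 3 → ⊥
  no-cubic-edge-in-triangle {x} {y} {z} xy xz yz dx dy = go (third-nbr H x y z dx (E-irr H yz) xy xz) (third-nbr H y x z dy (E-irr H xz) (E-sym H xy) yz)
    where
    T : Sub n
    T = del (del S x) y
    inT : ∀ {u} → S u ≡ true → u ≢ x → u ≢ y → T u ≡ true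
    inT s h h' = del-i (del S x) h' (del-i S h s)
    Sy : Sub n
    Sy = del S y
    module Recolour (x' y' : Fin n) (ne : x' ≢ y') (x'y : x' ≢ y) (y'x : y' ≢ x)
      (onlyx : ∀ v → E H x v → (v ≡ y) ⊎ (v ≡ z) ⊎ (v ≡ x')) (onlyy : ∀ v → E H y v → (v ≡ x) ⊎ (v ≡ z) ⊎ (v ≡ y'))
      (c : Colouring n) (pc : Proper (addE G x' y' ne ↾ T) c) (p q : Fin 3) (zp : c z ≢ p) (x'p : c x' ≢ p) (zq : c z ≢ q) (y'q : c y' ≢ q) (pq : p ≢ q) where
      c1 : Colouring n
      c1 = upd c x p
      h3 : ∀ u v → u ≢ x → v ≢ x → E (G ↾ Sy) u v → c u ≢ c v
      h3 u v a b e with ↾-E {G = G} {Sy} {u} {v} e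
      ... | r , s , t = pc u v (↾-i (addE G x' y' ne) (inT (del-⊆ S y u r) a (del-≢ S r)) (inT (del-⊆ S y v s) b (del-≢ S s)) (addE-i G x' y' ne t))
      h4 : ∀ v → E (G ↾ Sy) x v → c v ≢ p
      h4 v e with ↾-E {G = G} {Sy} {x} {v} e
      ... | r , s , t with onlyx v (↾-i G (H→S xy) (del-⊆ S y v s) t)
      ... | inj₁ refl = ⊥-elim (del-≢ S s refl)
      ... | inj₂ (inj₁ refl) = zp
      ... | inj₂ (inj₂ refl) = x'p
      c1p : Proper (G ↾ Sy) c1
      c1p = extend-vertex (G ↾ Sy) x c p h3 h4
      h1 : ∀ u v → u ≢ y → v ≢ y → E H u v → c1 u ≢ c1 v
      h1 u v a b e with ↾-E {G = G} {S} {u} {v} e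
      ... | r , s , t = c1p u v (↾-i G (del-i S a r) (del-i S b s) t)
      at : ∀ v → (v ≡ x) ⊎ (v ≡ z) ⊎ (v ≡ y') → c1 v ≢ q
      at v (inj₁ refl) e = pq (trans (sym (upd-same c v p)) e)
      at v (inj₂ (inj₁ refl)) e = zq (trans (sym (upd-other c {x} p (E-irr H xz ∘ sym))) e)
      at v (inj₂ (inj₂ refl)) e = y'q (trans (sym (upd-other c {x} p y'x)) e)
      clash : ⊥
      clash = nc (upd c1 y q , extend-vertex H y c1 q h1 (λ v e → at v (onlyy v e)))
    go : Nb3 H x y z → Nb3 H y x z → ⊥
    go (nb3 x' x'y x'z xx' onlyx) (nb3 y' y'x y'z yy' onlyy) = cases (x' ≟ y')
      where
      cases : Dec (x' ≡ y') → ⊥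
      cases (yes refl) = no-diamond xy xz yz xx' yy' (x'z ∘ sym)
      cases (no ne) = coloured (col-addE {T} {x} x' y' ne (λ u e → del-⊆ S x u (del-⊆ (del S x) y u e)) (H→S xy) (⊆-f {B = del S x} (del-⊆ (del S x) y) (del-x S x)))
        where
        coloured : Col (addE G x' y' ne ↾ T) → ⊥
        coloured (c , pc) = done (avoid-adjacent (c z) (c x') (c y') (pc x' y' (↾-i (addE G x' y' ne) (inT (H→S (E-sym H xx')) (E-irr H xx' ∘ sym) x'y) (inT (H→S (E-sym H yy')) y'x (E-irr H yy' ∘ sym)) (addE-new G x' y' ne))))
          where
          done : (∃ λ p → ∃ λ q → c z ≢ p × c x' ≢ p × c z ≢ q × c y' ≢ q × p ≢ q) → ⊥
          done (p , q , zp , x'p , zq , y'q , pq) = Recolour.clash x' y' ne x'y y'x onlyx onlyy c pc p q zp x'p zq y'q pq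

  -- Delete `x` and `y` and identify `a` with `b`. From a colouring, `y` sees two coloured
  -- neighbours and afterwards `x` sees two colours. An obstruction through `a`, enlarged by `b` and
  -- `x` with the edges `xa` and `xb`, has doubled potential at most 4 + 20 - 12 = 12 and misses
  -- `y`.
  no-cubic-edge : ∀ {x y a b} → E H x y → dg H x ≡ 3 → dg H y ≡ 3 → E H x a → E H x b → a ≢ b → a ≢ y → b ≢ y → ¬ E H a b → ⊥
  no-cubic-edge {x} {y} {a} {b} xy dx dy xa xb ab ay by nab = go (Col? (M ↾ T))
    where
    nabG : ¬ E G a b
    nabG e = nab (↾-i G (H→S (E-sym H xa)) (H→S (E-sym H xb)) e)
    M = merge G a b nabG
    Sx Sxy T : Sub n
    Sx = del S x
    Sxy = del Sx y
    T = del Sxy b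
    onlyx : ∀ v → E H x v → (v ≡ y) ⊎ (v ≡ a) ⊎ (v ≡ b)
    onlyx v e with third-nbr H x y a dx (ay ∘ sym) xy xa
    ... | nb3 d dy da xd only with only b xb
    ... | inj₁ p = ⊥-elim (by p)
    ... | inj₂ (inj₁ p) = ⊥-elim (ab (sym p))
    ... | inj₂ (inj₂ refl) = only v e
    T⊆S : T ⊆ S
    T⊆S u e = del-⊆ S x u (del-⊆ Sx y u (del-⊆ Sxy b u e))
    Tx : T x ≡ false
    Tx = ⊆-f {A = T} {B = Sx} (λ u e → del-⊆ Sx y u (del-⊆ Sxy b u e)) (del-x S x)
    Ty : T y ≡ false
    Ty = ⊆-f {A = T} {B = Sxy} {y} (del-⊆ Sxy b) (del-x Sx y)
    go : Dec (Col (M ↾ T)) → ⊥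
    go (yes (c , cp)) = nc (upd c2 x k' , extend-vertex H x c2 k' h1 h2)
      where
      c1 = upd c b (c a)
      inT : ∀ {u} → Sxy u ≡ true → u ≢ b → T u ≡ true
      inT e h = del-i Sxy h e
      aT : T a ≡ true
      aT = inT (del-i Sx ay (del-i S (E-irr H xa ∘ sym) (H→S (E-sym H xa)))) ab
      c1p : Proper (G ↾ Sxy) c1
      c1p = extend-vertex (G ↾ Sxy) b c (c a) (λ u v p q e → let (r , s , t) = ↾-E {G = G} {Sxy} {u} {v} e in cp u v (↾-i M (inT r p) (inT s q) (merge-old G a b nabG p q t)))
         (λ v e → let (r , s , t) = ↾-E {G = G} {Sxy} {b} {v} e in cp a v (↾-i M aT (inT s (E-irr G t ∘ sym)) (merge-new G a b nabG ab t)) ∘ sym)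
      dy2 : dg (G ↾ Sx) y ≤ 2
      dy2 = ℕₚ.≤-pred (ℕₚ.≤-trans (card-strict {A = adj (G ↾ Sx) y} {B = adj H y} x (λ u e → ↾-mono G (del-⊆ S x) y u e)
         (not-t→f λ e → del-≢ S (proj₁ (proj₂ (↾-E {G = G} {Sx} {y} {x} e))) refl) (E-sym H xy)) (ℕₚ.≤-reflexive dy))
      sk = small-nbrs (G ↾ Sx) y dy2 c1
      k = proj₁ sk
      c2 = upd c1 y k
      c2p : Proper (G ↾ Sx) c2
      c2p = extend-vertex (G ↾ Sx) y c1 k (λ u v p q e → let (r , s , t) = ↾-E {G = G} {Sx} {u} {v} e in c1p u v (↾-i G (del-i Sx p r) (del-i Sx q s) t)) (proj₂ sk)
      av = avoid2 (c2 y) (c2 a)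
      k' = proj₁ av
      h1 : ∀ u v → u ≢ x → v ≢ x → E H u v → c2 u ≢ c2 v
      h1 u v p q e = let (r , s , t) = ↾-E {G = G} {S} {u} {v} e in c2p u v (↾-i G (del-i S p r) (del-i S q s) t)
      c2ab : c2 b ≡ c2 a
      c2ab = trans (upd-other c1 k by) (trans (upd-same c b (c a)) (sym (trans (upd-other c1 k ay) (upd-other c (c a) ab))))
      h2 : ∀ v → E H x v → c2 v ≢ k'
      h2 v e with onlyx v e
      ... | inj₁ refl = proj₁ (proj₂ av)
      ... | inj₂ (inj₁ refl) = proj₂ (proj₂ av)
      ... | inj₂ (inj₂ refl) = λ z → proj₂ (proj₂ av) (trans (sym c2ab) z)
    go (no nct) with IH M T (card-strict x T⊆S Tx (H→S xy)) nct
    ... | A , A⊆ , ncA , a4 , low with bcase (A a)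
    ... | inj₂ Aa = ncA (Col-⊑ {H = M ↾ A} {G ↾ A} k (part-col {A} {x} (λ u e → T⊆S u (A⊆ u e)) (H→S xy) (⊆-f A⊆ Tx)))
      where k : (M ↾ A) ⊑ (G ↾ A)
            k u v e with ↾-E {G = M} {A} {u} {v} e
            ... | r , s , t with merge-t G a b nabG t
            ... | _ , _ , m-old f = ↾-i G r s f
            ... | _ , _ , m-left refl f = tf r Aa
            ... | _ , _ , m-right refl f = tf s Aa
    ... | inj₁ Aa = proper-dense₁₂ {R2} {y} sub2 (H→S (E-sym H xy)) R2y (ℕₚ.≤-trans a4 (ℕₚ.≤-trans (ℕₚ.m≤n+m _ 2) (ℕₚ.≤-reflexive (sym card2)))) fin
      where
      R1 R2 : Sub n
      R1 = ins A b
      R2 = ins R1 x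
      Ab : A b ≡ false
      Ab = ⊆-f A⊆ (del-x Sxy b)
      Ax : A x ≡ false
      Ax = ⊆-f A⊆ Tx
      Ay : A y ≡ false
      Ay = ⊆-f A⊆ Ty
      R1x : R1 x ≡ false
      R1x rewrite ≢→== (E-irr H xb) = Ax
      R2y : R2 y ≡ false
      R2y rewrite ≢→== (E-irr H xy ∘ sym) | ≢→== (by ∘ sym) = Ay
      card2 : ∣ R2 ∣ ≡ 2 + ∣ A ∣
      card2 = trans (card-ins R1 x R1x) (cong suc (card-ins A b Ab))
      sub2 : R2 ⊆ S
      sub2 u e with ∨-t {u == x} e
      ... | inj₁ p rewrite ==→≡ {i = u} {x} p = H→S xy
      ... | inj₂ e with ∨-t {u == b} e
      ... | inj₁ p rewrite ==→≡ {i = u} {b} p = H→S (E-sym H xb)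
      ... | inj₂ p = T⊆S u (A⊆ u p)
      nabR : ¬ E (G ↾ R1) a b
      nabR e = nabG (↾-⊑ G R1 a b e)
      le : e2 (M ↾ A) ≤ e2 (G ↾ R1)
      le = ℕₚ.≤-trans (e2-mono {H = M ↾ A} {merge (G ↾ R1) a b nabR} k) (e2-merge (G ↾ R1) a b nabR)
        where
        bR : R1 b ≡ true
        bR = ∨-il (==-refl b)
        k : (M ↾ A) ⊑ merge (G ↾ R1) a b nabR
        k u v e with ↾-E {G = M} {A} {u} {v} e
        ... | r , s , t with merge-t G a b nabG t
        ... | p , q , m-old f = merge-old (G ↾ R1) a b nabR p q (↾-i G (∨-ir {u == b} r) (∨-ir {v == b} s) f)
        ... | p , q , m-left refl f = merge-new (G ↾ R1) a b nabR ab (↾-i G bR (∨-ir {v == b} s) f)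
        ... | p , q , m-right refl f = E-sym (merge (G ↾ R1) a b nabR) {a} {u} (merge-new (G ↾ R1) a b nabR {u} ab (↾-i G {R1} bR (∨-ir {u == b} r) f))
      g = grow G R1 x {a ∷ b ∷ []} R1x ((ab ∷ []) ∷ [] ∷ []) ((∨-ir {a == b} Aa , H→G xa) ∷ (∨-il (==-refl b) , H→G xb) ∷ [])
      fin : 10 * ∣ R2 ∣ ≤ 3 * e2 (G ↾ R2) + 12
      fin rewrite card2 = farkas 0 (ℕₚ.+-mono-≤ low (ℕₚ.*-monoʳ-≤ 3 (ℕₚ.+-mono-≤ le g))) (ky-9 ∣ A ∣ (e2 (M ↾ A)) (e2 (G ↾ R1)) (e2 (G ↾ R2)))

  three? : Fin n → Bool
  three? u = dg H u ≡ᵇ 3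

  t : Fin n → Fin n → Bool
  t u w = adj H u w ∧ (three? u ∧ not (three? w))

  three-of : ∀ {u} → three? u ≡ true → dg H u ≡ 3
  three-of {u} e = ℕₚ.≡ᵇ⇒≡ (dg H u) 3 (subst IsTrue (sym e) tt)

  -- With two cubic neighbours `y` and `y'`, the third neighbour `b` of `u` is either adjacent to
  -- `y'` or not; the two preceding lemmas exclude these cases.
  one-three : ∀ {u y y'} → dg H u ≡ 3 → E H u y → E H u y' → y ≢ y' → dg H y ≡ 3 → dg H y' ≡ 3 → ⊥
  one-three {u} {y} {y'} du uy uy' ne dy dy' with third-nbr H u y y' du ne uy uy'
  ... | nb3 b b≢y b≢y' ub _ with E? H y' b
  ... | yes e = no-cubic-edge-in-triangle uy' ub e du dy'
  ... | no e = no-cubic-edge uy du dy uy' ub (b≢y' ∘ sym) (ne ∘ sym) b≢y e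

  sends : ∀ u → dg H u ≡ 3 → 2 ≤ ∑ (λ w → 𝟙 (t u w))
  sends u du with nbr-of H u (ℕₚ.≤-trans (s≤s z≤n) (ℕₚ.≤-reflexive (sym du)))
  ... | a , ua with third-of H u a a (ℕₚ.≤-reflexive (sym du))
  ... | b , b≢a , _ , ub with third-of H u a b (ℕₚ.≤-reflexive (sym du))
  ... | c , c≢a , c≢b , uc = go
    where
    tu : three? u ≡ true
    tu rewrite du = refl
    tt' : ∀ {w} → E H u w → three? w ≡ false → t u w ≡ true
    tt' e f rewrite f = ∧-i e (∧-i tu refl)
    pick2 : ∀ {v w} → v ≢ w → t u v ≡ true → t u w ≡ true → 2 ≤ ∑ (λ w → 𝟙 (t u w))
    pick2 ne p q = card-list (t u) ((ne ∷ []) ∷ [] ∷ []) (p ∷ q ∷ [])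
    go : 2 ≤ ∑ (λ w → 𝟙 (t u w))
    go with bcase (three? a) | bcase (three? b) | bcase (three? c)
    ... | inj₁ p | inj₁ q | _ = ⊥-elim (one-three du ua ub (b≢a ∘ sym) (three-of p) (three-of q))
    ... | inj₁ p | inj₂ q | inj₁ r = ⊥-elim (one-three du ua uc (c≢a ∘ sym) (three-of p) (three-of r))
    ... | inj₁ p | inj₂ q | inj₂ r = pick2 (c≢b ∘ sym) (tt' ub q) (tt' uc r)
    ... | inj₂ p | inj₂ q | _ = pick2 (b≢a ∘ sym) (tt' ua p) (tt' ub q)
    ... | inj₂ p | inj₁ q | inj₁ r = ⊥-elim (one-three du ub uc (c≢b ∘ sym) (three-of q) (three-of r))
    ... | inj₂ p | inj₁ q | inj₂ r = pick2 (c≢a ∘ sym) (tt' ua p) (tt' uc r)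

  receives : ∀ u → ∑ (λ w → 𝟙 (t w u)) ≤ dg H u
  receives u = ∑-mono λ w → 𝟙-mono λ e → E-sym H (proj₁ (∧-t {adj H w u} e))

  -- Discharging: every 3-vertex sends 1/2 to its neighbours of larger degree.
  discharge : ∀ u → 20 * 𝟙 (S u) + ∑ (λ w → 𝟙 (t w u)) ≤ 6 * dg H u + ∑ (λ w → 𝟙 (t u w))
  discharge u with bcase (S u)
  ... | inj₂ su = ℕₚ.≤-trans (ℕₚ.≤-reflexive (cong (λ z → 20 * 𝟙 z + ∑ (λ w → 𝟙 (t w u))) su)) (ℕₚ.≤-trans (receives u) (ℕₚ.≤-trans (ℕₚ.m≤m+n (dg H u) (5 * dg H u)) (ℕₚ.m≤m+n (6 * dg H u) _)))
  ... | inj₁ su = ℕₚ.≤-trans (ℕₚ.≤-reflexive (cong (λ z → 20 * 𝟙 z + ∑ (λ w → 𝟙 (t w u))) su)) (heavy (bcase (three? u)))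
    where
    -- For degree 3 the balance is 20 = 6 · 3 + 2; from degree 4 on, 20 + d ≤ 6d.
    heavy : (three? u ≡ true) ⊎ (three? u ≡ false) → 20 + ∑ (λ w → 𝟙 (t w u)) ≤ 6 * dg H u + ∑ (λ w → 𝟙 (t u w))
    heavy (inj₁ p) = ℕₚ.≤-trans (ℕₚ.≤-reflexive (cong (20 +_) none)) (ℕₚ.≤-trans (ℕₚ.≤-reflexive (sym (cong (λ z → 6 * z + 2) (three-of p)))) (ℕₚ.+-monoʳ-≤ (6 * dg H u) (sends u (three-of p))))
      where none : ∑ (λ w → 𝟙 (t w u)) ≡ 0
            none = ∑-z λ w → cong 𝟙 (not-t→f λ e → case trans (sym (proj₂ (∧-t {three? w} (proj₂ (∧-t {adj H w u} e))))) (cong not p) of λ ())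
    heavy (inj₂ p) = ℕₚ.≤-trans (farkas 0 (ℕₚ.+-mono-≤ (receives u) (ℕₚ.*-monoʳ-≤ 5 d4)) (ky-10 (∑ (λ w → 𝟙 (t w u))) (dg H u))) (ℕₚ.m≤m+n (6 * dg H u) _)
      where
      d4 : 4 ≤ dg H u
      d4 = ℕₚ.≤∧≢⇒< (degree3 u su) (λ e → tf (cong (_≡ᵇ 3) (sym e)) p)

  contra : ⊥
  contra = ℕₚ.<-irrefl refl (farkas {x = suc (20 * ∣ S ∣)} 9 (ℕₚ.+-mono-≤ (ℕₚ.*-monoʳ-≤ 2 big) tot') (ky-11 (e2 H) ∣ S ∣ tt'))
    where
    tt' = ∑₂ (λ u w → 𝟙 (t u w))
    tot' : 20 * ∣ S ∣ + tt' ≤ 6 * e2 H + tt'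
    tot' = subst₂ _≤_ (trans (∑-+ (λ u → 20 * 𝟙 (S u)) (λ u → ∑ λ w → 𝟙 (t w u))) (cong₂ _+_ (∑-* 20 (𝟙 ∘ S)) (∑-swap (λ u w → 𝟙 (t w u)))))
       (trans (∑-+ (λ u → 6 * dg H u) (λ u → ∑ λ w → 𝟙 (t u w))) (cong (_+ tt') (∑-* 6 (dg H)))) (∑-mono discharge)

-- Vertices are removed as long as the rest is not colourable; what remains is vertex-critical and
-- falls under `Critical`. The bound `k` on the size orders the induction across different graphs.
ky : ∀ k {n} (G : Graph n) S → ∣ S ∣ ≤ k → ¬ Col (G ↾ S) → Low G S
ky k G S h nc with Finₚ.any? (λ u → (S u ≟b true) ×-dec ¬? (Col? (G ↾ del S u)))
ky zero G S h nc | yes (u , su , nc') = case ℕₚ.≤-trans (ℕₚ.≤-reflexive (sym (card-del S u su))) h of λ ()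
ky (suc k) G S h nc | yes (u , su , nc') with ky k G (del S u) (ℕₚ.≤-pred (ℕₚ.≤-trans (ℕₚ.≤-reflexive (sym (card-del S u su))) h)) nc'
... | A , A⊆ , r = A , (λ v e → del-⊆ S u v (A⊆ v e)) , r
ky k G S h nc | no none = S , (λ u e → e) , nc , four , low
  where
  crit : ∀ u → S u ≡ true → Col (G ↾ del S u)
  crit u su = decidable-stable (Col? (G ↾ del S u)) (λ q → none (u , su , q))
  low : 10 * ∣ S ∣ ≤ 3 * e2 (G ↾ S) + 4
  low with 10 * ∣ S ∣ ≤? 3 * e2 (G ↾ S) + 4
  ... | yes p = p
  ... | no p = ⊥-elim (Critical.contra G S (ih k h) crit nc (ℕₚ.≰⇒> p))
    where ih : ∀ k → ∣ S ∣ ≤ k → ∀ {m} (H : Graph m) (A : Sub m) → suc ∣ A ∣ ≤ ∣ S ∣ → ¬ Col (H ↾ A) → Low H A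
          ih zero h H A l = ⊥-elim (ℕₚ.<-irrefl refl (ℕₚ.≤-trans (s≤s z≤n) (ℕₚ.≤-trans l h)))
          ih (suc k) h H A l = ky k H A (ℕₚ.≤-pred (ℕₚ.≤-trans l h))
  four : 4 ≤ ∣ S ∣
  four with Finₚ.any? (λ u → S u ≟b true)
  ... | no e = ⊥-elim (nc ((λ _ → zero) , λ u v p → ⊥-elim (e (u , proj₁ (↾-E {G = G} {S} {u} {v} p)))))
  ... | yes (u , su) with 3 ≤? dg (G ↾ S) u
  ... | yes d = ℕₚ.≤-trans (s≤s d) (card-strict {A = adj (G ↾ S) u} {B = S} u (λ v e → proj₁ (proj₂ (↾-E {G = G} {S} {u} {v} e))) (adj-irr (G ↾ S) u) su)
  ... | no d = ⊥-elim (nc (upd c u (proj₁ sk) , extend-vertex (G ↾ S) u c (proj₁ sk) a (proj₂ sk)))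
    where
    c = proj₁ (crit u su)
    sk = small-nbrs (G ↾ S) u (ℕₚ.≤-pred (ℕₚ.≰⇒> d)) c
    a : ∀ x y → x ≢ u → y ≢ u → E (G ↾ S) x y → c x ≢ c y
    a x y p q e with ↾-E {G = G} {S} {x} {y} e
    ... | r , s , t = proj₂ (crit u su) x y (↾-i G (del-i S p r) (del-i S q s) t)

-- The drop of potential for colourings that do not extend

Drop : ∀ {n} → Graph n → Sub n → Sub n → Colouring n → Set
Drop G O R ψ = (∃ λ A → A ⊆ O × 4 ≤ ∣ A ∣ × 10 * ∣ A ∣ ≤ 3 * e2 (G ↾ A) + 4 × ¬ Col (G ↾ A)) ⊎
  (∃ λ O' → O' ⊆ O × ¬ Extends (G ↾ (O' ∪ R)) R ψ × 10 * ∣ O' ∪ R ∣ + 3 * e2 (G ↾ R) + 6 ≤ 10 * ∣ R ∣ + 3 * e2 (G ↾ (O' ∪ R)))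

drop-kind : ∀ {n} (G : Graph n) O R ψ d p → Collapse.Result G O R ψ d p → Drop G O R ψ
drop-kind G O R ψ d p r = go (Result.O' r) (Result.O'⊆O r) (Result.noext r) (Result.kind r)
  where
  open Collapse G O R ψ d p
  go : ∀ O' → O' ⊆ O → ¬ Extends (G ↾ (O' ∪ R)) R ψ → Kind O' → Drop G O R ψ
  go O' O'⊆O noext (avoids q) = let (A , A⊆ , nc , a4 , low) = ky ∣ O' ∣ G O' ℕₚ.≤-refl q in inj₁ (A , (λ u e → O'⊆O u (A⊆ u e)) , a4 , low , nc)
  go O' O'⊆O noext (one _ g _) = inj₂ (O' , O'⊆O , noext , g)
  go O' O'⊆O noext (many g) = inj₂ (O' , O'⊆O , noext , ℕₚ.≤-trans (ℕₚ.+-monoʳ-≤ (10 * ∣ O' ∪ R ∣ + 3 * e2 (G ↾ R)) (ℕₚ.m≤m+n 6 2)) g)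

-- A colouring of R that does not extend forces a drop of the potential 5|A| - 3e(A).
abstract
  drop : ∀ {n} (G : Graph n) O R ψ → Disjoint O R → Proper (G ↾ R) ψ → ¬ Extends (G ↾ (O ∪ R)) R ψ → Drop G O R ψ
  drop G O R ψ d p ne = drop-kind G O R ψ d p (Collapse.collapse G O R ψ d p (λ A _ → ky ∣ A ∣ (Collapse.Y G O R ψ d p) A ℕₚ.≤-refl) ne)

-- Union-find

-- The head of the list is the last union: it redirects the class of `a` to the representative of
-- `b`. Classes are the fibres of `rep es`.
rep : ∀ {N} → List (Pair N) → Fin N → Fin N
rep [] x = x
rep ((a , b) ∷ es) x = if rep es x == rep es a then rep es b else rep es x

module _ {N} (a b : Fin N) (es : List (Pair N)) where
  rep-hit : ∀ x → rep es x ≡ rep es a → rep ((a , b) ∷ es) x ≡ rep es b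
  rep-hit x e rewrite e | ==-refl (rep es a) = refl

  rep-miss : ∀ x → rep es x ≢ rep es a → rep ((a , b) ∷ es) x ≡ rep es x
  rep-miss x e rewrite ≢→== e = refl

rep-cong : ∀ {N} e (es : List (Pair N)) {x y} → rep es x ≡ rep es y → rep (e ∷ es) x ≡ rep (e ∷ es) y
rep-cong (a , b) es p rewrite p = refl

-- An equivalence relation that contains the listed pairs contains the generated one. Invariance of
-- functions along classes, and paths inside classes, are instances.
rep-rel : ∀ {N} (R : Fin N → Fin N → Set) → (∀ x → R x x) → (∀ {x y} → R x y → R y x) → (∀ {x y z} → R x y → R y z → R x z) →
  ∀ es → (∀ {a b} → (a , b) ∈ es → R a b) → ∀ x → R (rep es x) x
rep-rel R r s t [] h x = r x
rep-rel R r s t ((a , b) ∷ es) h x with rep es x ≟ rep es a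
... | no ne rewrite ≢→== ne = rep-rel R r s t es (h ∘ there) x
... | yes e rewrite e | ==-refl (rep es a) = t (ih b) (t (s (h (here refl))) (t (s (ih a)) (subst (λ z → R z x) e (ih x))))
  where ih = rep-rel R r s t es (h ∘ there)

rep-fun : ∀ {N} {A : Set} (f : Fin N → A) es → (∀ {a b} → (a , b) ∈ es → f a ≡ f b) → ∀ x → f (rep es x) ≡ f x
rep-fun f es h = rep-rel (λ x y → f x ≡ f y) (λ _ → refl) sym trans es h

rep-idem : ∀ {N} (es : List (Pair N)) x → rep es (rep es x) ≡ rep es x
rep-idem [] x = refl
rep-idem ((a , b) ∷ es) x with rep es x ≟ rep es a
... | no ne = trans (cong (rep ((a , b) ∷ es)) (rep-miss a b es x ne)) (trans (rep-miss a b es (rep es x) (λ q → ne (trans (sym (rep-idem es x)) q))) (trans (rep-idem es x) (sym (rep-miss a b es x ne))))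
... | yes e = trans (cong (rep ((a , b) ∷ es)) (rep-hit a b es x e)) (trans k (sym (rep-hit a b es x e)))
  where k : rep ((a , b) ∷ es) (rep es b) ≡ rep es b
        k with rep es (rep es b) ≟ rep es a
        ... | yes q = rep-hit a b es _ q
        ... | no q = trans (rep-miss a b es _ q) (rep-idem es b)

rep-∈ : ∀ {N} (es : List (Pair N)) {a b} → (a , b) ∈ es → rep es a ≡ rep es b
rep-∈ ((a , b) ∷ es) (here refl) with rep es b ≟ rep es a
... | yes q = trans (rep-hit a b es a refl) (sym (rep-hit a b es b q))
... | no q = trans (rep-hit a b es a refl) (sym (rep-miss a b es b q))
rep-∈ (e ∷ es) (there i) = rep-cong e es (rep-∈ es i)

rep-++ : ∀ {N} (es fs : List (Pair N)) {x y} → rep fs x ≡ rep fs y → rep (es ++ fs) x ≡ rep (es ++ fs) y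
rep-++ [] fs p = p
rep-++ (e ∷ es) fs p = rep-cong e (es ++ fs) (rep-++ es fs p)

fixed : ∀ {N} → List (Pair N) → Sub N
fixed es x = rep es x == x

classes : ∀ {N} → List (Pair N) → ℕ
classes es = ∣ fixed es ∣

fixed-rep : ∀ {N} (es : List (Pair N)) x → fixed es (rep es x) ≡ true
fixed-rep es x rewrite rep-idem es x = ==-refl (rep es x)

classes-merge : ∀ {N} (a b : Fin N) es → rep es a ≢ rep es b → classes es ≡ suc (classes ((a , b) ∷ es))
classes-merge a b es ne = trans (card-del (fixed es) (rep es a) (fixed-rep es a)) (cong suc (∑-cong λ x → cong 𝟙 (sym (k x))))
  where
  k : ∀ x → fixed ((a , b) ∷ es) x ≡ del (fixed es) (rep es a) x
  k x with x ≟ rep es a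
  ... | yes refl rewrite ==-refl (rep es a) | rep-idem es a | ==-refl (rep es a) = ≢→== (ne ∘ sym)
  ... | no nx rewrite ≢→== nx with rep es x ≟ rep es a
  ... | no q rewrite ≢→== q = refl
  ... | yes q rewrite q | ==-refl (rep es a) = trans (≢→== bad) (sym (≢→== (nx ∘ sym)))
    where bad : rep es b ≢ x
          bad e = ne (trans (sym q) (trans (cong (rep es) (sym e)) (rep-idem es b)))

classes-same : ∀ {N} (a b : Fin N) es → rep es a ≡ rep es b → classes ((a , b) ∷ es) ≡ classes es
classes-same a b es e = ∑-cong λ x → cong (λ z → 𝟙 (z == x)) (k x)
  where k : ∀ x → rep ((a , b) ∷ es) x ≡ rep es x
        k x with rep es x ≟ rep es a
        ... | yes q = trans (rep-hit a b es x q) (trans (sym e) (sym q))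
        ... | no q = rep-miss a b es x q

classes-++ : ∀ {N} (es fs : List (Pair N)) → classes fs ≤ classes (es ++ fs) + length es
classes-++ [] fs = ℕₚ.m≤m+n _ 0
classes-++ ((a , b) ∷ es) fs with rep (es ++ fs) a ≟ rep (es ++ fs) b
... | yes e rewrite classes-same a b (es ++ fs) e = ℕₚ.≤-trans (classes-++ es fs) (ℕₚ.+-monoʳ-≤ (classes (es ++ fs)) (ℕₚ.n≤1+n _))
... | no ne = ℕₚ.≤-trans (classes-++ es fs) (ℕₚ.≤-reflexive (trans (cong (_+ length es) (classes-merge a b (es ++ fs) ne)) (sym (ℕₚ.+-suc _ (length es)))))

-- The count of classes says that each listed pair joins two different classes, so the pairs form a
-- forest over the classes of `fs`. Adding them one at a time, a wrong value at the new pair is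
-- corrected by flipping `s` on the whole class of `a`.
coboundary : ∀ {N} {A : Set} (f : A → Pair N) (val : A → Bool) xs fs → classes (map f xs ++ fs) + length xs ≤ classes fs →
  ∃ λ (s : Fin N → Bool) → (∀ {a b} → (a , b) ∈ fs → s a ≡ s b) × (∀ {x} → x ∈ xs → s (proj₁ (f x)) xor s (proj₂ (f x)) ≡ val x)
coboundary f val [] fs h = (λ _ → false) , (λ _ → refl) , λ ()
coboundary {A = A} f val (x ∷ xs) fs h with f x in fx
... | a , b with rep (map f xs ++ fs) a ≟ rep (map f xs ++ fs) b
... | yes e = ⊥-elim (ℕₚ.<-irrefl refl (ℕₚ.≤-trans (ℕₚ.≤-reflexive (sym (ℕₚ.+-suc _ (length xs)))) (ℕₚ.≤-trans (ℕₚ.≤-reflexive (cong (_+ suc (length xs)) (sym (classes-same a b es e))))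
        (ℕₚ.≤-trans h (ℕₚ.≤-trans (classes-++ (map f xs) fs) (ℕₚ.≤-reflexive (cong (classes es +_) (len xs))))))))
  where es = map f xs ++ fs
        len : ∀ ys → length (map f ys) ≡ length ys
        len [] = refl
        len (y ∷ ys) = cong suc (len ys)
... | no ne with coboundary f val xs fs (ℕₚ.≤-trans (ℕₚ.≤-reflexive (trans (cong (_+ length xs) (classes-merge a b (map f xs ++ fs) ne)) (sym (ℕₚ.+-suc _ (length xs))))) h)
... | s , s1 , s2 = s' , (λ i → keep (rep-++ (map f xs) fs (rep-∈ fs i)) (s1 i)) , λ { (here refl) → new ; (there i) → old i }
  where
  c = rep (map f xs ++ fs)
  δ = (s a xor s b) xor val x
  s' : Fin _ → Bool
  s' y = s y xor (δ ∧ (c y == c a))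
  keep : ∀ {p q} → c p ≡ c q → s p ≡ s q → s' p ≡ s' q
  keep e e' rewrite e | e' = refl
  ∈c : ∀ {ys y} → y ∈ ys → f y ∈ map f ys
  ∈c (here refl) = here refl
  ∈c (there i) = there (∈c i)
  joined : ∀ {ys y} → y ∈ ys → rep (map f ys ++ fs) (proj₁ (f y)) ≡ rep (map f ys ++ fs) (proj₂ (f y))
  joined {y' ∷ ys} (here refl) = rep-∈ (f y' ∷ map f ys ++ fs) (here refl)
  joined {y' ∷ ys} (there i) = rep-cong (f y') (map f ys ++ fs) (joined i)
  xx : ∀ p q d → (p xor d) xor (q xor d) ≡ p xor q
  xx true true true = refl
  xx true true false = refl
  xx true false true = refl
  xx true false false = refl
  xx false true true = refl
  xx false true false = refl
  xx false false true = refl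
  xx false false false = refl
  old : ∀ {y} → y ∈ xs → s' (proj₁ (f y)) xor s' (proj₂ (f y)) ≡ val y
  old {y} i rewrite joined i = trans (xx (s (proj₁ (f y))) (s (proj₂ (f y))) _) (s2 i)
  yy : ∀ p q v → (p xor ((p xor q) xor v)) xor q ≡ v
  yy true true true = refl
  yy true true false = refl
  yy true false true = refl
  yy true false false = refl
  yy false true true = refl
  yy false true false = refl
  yy false false true = refl
  yy false false false = refl
  new : s' (proj₁ (f x)) xor s' (proj₂ (f x)) ≡ val x
  new rewrite fx | ==-refl (c a) | ≢→== (ne ∘ sym) | Boolₚ.∧-identityʳ δ | Boolₚ.∧-zeroʳ δ | Boolₚ.xor-identityʳ (s b) = yy (s a) (s b) (val x)

-- Edge sets with prescribed boundary

-- Edge sets are Boolean matrices added modulo 2. With `xor` the boundary formula `st-∂` also holds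
-- for `a = b`, where the set is empty.
st : ∀ {n} → Fin n → Fin n → Fin n → Fin n → Bool
st a b u v = (u == a ∧ v == b) xor (u == b ∧ v == a)

st-sym : ∀ {n} (a b u v : Fin n) → st a b u v ≡ st a b v u
st-sym a b u v = trans (Boolₚ.xor-comm (u == a ∧ v == b) _) (cong₂ _xor_ (Boolₚ.∧-comm (u == b) (v == a)) (Boolₚ.∧-comm (u == a) (v == b)))

st-swap : ∀ {n} (a b u v : Fin n) → st a b u v ≡ st b a u v
st-swap a b u v = Boolₚ.xor-comm (u == a ∧ v == b) _

st-t : ∀ {n} (a b u v : Fin n) → st a b u v ≡ true → (u ≡ a × v ≡ b) ⊎ (u ≡ b × v ≡ a)
st-t a b u v e with u == a ∧ v == b in p
... | true = inj₁ (==→≡ {i = u} {a} (proj₁ (∧-t {u == a} p)) , ==→≡ {i = v} {b} (proj₂ (∧-t {u == a} p)))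
... | false = inj₂ (==→≡ {i = u} {b} (proj₁ (∧-t {u == b} e)) , ==→≡ {i = v} {a} (proj₂ (∧-t {u == b} e)))

st-1 : ∀ {n} (a b : Fin n) → a ≢ b → st a b a b ≡ true
st-1 a b h rewrite ==-refl a | ==-refl b | ≢→== h = refl

st-0 : ∀ {n} (a b u v : Fin n) → ¬ ((u ≡ a × v ≡ b) ⊎ (u ≡ b × v ≡ a)) → st a b u v ≡ false
st-0 a b u v h = not-t→f (h ∘ st-t a b u v)

st-∂ : ∀ {n} (a b u : Fin n) → ⊕ (st a b u) ≡ (u == a) xor (u == b)
st-∂ a b u = trans (⊕-xor (λ v → u == a ∧ v == b) (λ v → u == b ∧ v == a)) (cong₂ _xor_ (k a b) (k b a))
  where k : ∀ a b → ⊕ (λ v → u == a ∧ v == b) ≡ (u == a)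
        k a b = trans (⊕-1 (λ v → u == a ∧ v == b) b (λ i h → trans (cong (u == a ∧_) (≢→== h)) (Boolₚ.∧-zeroʳ _))) (trans (cong (u == a ∧_) (==-refl b)) (Boolₚ.∧-identityʳ _))

xor-mid : ∀ a b c → (a xor b) xor (b xor c) ≡ a xor c
xor-mid true true true = refl
xor-mid true true false = refl
xor-mid true false c = refl
xor-mid false true true = refl
xor-mid false true false = refl
xor-mid false false c = refl

-- Not a walk, but an edge set modulo 2 with boundary `x + y`. Such sets compose by addition,
-- whatever vertices or edges they repeat.
record Path {n} (es : List (Pair n)) (x y : Fin n) : Set where
  field Q : Fin n → Fin n → Bool
        Q-sym : ∀ u v → Q u v ≡ Q v u
        Q-supp : ∀ u v → Q u v ≡ true → ((u , v) ∈ es) ⊎ ((v , u) ∈ es)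
        Q-∂ : ∀ w → ⊕ (Q w) ≡ (w == x) xor (w == y)
open Path public

path-rep : ∀ {n} (es : List (Pair n)) x → Path es (rep es x) x
path-rep es = rep-rel (Path es)
  (λ x → record { Q = λ _ _ → false ; Q-sym = λ _ _ → refl ; Q-supp = λ _ _ () ; Q-∂ = λ w → trans (⊕-0 (λ _ → refl)) (sym (Boolₚ.xor-same (w == x))) })
  (λ p → record { Q = Q p ; Q-sym = Q-sym p ; Q-supp = Q-supp p ; Q-∂ = λ w → trans (Q-∂ p w) (Boolₚ.xor-comm (w == _) _) })
  (λ {x} {y} {z} p q → record { Q = λ u v → Q p u v xor Q q u v ; Q-sym = λ u v → cong₂ _xor_ (Q-sym p u v) (Q-sym q u v)
     ; Q-supp = λ u v e → sup p q u v e ; Q-∂ = λ w → trans (⊕-xor (Q p w) (Q q w)) (trans (cong₂ _xor_ (Q-∂ p w) (Q-∂ q w)) (xor-mid (w == x) (w == y) (w == z))) })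
  es (λ {a} {b} i → record { Q = st a b ; Q-sym = st-sym a b ; Q-supp = λ u v e → case st-t a b u v e of λ { (inj₁ (refl , refl)) → inj₁ i ; (inj₂ (refl , refl)) → inj₂ i } ; Q-∂ = st-∂ a b })
  where
  sup : ∀ {x y z} (p : Path es x y) (q : Path es y z) u v → Q p u v xor Q q u v ≡ true → ((u , v) ∈ es) ⊎ ((v , u) ∈ es)
  sup p q u v e with Q p u v in eq
  ... | true = Q-supp p u v eq
  ... | false = Q-supp q u v e

path : ∀ {n} (es : List (Pair n)) x y → rep es x ≡ rep es y → Path es x y
path es x y e = record { Q = λ u v → Q p u v xor Q q u v ; Q-sym = λ u v → cong₂ _xor_ (Q-sym p u v) (Q-sym q u v)
     ; Q-supp = sup ; Q-∂ = λ w → trans (⊕-xor (Q p w) (Q q w)) (trans (cong₂ _xor_ (trans (Q-∂ p w) (Boolₚ.xor-comm (w == rep es x) (w == x))) (Q-∂ q w)) (trans (cong (λ z → ((w == x) xor (w == rep es x)) xor ((w == z) xor (w == y))) (sym e)) (xor-mid (w == x) (w == rep es x) (w == y)))) }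
  where
  p = path-rep es x
  q = path-rep es y
  sup : ∀ u v → Q p u v xor Q q u v ≡ true → ((u , v) ∈ es) ⊎ ((v , u) ∈ es)
  sup u v e with Q p u v in eq
  ... | true = Q-supp p u v eq
  ... | false = Q-supp q u v e

-- Edge lists

all-pairs : ∀ n → List (Pair n)
all-pairs n = cartesianProduct (allFin n) (allFin n)

up? : ∀ {n} → Graph n → Pair n → Bool
up? G (u , v) = adj G u v ∧ (toℕ u <ᵇ toℕ v)

edges : ∀ {n} → Graph n → List (Pair n)
edges {n} G = filterᵇ (up? G) (all-pairs n)

<ᵇ-t : ∀ {a b} → (a <ᵇ b) ≡ true → a < b
<ᵇ-t {a} {b} e = ℕₚ.<ᵇ⇒< a b (subst IsTrue (sym e) tt)

t-<ᵇ : ∀ {a b} → a < b → (a <ᵇ b) ≡ true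
t-<ᵇ {a} {b} h with a <ᵇ b | ℕₚ.<⇒<ᵇ h
... | true | _ = refl

∈-pairs : ∀ {n} (u v : Fin n) → (u , v) ∈ all-pairs n
∈-pairs u v = go (∈-tab id u) (∈-tab id v)
  where
  inmap : ∀ {A B : Set} (f : A → B) {y ys} → y ∈ ys → f y ∈ map f ys
  inmap f (here refl) = here refl
  inmap f (there i) = there (inmap f i)
  inr : ∀ {A : Set} {x : A} (xs : List A) {ys} → x ∈ ys → x ∈ xs ++ ys
  inr [] i = i
  inr (x ∷ xs) i = there (inr xs i)
  inl : ∀ {A : Set} {x : A} {xs : List A} {ys} → x ∈ xs → x ∈ xs ++ ys
  inl (here e) = here e
  inl (there i) = there (inl i)
  go : ∀ {A : Set} {x y : A} {xs ys : List A} → x ∈ xs → y ∈ ys → (x , y) ∈ cartesianProduct xs ys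
  go {xs = x ∷ xs} (here refl) j = inl (inmap (x ,_) j)
  go {xs = x ∷ xs} {ys} (there i) j = inr (map (x ,_) ys) (go i j)

∈-edges : ∀ {n} (G : Graph n) {u v} → E G u v → toℕ u < toℕ v → (u , v) ∈ edges G
∈-edges G {u} {v} e h = filt-∈ (up? G) (∈-pairs u v) (∧-i e (t-<ᵇ h))

edges-∈ : ∀ {n} (G : Graph n) {u v} → (u , v) ∈ edges G → E G u v × toℕ u < toℕ v
edges-∈ {n} G {u} {v} i = let p = ∧-t {adj G u v} (∈-filt (up? G) (all-pairs n) i) in proj₁ p , <ᵇ-t (proj₂ p)

count-++ : ∀ {A : Set} (p : A → Bool) xs ys → countᵇ p (xs ++ ys) ≡ countᵇ p xs + countᵇ p ys
count-++ p [] ys = refl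
count-++ p (x ∷ xs) ys with p x
... | true = cong suc (count-++ p xs ys)
... | false = count-++ p xs ys

count-map : ∀ {A B : Set} (p : B → Bool) (f : A → B) xs → countᵇ p (map f xs) ≡ countᵇ (p ∘ f) xs
count-map p f [] = refl
count-map p f (x ∷ xs) with p (f x)
... | true = cong suc (count-map p f xs)
... | false = count-map p f xs

count-cong : ∀ {A : Set} {p q : A → Bool} → (∀ x → p x ≡ q x) → ∀ xs → countᵇ p xs ≡ countᵇ q xs
count-cong h [] = refl
count-cong {p = p} {q} h (x ∷ xs) with p x | q x | h x
... | true | _ | refl = cong suc (count-cong h xs)
... | false | _ | refl = count-cong h xs

count-pairs : ∀ {n} (p : Pair n → Bool) → countᵇ p (all-pairs n) ≡ ∑₂ λ u v → 𝟙 (p (u , v))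
count-pairs {n} p = go id
  where
  go : ∀ {m} (f : Fin m → Fin n) → countᵇ p (cartesianProduct (tabulate f) (allFin n)) ≡ ∑₂ λ u v → 𝟙 (p (f u , v))
  go {zero} f = refl
  go {suc m} f = trans (count-++ p (map (f zero ,_) (allFin n)) _) (cong₂ _+_ (trans (count-map p (f zero ,_) (allFin n)) (count-tab (λ v → p (f zero , v)) id)) (go (f ∘ suc)))

e2-edges : ∀ {n} (G : Graph n) → e2 G ≡ 2 * length (edges G)
e2-edges G = trans (∑₂-cong pt) (trans (∑₂-+ f (λ u v → f v u)) (trans (cong (∑₂ f +_) (∑-swap (λ u v → f v u))) (trans (lem (∑₂ f)) (cong (2 *_) (sym (count-pairs (up? G)))))))
  where
  f : Fin _ → Fin _ → ℕ
  f u v = 𝟙 (adj G u v ∧ (toℕ u <ᵇ toℕ v))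
  lem : ∀ a → a + a ≡ 2 * a
  lem = solve-∀
  pt : ∀ u v → 𝟙 (adj G u v) ≡ f u v + f v u
  pt u v with adj G u v in e | adj G v u in e'
  ... | false | false = refl
  ... | true | false = tf (E-sym G e) e'
  ... | false | true = tf (E-sym G e') e
  ... | true | true with ℕₚ.<-cmp (toℕ u) (toℕ v)
  ... | tri< a _ c rewrite t-<ᵇ a | not-t→f (c ∘ <ᵇ-t {toℕ v} {toℕ u}) = refl
  ... | tri≈ _ b _ = ⊥-elim (E-irr G e (Finₚ.toℕ-injective b))
  ... | tri> a _ c rewrite t-<ᵇ c | not-t→f (a ∘ <ᵇ-t {toℕ u} {toℕ v}) = refl

filt-AllPairs : ∀ {A : Set} {R : A → A → Set} (p : A → Bool) {xs} → AllPairs R xs → AllPairs R (filterᵇ p xs)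
filt-AllPairs p [] = []
filt-AllPairs p {y ∷ ys} (h ∷ hs) with p y
... | true = filt-All p h ∷ filt-AllPairs p hs
... | false = filt-AllPairs p hs

pairs-distinct : ∀ n → AllPairs _≢_ (all-pairs n)
pairs-distinct n = go (tab-unique {n} {n} id (λ _ _ e → e))
  where
  mapA : ∀ {A B : Set} {P : B → Set} (f : A → B) {xs} → All (P ∘ f) xs → All P (map f xs)
  mapA f [] = []
  mapA f (h ∷ hs) = h ∷ mapA f hs
  appA : ∀ {A : Set} {P : A → Set} {xs ys : List A} → All P xs → All P ys → All P (xs ++ ys)
  appA [] k = k
  appA (h ∷ hs) k = h ∷ appA hs k
  row : ∀ {x : Fin n} {ys : List (Fin n)} → Unique ys → AllPairs _≢_ (map (x ,_) ys)
  row [] = []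
  row (h ∷ hs) = mapA _ (Allₚ.map (λ ne e → ne (cong proj₂ e)) h) ∷ row hs
  oth : ∀ {x y : Fin n} {xs ys : List (Fin n)} → All (x ≢_) xs → All ((x , y) ≢_) (cartesianProduct xs ys)
  oth [] = []
  oth {ys = ys} (h ∷ hs) = appA (mapA _ (Allₚ.universal (λ _ e → h (cong proj₁ e)) ys)) (oth hs)
  app : ∀ {xs ys : List (Pair n)} → AllPairs _≢_ xs → AllPairs _≢_ ys → All (λ p → All (p ≢_) ys) xs → AllPairs _≢_ (xs ++ ys)
  app [] k _ = k
  app (h ∷ hs) k (z ∷ zs) = appA h z ∷ app hs k zs
  go : ∀ {xs : List (Fin n)} → Unique xs → AllPairs _≢_ (cartesianProduct xs (allFin n))
  go [] = []
  go (h ∷ hs) = app (row (tab-unique id (λ _ _ e → e))) (go hs) (mapA _ (Allₚ.universal (λ y → oth h) (allFin n)))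

edges-fresh : ∀ {n} (G : Graph n) {e es} → (∀ {x} → x ∈ e ∷ es → x ∈ edges G) → All (e ≢_) es → ∀ {u v} → (proj₁ e ≡ u × proj₂ e ≡ v) → ((u , v) ∈ es) ⊎ ((v , u) ∈ es) → ⊥
edges-fresh G sub h (refl , refl) (inj₁ i) = Allₚ.lookup h i refl
edges-fresh G sub h (refl , refl) (inj₂ i) = ℕₚ.<-asym (proj₂ (edges-∈ G (sub (here refl)))) (proj₂ (edges-∈ G (sub (there i))))

-- Algebraic planarity: each edge uv has the two faces side u v and side v u; face sets have even
-- boundaries, every even edge set is such a boundary (Jordan), and the dual graph is connected,
-- globally and around every vertex.  Unlike rotation systems, this passes easily to subgraphs and
-- to identifications inside a face.
record Planarity {n} (G : Graph n) : Set where
  field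
    m : ℕ
    side : Fin n → Fin n → Fin m
  ∂ : (Fin m → Bool) → Fin n → Fin n → Bool
  ∂ s u v = s (side u v) xor s (side v u)
  field
    even : ∀ s u → ⊕ (λ v → adj G u v ∧ ∂ s u v) ≡ false
    jordan : ∀ (Z : Fin n → Fin n → Bool) → (∀ u v → Z u v ≡ Z v u) → (∀ u v → Z u v ≡ true → E G u v) →
      (∀ u → ⊕ (Z u) ≡ false) → ∃ λ s → ∀ u v → E G u v → ∂ s u v ≡ Z u v
    conn : ∀ (s : Fin m → Bool) → (∀ u v → E G u v → s (side u v) ≡ s (side v u)) → ∀ u v u' v' → E G u v → E G u' v' → s (side u v) ≡ s (side u' v')
    local : ∀ (s : Fin m → Bool) u → (∀ v → E G u v → s (side u v) ≡ s (side v u)) → ∀ v w → E G u v → E G u w → s (side u v) ≡ s (side u w)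

module _ {n} {G : Graph n} (P : Planarity G) where
  open Planarity P

  ∂-sym : ∀ s u v → ∂ s u v ≡ ∂ s v u
  ∂-sym s u v = Boolₚ.xor-comm (s (side u v)) _

  -- Deleting edges merges faces.
  module Subgraph (H : Graph n) (H⊑ : H ⊑ G) where
    gone? : Pair n → Bool
    gone? (u , v) = adj G u v ∧ not (adj H u v)
    sp : Pair n → Pair m
    sp (u , v) = side u v , side v u
    es : List (Pair m)
    es = map sp (filterᵇ gone? (all-pairs n))
    c : Fin m → Fin m
    c = rep es
    es-∈ : ∀ {u v} → E G u v → ¬ E H u v → (side u v , side v u) ∈ es
    es-∈ {u} {v} e h = go (filt-∈ gone? (∈-pairs u v) (∧-i e (cong not (not-t→f h))))
      where go : ∀ {xs} → (u , v) ∈ xs → sp (u , v) ∈ map sp xs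
            go (here refl) = here refl
            go (there i) = there (go i)
    ∈-es : ∀ {a b} → (a , b) ∈ es → ∃ λ u → ∃ λ v → E G u v × ¬ E H u v × a ≡ side u v × b ≡ side v u
    ∈-es i = go (filterᵇ gone? (all-pairs n)) (λ {x} → ∈-filt gone? (all-pairs n) {x}) i
      where go : ∀ xs → (∀ {x} → x ∈ xs → gone? x ≡ true) → ∀ {a b} → (a , b) ∈ map sp xs → ∃ λ u → ∃ λ v → E G u v × ¬ E H u v × a ≡ side u v × b ≡ side v u
            go ((u , v) ∷ xs) h (here refl) = u , v , proj₁ (∧-t {adj G u v} (h (here refl))) , (λ e → case trans (sym (proj₂ (∧-t {adj G u v} (h (here refl))))) (cong not e) of λ ()) , refl , refl
            go (x ∷ xs) h (there i) = go xs (h ∘ there) i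
    c-same : ∀ {u v} → E G u v → ¬ E H u v → c (side u v) ≡ c (side v u)
    c-same e h = rep-∈ es (es-∈ e h)
    c-fun : ∀ {A : Set} (s : Fin m → A) → (∀ u v → E G u v → ¬ E H u v → s (side u v) ≡ s (side v u)) → ∀ x → s (c x) ≡ s x
    c-fun s h = rep-fun s es λ i → let (u , v , e , ne , p , q) = ∈-es i in trans (cong s p) (trans (h u v e ne) (cong s (sym q)))
    lift : ∀ (s : Fin m → Bool) u v → (E H u v → s (c (side u v)) ≡ s (c (side v u))) → E G u v → s (c (side u v)) ≡ s (c (side v u))
    lift s u v h e with E? H u v
    ... | yes p = h p
    ... | no p = cong s (c-same e p)
    sub : Planarity H
    sub = record
      { m = m ; side = λ u v → c (side u v)
      ; even = λ s u → trans (⊕-cong (λ v → ev s u v)) (even (s ∘ c) u)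
      -- The face set found in `G` has no deleted edge on its boundary, so it is constant on merged
      -- faces.
      ; jordan = λ Z zs zp ze → let (s , h) = jordan Z zs (λ u v e → H⊑ u v (zp u v e)) ze
                                    k = c-fun s λ u v e ne → xor-f _ _ (trans (h u v e) (not-t→f λ z → ne (zp u v z)))
                                in s , λ u v e → trans (cong₂ _xor_ (k (side u v)) (k (side v u))) (h u v (H⊑ u v e))
      ; conn = λ s h u v u' v' e e' → conn (s ∘ c) (λ u v e → lift s u v (h u v) e) u v u' v' (H⊑ u v e) (H⊑ u' v' e')
      ; local = λ s u h v w e e' → local (s ∘ c) u (λ v e → lift s u v (h v) e) v w (H⊑ u v e) (H⊑ u w e') }
      where
      ev : ∀ s u v → adj H u v ∧ (s (c (side u v)) xor s (c (side v u))) ≡ adj G u v ∧ ∂ (s ∘ c) u v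
      ev s u v with adj H u v in p | adj G u v in q
      ... | true | true = refl
      ... | true | false = tf (H⊑ u v p) q
      ... | false | false = refl
      ... | false | true rewrite c-same {u} {v} q (λ z → tf z p) = sym (Boolₚ.xor-same (s (c (side v u))))

  used? : ∀ f → Dec (∃ λ u → ∃ λ v → E G u v × side u v ≡ f)
  used? f = Finₚ.any? λ u → Finₚ.any? λ v → E? G u v ×-dec (side u v ≟ f)

  -- Merging faces leaves labels behind that no dart carries; these must not count as faces.
  used : Sub m
  used f = does (used? f)

  used-i : ∀ {u v} → E G u v → used (side u v) ≡ true
  used-i {u} {v} e with used? (side u v)
  ... | yes _ = refl
  ... | no h = ⊥-elim (h (u , v , e , refl))

  used-t : ∀ {f} → used f ≡ true → ∃ λ u → ∃ λ v → E G u v × side u v ≡ f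
  used-t {f} e with used? f
  ... | yes p = p

sub : ∀ {n} {G : Graph n} → Planarity G → ∀ H → H ⊑ G → Planarity H
sub P H h = Subgraph.sub P H h

delE : ∀ {n} → Graph n → Fin n → Fin n → Graph n
adj (delE G a b) u v = adj G u v ∧ not (isE a b u v)
adj-sym (delE G a b) u v = cong₂ _∧_ (adj-sym G u v) (cong not (trans (Boolₚ.∨-comm (u == a ∧ v == b) (u == b ∧ v == a)) (cong₂ _∨_ (Boolₚ.∧-comm (u == b) (v == a)) (Boolₚ.∧-comm (u == a) (v == b)))))
adj-irr (delE G a b) u rewrite adj-irr G u = refl

delE-⊑ : ∀ {n} (G : Graph n) a b → delE G a b ⊑ G
delE-⊑ G a b u v e = proj₁ (∧-t {adj G u v} e)

delE-i : ∀ {n} (G : Graph n) {a b u v} → E G u v → ¬ ((u ≡ a × v ≡ b) ⊎ (u ≡ b × v ≡ a)) → E (delE G a b) u v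
delE-i G {a} {b} {u} {v} e h = ∧-i e (cong not (not-t→f λ q → h (isE-t a b u v q)))

delE-no : ∀ {n} (G : Graph n) a b → ¬ E (delE G a b) a b
delE-no G a b e rewrite ==-refl a | ==-refl b = case proj₂ (∧-t {adj G a b} e) of λ ()

delE-t : ∀ {n} (G : Graph n) {a b u v} → E (delE G a b) u v → ¬ ((u ≡ a × v ≡ b) ⊎ (u ≡ b × v ≡ a))
delE-t G {a} {b} e (inj₁ (refl , refl)) = delE-no G a b e
delE-t G {a} {b} e (inj₂ (refl , refl)) = delE-no G a b (E-sym (delE G a b) e)

e2-delE : ∀ {n} (G : Graph n) a b → e2 G ≤ e2 (delE G a b) + 2
e2-delE G a b = ℕₚ.≤-trans (∑₂-mono pt) (ℕₚ.≤-reflexive (trans (∑₂-+ (λ u v → 𝟙 (adj (delE G a b) u v)) (λ u v → d a b u v + d b a u v)) (cong (e2 (delE G a b) +_) (trans (∑₂-+ (d a b) (d b a)) (cong₂ _+_ (∑₂-δ 1 a b) (∑₂-δ 1 b a))))))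
  where
  d : Fin _ → Fin _ → Fin _ → Fin _ → ℕ
  d a b u v = if u == a then (if v == b then 1 else 0) else 0
  pt : ∀ u v → 𝟙 (adj G u v) ≤ 𝟙 (adj G u v ∧ not (isE a b u v)) + (d a b u v + d b a u v)
  pt u v with adj G u v
  ... | false = z≤n
  ... | true with u == a | v == b | u == b | v == a
  ... | true | true | _ | _ = s≤s z≤n
  ... | true | false | true | true = s≤s z≤n
  ... | true | false | true | false = s≤s z≤n
  ... | true | false | false | _ = s≤s z≤n
  ... | false | _ | true | true = s≤s z≤n
  ... | false | _ | true | false = s≤s z≤n
  ... | false | _ | false | _ = s≤s z≤n

-- Forests and Euler's inequality

∑-1 : ∀ n → ∑ {n} (λ _ → 1) ≡ n
∑-1 zero = refl
∑-1 (suc n) = cong suc (∑-1 n)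

length-map : ∀ {A B : Set} (f : A → B) xs → length (map f xs) ≡ length xs
length-map f [] = refl
length-map f (x ∷ xs) = cong suc (length-map f xs)

-- An edge within a class of the other edges already listed would close up to a nonempty even set,
-- so every edge merges two classes and n is the number of classes plus the number of edges.
-- Vertices outside `A` are classes of their own, and at least one further representative lies in
-- `A`.
forest-bound : ∀ {n} (G : Graph n) (A : Sub n) u₀ v₀ → E G u₀ v₀ → (∀ u v → E G u v → A u ≡ true) →
  (∀ (Z : Fin n → Fin n → Bool) → (∀ u v → Z u v ≡ Z v u) → (∀ u v → Z u v ≡ true → E G u v) → (∀ u → ⊕ (Z u) ≡ false) → ∀ u v → Z u v ≡ false) →
  suc (length (edges G)) ≤ ∣ A ∣
forest-bound {n} G A u₀ v₀ e₀ inA noZ = ℕₚ.+-cancelˡ-≤ (classes (edges G)) _ _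
   (ℕₚ.≤-trans (ℕₚ.≤-reflexive (trans (ℕₚ.+-suc _ _) (cong suc (merges (edges G) id (filt-AllPairs (up? G) (pairs-distinct n)))))) many)
  where
  merges : ∀ es → (∀ {x} → x ∈ es → x ∈ edges G) → AllPairs _≢_ es → classes es + length es ≡ n
  merges [] sub d = trans (ℕₚ.+-identityʳ _) (trans (∑-cong {n} {λ x → 𝟙 (x == x)} {λ _ → 1} λ x → cong 𝟙 (==-refl x)) (∑-1 n))
  merges ((a , b) ∷ es) sub (d ∷ ds) with rep es a ≟ rep es b
  ... | no ne = trans (ℕₚ.+-suc _ (length es)) (trans (cong (_+ length es) (sym (classes-merge a b es ne))) (merges es (sub ∘ there) ds))
  ... | yes e = tf Zab (noZ Z (λ u v → cong₂ _xor_ (st-sym a b u v) (Q-sym p u v)) supp ev a b)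
    where
    p = path es a b e
    Z : Fin n → Fin n → Bool
    Z u v = st a b u v xor Q p u v
    a≢b : a ≢ b
    a≢b q = E-irr G (proj₁ (edges-∈ G (sub (here refl)))) q
    Zab : Z a b ≡ true
    Zab rewrite st-1 a b a≢b = cong not (not-t→f λ q → edges-fresh G {a , b} {es} sub d (refl , refl) (Q-supp p a b q))
    ev : ∀ u → ⊕ (Z u) ≡ false
    ev u = trans (⊕-xor (st a b u) (Q p u)) (trans (cong₂ _xor_ (st-∂ a b u) (Q-∂ p u)) (Boolₚ.xor-same ((u == a) xor (u == b))))
    supp : ∀ u v → Z u v ≡ true → E G u v
    supp u v z with st a b u v in eq
    ... | true = case st-t a b u v eq of λ { (inj₁ (refl , refl)) → proj₁ (edges-∈ G (sub (here refl))) ; (inj₂ (refl , refl)) → E-sym G (proj₁ (edges-∈ G (sub (here refl)))) }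
    ... | false = case Q-supp p u v z of λ { (inj₁ i) → proj₁ (edges-∈ G (sub (there i))) ; (inj₂ i) → E-sym G (proj₁ (edges-∈ G (sub (there i)))) }
  Both : Fin n → Fin n → Set
  Both x y = (x ≡ y) ⊎ (A x ≡ true × A y ≡ true)
  rp : ∀ x → Both (rep (edges G) x) x
  rp = rep-rel Both (λ _ → inj₁ refl) (λ { (inj₁ e) → inj₁ (sym e) ; (inj₂ (a , b)) → inj₂ (b , a) })
    (λ { (inj₁ refl) q → q ; (inj₂ p) (inj₁ refl) → inj₂ p ; (inj₂ (a , _)) (inj₂ (_ , b)) → inj₂ (a , b) })
    (edges G) (λ {a} {b} i → let e = proj₁ (edges-∈ G i) in inj₂ (inA a b e , inA b a (E-sym G e)))
  x₀ = rep (edges G) u₀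
  Ax₀ : A x₀ ≡ true
  Ax₀ with rp u₀
  ... | inj₁ e = trans (cong A e) (inA u₀ v₀ e₀)
  ... | inj₂ (a , _) = a
  many : suc n ≤ classes (edges G) + ∣ A ∣
  many = ℕₚ.≤-trans (ℕₚ.≤-reflexive (sym (trans (∑-+ (λ x → if x == x₀ then 1 else 0) (λ _ → 1)) (cong₂ _+_ (∑-δ 1 x₀) (∑-1 n)))))
     (ℕₚ.≤-trans (∑-mono pt) (ℕₚ.≤-reflexive (∑-+ (𝟙 ∘ fixed (edges G)) (𝟙 ∘ A))))
    where
    pt : ∀ x → (if x == x₀ then 1 else 0) + 1 ≤ 𝟙 (fixed (edges G) x) + 𝟙 (A x)
    pt x with x ≟ x₀
    ... | yes refl rewrite ==-refl x₀ | fixed-rep (edges G) u₀ | Ax₀ = ℕₚ.≤-refl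
    ... | no h rewrite ≢→== h with A x in ax
    ... | true = ℕₚ.m≤n+m 1 _
    ... | false with rp x
    ... | inj₁ e rewrite e | ==-refl x = ℕₚ.≤-refl
    ... | inj₂ (_ , b) = tf b ax

-- Edges between distinct faces are deleted until a forest remains.
euler : ∀ k {n} {G : Graph n} (P : Planarity G) (A : Sub n) u₀ v₀ → E G u₀ v₀ → (∀ u v → E G u v → A u ≡ true) → e2 G ≤ k →
  4 + e2 G ≤ 2 * ∣ A ∣ + 2 * ∣ used P ∣
euler k {n} {G} P A u₀ v₀ e₀ inA hk with Finₚ.any? (λ u → Finₚ.any? λ v → E? G u v ×-dec ¬? (Planarity.side P u v ≟ Planarity.side P v u))
... | no none = ℕₚ.≤-trans (ℕₚ.≤-reflexive (trans (cong (4 +_) (e2-edges G)) (ar (length (edges G))))) (ℕₚ.+-mono-≤ (ℕₚ.*-monoʳ-≤ 2 fb) (ℕₚ.*-monoʳ-≤ 2 one))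
  where
  open Planarity P
  same : ∀ u v → E G u v → side u v ≡ side v u
  same u v e = decidable-stable (side u v ≟ side v u) (λ h → none (u , v , e , h))
  -- An even set bounds some face set, but every edge has the same face on both sides.
  noZ : ∀ (Z : Fin n → Fin n → Bool) → (∀ u v → Z u v ≡ Z v u) → (∀ u v → Z u v ≡ true → E G u v) → (∀ u → ⊕ (Z u) ≡ false) → ∀ u v → Z u v ≡ false
  noZ Z zs zp ze u v = not-t→f λ z → tf z (trans (sym (proj₂ (jordan Z zs zp ze) u v (zp u v z))) (trans (cong (λ w → proj₁ (jordan Z zs zp ze) w xor proj₁ (jordan Z zs zp ze) (side v u)) (same u v (zp u v z))) (Boolₚ.xor-same (proj₁ (jordan Z zs zp ze) (side v u)))))
  fb = forest-bound G A u₀ v₀ e₀ inA noZ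
  one : 1 ≤ ∣ used P ∣
  one = card-list (used P) ([] ∷ []) (used-i P e₀ ∷ [])
  ar : ∀ l → 4 + 2 * l ≡ 2 * suc l + 2 * 1
  ar = solve-∀
... | yes (u , v , e , ne) = go k hk
  where
  open Planarity P
  H = delE G u v
  H⊑ = delE-⊑ G u v
  module S = Subgraph P H H⊑
  P' = sub P H H⊑
  -- The boundary of the face is even at `u`, so a second edge survives the deletion and keeps the
  -- remaining graph from being empty.
  du : ∃ λ w → w ≢ v × adj G u w ∧ ∂ (_== side u v) u w ≡ true
  du = ⊕-other (λ w → adj G u w ∧ ∂ (_== side u v) u w) v (even (_== side u v) u) (∧-i e k')
    where k' : ∂ (_== side u v) u v ≡ true
          k' rewrite ==-refl (side u v) | ≢→== (ne ∘ sym) = refl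
  w = proj₁ du
  eH : E H u w
  eH = delE-i G (proj₁ (∧-t {adj G u w} (proj₂ (proj₂ du)))) λ { (inj₁ (_ , q)) → proj₁ (proj₂ du) q ; (inj₂ (q , _)) → E-irr G e q }
  used-c : ∀ x → (S.c x ≡ x) ⊎ (used P (S.c x) ≡ true)
  used-c x with rep-rel (λ a b → (a ≡ b) ⊎ (used P a ≡ true × used P b ≡ true)) (λ _ → inj₁ refl) (λ { (inj₁ e) → inj₁ (sym e) ; (inj₂ (a , b)) → inj₂ (b , a) })
     (λ { (inj₁ refl) q → q ; (inj₂ p) (inj₁ refl) → inj₂ p ; (inj₂ (a , _)) (inj₂ (_ , b)) → inj₂ (a , b) }) S.es
     (λ i → let (p , q , f , _ , r , s) = S.∈-es i in inj₂ (trans (cong (used P) r) (used-i P f) , trans (cong (used P) s) (used-i P (E-sym G f)))) x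
  ... | inj₁ q = inj₁ q
  ... | inj₂ (q , _) = inj₂ q
  used⊆ : used P' ⊆ used P
  used⊆ f uf with used-t P' {f} uf
  ... | a , b , q , refl with used-c (side a b)
  ... | inj₁ z = trans (cong (used P) z) (used-i P (H⊑ a b q))
  ... | inj₂ z = z
  unfixed : ∀ z → S.c z ≢ z → used P' z ≡ false
  unfixed z h = not-t→f λ uz → let (a , b , q , r) = used-t P' {z} uz in h (trans (cong S.c (sym r)) (trans (rep-idem S.es (side a b)) r))
  -- The two merged labels have one representative, so at least one of them falls out of use.
  fewer : suc ∣ used P' ∣ ≤ ∣ used P ∣
  fewer with S.c (side u v) ≟ side u v
  ... | no h = card-strict (side u v) used⊆ (unfixed _ h) (used-i P e)
  ... | yes h with S.c (side v u) ≟ side v u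
  ... | no h' = card-strict (side v u) used⊆ (unfixed _ h') (used-i P (E-sym G e))
  ... | yes h' = ⊥-elim (ne (trans (sym h) (trans (S.c-same e (delE-no G u v)) h')))
  ar : ∀ g h a f f' → 4 + g + ((h + 2) + (2 * a + 2 * f') + 2 * f) + 0 ≡ 2 * a + 2 * f + (g + (4 + h) + 2 * suc f') 
  ar = solve-∀
  go : ∀ k → e2 G ≤ k → 4 + e2 G ≤ 2 * ∣ A ∣ + 2 * ∣ used P ∣
  go zero h = case ℕₚ.≤-trans (e2-strict {H = H} {G} H⊑ u v e (delE-no G u v)) h of λ ()
  go (suc k) h = farkas 0 (ℕₚ.+-mono-≤ (ℕₚ.+-mono-≤ (e2-delE G u v) (euler k P' A u w eH (λ a b q → inA a b (H⊑ a b q))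
      (ℕₚ.≤-pred (ℕₚ.≤-trans (ℕₚ.n≤1+n _) (ℕₚ.≤-trans (e2-strict {H = H} {G} H⊑ u v e (delE-no G u v)) h))))) (ℕₚ.*-monoʳ-≤ 2 fewer))
      (ar (e2 G) (e2 H) (∣ A ∣) (∣ used P ∣) (∣ used P' ∣))

-- Walks, 4-cycles and faces

wk : ∀ {n} → Fin n → List (Fin n) → Fin n → Fin n → Bool
wk x [] u v = false
wk x (y ∷ ys) u v = st x y u v xor wk y ys u v

end : ∀ {n} → Fin n → List (Fin n) → Fin n
end x [] = x
end x (y ∷ ys) = end y ys

wk-sym : ∀ {n} (x : Fin n) ys u v → wk x ys u v ≡ wk x ys v u
wk-sym x [] u v = refl
wk-sym x (y ∷ ys) u v = cong₂ _xor_ (st-sym x y u v) (wk-sym y ys u v)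

wk-∂ : ∀ {n} (x : Fin n) ys u → ⊕ (wk x ys u) ≡ (u == x) xor (u == end x ys)
wk-∂ x [] u = trans (⊕-0 (λ _ → refl)) (sym (Boolₚ.xor-same (u == x)))
wk-∂ x (y ∷ ys) u = trans (⊕-xor (st x y u) (wk y ys u)) (trans (cong₂ _xor_ (st-∂ x y u) (wk-∂ y ys u)) (xor-mid (u == x) (u == y) (u == end y ys)))

Steps : ∀ {n} → Graph n → Fin n → List (Fin n) → Set
Steps G x [] = ⊤
Steps G x (y ∷ ys) = E G x y × Steps G y ys

wk-E : ∀ {n} (G : Graph n) x ys → Steps G x ys → ∀ u v → wk x ys u v ≡ true → E G u v
wk-E G x (y ∷ ys) (e , es) u v h with st x y u v in eq
... | true = case st-t x y u v eq of λ { (inj₁ (refl , refl)) → e ; (inj₂ (refl , refl)) → E-sym G e }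
... | false = wk-E G y ys es u v h

st-off : ∀ {n} {a b u : Fin n} v → u ≢ a → u ≢ b → st a b u v ≡ false
st-off {a = a} {b} {u} v h h' = st-0 a b u v λ { (inj₁ (p , _)) → h p ; (inj₂ (p , _)) → h' p }

wk-off : ∀ {n} (x : Fin n) ys {u} v → u ≢ x → All (u ≢_) ys → wk x ys u v ≡ false
wk-off x [] v h hs = refl
wk-off x (y ∷ ys) v h (h' ∷ hs) rewrite st-off v h h' = wk-off y ys v h' hs

record C4 {n} (G : Graph n) (a b c d : Fin n) : Set where
  constructor c4
  field ab : E G a b
        bc : E G b c
        cd : E G c d
        da : E G d a
        a≢c : a ≢ c
        b≢d : b ≢ d

C4-rot : ∀ {n} {G : Graph n} {a b c d} → C4 G a b c d → C4 G b c d a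
C4-rot (c4 ab bc cd da p q) = c4 bc cd da ab q (p ∘ sym)

C4-refl : ∀ {n} {G : Graph n} {a b c d} → C4 G a b c d → C4 G b a d c
C4-refl {G = G} (c4 ab bc cd da p q) = c4 (E-sym G ab) (E-sym G da) (E-sym G cd) (E-sym G bc) q p

C4-⊑ : ∀ {n} {G H : Graph n} → H ⊑ G → ∀ {a b c d} → C4 H a b c d → C4 G a b c d
C4-⊑ h (c4 ab bc cd da p q) = c4 (h _ _ ab) (h _ _ bc) (h _ _ cd) (h _ _ da) p q

Ed : ∀ {n} → Fin n → Fin n → Fin n → Fin n → Set
Ed a b u v = (u ≡ a × v ≡ b) ⊎ (u ≡ b × v ≡ a)

CE : ∀ {n} (a b c d u v : Fin n) → Set
CE a b c d u v = Ed a b u v ⊎ Ed b c u v ⊎ Ed c d u v ⊎ Ed d a u v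

On : ∀ {n} (a b c d u : Fin n) → Set
On a b c d u = (u ≡ a) ⊎ (u ≡ b) ⊎ (u ≡ c) ⊎ (u ≡ d)

On? : ∀ {n} (a b c d u : Fin n) → Dec (On a b c d u)
On? a b c d u = (u ≟ a) ⊎-dec (u ≟ b) ⊎-dec (u ≟ c) ⊎-dec (u ≟ d)

CE-On : ∀ {n} {a b c d u v : Fin n} → CE a b c d u v → On a b c d u
CE-On (inj₁ (inj₁ (p , _))) = inj₁ p
CE-On (inj₁ (inj₂ (p , _))) = inj₂ (inj₁ p)
CE-On (inj₂ (inj₁ (inj₁ (p , _)))) = inj₂ (inj₁ p)
CE-On (inj₂ (inj₁ (inj₂ (p , _)))) = inj₂ (inj₂ (inj₁ p))
CE-On (inj₂ (inj₂ (inj₁ (inj₁ (p , _))))) = inj₂ (inj₂ (inj₁ p))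
CE-On (inj₂ (inj₂ (inj₁ (inj₂ (p , _))))) = inj₂ (inj₂ (inj₂ p))
CE-On (inj₂ (inj₂ (inj₂ (inj₁ (p , _))))) = inj₂ (inj₂ (inj₂ p))
CE-On (inj₂ (inj₂ (inj₂ (inj₂ (p , _))))) = inj₁ p

CE-E : ∀ {n} {G : Graph n} {a b c d u v} → C4 G a b c d → CE a b c d u v → E G u v
CE-E C (inj₁ (inj₁ (refl , refl))) = C4.ab C
CE-E {G = G} C (inj₁ (inj₂ (refl , refl))) = E-sym G (C4.ab C)
CE-E C (inj₂ (inj₁ (inj₁ (refl , refl)))) = C4.bc C
CE-E {G = G} C (inj₂ (inj₁ (inj₂ (refl , refl)))) = E-sym G (C4.bc C)
CE-E C (inj₂ (inj₂ (inj₁ (inj₁ (refl , refl))))) = C4.cd C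
CE-E {G = G} C (inj₂ (inj₂ (inj₁ (inj₂ (refl , refl))))) = E-sym G (C4.cd C)
CE-E C (inj₂ (inj₂ (inj₂ (inj₁ (refl , refl))))) = C4.da C
CE-E {G = G} C (inj₂ (inj₂ (inj₂ (inj₂ (refl , refl))))) = E-sym G (C4.da C)

Chordless : ∀ {n} → Graph n → (a b c d : Fin n) → Set
Chordless G a b c d = ¬ E G a c × ¬ E G b d

On-CE : ∀ {n} {G : Graph n} {a b c d u v} → Chordless G a b c d → On a b c d u → On a b c d v → E G u v → CE a b c d u v
On-CE {G = G} h (inj₁ refl) (inj₁ refl) e = ⊥-elim (E-irr G e refl)
On-CE h (inj₁ refl) (inj₂ (inj₁ refl)) e = inj₁ (inj₁ (refl , refl))
On-CE h (inj₁ refl) (inj₂ (inj₂ (inj₁ refl))) e = ⊥-elim (proj₁ h e)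
On-CE h (inj₁ refl) (inj₂ (inj₂ (inj₂ refl))) e = inj₂ (inj₂ (inj₂ (inj₂ (refl , refl))))
On-CE h (inj₂ (inj₁ refl)) (inj₁ refl) e = inj₁ (inj₂ (refl , refl))
On-CE {G = G} h (inj₂ (inj₁ refl)) (inj₂ (inj₁ refl)) e = ⊥-elim (E-irr G e refl)
On-CE h (inj₂ (inj₁ refl)) (inj₂ (inj₂ (inj₁ refl))) e = inj₂ (inj₁ (inj₁ (refl , refl)))
On-CE h (inj₂ (inj₁ refl)) (inj₂ (inj₂ (inj₂ refl))) e = ⊥-elim (proj₂ h e)
On-CE {G = G} h (inj₂ (inj₂ (inj₁ refl))) (inj₁ refl) e = ⊥-elim (proj₁ h (E-sym G e))
On-CE h (inj₂ (inj₂ (inj₁ refl))) (inj₂ (inj₁ refl)) e = inj₂ (inj₁ (inj₂ (refl , refl)))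
On-CE {G = G} h (inj₂ (inj₂ (inj₁ refl))) (inj₂ (inj₂ (inj₁ refl))) e = ⊥-elim (E-irr G e refl)
On-CE h (inj₂ (inj₂ (inj₁ refl))) (inj₂ (inj₂ (inj₂ refl))) e = inj₂ (inj₂ (inj₁ (inj₁ (refl , refl))))
On-CE h (inj₂ (inj₂ (inj₂ refl))) (inj₁ refl) e = inj₂ (inj₂ (inj₂ (inj₁ (refl , refl))))
On-CE {G = G} h (inj₂ (inj₂ (inj₂ refl))) (inj₂ (inj₁ refl)) e = ⊥-elim (proj₂ h (E-sym G e))
On-CE h (inj₂ (inj₂ (inj₂ refl))) (inj₂ (inj₂ (inj₁ refl))) e = inj₂ (inj₂ (inj₁ (inj₂ (refl , refl))))
On-CE {G = G} h (inj₂ (inj₂ (inj₂ refl))) (inj₂ (inj₂ (inj₂ refl))) e = ⊥-elim (E-irr G e refl)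

cyc : ∀ {n} → (a b c d u v : Fin n) → Bool
cyc a b c d = wk a (b ∷ c ∷ d ∷ a ∷ [])

cyc-∂ : ∀ {n} (a b c d u : Fin n) → ⊕ (cyc a b c d u) ≡ false
cyc-∂ a b c d u = trans (wk-∂ a (b ∷ c ∷ d ∷ a ∷ []) u) (Boolₚ.xor-same (u == a))

xor4 : ∀ p q r s → p xor (q xor (r xor (s xor false))) ≡ q xor (r xor (s xor (p xor false)))
xor4 true true true true = refl
xor4 true true true false = refl
xor4 true true false true = refl
xor4 true true false false = refl
xor4 true false true true = refl
xor4 true false true false = refl
xor4 true false false true = refl
xor4 true false false false = refl
xor4 false q r s = refl

cyc-rot : ∀ {n} (a b c d u v : Fin n) → cyc a b c d u v ≡ cyc b c d a u v
cyc-rot a b c d u v = xor4 (st a b u v) (st b c u v) (st c d u v) (st d a u v)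

cyc-refl : ∀ {n} (a b c d u v : Fin n) → cyc a b c d u v ≡ cyc b a d c u v
cyc-refl a b c d u v = trans (lem (st a b u v) (st b c u v) (st c d u v) (st d a u v))
  (cong₂ _xor_ (st-swap a b u v) (cong₂ _xor_ (st-swap d a u v) (cong₂ _xor_ (st-swap c d u v) (cong (_xor false) (st-swap b c u v)))))
  where lem : ∀ p q r s → p xor (q xor (r xor (s xor false))) ≡ p xor (s xor (r xor (q xor false)))
        lem p true true true = refl
        lem p true true false = refl
        lem p true false true = refl
        lem p true false false = refl
        lem p false true true = refl
        lem p false true false = refl
        lem p false false true = refl
        lem p false false false = refl

cyc-t : ∀ {n} (a b c d u v : Fin n) → cyc a b c d u v ≡ true → CE a b c d u v
cyc-t a b c d u v h with st a b u v in e1 | st b c u v in e2 | st c d u v in e3 | st d a u v in e4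
... | true | _ | _ | _ = inj₁ (st-t a b u v e1)
... | false | true | _ | _ = inj₂ (inj₁ (st-t b c u v e2))
... | false | false | true | _ = inj₂ (inj₂ (inj₁ (st-t c d u v e3)))
... | false | false | false | true = inj₂ (inj₂ (inj₂ (st-t d a u v e4)))

module _ {n} {G : Graph n} where
  cyc-first : ∀ {a b c d} → C4 G a b c d → cyc a b c d a b ≡ true
  cyc-first {a} {b} {c} {d} (c4 ab bc cd da p q)
    rewrite st-1 a b (E-irr G ab) | st-off {a = b} {c} {a} b (E-irr G ab) p | st-off {a = c} {d} {a} b p (E-irr G da ∘ sym)
      | st-0 d a a b (λ { (inj₁ (x , _)) → E-irr G da (sym x) ; (inj₂ (_ , x)) → q x }) = refl

  cyc-i : ∀ {a b c d u v} → C4 G a b c d → CE a b c d u v → cyc a b c d u v ≡ true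
  cyc-i C (inj₁ (inj₁ (refl , refl))) = cyc-first C
  cyc-i {a} {b} {c} {d} C (inj₁ (inj₂ (refl , refl))) = trans (wk-sym a (b ∷ c ∷ d ∷ a ∷ []) b a) (cyc-first C)
  cyc-i {a} {b} {c} {d} {u} {v} C (inj₂ (inj₁ p)) = trans (cyc-rot a b c d u v) (cyc-i (C4-rot C) (inj₁ p))
  cyc-i {a} {b} {c} {d} {u} {v} C (inj₂ (inj₂ (inj₁ p))) = trans (cyc-rot a b c d u v) (trans (cyc-rot b c d a u v) (cyc-i (C4-rot (C4-rot C)) (inj₁ p)))
  cyc-i {a} {b} {c} {d} {u} {v} C (inj₂ (inj₂ (inj₂ p))) = trans (cyc-rot a b c d u v) (trans (cyc-rot b c d a u v) (trans (cyc-rot c d a b u v) (cyc-i (C4-rot (C4-rot (C4-rot C))) (inj₁ p))))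

-- `bd` alone would admit further edges with `ℓ` on both sides; `onC` excludes them.
record Facial {n} {G : Graph n} (P : Planarity G) (a b c d : Fin n) : Set where
  constructor facial
  open Planarity P
  field ℓ : Fin m
        bd : ∀ u v → E G u v → ∂ (_== ℓ) u v ≡ cyc a b c d u v
        onC : ∀ u v → E G u v → side u v ≡ ℓ → CE a b c d u v

CE-rot : ∀ {n} {a b c d u v : Fin n} → CE a b c d u v → CE b c d a u v
CE-rot (inj₁ p) = inj₂ (inj₂ (inj₂ p))
CE-rot (inj₂ (inj₁ p)) = inj₁ p
CE-rot (inj₂ (inj₂ (inj₁ p))) = inj₂ (inj₁ p)
CE-rot (inj₂ (inj₂ (inj₂ p))) = inj₂ (inj₂ (inj₁ p))

Ed-swap : ∀ {n} {a b u v : Fin n} → Ed a b u v → Ed b a u v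
Ed-swap (inj₁ p) = inj₂ p
Ed-swap (inj₂ p) = inj₁ p

CE-refl : ∀ {n} {a b c d u v : Fin n} → CE a b c d u v → CE b a d c u v
CE-refl (inj₁ p) = inj₁ (Ed-swap p)
CE-refl (inj₂ (inj₁ p)) = inj₂ (inj₂ (inj₂ (Ed-swap p)))
CE-refl (inj₂ (inj₂ (inj₁ p))) = inj₂ (inj₂ (inj₁ (Ed-swap p)))
CE-refl (inj₂ (inj₂ (inj₂ p))) = inj₂ (inj₁ (Ed-swap p))

Facial-rot : ∀ {n} {G : Graph n} {P : Planarity G} {a b c d} → Facial P a b c d → Facial P b c d a
Facial-rot {a = a} {b} {c} {d} (facial ℓ bd onC) = facial ℓ (λ u v e → trans (bd u v e) (cyc-rot a b c d u v)) (λ u v e q → CE-rot (onC u v e q))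

Facial-refl : ∀ {n} {G : Graph n} {P : Planarity G} {a b c d} → Facial P a b c d → Facial P b a d c
Facial-refl {a = a} {b} {c} {d} (facial ℓ bd onC) = facial ℓ (λ u v e → trans (bd u v e) (cyc-refl a b c d u v)) (λ u v e q → CE-refl (onC u v e q))

-- Separation by a 4-cycle

-- The two parts share the cycle, and by `meet` only its corners. `home` places every face in one
-- part; this later decides which part contains a second, facial 4-cycle.
record Split {n} {G : Graph n} (P : Planarity G) (a b c d : Fin n) : Set where
  open Planarity P
  field
    part : Bool → Graph n
    part-⊑ : ∀ i → part i ⊑ G
    smaller : ∀ i → 2 + e2 (part i) ≤ e2 G
    cover : ∀ u v → E G u v → E (part false) u v ⊎ E (part true) u v
    cycle : ∀ i {u v} → CE a b c d u v → E (part i) u v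
    meet : ∀ i {u v w} → E (part i) u v → E (part (not i)) u w → On a b c d u
    inner : ∀ i → ∃ λ u → ∃ λ v → E (part i) u v × ¬ On a b c d u
    home : ∀ ℓ → ∃ λ i → ∀ u v → E G u v → side u v ≡ ℓ → E (part i) u v

module _ {n} {G : Graph n} (P : Planarity G) {a b c d : Fin n} (C : C4 G a b c d) (ch : Chordless G a b c d) where
  open Planarity P

  -- At each corner only two edges of the cycle are available, so either both belong to `Z` or
  -- neither does.
  even-on-cycle : ∀ (Z : Fin n → Fin n → Bool) → (∀ u v → Z u v ≡ Z v u) → (∀ u v → Z u v ≡ true → CE a b c d u v) →
    (∀ u → ⊕ (Z u) ≡ false) → (Z a b ≡ Z b c) × (Z b c ≡ Z c d) × (Z c d ≡ Z d a)
  even-on-cycle Z zs zp ze = turn a b c C.a≢c (λ w h h' → λ { (inj₁ (inj₁ (p , _))) → E-irr G C.ab (sym p) ; (inj₁ (inj₂ (_ , p))) → h p ; (inj₂ (inj₁ (inj₁ (_ , p)))) → h' p ; (inj₂ (inj₁ (inj₂ (p , _)))) → E-irr G C.bc p ; (inj₂ (inj₂ (inj₁ (inj₁ (p , _))))) → E-irr G C.bc p ; (inj₂ (inj₂ (inj₁ (inj₂ (p , _))))) → C.b≢d p ; (inj₂ (inj₂ (inj₂ (inj₁ (p , _))))) → C.b≢d p ; (inj₂ (inj₂ (inj₂ (inj₂ (p , _))))) → E-irr G C.ab (sym p) })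
    , turn b c d C.b≢d (λ w h h' → λ { (inj₁ (inj₁ (p , _))) → C.a≢c (sym p) ; (inj₁ (inj₂ (p , _))) → E-irr G C.bc (sym p) ; (inj₂ (inj₁ (inj₁ (p , _)))) → E-irr G C.bc (sym p) ; (inj₂ (inj₁ (inj₂ (_ , p)))) → h p ; (inj₂ (inj₂ (inj₁ (inj₁ (_ , p))))) → h' p ; (inj₂ (inj₂ (inj₁ (inj₂ (p , _))))) → E-irr G C.cd p ; (inj₂ (inj₂ (inj₂ (inj₁ (p , _))))) → E-irr G C.cd p ; (inj₂ (inj₂ (inj₂ (inj₂ (p , _))))) → C.a≢c (sym p) })
    , turn c d a (C.a≢c ∘ sym) (λ w h h' → λ { (inj₁ (inj₁ (p , _))) → E-irr G C.da p ; (inj₁ (inj₂ (p , _))) → C.b≢d (sym p) ; (inj₂ (inj₁ (inj₁ (p , _)))) → C.b≢d (sym p) ; (inj₂ (inj₁ (inj₂ (p , _)))) → E-irr G C.cd (sym p) ; (inj₂ (inj₂ (inj₁ (inj₁ (p , _))))) → E-irr G C.cd (sym p) ; (inj₂ (inj₂ (inj₁ (inj₂ (_ , p))))) → h p ; (inj₂ (inj₂ (inj₂ (inj₁ (_ , p))))) → h' p ; (inj₂ (inj₂ (inj₂ (inj₂ (p , _))))) → E-irr G C.da p })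
    where
    module C = C4 C
    turn : ∀ x y z → x ≢ z → (∀ w → w ≢ x → w ≢ z → ¬ CE a b c d y w) → Z x y ≡ Z y z
    turn x y z ne h = trans (zs x y) (xor-f _ _ (trans (sym (⊕-2 (Z y) x z ne (λ w p q → not-t→f λ r → h w p q (zp y w r)))) (ze y)))

  -- `s` is one side of the cycle, as a set of faces. A side without edges off the cycle is a single
  -- face; if both sides have such edges, they give the two parts.
  module Sides (s : Fin m → Bool) (sj : ∀ u v → E G u v → ∂ s u v ≡ cyc a b c d u v) where
    Out : Bool → Set
    Out i = ∃ λ u → ∃ λ v → E G u v × cyc a b c d u v ≡ false × s (side u v) ≡ i
    out? : ∀ i → Dec (Out i)
    out? i = Finₚ.any? λ u → Finₚ.any? λ v → E? G u v ×-dec (cyc a b c d u v ≟b false) ×-dec (s (side u v) ≟b i)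
    s-flat : ∀ u v → E G u v → cyc a b c d u v ≡ false → s (side u v) ≡ s (side v u)
    s-flat u v e q = xor-f _ _ (trans (sj u v e) q)
    off-C : ∀ {u} v → ¬ On a b c d u → cyc a b c d u v ≡ false
    off-C {u} v h = not-t→f λ q → h (CE-On (cyc-t a b c d u v q))
    -- Some face on side `i` lies along `ab`. Its darts cannot leave the cycle, and its boundary is
    -- even and contains `ab`, hence is the whole cycle.
    face : ∀ i → ¬ Out i → Facial P a b c d
    face i no-out = facial ℓ bd onC
      where
      ℓs : ∃ λ ℓ → s ℓ ≡ i × ∂ (_== ℓ) a b ≡ true
      ℓs with bcase (s (side a b) xor i)
      ... | inj₂ q = side a b , xor-f _ _ q , k
        where k : ∂ (_== side a b) a b ≡ true
              k rewrite ==-refl (side a b) | ≢→== {i = side b a} {side a b} (λ r → tf (cyc-i C (inj₁ (inj₁ (refl , refl)))) (trans (sym (sj a b (C4.ab C))) (trans (cong (λ z → s (side a b) xor s z) r) (Boolₚ.xor-same (s (side a b)))))) = refl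
      ... | inj₁ q = side b a , l , k
        where d' : s (side a b) ≡ not (s (side b a))
              d' = xor-t _ _ (trans (sj a b (C4.ab C)) (cyc-i C (inj₁ (inj₁ (refl , refl)))))
              l : s (side b a) ≡ i
              l = trans (sym (Boolₚ.not-involutive _)) (trans (cong not (sym d')) (trans (cong not (xor-t _ _ q)) (Boolₚ.not-involutive i)))
              k : ∂ (_== side b a) a b ≡ true
              k rewrite ==-refl (side b a) | ≢→== {i = side a b} {side b a} (λ r → Boolₚ.not-¬ {s (side b a)} refl (trans (cong s (sym r)) d')) = refl
      ℓ = proj₁ ℓs
      onC : ∀ u v → E G u v → side u v ≡ ℓ → CE a b c d u v
      onC u v e q with bcase (cyc a b c d u v)
      ... | inj₁ r = cyc-t a b c d u v r
      ... | inj₂ r = ⊥-elim (no-out (u , v , e , r , trans (cong s q) (proj₁ (proj₂ ℓs))))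
      Z : Fin n → Fin n → Bool
      Z u v = adj G u v ∧ ∂ (_== ℓ) u v
      flip : ∀ {u v} → CE a b c d v u → CE a b c d u v
      flip (inj₁ p) = inj₁ (fl p) where fl : ∀ {x y u v} → Ed x y v u → Ed x y u v
                                        fl (inj₁ (p , q)) = inj₂ (q , p)
                                        fl (inj₂ (p , q)) = inj₁ (q , p)
      flip (inj₂ (inj₁ (inj₁ (p , q)))) = inj₂ (inj₁ (inj₂ (q , p)))
      flip (inj₂ (inj₁ (inj₂ (p , q)))) = inj₂ (inj₁ (inj₁ (q , p)))
      flip (inj₂ (inj₂ (inj₁ (inj₁ (p , q))))) = inj₂ (inj₂ (inj₁ (inj₂ (q , p))))
      flip (inj₂ (inj₂ (inj₁ (inj₂ (p , q))))) = inj₂ (inj₂ (inj₁ (inj₁ (q , p))))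
      flip (inj₂ (inj₂ (inj₂ (inj₁ (p , q))))) = inj₂ (inj₂ (inj₂ (inj₂ (q , p))))
      flip (inj₂ (inj₂ (inj₂ (inj₂ (p , q))))) = inj₂ (inj₂ (inj₂ (inj₁ (q , p))))
      Zs : ∀ u v → Z u v ≡ Z v u
      Zs u v = cong₂ _∧_ (adj-sym G u v) (Boolₚ.xor-comm (side u v == ℓ) _)
      Zp : ∀ u v → Z u v ≡ true → CE a b c d u v
      Zp u v z with ∧-t {adj G u v} z
      ... | e , q with bcase (side u v == ℓ)
      ... | inj₁ r = onC u v e (==→≡ {i = side u v} {ℓ} r)
      ... | inj₂ r rewrite r = flip (onC v u (E-sym G e) (==→≡ {i = side v u} {ℓ} q))
      four = even-on-cycle Z Zs Zp (even (_== ℓ))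
      Zab : Z a b ≡ true
      Zab = ∧-i (C4.ab C) (proj₂ (proj₂ ℓs))
      Zbc = trans (sym (proj₁ four)) Zab
      Zcd = trans (sym (proj₁ (proj₂ four))) Zbc
      Zda = trans (sym (proj₂ (proj₂ four))) Zcd
      Zi : ∀ {u v} → CE a b c d u v → Z u v ≡ true
      Zi (inj₁ (inj₁ (refl , refl))) = Zab
      Zi (inj₁ (inj₂ (refl , refl))) = trans (Zs b a) Zab
      Zi (inj₂ (inj₁ (inj₁ (refl , refl)))) = Zbc
      Zi (inj₂ (inj₁ (inj₂ (refl , refl)))) = trans (Zs c b) Zbc
      Zi (inj₂ (inj₂ (inj₁ (inj₁ (refl , refl))))) = Zcd
      Zi (inj₂ (inj₂ (inj₁ (inj₂ (refl , refl))))) = trans (Zs d c) Zcd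
      Zi (inj₂ (inj₂ (inj₂ (inj₁ (refl , refl))))) = Zda
      Zi (inj₂ (inj₂ (inj₂ (inj₂ (refl , refl))))) = trans (Zs a d) Zda
      bd : ∀ u v → E G u v → ∂ (_== ℓ) u v ≡ cyc a b c d u v
      bd u v e = b-ext (λ q → cyc-i C (Zp u v (∧-i e q))) (λ q → proj₂ (∧-t {adj G u v} (Zi (cyc-t a b c d u v q))))
    go : Dec (Out true) → Dec (Out false) → Facial P a b c d ⊎ Split P a b c d
    go (no h) _ = inj₁ (face true h)
    go (yes _) (no h) = inj₁ (face false h)
    go (yes o1) (yes o0) = inj₂ record
      { part = part ; part-⊑ = λ i u v e → proj₁ (∧-t {adj G u v} e) ; smaller = smaller ; cover = cover
      ; cycle = λ i {u} {v} p → ∧-i (CE-E {G = G} C p) (∨-il (cyc-i C p)) ; meet = meet ; inner = inner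
      ; home = λ ℓ → s ℓ , λ u v e q → part-i e (cong s q) }
      where
      part : Bool → Graph n
      adj (part i) u v = adj G u v ∧ (cyc a b c d u v ∨ not (s (side u v) xor i))
      adj-sym (part i) u v = ∧-cong' (adj-sym G u v) λ e → k e (bcase (cyc a b c d u v))
        where
        ∧-cong' : ∀ {x y p q} → x ≡ y → (x ≡ true → p ≡ q) → x ∧ p ≡ y ∧ q
        ∧-cong' {true} refl h = h refl
        ∧-cong' {false} refl h = refl
        k : E G u v → (cyc a b c d u v ≡ true) ⊎ (cyc a b c d u v ≡ false) → cyc a b c d u v ∨ not (s (side u v) xor i) ≡ cyc a b c d v u ∨ not (s (side v u) xor i)
        k e (inj₁ q) rewrite wk-sym a (b ∷ c ∷ d ∷ a ∷ []) v u | q = refl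
        k e (inj₂ q) rewrite wk-sym a (b ∷ c ∷ d ∷ a ∷ []) v u | q | s-flat u v e q = refl
      adj-irr (part i) u rewrite adj-irr G u = refl
      xs : ∀ i → not (i xor i) ≡ true
      xs true = refl
      xs false = refl
      part-i : ∀ {i u v} → E G u v → s (side u v) ≡ i → E (part i) u v
      part-i {i} {u} {v} e q = ∧-i e (∨-ir {cyc a b c d u v} (trans (cong (λ z → not (z xor i)) q) (xs i)))
      part-t : ∀ {i u v} → E (part i) u v → cyc a b c d u v ≡ false → s (side u v) ≡ i
      part-t {i} {u} {v} e q with ∨-t {cyc a b c d u v} (proj₂ (∧-t {adj G u v} e))
      ... | inj₁ r = tf r q
      ... | inj₂ r = xor-f _ _ (trans (sym (Boolₚ.not-involutive _)) (cong not r))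
      outs : ∀ i → Out i
      outs true = o1
      outs false = o0
      inner : ∀ i → ∃ λ u → ∃ λ v → E (part i) u v × ¬ On a b c d u
      inner i with outs i
      ... | u , v , e , q , r with On? a b c d u | On? a b c d v
      ... | no h | _ = u , v , part-i e r , h
      ... | yes _ | no h = v , u , E-sym (part i) {u} {v} (part-i e r) , h
      ... | yes p | yes p' = tf (cyc-i C (On-CE {G = G} ch p p' e)) q
      smaller : ∀ i → 2 + e2 (part i) ≤ e2 G
      smaller i with outs (not i)
      ... | u , v , e , q , r = e2-strict {H = part i} {G} (λ u v e → proj₁ (∧-t {adj G u v} e)) u v e (λ f → Boolₚ.not-¬ {i} refl (trans (sym (part-t {i} {u} {v} f q)) r))
      cover : ∀ u v → E G u v → E (part false) u v ⊎ E (part true) u v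
      cover u v e with bcase (s (side u v))
      ... | inj₁ q = inj₂ (part-i e q)
      ... | inj₂ q = inj₁ (part-i e q)
      meet : ∀ i {u v w} → E (part i) u v → E (part (not i)) u w → On a b c d u
      meet i {u} {v} {w} e f with On? a b c d u
      ... | yes p = p
      -- Around a vertex off the cycle `s` does not change, so all its edges lie on one side.
      ... | no h = ⊥-elim (Boolₚ.not-¬ {i} refl (trans (sym (part-t {i} {u} {v} e (off-C v h)))
           (trans (local s u (λ x g → s-flat u x g (off-C x h)) v w (proj₁ (∧-t {adj G u v} e)) (proj₁ (∧-t {adj G u w} f))) (part-t {not i} {u} {w} f (off-C w h)))))

    sides : Facial P a b c d ⊎ Split P a b c d
    sides = go (out? true) (out? false)

  separation : Facial P a b c d ⊎ Split P a b c d
  separation = let (s , sj) = jordan (cyc a b c d) (wk-sym a (b ∷ c ∷ d ∷ a ∷ [])) (λ u v e → CE-E {G = G} C (cyc-t a b c d u v e)) (cyc-∂ a b c d) in Sides.sides s sj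

  -- The closed walk a s t c b would separate the face from the path b s' t' d.
  crossing : Facial P a b c d → ∀ {s t s' t'} → E G a s → E G s t → E G t c → E G b s' → E G s' t' → E G t' d →
    s ≢ b → t ≢ b → s ≢ d → t ≢ d → s' ≢ a → s' ≢ c → s' ≢ s → s' ≢ t → t' ≢ a → t' ≢ c → t' ≢ s → t' ≢ t → ⊥
  crossing (facial ℓ bd onC) {x} {y} {x'} {y'} ax xy yc bx' xy' yd x≢b y≢b x≢d y≢d x'a x'c x'x x'y y'a y'c y'x y'y = clash
    where
    module C = C4 C
    ws = x ∷ y ∷ c ∷ b ∷ a ∷ []
    Z = wk a ws
    Zj = jordan Z (wk-sym a ws) (wk-E G a ws (ax , xy , yc , E-sym G C.bc , E-sym G C.ab , tt)) (λ u → trans (wk-∂ a ws u) (Boolₚ.xor-same (u == a)))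
    s = proj₁ Zj
    flat : ∀ {u} → u ≢ a → u ≢ x → u ≢ y → u ≢ c → u ≢ b → ∀ v → E G u v → s (side u v) ≡ s (side v u)
    flat {u} p q r z w v e = xor-f _ _ (trans (proj₂ Zj u v e) (wk-off a ws v p (q ∷ r ∷ z ∷ w ∷ p ∷ [])))
    fd = flat {d} (E-irr G C.da) (x≢d ∘ sym) (y≢d ∘ sym) (E-irr G C.cd ∘ sym) (C.b≢d ∘ sym)
    fy' = flat {y'} y'a y'x y'y y'c (λ q → proj₂ ch (subst (λ z → E G z d) q yd))
    fx' = flat {x'} x'a x'x x'y x'c (E-irr G bx' ∘ sym)
    -- s takes the same value σ on the face ℓ and along the path from d to b
    on-ℓ : ∀ {u v} (σ : Fin m → Bool) → E G u v → cyc a b c d u v ≡ true → σ (side u v) ≡ σ (side v u) → σ ℓ ≡ σ (side u v)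
    on-ℓ {u} {v} σ e q fl with bcase (side u v == ℓ)
    ... | inj₁ r = cong σ (sym (==→≡ {i = side u v} {ℓ} r))
    ... | inj₂ r = trans (cong σ (sym (==→≡ {i = side v u} {ℓ} k))) (sym fl)
      where k : (side v u == ℓ) ≡ true
            k = trans (cong (_xor (side v u == ℓ)) (sym r)) (trans (bd u v e) q)
    σb : s ℓ ≡ s (side b x')
    σb = trans (on-ℓ s C.da (cyc-i C (inj₂ (inj₂ (inj₂ (inj₁ (refl , refl)))))) (fd a C.da))
        (trans (local s d fd a y' C.da (E-sym G yd)) (trans (fd y' (E-sym G yd)) (trans (local s y' fy' d x' yd (E-sym G xy')) (trans (fy' x' (E-sym G xy'))
        (trans (local s x' fx' y' b xy' (E-sym G bx')) (fx' b (E-sym G bx')))))))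
    -- At `b` the closed walk and the face `ℓ` have the same two boundary edges. Their sum is
    -- constant around `b`, so `s` itself differs on `ℓ` and next to `bx'`, while along the path
    -- from `d` it does not.
    s~ : Fin m → Bool
    s~ z = s z xor (z == ℓ)
    xx : ∀ p q r t → (p xor q) xor (r xor t) ≡ (p xor r) xor (q xor t)
    xx true true true t = refl
    xx true true false t = sym (Boolₚ.not-involutive t)
    xx true false true t = Boolₚ.not-involutive t
    xx true false false t = refl
    xx false true true t = refl
    xx false true false t = refl
    xx false false r t = refl
    fb : ∀ v → E G b v → s~ (side b v) ≡ s~ (side v b)
    fb v e = xor-f _ _ (trans (xx (s (side b v)) (side b v == ℓ) (s (side v b)) (side v b == ℓ)) (trans (cong₂ _xor_ (proj₂ Zj b v e) (bd b v e)) k))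
      where
      k : Z b v xor cyc a b c d b v ≡ false
      k rewrite st-off {a = a} {x} {b} v (E-irr G C.ab ∘ sym) (x≢b ∘ sym) | st-off {a = x} {y} {b} v (x≢b ∘ sym) (y≢b ∘ sym)
        | st-off {a = y} {c} {b} v (y≢b ∘ sym) (E-irr G C.bc) | st-off {a = c} {d} {b} v (E-irr G C.bc) C.b≢d | st-off {a = d} {a} {b} v C.b≢d (E-irr G C.ab ∘ sym)
        | st-swap c b b v | st-swap b a b v = l (st b c b v) (st a b b v)
        where l : ∀ p q → (p xor (q xor false)) xor (q xor (p xor false)) ≡ false
              l true true = refl
              l true false = refl
              l false true = refl
              l false false = refl
    σa : s~ ℓ ≡ s~ (side b x')
    σa = trans (on-ℓ s~ (E-sym G C.ab) (cyc-i C (inj₁ (inj₂ (refl , refl)))) (fb a (E-sym G C.ab))) (local s~ b fb a x' (E-sym G C.ab) bx')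
    x'off : (side b x' == ℓ) ≡ false
    x'off = not-t→f λ q → case onC b x' bx' (==→≡ {i = side b x'} {ℓ} q) of λ
      { (inj₁ (inj₁ (p , _))) → E-irr G C.ab (sym p) ; (inj₁ (inj₂ (_ , p))) → x'a p ; (inj₂ (inj₁ (inj₁ (_ , p)))) → x'c p ; (inj₂ (inj₁ (inj₂ (p , _)))) → E-irr G C.bc p
      ; (inj₂ (inj₂ (inj₁ (inj₁ (p , _))))) → E-irr G C.bc p ; (inj₂ (inj₂ (inj₁ (inj₂ (p , _))))) → C.b≢d p ; (inj₂ (inj₂ (inj₂ (inj₁ (p , _))))) → C.b≢d p ; (inj₂ (inj₂ (inj₂ (inj₂ (p , _))))) → E-irr G C.ab (sym p) }
    clash : ⊥
    clash = Boolₚ.not-¬ {s ℓ} refl (trans σb (trans (sym (trans (cong (s (side b x') xor_) x'off) (Boolₚ.xor-identityʳ _)))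
      (trans (sym σa) (trans (cong (s ℓ xor_) (==-refl ℓ)) (Boolₚ.xor-comm (s ℓ) true)))))

-- Obstructions to identifying opposite corners of a 4-face

-- A path of length 3 that the identification of `a` and `c` closes to a triangle. The two non-edges
-- exclude triangles that come from triangles of `G`.
Bad : ∀ {n} → Graph n → Fin n → Fin n → Set
Bad G a c = ∃ λ s → ∃ λ t → E G a s × E G s t × E G t c × ¬ E G a t × ¬ E G s c

Bad? : ∀ {n} (G : Graph n) a c → Dec (Bad G a c)
Bad? G a c = Finₚ.any? λ s → Finₚ.any? λ t → E? G a s ×-dec E? G s t ×-dec E? G t c ×-dec ¬? (E? G a t) ×-dec ¬? (E? G s c)

-- Both identifications on the face abcd create triangles through the common neighbour z of a and b.
record Fan {n} (G : Graph n) (a b c d : Fin n) : Set where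
  constructor fan
  field z t t' : Fin n
        za : E G z a
        zb : E G z b
        zt : E G z t
        tc : E G t c
        zt' : E G z t'
        t'd : E G t' d
        at : ¬ E G a t
        zc : ¬ E G z c
        bt' : ¬ E G b t'
        zd : ¬ E G z d

-- By `crossing` the two paths share an inner vertex, and each of the four possible coincidences is
-- a fan on one of the four rotations of the cycle.
bad-fan : ∀ {n} {G : Graph n} (P : Planarity G) {a b c d} → C4 G a b c d → Chordless G a b c d → Facial P a b c d →
  Bad G a c → Bad G b d → Fan G a b c d ⊎ Fan G b c d a ⊎ Fan G c d a b ⊎ Fan G d a b c
bad-fan {G = G} P {a} {b} {c} {d} C ch F (s , t , as , st' , tc , at , sc) (s' , t' , bs , st'' , td , bt , sd) with s ≟ s' | s ≟ t' | t ≟ s' | t ≟ t'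
... | yes refl | _ | _ | _ = inj₁ (fan s t t' (E-sym G as) (E-sym G bs) st' tc st'' td at sc bt sd)
... | no _ | yes refl | _ | _ = inj₂ (inj₂ (inj₂ (fan s s' t td (E-sym G as) (E-sym G st'') (E-sym G bs) st' tc (sd ∘ E-sym G) (bt ∘ E-sym G) at sc)))
... | no _ | no _ | yes refl | _ = inj₂ (inj₁ (fan t t' s (E-sym G bs) tc st'' td (E-sym G st') (E-sym G as) bt sd (sc ∘ E-sym G) (at ∘ E-sym G)))
... | no _ | no _ | no _ | yes refl = inj₂ (inj₂ (inj₁ (fan t s s' tc td (E-sym G st') (E-sym G as) (E-sym G st'') (E-sym G bs) (sc ∘ E-sym G) (at ∘ E-sym G) (sd ∘ E-sym G) (bt ∘ E-sym G))))
... | no p | no q | no r | no w = ⊥-elim (crossing P C ch F as st' tc bs st'' td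
   (λ { refl → sc (C4.bc C) }) (λ { refl → at (C4.ab C) }) (λ { refl → sc (E-sym G (C4.cd C)) }) (λ { refl → at (E-sym G (C4.da C)) })
   (λ { refl → sd (E-sym G (C4.da C)) }) (λ { refl → sd (C4.cd C) }) (p ∘ sym) (r ∘ sym) (λ { refl → bt (E-sym G (C4.ab C)) }) (λ { refl → bt (C4.bc C) }) (q ∘ sym) (w ∘ sym))

Tri : ∀ {n} → Graph n → (a b c : Fin n) → Set
Tri G a b c = E G a b × E G b c × E G a c

TriFree : ∀ {n} → Graph n → Set
TriFree G = ∀ a b c → ¬ Tri G a b c

-- Uniqueness without an order on the corners: rotating the second triangle puts all of its corners
-- on the first.
OneTri : ∀ {n} → Graph n → Set
OneTri G = ∀ {a b c x y z} → Tri G a b c → Tri G x y z → (x ≡ a) ⊎ (x ≡ b) ⊎ (x ≡ c)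

module _ {n} {G : Graph n} (U : OneTri G) where
  -- A chord would cut the cycle into two different triangles.
  chordless : ∀ {a b c d} → C4 G a b c d → Chordless G a b c d
  chordless (c4 ab bc cd da p q) = (λ ac → case U (ab , bc , ac) (E-sym G cd , E-sym G ac , da) of λ
      { (inj₁ e) → E-irr G da e ; (inj₂ (inj₁ e)) → q (sym e) ; (inj₂ (inj₂ e)) → E-irr G cd (sym e) })
    , (λ bd → case U (bc , cd , bd) (ab , bd , E-sym G da) of λ
      { (inj₁ e) → E-irr G ab e ; (inj₂ (inj₁ e)) → p e ; (inj₂ (inj₂ e)) → E-irr G da (sym e) })

  module _ {a b c d} (C : C4 G a b c d) (F : Fan G a b c d) where
    open C4 C
    open Fan F
    ch = chordless C

    T₀ : Tri G a b z
    T₀ = ab , E-sym G zb , E-sym G za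

    a≢t' : a ≢ t'
    a≢t' refl = bt' (E-sym G ab)
    z≢d : z ≢ d
    z≢d refl = proj₂ ch (E-sym G zb)
    t'∉ : ¬ ((t' ≡ a) ⊎ (t' ≡ b) ⊎ (t' ≡ z))
    t'∉ (inj₁ e) = a≢t' (sym e)
    t'∉ (inj₂ (inj₁ refl)) = proj₂ ch t'd
    t'∉ (inj₂ (inj₂ refl)) = E-irr G zt' refl
    c∉ : ¬ ((c ≡ a) ⊎ (c ≡ b) ⊎ (c ≡ z))
    c∉ (inj₁ e) = a≢c (sym e)
    c∉ (inj₂ (inj₁ e)) = E-irr G bc (sym e)
    c∉ (inj₂ (inj₂ refl)) = proj₁ ch (E-sym G za)
    d∉ : ¬ ((d ≡ a) ⊎ (d ≡ b) ⊎ (d ≡ z))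
    d∉ (inj₁ e) = E-irr G da e
    d∉ (inj₂ (inj₁ e)) = b≢d (sym e)
    d∉ (inj₂ (inj₂ e)) = z≢d (sym e)
    t∉ : ¬ ((t ≡ a) ⊎ (t ≡ b) ⊎ (t ≡ z))
    t∉ (inj₁ refl) = proj₁ ch tc
    t∉ (inj₂ (inj₁ refl)) = at ab
    t∉ (inj₂ (inj₂ refl)) = E-irr G zt refl

    fan-C4 : C4 G a z t' d
    fan-C4 = c4 (E-sym G za) zt' t'd da a≢t' z≢d

    -- If both diagonals of `a z t' d` were bad there would be a second fan, whose triangle has to
    -- be `abz`. This leaves only the side `az` with apex `b`, and then the paths `a z t c` and
    -- `b τ t' d` cross on the face `abcd`.
    fan-good : (P : Planarity G) → Facial P a b c d → Facial P a z t' d → Bad G a t' → Bad G z d → ⊥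
    fan-good P F₀ F₁ b1 b2 with bad-fan P fan-C4 (chordless fan-C4) F₁ b1 b2
    ... | inj₂ (inj₁ f) = t'∉ (U T₀ (E-sym G zt' , E-sym G (Fan.za f) , E-sym G (Fan.zb f)))
    ... | inj₂ (inj₂ (inj₁ f)) = t'∉ (U T₀ (t'd , E-sym G (Fan.zb f) , E-sym G (Fan.za f)))
    ... | inj₂ (inj₂ (inj₂ f)) = d∉ (U T₀ (da , E-sym G (Fan.zb f) , E-sym G (Fan.za f)))
    ... | inj₁ (fan w τ _ wa wz wτ τt' _ _ aτ _ _ _) with U T₀ (wa , E-sym G za , wz)
    ... | inj₁ e = E-irr G wa e
    ... | inj₂ (inj₂ e) = E-irr G wz e
    ... | inj₂ (inj₁ refl) = crossing P C ch F₀ (E-sym G za) zt tc wτ τt' t'd (E-irr G zb) (λ e → t∉ (inj₂ (inj₁ e))) z≢d (λ { refl → at (E-sym G da) })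
      (λ { refl → t'∉ (U T₀ (E-sym G τt' , E-sym G za , E-sym G zt')) }) (λ { refl → c∉ (U T₀ (cd , E-sym G t'd , τt')) }) (λ { refl → aτ (E-sym G za) }) (λ { refl → t∉ (U T₀ (E-sym G wτ , E-sym G zb , E-sym G zt)) })
      (a≢t' ∘ sym) (λ { refl → zc zt' }) (E-irr G zt' ∘ sym) (λ { refl → c∉ (U T₀ (cd , E-sym G t'd , E-sym G tc)) })

Fan-refl : ∀ {n} {G : Graph n} {a b c d} → Fan G a b c d → Fan G b a d c
Fan-refl (fan z t t' za zb zt tc zt' t'd at zc bt' zd) = fan z t' t zb za zt' t'd zt tc bt' zd at zc

xor-ends : ∀ p q c d r → (p xor q) xor (((c ∧ r) xor p) xor ((d ∧ r) xor q)) ≡ (c xor d) ∧ r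
xor-ends true true true true true = refl
xor-ends true true true true false = refl
xor-ends true true true false true = refl
xor-ends true true true false false = refl
xor-ends true true false true true = refl
xor-ends true true false true false = refl
xor-ends true true false false r = refl
xor-ends true false true true true = refl
xor-ends true false true true false = refl
xor-ends true false true false true = refl
xor-ends true false true false false = refl
xor-ends true false false true true = refl
xor-ends true false false true false = refl
xor-ends true false false false r = refl
xor-ends false true true true true = refl
xor-ends false true true true false = refl
xor-ends false true true false true = refl
xor-ends false true true false false = refl
xor-ends false true false true true = refl
xor-ends false true false true false = refl
xor-ends false true false false r = refl
xor-ends false false true true true = refl
xor-ends false false true true false = refl
xor-ends false false true false true = refl
xor-ends false false true false false = refl
xor-ends false false false true true = refl
xor-ends false false false true false = refl
xor-ends false false false false r = refl

xor-cancel : ∀ p q r → (p xor r) xor (q xor r) ≡ p xor q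
xor-cancel true true true = refl
xor-cancel true true false = refl
xor-cancel true false true = refl
xor-cancel true false false = refl
xor-cancel false true true = refl
xor-cancel false true false = refl
xor-cancel false false true = refl
xor-cancel false false false = refl

xor-any : ∀ {p q} → p xor q ≡ true → (p ≡ true) ⊎ (q ≡ true)
xor-any {true} _ = inj₁ refl
xor-any {false} e = inj₂ e

-- Identification of the opposite corners a, b of a face a x b y: the parallel edges ax, bx (and
-- ay, by) become one edge, whose faces are the two outer faces; the face itself disappears.
module MergeFace {n} {G : Graph n} (P : Planarity G) {a x b y} (C : C4 G a x b y) (F : Facial P a x b y) (nab : ¬ E G a b)
  (cn : ∀ v → E G a v → E G b v → (v ≡ x) ⊎ (v ≡ y)) where
  open Planarity P
  open Facial F
  module C = C4 C

  M : Graph n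
  M = merge G a b nab

  a≢b : a ≢ b
  a≢b = C.a≢c

  xy : Fin n → Bool
  xy v = (v == x) ∨ (v == y)

  xy-t : ∀ {v} → xy v ≡ true → (v ≡ x) ⊎ (v ≡ y)
  xy-t {v} e with ∨-t {v == x} e
  ... | inj₁ p = inj₁ (==→≡ {i = v} {x} p)
  ... | inj₂ p = inj₂ (==→≡ {i = v} {y} p)

  xy-i : ∀ {v} → (v ≡ x) ⊎ (v ≡ y) → xy v ≡ true
  xy-i (inj₁ refl) = ∨-il (==-refl x)
  xy-i (inj₂ refl) = ∨-ir {y == x} (==-refl y)

  ea : ∀ v → xy v ≡ true → E G a v
  ea v e with xy-t {v} e
  ... | inj₁ refl = C.ab
  ... | inj₂ refl = E-sym G C.da

  eb : ∀ v → xy v ≡ true → E G b v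
  eb v e with xy-t {v} e
  ... | inj₁ refl = E-sym G C.bc
  ... | inj₂ refl = C.cd

  ca : ∀ v → xy v ≡ true → cyc a x b y a v ≡ true
  ca v e with xy-t {v} e
  ... | inj₁ refl = cyc-i C (inj₁ (inj₁ (refl , refl)))
  ... | inj₂ refl = cyc-i C (inj₂ (inj₂ (inj₂ (inj₂ (refl , refl)))))

  cb : ∀ v → xy v ≡ true → cyc a x b y b v ≡ true
  cb v e with xy-t {v} e
  ... | inj₁ refl = cyc-i C (inj₂ (inj₁ (inj₂ (refl , refl))))
  ... | inj₂ refl = cyc-i C (inj₂ (inj₂ (inj₁ (inj₁ (refl , refl)))))

  -- For an edge of the 4-face, the face on its far side.
  oth : Fin n → Fin n → Fin m
  oth u v = if side u v == ℓ then side v u else side u v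

  one-ℓ : ∀ {u v} → E G u v → cyc a x b y u v ≡ true → (side u v ≡ ℓ × side v u ≢ ℓ) ⊎ (side u v ≢ ℓ × side v u ≡ ℓ)
  one-ℓ {u} {v} e q with side u v ≟ ℓ | side v u ≟ ℓ
  ... | yes p | no r = inj₁ (p , r)
  ... | no p | yes r = inj₂ (p , r)
  ... | yes p | yes r = tf q (trans (sym (bd u v e)) (trans (cong₂ (λ z w → (z == ℓ) xor (w == ℓ)) p r) (Boolₚ.xor-same (ℓ == ℓ))))
  ... | no p | no r = tf q (trans (sym (bd u v e)) (cong₂ _xor_ (≢→== p) (≢→== r)))

  oth-l : ∀ {u v} → side u v ≡ ℓ → oth u v ≡ side v u
  oth-l {u} {v} e rewrite e | ==-refl ℓ = refl

  oth-r : ∀ {u v} → side u v ≢ ℓ → oth u v ≡ side u v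
  oth-r e rewrite ≢→== e = refl

  oth-≢ : ∀ {u v} → E G u v → cyc a x b y u v ≡ true → oth u v ≢ ℓ
  oth-≢ {u} {v} e q with one-ℓ e q
  ... | inj₁ (p , r) = λ z → r (trans (sym (oth-l {u} {v} p)) z)
  ... | inj₂ (p , r) = λ z → p (trans (sym (oth-r {u} {v} p)) z)

  oth-∂ : ∀ (s : Fin m → Bool) {u v} → E G u v → cyc a x b y u v ≡ true → ∂ s u v ≡ s ℓ xor s (oth u v)
  oth-∂ s {u} {v} e q with one-ℓ e q
  ... | inj₁ (p , r) = cong₂ (λ z w → s z xor s w) p (sym (oth-l {u} {v} p))
  ... | inj₂ (p , r) = trans (Boolₚ.xor-comm (s (side u v)) _) (cong₂ (λ z w → s z xor s w) r (sym (oth-r {u} {v} p)))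

  oth-side : ∀ u v → (oth u v ≡ side u v) ⊎ (oth u v ≡ side v u)
  oth-side u v with side u v ≟ ℓ
  ... | yes p = inj₂ (oth-l {u} {v} p)
  ... | no p = inj₁ (oth-r {u} {v} p)

  -- The faces to the left and right of the edge `av` of the quotient. At a corner `v` two parallel
  -- edges enclose nothing after the identification, and only their outer faces are kept.
  lp rp : Fin n → Fin m
  lp v = if xy v then oth a v else (if adj G a v then side a v else side b v)
  rp v = if xy v then oth b v else (if adj G a v then side v a else side v b)

  side2 : Fin n → Fin n → Fin m
  side2 u v = if u == a then lp v else (if v == a then rp u else side u v)

  side2-a : ∀ v → side2 a v ≡ lp v
  side2-a v rewrite ==-refl a = refl

  side2-a' : ∀ {v} → v ≢ a → side2 v a ≡ rp v
  side2-a' h rewrite ≢→== h | ==-refl a = refl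

  side2-o : ∀ {u v} → u ≢ a → v ≢ a → side2 u v ≡ side u v
  side2-o h h' rewrite ≢→== h | ≢→== h' = refl

  ∂2 : (Fin m → Bool) → Fin n → Fin n → Bool
  ∂2 s u v = s (side2 u v) xor s (side2 v u)

  D : (Fin m → Bool) → Fin n → Fin n → Bool
  D s u v = adj G u v ∧ ∂ s u v

  D-sym : ∀ s u v → D s u v ≡ D s v u
  D-sym s u v = cong₂ _∧_ (adj-sym G u v) (∂-sym P s u v)

  D-E : ∀ s {u v} → E G u v → D s u v ≡ ∂ s u v
  D-E s e rewrite e = refl

  D-no : ∀ s {u v} → ¬ E G u v → D s u v ≡ false
  D-no s h rewrite not-t→f h = refl

  M-cases : ∀ {v} → E M a v → v ≢ a × v ≢ b × (xy v ≡ true ⊎ (xy v ≡ false × E G a v × ¬ E G b v) ⊎ (xy v ≡ false × ¬ E G a v × E G b v))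
  M-cases {v} e with merge-t G a b nab e | E? G a v | E? G b v | bcase (xy v)
  ... | _ , vb , _ | _ | _ | inj₁ q = (E-irr M e ∘ sym) , vb , inj₁ q
  ... | _ , vb , _ | yes p | yes r | inj₂ q = tf (xy-i (cn v p r)) q
  ... | _ , vb , _ | yes p | no r | inj₂ q = (E-irr M e ∘ sym) , vb , inj₂ (inj₁ (q , p , r))
  ... | _ , vb , _ | no p | yes r | inj₂ q = (E-irr M e ∘ sym) , vb , inj₂ (inj₂ (q , p , r))
  ... | _ , vb , m-old f | no p | no r | inj₂ q = ⊥-elim (p f)
  ... | _ , vb , m-left _ f | no p | no r | inj₂ q = ⊥-elim (r f)
  ... | _ , vb , m-right refl f | no p | no r | inj₂ q = ⊥-elim (E-irr M e refl)

  lp1 : ∀ {v} → xy v ≡ true → lp v ≡ oth a v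
  lp1 e rewrite e = refl
  lp2 : ∀ {v} → xy v ≡ false → E G a v → lp v ≡ side a v
  lp2 e f rewrite e | f = refl
  lp3 : ∀ {v} → xy v ≡ false → ¬ E G a v → lp v ≡ side b v
  lp3 e f rewrite e | not-t→f f = refl
  rp1 : ∀ {v} → xy v ≡ true → rp v ≡ oth b v
  rp1 e rewrite e = refl
  rp2 : ∀ {v} → xy v ≡ false → E G a v → rp v ≡ side v a
  rp2 e f rewrite e | f = refl
  rp3 : ∀ {v} → xy v ≡ false → ¬ E G a v → rp v ≡ side v b
  rp3 e f rewrite e | not-t→f f = refl

  -- Boundaries add under the identification; at a corner the two contributions of `ℓ` cancel.
  ∂2-a : ∀ s {v} → E M a v → ∂2 s a v ≡ D s a v xor D s b v
  ∂2-a s {v} e with M-cases e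
  ... | va , vb , k = trans (cong₂ (λ z w → s z xor s w) (side2-a v) (side2-a' va)) (go k)
    where
    xx : ∀ p q r → p xor q ≡ (r xor p) xor (r xor q)
    xx p q false = refl
    xx true q true = refl
    xx false q true = sym (Boolₚ.not-involutive q)
    go : _ → s (lp v) xor s (rp v) ≡ D s a v xor D s b v
    go (inj₁ q) = trans (cong₂ (λ z w → s z xor s w) (lp1 q) (rp1 q)) (trans (xx _ _ (s ℓ)) (sym (cong₂ _xor_ (trans (D-E s (ea v q)) (oth-∂ s (ea v q) (ca v q))) (trans (D-E s (eb v q)) (oth-∂ s (eb v q) (cb v q))))))
    go (inj₂ (inj₁ (q , f , h))) = trans (cong₂ (λ z w → s z xor s w) (lp2 q f) (rp2 q f)) (trans (sym (D-E s f)) (trans (sym (Boolₚ.xor-identityʳ _)) (cong (D s a v xor_) (sym (D-no s h)))))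
    go (inj₂ (inj₂ (q , h , f))) = trans (cong₂ (λ z w → s z xor s w) (lp3 q h) (rp3 q h)) (trans (sym (D-E s f)) (cong (_xor D s b v) (sym (D-no s h))))

  row-a : ∀ s v → adj M a v ∧ ∂2 s a v ≡ D s a v xor D s b v
  row-a s v with bcase (adj M a v)
  ... | inj₁ e = trans (cong (_∧ ∂2 s a v) e) (∂2-a s e)
  ... | inj₂ e = trans (cong (_∧ ∂2 s a v) e) (sym (k (v ≟ b)))
    where k : Dec (v ≡ b) → D s a v xor D s b v ≡ false
          k (yes refl) = cong₂ _xor_ (D-no s nab) (D-no s (λ f → E-irr G f refl))
          k (no h) = cong₂ _xor_ (D-no s (λ f → tf (merge-old G a b nab a≢b h f) e)) (D-no s (λ f → tf (merge-new G a b nab a≢b f) e))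

  row-a' : ∀ s u → adj M u a ∧ ∂2 s u a ≡ D s u a xor D s u b
  row-a' s u = trans (cong₂ _∧_ (adj-sym M u a) (Boolₚ.xor-comm (s (side2 u a)) _)) (trans (row-a s u) (cong₂ _xor_ (D-sym s a u) (D-sym s b u)))

  M-b : ∀ v → adj M b v ≡ false
  M-b v = not-t→f λ e → proj₁ (merge-t G a b nab e) refl

  row-o : ∀ s {u v} → u ≢ a → u ≢ b → v ≢ a → v ≢ b → adj M u v ∧ ∂2 s u v ≡ D s u v
  row-o s {u} {v} p q r t = cong₂ _∧_ (b-ext (λ e → k (proj₂ (proj₂ (merge-t G a b nab e)))) (merge-old G a b nab q t)) (cong₂ (λ z w → s z xor s w) (side2-o p r) (side2-o r p))
    where k : MergeE G a b nab u v → E G u v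
          k (m-old f) = f
          k (m-left z _) = ⊥-elim (p z)
          k (m-right z _) = ⊥-elim (r z)

  ⊕-at : ∀ (k : Bool) (z : Fin n) → ⊕ (λ v → (v == z) ∧ k) ≡ k
  ⊕-at k z = trans (⊕-1 (λ v → (v == z) ∧ k) z (λ i h → cong (_∧ k) (≢→== h))) (cong (_∧ k) (==-refl z))

  even2 : ∀ s u → ⊕ (λ v → adj M u v ∧ ∂2 s u v) ≡ false
  even2 s u with u ≟ a | u ≟ b
  ... | yes refl | _ = trans (⊕-cong (row-a s)) (trans (⊕-xor (D s a) (D s b)) (cong₂ _xor_ (even s a) (even s b)))
  ... | no _ | yes refl = ⊕-0 (λ v → cong (_∧ ∂2 s b v) (M-b v))
  ... | no p | no q = trans (⊕-cong pt) (trans (⊕-xor (D s u) _) (cong₂ _xor_ (even s u) (trans (⊕-xor (λ v → (v == a) ∧ D s u b) _) (trans (cong₂ _xor_ (⊕-at (D s u b) a) (⊕-at (D s u b) b)) (Boolₚ.xor-same (D s u b))))))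
    where
    pt : ∀ v → adj M u v ∧ ∂2 s u v ≡ D s u v xor (((v == a) ∧ D s u b) xor ((v == b) ∧ D s u b))
    pt v with v ≟ a | v ≟ b
    ... | yes refl | yes z = ⊥-elim (a≢b z)
    ... | yes refl | no h = trans (row-a' s u) (cong (D s u a xor_) (sym (trans (cong₂ (λ c d → (c ∧ D s u b) xor (d ∧ D s u b)) (==-refl v) (≢→== h)) (Boolₚ.xor-identityʳ _))))
    ... | no h | yes refl = trans (cong (_∧ ∂2 s u v) (trans (adj-sym M u v) (M-b u))) (sym (trans (cong (D s u v xor_) (cong₂ (λ c d → (c ∧ D s u v) xor (d ∧ D s u v)) (≢→== h) (==-refl v))) (Boolₚ.xor-same (D s u v))))
    ... | no h | no h' = trans (row-o s p q h h') (sym (trans (cong (D s u v xor_) (cong₂ (λ c d → (c ∧ D s u b) xor (d ∧ D s u b)) (≢→== h) (≢→== h'))) (Boolₚ.xor-identityʳ _)))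

  -- The edges of `Z2` at the identified vertex are returned to their origins, `A` to `a` and `B` to
  -- `b`. This leaves both vertices with the parity `π`, which the path `a x b` repairs; in the
  -- quotient its two edges cancel.
  module Lift (Z2 : Fin n → Fin n → Bool) (Zs : ∀ u v → Z2 u v ≡ Z2 v u) (Zp : ∀ u v → Z2 u v ≡ true → E M u v) (Ze : ∀ u → ⊕ (Z2 u) ≡ false) where
    A B : Fin n → Bool
    A v = Z2 a v ∧ adj G a v
    B v = Z2 a v ∧ not (adj G a v)
    AB : ∀ v → A v xor B v ≡ Z2 a v
    AB v with Z2 a v | adj G a v
    ... | true | true = refl
    ... | true | false = refl
    ... | false | _ = refl
    base Z0 Z : Fin n → Fin n → Bool
    base u v = Z2 u v ∧ (not (u == a) ∧ not (v == a))
    Z0 u v = base u v xor ((((u == a) ∧ A v) xor ((v == a) ∧ A u)) xor (((u == b) ∧ B v) xor ((v == b) ∧ B u)))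
    Z0-sym : ∀ u v → Z0 u v ≡ Z0 v u
    Z0-sym u v = cong₂ _xor_ (cong₂ _∧_ (Zs u v) (Boolₚ.∧-comm (not (u == a)) _)) (cong₂ _xor_ (Boolₚ.xor-comm ((u == a) ∧ A v) _) (Boolₚ.xor-comm ((u == b) ∧ B v) _))
    eA : ∀ {u v} → (u == a) ∧ A v ≡ true → E G u v
    eA {u} {v} e with ∧-t {u == a} e
    ... | p , q rewrite ==→≡ {i = u} {a} p = proj₂ (∧-t {Z2 a v} q)
    eB : ∀ {u v} → (u == b) ∧ B v ≡ true → E G u v
    eB {u} {v} e with ∧-t {u == b} e
    ... | p , q rewrite ==→≡ {i = u} {b} p with ∧-t {Z2 a v} q
    ... | r , t with merge-t G a b nab (Zp a v r)
    ... | _ , _ , m-old f = case trans (sym t) (cong not f) of λ ()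
    ... | _ , _ , m-left _ f = f
    ... | _ , _ , m-right refl f = ⊥-elim (E-irr M (Zp a v r) refl)
    Z0-E : ∀ u v → Z0 u v ≡ true → E G u v
    Z0-E u v e with xor-any {base u v} e
    ... | inj₁ p with ∧-t {Z2 u v} p
    ... | q , r with merge-t G a b nab (Zp u v q)
    ... | _ , _ , m-old f = f
    ... | _ , _ , m-left refl f = case trans (sym (proj₁ (∧-t {not (u == u)} r))) (cong not (==-refl u)) of λ ()
    ... | _ , _ , m-right refl f = case trans (sym (proj₂ (∧-t {not (u == v)} r))) (cong not (==-refl v)) of λ ()
    Z0-E u v e | inj₂ p with xor-any {((u == a) ∧ A v) xor ((v == a) ∧ A u)} p
    ... | inj₁ q with xor-any {(u == a) ∧ A v} q
    ... | inj₁ r = eA r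
    ... | inj₂ r = E-sym G (eA r)
    Z0-E u v e | inj₂ p | inj₂ q with xor-any {(u == b) ∧ B v} q
    ... | inj₁ r = eB r
    ... | inj₂ r = E-sym G (eB r)
    π : Bool
    π = ⊕ A
    π' : ⊕ B ≡ π
    π' = sym (xor-f _ _ (trans (sym (⊕-xor A B)) (trans (⊕-cong AB) (Ze a))))
    ∧-⊕ : ∀ c (f : Fin n → Bool) → ⊕ (λ v → c ∧ f v) ≡ c ∧ ⊕ f
    ∧-⊕ true f = refl
    ∧-⊕ false f = ⊕-0 (λ _ → refl)
    base-∂ : ∀ u → ⊕ (base u) ≡ Z2 u a
    base-∂ u with u ≟ a
    ... | yes refl rewrite ==-refl u = trans (⊕-0 (λ v → Boolₚ.∧-zeroʳ _)) (sym (not-t→f λ z → E-irr M (Zp u u z) refl))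
    ... | no h rewrite ≢→== h = trans (⊕-cong k) (trans (⊕-xor (Z2 u) _) (cong₂ _xor_ (Ze u) (⊕-at (Z2 u a) a)))
      where k : ∀ v → Z2 u v ∧ not (v == a) ≡ Z2 u v xor ((v == a) ∧ Z2 u a)
            k v with v ≟ a
            ... | yes refl rewrite ==-refl v = trans (Boolₚ.∧-zeroʳ _) (sym (Boolₚ.xor-same (Z2 u v)))
            ... | no h rewrite ≢→== h = trans (Boolₚ.∧-identityʳ _) (sym (Boolₚ.xor-identityʳ _))
    Z0-∂ : ∀ u → ⊕ (Z0 u) ≡ ((u == a) xor (u == b)) ∧ π
    Z0-∂ u = trans (⊕-xor (base u) _) (trans (cong₂ _xor_ (trans (base-∂ u) (trans (Zs u a) (sym (AB u)))) (trans (⊕-xor (λ v → ((u == a) ∧ A v) xor ((v == a) ∧ A u)) _) (cong₂ _xor_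
        (trans (⊕-xor (λ v → (u == a) ∧ A v) _) (cong₂ _xor_ (∧-⊕ (u == a) A) (⊕-at (A u) a)))
        (trans (⊕-xor (λ v → (u == b) ∧ B v) _) (cong₂ _xor_ (trans (∧-⊕ (u == b) B) (cong ((u == b) ∧_) π')) (⊕-at (B u) b))))))
       (xor-ends (A u) (B u) (u == a) (u == b) π))
    W : Fin n → Fin n → Bool
    W = wk a (x ∷ b ∷ [])
    Z u v = Z0 u v xor (π ∧ W u v)
    Z-E : ∀ u v → Z u v ≡ true → E G u v
    Z-E u v e with xor-any {Z0 u v} e
    ... | inj₁ p = Z0-E u v p
    ... | inj₂ p = wk-E G a (x ∷ b ∷ []) (C.ab , C.bc , tt) u v (proj₂ (∧-t {π} p))
    Z-∂ : ∀ u → ⊕ (Z u) ≡ false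
    Z-∂ u = trans (⊕-xor (Z0 u) _) (trans (cong₂ _xor_ (Z0-∂ u) (trans (∧-⊕ π (W u)) (trans (cong (π ∧_) (wk-∂ a (x ∷ b ∷ []) u)) (Boolₚ.∧-comm π _)))) (Boolₚ.xor-same (((u == a) xor (u == b)) ∧ π)))
    Za : ∀ {v} → v ≢ a → v ≢ b → Z a v ≡ A v xor (π ∧ (v == x))
    Za {v} p q rewrite ==-refl a | ≢→== p | ≢→== a≢b | ≢→== q | Boolₚ.∧-zeroʳ (Z2 a v) | ≢→== (E-irr G C.ab)
      | Boolₚ.xor-identityʳ (A v) | Boolₚ.xor-identityʳ (A v) | Boolₚ.xor-identityʳ (v == x) | Boolₚ.xor-identityʳ (v == x) = refl
    Zb : ∀ {v} → v ≢ a → v ≢ b → Z b v ≡ B v xor (π ∧ (v == x))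
    Zb {v} p q rewrite ≢→== (a≢b ∘ sym) | ≢→== p | ==-refl b | ≢→== q | ≢→== (E-irr G C.bc ∘ sym) | not-t→f (λ z → proj₁ (merge-t G a b nab (Zp b v z)) refl)
      | Boolₚ.xor-identityʳ (B v) | Boolₚ.xor-identityʳ (v == x) = refl
    Zo : ∀ {u v} → u ≢ a → u ≢ b → v ≢ a → v ≢ b → Z u v ≡ Z2 u v
    Zo {u} {v} p q r t rewrite ≢→== p | ≢→== q | ≢→== r | ≢→== t | Boolₚ.∧-identityʳ (Z2 u v) | Boolₚ.∧-zeroʳ (u == x) | Boolₚ.∧-zeroʳ π | Boolₚ.xor-identityʳ (Z2 u v) = Boolₚ.xor-identityʳ (Z2 u v)
    module Solved (s : Fin m → Bool) (sz : ∀ u v → E G u v → ∂ s u v ≡ Z u v) where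
      DZ : ∀ u v → D s u v ≡ Z u v
      DZ u v with bcase (adj G u v)
      ... | inj₁ e = trans (D-E s e) (sz u v e)
      ... | inj₂ e = trans (D-no s (λ z → tf z e)) (sym (not-t→f λ z → tf (Z-E u v z) e))
      at-a : ∀ {v} → E M a v → ∂2 s a v ≡ Z2 a v
      at-a {v} e with M-cases e
      ... | p , q , _ = trans (∂2-a s e) (trans (cong₂ _xor_ (trans (DZ a v) (Za p q)) (trans (DZ b v) (Zb p q))) (trans (xor-cancel (A v) (B v) (π ∧ (v == x))) (AB v)))
      all : ∀ u v → E M u v → ∂2 s u v ≡ Z2 u v
      all u v e with u ≟ a | v ≟ a | merge-t G a b nab e
      ... | yes refl | _ | _ = at-a e
      ... | no _ | yes refl | _ = trans (Boolₚ.xor-comm (s (side2 u a)) _) (trans (at-a (E-sym M e)) (Zs a u))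
      ... | no p | no q | ub , vb , _ = trans (sym (trans (cong (_∧ ∂2 s u v) e) refl)) (trans (row-o s p ub q vb) (trans (DZ u v) (Zo p ub q vb)))

    solution : ∃ λ s → ∀ u v → E M u v → ∂2 s u v ≡ Z2 u v
    solution = let (s , sz) = jordan Z (λ u v → cong₂ _xor_ (Z0-sym u v) (cong (π ∧_) (wk-sym a (x ∷ b ∷ []) u v))) Z-E Z-∂ in s , Solved.all s sz

  -- `ℓ` is not a face of the quotient, so the value of a face function on it can be chosen freely,
  -- and is chosen to make an edge of the 4-face flat.
  module Re (s : Fin m → Bool) (val : Bool) where
    s~ : Fin m → Bool
    s~ z = if z == ℓ then val else s z

    s~ℓ : s~ ℓ ≡ val
    s~ℓ rewrite ==-refl ℓ = refl

    s~o : ∀ {z} → z ≢ ℓ → s~ z ≡ s z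
    s~o h rewrite ≢→== h = refl

  not-ℓ : ∀ {u v} → E G u v → ¬ CE a x b y u v → side u v ≢ ℓ
  not-ℓ e h q = h (onC _ _ e q)

  ce-xy : ∀ {v} → CE a x b y a v ⊎ CE a x b y b v → xy v ≡ true
  ce-xy (inj₁ (inj₁ (inj₁ (_ , p)))) = xy-i (inj₁ p)
  ce-xy (inj₁ (inj₁ (inj₂ (p , _)))) = ⊥-elim (E-irr G C.ab p)
  ce-xy (inj₁ (inj₂ (inj₁ (inj₁ (p , _))))) = ⊥-elim (E-irr G C.ab p)
  ce-xy (inj₁ (inj₂ (inj₁ (inj₂ (p , _))))) = ⊥-elim (a≢b p)
  ce-xy (inj₁ (inj₂ (inj₂ (inj₁ (inj₁ (p , _)))))) = ⊥-elim (a≢b p)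
  ce-xy (inj₁ (inj₂ (inj₂ (inj₁ (inj₂ (p , _)))))) = ⊥-elim (E-irr G C.da (sym p))
  ce-xy (inj₁ (inj₂ (inj₂ (inj₂ (inj₁ (p , _)))))) = ⊥-elim (E-irr G C.da (sym p))
  ce-xy (inj₁ (inj₂ (inj₂ (inj₂ (inj₂ (_ , p)))))) = xy-i (inj₂ p)
  ce-xy (inj₂ (inj₁ (inj₁ (p , _)))) = ⊥-elim (a≢b (sym p))
  ce-xy (inj₂ (inj₁ (inj₂ (p , _)))) = ⊥-elim (E-irr G C.bc (sym p))
  ce-xy (inj₂ (inj₂ (inj₁ (inj₁ (p , _))))) = ⊥-elim (E-irr G C.bc (sym p))
  ce-xy (inj₂ (inj₂ (inj₁ (inj₂ (_ , p))))) = xy-i (inj₁ p)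
  ce-xy (inj₂ (inj₂ (inj₂ (inj₁ (inj₁ (_ , p)))))) = xy-i (inj₂ p)
  ce-xy (inj₂ (inj₂ (inj₂ (inj₁ (inj₂ (p , _)))))) = ⊥-elim (E-irr G C.cd p)
  ce-xy (inj₂ (inj₂ (inj₂ (inj₂ (inj₁ (p , _)))))) = ⊥-elim (E-irr G C.cd p)
  ce-xy (inj₂ (inj₂ (inj₂ (inj₂ (inj₂ (p , _)))))) = ⊥-elim (a≢b (sym p))

  flip : ∀ {u v} → CE a x b y u v → CE a x b y v u
  flip {u} {v} p = cyc-t a x b y v u (trans (wk-sym a (x ∷ b ∷ y ∷ a ∷ []) v u) (cyc-i C p))

  ce-ab : ∀ {u v} → CE a x b y u v → ((u ≡ a) ⊎ (u ≡ b)) ⊎ ((v ≡ a) ⊎ (v ≡ b))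
  ce-ab (inj₁ (inj₁ (p , _))) = inj₁ (inj₁ p)
  ce-ab (inj₁ (inj₂ (_ , p))) = inj₂ (inj₁ p)
  ce-ab (inj₂ (inj₁ (inj₁ (_ , p)))) = inj₂ (inj₂ p)
  ce-ab (inj₂ (inj₁ (inj₂ (p , _)))) = inj₁ (inj₂ p)
  ce-ab (inj₂ (inj₂ (inj₁ (inj₁ (p , _))))) = inj₁ (inj₂ p)
  ce-ab (inj₂ (inj₂ (inj₁ (inj₂ (_ , p))))) = inj₂ (inj₂ p)
  ce-ab (inj₂ (inj₂ (inj₂ (inj₁ (_ , p))))) = inj₂ (inj₁ p)
  ce-ab (inj₂ (inj₂ (inj₂ (inj₂ (p , _))))) = inj₁ (inj₁ p)

  side2-real : ∀ u v → E M u v → side2 u v ≢ ℓ × (∃ λ p → ∃ λ q → E G p q × side2 u v ≡ side p q)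
  side2-real u v e with u ≟ a | v ≟ a
  ... | yes refl | _ rewrite side2-a v = la e
    where
    la : ∀ {v} → E M a v → lp v ≢ ℓ × (∃ λ p → ∃ λ q → E G p q × lp v ≡ side p q)
    la {v} e with M-cases e
    ... | _ , _ , inj₁ q rewrite lp1 {v} q = oth-≢ (ea v q) (ca v q) , (case oth-side a v of λ { (inj₁ z) → a , v , ea v q , z ; (inj₂ z) → v , a , E-sym G (ea v q) , z })
    ... | _ , _ , inj₂ (inj₁ (q , f , _)) rewrite lp2 {v} q f = not-ℓ f (λ z → tf (ce-xy (inj₁ z)) q) , a , v , f , refl
    ... | _ , _ , inj₂ (inj₂ (q , h , f)) rewrite lp3 {v} q h = not-ℓ f (λ z → tf (ce-xy (inj₂ z)) q) , b , v , f , refl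
  ... | no p | yes refl rewrite side2-a' p = ra (E-sym M e)
    where
    ra : ∀ {v} → E M a v → rp v ≢ ℓ × (∃ λ p → ∃ λ q → E G p q × rp v ≡ side p q)
    ra {v} e with M-cases e
    ... | _ , _ , inj₁ q rewrite rp1 {v} q = oth-≢ (eb v q) (cb v q) , (case oth-side b v of λ { (inj₁ z) → b , v , eb v q , z ; (inj₂ z) → v , b , E-sym G (eb v q) , z })
    ... | _ , _ , inj₂ (inj₁ (q , f , _)) rewrite rp2 {v} q f = not-ℓ (E-sym G f) (λ z → tf (ce-xy (inj₁ (flip z))) q) , v , a , E-sym G f , refl
    ... | _ , _ , inj₂ (inj₂ (q , h , f)) rewrite rp3 {v} q h = not-ℓ (E-sym G f) (λ z → tf (ce-xy (inj₂ (flip z))) q) , v , b , E-sym G f , refl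
  ... | no p | no q rewrite side2-o {u} {v} p q with merge-t G a b nab e
  ... | ub , vb , m-old f = not-ℓ f (λ z → case ce-ab z of λ { (inj₁ (inj₁ w)) → p w ; (inj₁ (inj₂ w)) → ub w ; (inj₂ (inj₁ w)) → q w ; (inj₂ (inj₂ w)) → vb w }) , u , v , f , refl
  ... | ub , vb , m-left z _ = ⊥-elim (p z)
  ... | ub , vb , m-right z _ = ⊥-elim (q z)

  flat2 : ∀ s val {u v} → E M u v → s (side2 u v) ≡ s (side2 v u) → ∂2 (Re.s~ s val) u v ≡ false
  flat2 s val {u} {v} e h = trans (cong₂ _xor_ (Re.s~o s val (proj₁ (side2-real u v e))) (Re.s~o s val (proj₁ (side2-real v u (E-sym M e))))) (trans (cong (_xor s (side2 v u)) h) (Boolₚ.xor-same (s (side2 v u))))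

  ∧-flat : ∀ {c d} → (c ≡ true → d ≡ false) → c ∧ d ≡ false
  ∧-flat {true} h = h refl
  ∧-flat {false} h = refl

  re-∂ : ∀ s z → xy z ≡ true → D (Re.s~ s (s (oth a z))) a z ≡ false
  re-∂ s z q = trans (D-E (Re.s~ s (s (oth a z))) (ea z q)) (trans (oth-∂ (Re.s~ s (s (oth a z))) (ea z q) (ca z q)) (trans (cong₂ _xor_ (Re.s~ℓ s _) (Re.s~o s _ (oth-≢ (ea z q) (ca z q)))) (Boolₚ.xor-same (s (oth a z)))))

  x-xy : xy x ≡ true
  x-xy = xy-i (inj₁ refl)

  -- The value on `ℓ` is chosen for `ax`. Other edges `av` with `v ≢ y` are flat because `v` is not
  -- a neighbour of `b`, then evenness at `a` settles `ay`. The edges at `b` follow, since the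
  -- contributions at `a` and `b` sum to zero.
  flat-ab : ∀ s → (∀ v → E M a v → s (side2 a v) ≡ s (side2 v a)) → (∀ v → D (Re.s~ s (s (oth a x))) a v ≡ false) × (∀ v → D (Re.s~ s (s (oth a x))) b v ≡ false)
  flat-ab s h = Da , λ v → trans (sym (xor-f _ _ (sum v))) (Da v)
    where
    open Re s (s (oth a x))
    sum : ∀ v → D s~ a v xor D s~ b v ≡ false
    sum v = trans (sym (row-a s~ v)) (∧-flat λ e → flat2 s _ e (h v e))
    Do : ∀ v → v ≢ y → D s~ a v ≡ false
    Do v ne with v ≟ x
    ... | yes refl = re-∂ s x x-xy
    ... | no nx with E? G a v
    ... | no g = D-no s~ g
    ... | yes g = trans (xor-f _ _ (sum v)) (D-no s~ λ f → case cn v g f of λ { (inj₁ z) → nx z ; (inj₂ z) → ne z })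
    Da : ∀ v → D s~ a v ≡ false
    Da v with v ≟ y
    ... | no ne = Do v ne
    ... | yes refl = trans (sym (⊕-1 (D s~ a) y Do)) (even s~ a)

  conn2 : ∀ (s : Fin m → Bool) → (∀ u v → E M u v → s (side2 u v) ≡ s (side2 v u)) → ∀ u v u' v' → E M u v → E M u' v' → s (side2 u v) ≡ s (side2 u' v')
  conn2 s h u v u' v' e e' with side2-real u v e | side2-real u' v' e'
  ... | nl , p , q , f , r | nl' , p' , q' , f' , r' = trans (sym (s~o nl)) (trans (cong s~ r) (trans (conn s~ flat p q p' q' f f') (trans (cong s~ (sym r')) (s~o nl'))))
    where
    open Re s (s (oth a x))
    fab = flat-ab s (h a)
    Dall : ∀ u v → D s~ u v ≡ false
    Dall u v with u ≟ a | u ≟ b | v ≟ a | v ≟ b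
    ... | yes refl | _ | _ | _ = proj₁ fab v
    ... | no _ | yes refl | _ | _ = proj₂ fab v
    ... | no _ | no _ | yes refl | _ = trans (D-sym s~ u a) (proj₁ fab u)
    ... | no _ | no _ | no _ | yes refl = trans (D-sym s~ u b) (proj₂ fab u)
    ... | no a1 | no a2 | no a3 | no a4 = trans (sym (row-o s~ a1 a2 a3 a4)) (∧-flat λ e → flat2 s _ e (h u v e))
    flat : ∀ u v → E G u v → s~ (side u v) ≡ s~ (side v u)
    flat u v e = xor-f _ _ (trans (sym (D-E s~ e)) (Dall u v))

  local2 : ∀ (s : Fin m → Bool) u → (∀ v → E M u v → s (side2 u v) ≡ s (side2 v u)) → ∀ v w → E M u v → E M u w → s (side2 u v) ≡ s (side2 u w)
  local2 s u h v w e f with u ≟ a | bcase (xy u)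
  ... | yes refl | _ = trans (one v e) (sym (one w f))
    where
    open Re s (s (oth a x))
    fab = flat-ab s h
    fl : ∀ {p} → (∀ v → D s~ p v ≡ false) → ∀ v → E G p v → s~ (side p v) ≡ s~ (side v p)
    fl k v e = xor-f _ _ (trans (sym (D-E s~ e)) (k v))
    at : ∀ {p} → (∀ v → D s~ p v ≡ false) → E G p x → cyc a x b y p x ≡ true → ∀ v → E G p v → s~ (side p v) ≡ s (oth a x)
    at {p} k ex cx v e = trans (local s~ p (fl k) v x e ex) (trans onl s~ℓ)
      where onl : s~ (side p x) ≡ s~ ℓ
            onl with one-ℓ ex cx
            ... | inj₁ (z , _) = cong s~ z
            ... | inj₂ (_ , z) = trans (fl k x ex) (cong s~ z)
    one : ∀ v → E M a v → s (side2 a v) ≡ s (oth a x)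
    one v e = trans (sym (s~o (proj₁ (side2-real a v e)))) (trans (cong s~ (side2-a v)) (go (proj₂ (proj₂ (M-cases e)))))
      where
      go : _ → s~ (lp v) ≡ s (oth a x)
      go (inj₁ q) = trans (cong s~ (lp1 q)) (trans (case oth-side a v of λ { (inj₁ z) → cong s~ z ; (inj₂ z) → trans (cong s~ z) (sym (fl (proj₁ fab) v (ea v q))) }) (at (proj₁ fab) C.ab (ca x x-xy) v (ea v q)))
      go (inj₂ (inj₁ (q , g , _))) = trans (cong s~ (lp2 q g)) (at (proj₁ fab) C.ab (ca x x-xy) v g)
      go (inj₂ (inj₂ (q , k , g))) = trans (cong s~ (lp3 q k)) (at (proj₂ fab) (E-sym G C.bc) (cb x x-xy) v g)
  -- At a corner `u` the value on `ℓ` is chosen for the edge `au` instead.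
  ... | no ua | inj₁ xu = trans (one v e) (sym (one w f))
    where
    open Re s (s (oth a u))
    ub : u ≢ b
    ub = proj₁ (merge-t G a b nab e)
    sum : D s~ u a xor D s~ u b ≡ false
    sum = trans (sym (row-a' s~ u)) (∧-flat λ e → flat2 s _ e (h a e))
    Du : ∀ v → D s~ u v ≡ false
    Du v with v ≟ a | v ≟ b
    ... | yes refl | _ = trans (D-sym s~ u a) (re-∂ s u xu)
    ... | no _ | yes refl = trans (sym (xor-f _ _ sum)) (trans (D-sym s~ u a) (re-∂ s u xu))
    ... | no p | no q = trans (sym (row-o s~ ua ub p q)) (∧-flat λ e → flat2 s _ e (h v e))
    fl : ∀ v → E G u v → s~ (side u v) ≡ s~ (side v u)
    fl v e = xor-f _ _ (trans (sym (D-E s~ e)) (Du v))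
    one : ∀ v → E M u v → s (side2 u v) ≡ s~ (side u b)
    one v e = trans (sym (s~o (proj₁ (side2-real u v e)))) (go (v ≟ a))
      where
      go : Dec (v ≡ a) → s~ (side2 u v) ≡ s~ (side u b)
      go (yes refl) = trans (cong s~ (trans (side2-a' ua) (rp1 xu))) (case oth-side b u of λ { (inj₁ z) → trans (cong s~ z) (sym (fl b (E-sym G (eb u xu)))) ; (inj₂ z) → cong s~ z })
      go (no p) with merge-t G a b nab e
      ... | _ , _ , m-old g = trans (cong s~ (side2-o ua p)) (local s~ u fl v b g (E-sym G (eb u xu)))
      ... | _ , _ , m-left z _ = ⊥-elim (ua z)
      ... | _ , _ , m-right z _ = ⊥-elim (p z)
  ... | no ua | inj₂ xu = go (real v e) (real w f)
    where
    ub : u ≢ b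
    ub = proj₁ (merge-t G a b nab e)
    sum : D s u a xor D s u b ≡ false
    sum = trans (sym (row-a' s u)) (∧-flat λ e → trans (cong (_xor s (side2 a u)) (h a e)) (Boolₚ.xor-same (s (side2 a u))))
    Du : ∀ v → D s u v ≡ false
    Du v with v ≟ a | v ≟ b | E? G u a | E? G u b
    ... | yes refl | _ | no g | _ = D-no s g
    ... | yes refl | _ | yes g | no g' = trans (xor-f _ _ sum) (D-no s g')
    ... | yes refl | _ | yes g | yes g' = tf (xy-i (cn u (E-sym G g) (E-sym G g'))) xu
    ... | no _ | yes refl | _ | no g = D-no s g
    ... | no _ | yes refl | no g' | yes g = trans (sym (xor-f _ _ sum)) (D-no s g')
    ... | no _ | yes refl | yes g | yes g' = tf (xy-i (cn u (E-sym G g) (E-sym G g'))) xu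
    ... | no p | no q | _ | _ = trans (sym (row-o s ua ub p q)) (∧-flat λ e → trans (cong (_xor s (side2 v u)) (h v e)) (Boolₚ.xor-same (s (side2 v u))))
    fl : ∀ v → E G u v → s (side u v) ≡ s (side v u)
    fl v e = xor-f _ _ (trans (sym (D-E s e)) (Du v))
    real : ∀ v → E M u v → ∃ λ p → E G u p × side2 u v ≡ side u p
    real v e with v ≟ a
    ... | no p with merge-t G a b nab e
    ... | _ , _ , m-old g = v , g , side2-o ua p
    ... | _ , _ , m-left z _ = ⊥-elim (ua z)
    ... | _ , _ , m-right z _ = ⊥-elim (p z)
    real v e | yes refl with M-cases (E-sym M e)
    ... | _ , _ , inj₁ q = tf q xu
    ... | _ , _ , inj₂ (inj₁ (q , g , _)) = a , E-sym G g , trans (side2-a' ua) (rp2 q g)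
    ... | _ , _ , inj₂ (inj₂ (q , k , g)) = b , E-sym G g , trans (side2-a' ua) (rp3 q k)
    go : (∃ λ p → E G u p × side2 u v ≡ side u p) → (∃ λ p → E G u p × side2 u w ≡ side u p) → s (side2 u v) ≡ s (side2 u w)
    go (p , g , r) (q , g' , r') = trans (cong s r) (trans (local s u fl p q g g') (cong s (sym r')))

  merged : Planarity M
  merged = record { m = m ; side = side2 ; even = even2 ; jordan = Lift.solution ; conn = conn2 ; local = local2 }

-- All edges on `ℓ` belong to the cycle and survive, so no deletion merges `ℓ` with another face.
Facial-sub : ∀ {n} {G : Graph n} (P : Planarity G) H (H⊑ : H ⊑ G) {a b c d} → Facial P a b c d → C4 H a b c d → Facial (sub P H H⊑) a b c d
Facial-sub {G = G} P H H⊑ {a} {b} {c} {d} (facial ℓ bd onC) C = facial ℓ (λ u v e → trans (cong₂ _xor_ (cℓ (side u v)) (cℓ (side v u))) (bd u v (H⊑ u v e)))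
    (λ u v e q → onC u v (H⊑ u v e) (==→≡ {i = side u v} {ℓ} (trans (sym (cℓ (side u v))) (trans (cong (_== ℓ) q) (==-refl ℓ)))))
  where
  open Planarity P
  module S = Subgraph P H H⊑
  cℓ : ∀ x → (S.c x == ℓ) ≡ (x == ℓ)
  cℓ = S.c-fun (_== ℓ) λ u v e ne → trans (offℓ u v e ne) (sym (offℓ v u (E-sym G e) (ne ∘ E-sym H)))
    where offℓ : ∀ u v → E G u v → ¬ E H u v → (side u v == ℓ) ≡ false
          offℓ u v e ne = not-t→f λ q → ne (CE-E {G = H} C (onC u v e (==→≡ {i = side u v} {ℓ} q)))

-- `MergeFace` asks for `x` and `y` to be the only common neighbours. For every other common
-- neighbour `v` the edge `bv` is deleted first, which the quotient does not notice because `av`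
-- remains.
merge-planar : ∀ {n} {G : Graph n} (P : Planarity G) {a x b y} → C4 G a x b y → Facial P a x b y → (nab : ¬ E G a b) → Planarity (merge G a b nab)
merge-planar {n} {G} P {a} {x} {b} {y} C F nab = sub (MergeFace.merged PH CH FH nabH cnH) (merge G a b nab) le
  where
  module C = C4 C
  common : Fin n → Bool
  common v = (adj G a v ∧ adj G b v) ∧ (not (v == x) ∧ not (v == y))
  H : Graph n
  adj H u v = adj G u v ∧ not (((u == b) ∧ common v) ∨ ((v == b) ∧ common u))
  adj-sym H u v = cong₂ _∧_ (adj-sym G u v) (cong not (Boolₚ.∨-comm ((u == b) ∧ common v) _))
  adj-irr H u rewrite adj-irr G u = refl
  H⊑ : H ⊑ G
  H⊑ u v e = proj₁ (∧-t {adj G u v} e)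
  H-i : ∀ {u v} → E G u v → ¬ (u ≡ b × common v ≡ true) → ¬ (v ≡ b × common u ≡ true) → E H u v
  H-i {u} {v} e h h' = ∧-i e (cong not (not-t→f λ q → case ∨-t {(u == b) ∧ common v} q of λ
    { (inj₁ r) → h (==→≡ {i = u} {b} (proj₁ (∧-t {u == b} r)) , proj₂ (∧-t {u == b} r)) ; (inj₂ r) → h' (==→≡ {i = v} {b} (proj₁ (∧-t {v == b} r)) , proj₂ (∧-t {v == b} r)) }))
  xno : common x ≡ true → ⊥
  xno q rewrite ==-refl x = case proj₂ (∧-t {adj G a x ∧ adj G b x} q) of λ ()
  yno : common y ≡ true → ⊥
  yno q rewrite ==-refl y = case trans (sym (proj₂ (∧-t {adj G a y ∧ adj G b y} q))) (Boolₚ.∧-zeroʳ _) of λ ()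
  ano : common a ≡ true → ⊥
  ano q = E-irr G (proj₁ (∧-t {adj G a a} (proj₁ (∧-t {adj G a a ∧ adj G b a} q)))) refl
  bno : common b ≡ true → ⊥
  bno q = nab (proj₁ (∧-t {adj G a b} (proj₁ (∧-t {adj G a b ∧ adj G b b} q))))
  CH : C4 H a x b y
  CH = c4 (H-i C.ab (λ (_ , q) → xno q) (λ (_ , q) → ano q)) (H-i C.bc (λ (_ , q) → bno q) (λ (_ , q) → xno q)) (H-i C.cd (λ (_ , q) → yno q) (λ (_ , q) → bno q)) (H-i C.da (λ (_ , q) → ano q) (λ (_ , q) → yno q)) C.a≢c C.b≢d
  PH = sub P H H⊑
  FH = Facial-sub P H H⊑ F CH
  nabH : ¬ E H a b
  nabH e = nab (H⊑ a b e)
  cnH : ∀ v → E H a v → E H b v → (v ≡ x) ⊎ (v ≡ y)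
  cnH v e f with v ≟ x | v ≟ y
  ... | yes p | _ = inj₁ p
  ... | no _ | yes p = inj₂ p
  ... | no p | no q = ⊥-elim (k (proj₂ (∧-t {adj G b v} f)))
    where cv : common v ≡ true
          cv = ∧-i (∧-i (H⊑ a v e) (H⊑ b v f)) (∧-i (cong not (≢→== p)) (cong not (≢→== q)))
          k : not (((b == b) ∧ common v) ∨ ((v == b) ∧ common b)) ≡ true → ⊥
          k z = case trans (sym z) (cong not (∨-il (∧-i (==-refl b) cv))) of λ ()
  -- an edge bv is only deleted if av is present
  le : merge G a b nab ⊑ merge H a b nabH
  le u v e with merge-t G a b nab e
  ... | p , q , m-old f = merge-old H a b nabH p q (H-i f (λ (z , _) → p z) (λ (z , _) → q z))
  ... | p , q , m-left refl f = via q f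
    where via : ∀ {v} → v ≢ b → E G b v → E (merge H a b nabH) a v
          via {v} q f with bcase (common v)
          ... | inj₁ r = merge-old H a b nabH C.a≢c q (H-i (proj₁ (∧-t {adj G a v} (proj₁ (∧-t {adj G a v ∧ adj G b v} r)))) (λ (z , _) → C.a≢c z) (λ (z , _) → q z))
          ... | inj₂ r = merge-new H a b nabH C.a≢c (H-i f (λ (_ , z) → tf z r) (λ (z , _) → q z))
  ... | p , q , m-right refl f = E-sym (merge H a b nabH) {a} {u} (via p f)
    where via : ∀ {v} → v ≢ b → E G b v → E (merge H a b nabH) a v
          via {v} q f with bcase (common v)
          ... | inj₁ r = merge-old H a b nabH C.a≢c q (H-i (proj₁ (∧-t {adj G a v} (proj₁ (∧-t {adj G a v ∧ adj G b v} r)))) (λ (z , _) → C.a≢c z) (λ (z , _) → q z))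
          ... | inj₂ r = merge-new H a b nabH C.a≢c (H-i f (λ (_ , z) → tf z r) (λ (z , _) → q z))

len-1 : ∀ e a w → 2 + e + (2 * a + 2 * w + 2 * 1) + 0 ≡ 2 * a + (4 + e + 2 * w)
len-1 = solve-∀

len-2 : ∀ e a w → 8 + e + (2 * (2 * a + 2 * w) + e) + 0 ≡ 4 * a + (2 * (4 + e) + 4 * w)
len-2 = solve-∀

len-3 : ∀ e a → 8 + e + (2 * a + 2 * a) + 0 ≡ 4 * a + (2 + e + 2 * 3)
len-3 = solve-∀

len-4 : ∀ e a w → 20 + 3 * e + (5 * (2 * a + 2 * w) + 2 * e) + 0 ≡ 10 * a + (5 * (4 + e) + 2 * (5 * w))
len-4 = solve-∀

-- Face lengths

ap₁ : ∀ {n} {a b c d : Fin n} → c ≢ a → c ≢ b → Apart (a , b) (c , d)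
ap₁ h h' = (λ p → h (proj₁ p)) , (λ p → h' (proj₁ p))

ap₂ : ∀ {n} {a b c d : Fin n} → d ≢ a → d ≢ b → Apart (a , b) (c , d)
ap₂ h h' = (λ p → h' (proj₂ p)) , (λ p → h (proj₂ p))

module Face {n} {G : Graph n} (P : Planarity G) (f : Fin (Planarity.m P)) where
  open Planarity P

  h : Fin n → Fin n → ℕ
  h u v = 𝟙 (adj G u v ∧ (side u v == f))

  len : ℕ
  len = ∑₂ h

  -- The boundary modulo 2. Edges with `f` on both sides are left out here, whereas `len` counts
  -- them twice.
  Z : Fin n → Fin n → Set
  Z u v = E G u v × ∂ (_== f) u v ≡ true

  Z-sym : ∀ {u v} → Z u v → Z v u
  Z-sym {u} {v} (e , p) = E-sym G e , trans (∂-sym P (_== f) v u) p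

  next : ∀ {a b} → Z a b → ∃ λ c → c ≢ a × Z b c
  next {a} {b} z with ⊕-other (λ v → adj G b v ∧ ∂ (_== f) b v) a (even (_== f) b) (∧-i (proj₁ (Z-sym z)) (proj₂ (Z-sym z)))
  ... | c , ne , e = c , ne , ∧-t {adj G b c} e

  on : ∀ {u v} → E G u v → side u v ≡ f → 1 ≤ h u v + h v u
  on {u} {v} e p = ℕₚ.≤-trans (ℕₚ.≤-reflexive (sym (cong 𝟙 (∧-i e (trans (cong (_== f) p) (==-refl f)))))) (ℕₚ.m≤m+n _ (h v u))

  Z-on : ∀ {u v} → Z u v → 1 ≤ h u v + h v u
  Z-on {u} {v} (e , p) with bcase (side u v == f)
  ... | inj₁ q = on e (==→≡ {i = side u v} {f} q)
  ... | inj₂ q = ℕₚ.≤-trans (on (E-sym G e) (==→≡ {i = side v u} {f} (trans (cong (_xor (side v u == f)) (sym q)) p))) (ℕₚ.≤-reflexive (ℕₚ.+-comm (h v u) (h u v)))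

  On-f : Pair n → Set
  On-f (u , v) = u ≢ v × 1 ≤ h u v + h v u

  zf : ∀ {u v} → Z u v → On-f (u , v)
  zf z = E-irr G (proj₁ z) , Z-on z

  count-edges : ∀ {es} → All On-f es → AllPairs Apart es → length es ≤ len
  count-edges {es} a p = ℕₚ.≤-trans (sum a) (∑-pickE h (Allₚ.map proj₁ a) p)
    where sum : ∀ {xs} → All On-f xs → length xs ≤ ∑E h xs
          sum [] = z≤n
          sum (q ∷ qs) = ℕₚ.+-mono-≤ (proj₂ q) (sum qs)

  -- Without a boundary edge the indicator of `f` is flat everywhere, so connectedness of the dual
  -- makes `f` the only face.
  one-sided : ∀ {u v} → E G u v → side u v ≡ f → (∀ x y → E G x y → side x y ≡ f) ⊎ (∃ λ a → ∃ λ b → Z a b)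
  one-sided {u} {v} e p with Finₚ.any? (λ a → Finₚ.any? λ b → E? G a b ×-dec (∂ (_== f) a b ≟b true))
  ... | yes (a , b , z) = inj₂ (a , b , z)
  ... | no none = inj₁ λ x y e' → ==→≡ {i = side x y} {f} (trans (sym (conn (_== f) (λ a b g → xor-f _ _ (not-t→f λ q → none (a , b , g , q))) u v x y e e')) (trans (cong (_== f) p) (==-refl f)))

  module _ (tf₃ : TriFree G) where
    -- Four boundary edges `xa`, `ab`, `bc`, `cd`, obtained by continuing `ab` at both ends; `x` and
    -- `d` may coincide.
    record Start : Set where
      field {a b c d x} : Fin n
            zab : Z a b
            zbc : Z b c
            zcd : Z c d
            zax : Z a x
            ca : c ≢ a
            db : d ≢ b
            da : d ≢ a
            xb : x ≢ b

    start : ∀ {a b} → Z a b → Start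
    start {a} {b} z with next z
    ... | c , ca , zbc with next zbc
    ... | d , db , zcd with next (Z-sym z)
    ... | x , xb , zax = record { zab = z ; zbc = zbc ; zcd = zcd ; zax = zax ; ca = ca ; db = db ; da = (λ { refl → tf₃ a b c (proj₁ z , proj₁ zbc , E-sym G (proj₁ zcd)) }) ; xb = xb }

    len≥4 : ∀ {a b} → Z a b → 4 ≤ len
    len≥4 z = count-edges (zf zab ∷ zf zbc ∷ zf zcd ∷ zf zax ∷ [])
       ((ap₂ ca (E-irr G (proj₁ zbc) ∘ sym) ∷ ap₂ da db ∷ ap₂ (E-irr G (proj₁ zax) ∘ sym) xb ∷ []) ∷ (ap₂ db (E-irr G (proj₁ zcd) ∘ sym) ∷ ap₁ (E-irr G (proj₁ zab)) (ca ∘ sym) ∷ [])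
         ∷ (ap₁ (ca ∘ sym) (da ∘ sym) ∷ []) ∷ [] ∷ [])
      where open Start (start z)

    -- The boundary continues from `d` to some `e`; unless `e` is `a` there are five edges. Any
    -- further edge on the face would be a fifth one too, so the face touches no edge off the cycle.
    face-4 : ∀ {a b} → Z a b → len ≤ 4 → ∃ λ a → ∃ λ b → ∃ λ c → ∃ λ d → C4 G a b c d × Σ (Facial P a b c d) λ F → Facial.ℓ F ≡ f
    face-4 z l with start z
    ... | record { a = a ; b = b ; c = c ; d = d ; x = x ; zab = zab ; zbc = zbc ; zcd = zcd ; zax = zax ; ca = ca ; db = db ; da = da ; xb = xb } with next zcd
    ... | e , ec , zde with e ≟ a
    ... | no ea = ⊥-elim (ℕₚ.<-irrefl refl (ℕₚ.≤-trans (count-edges (zf zab ∷ zf zbc ∷ zf zcd ∷ zf zde ∷ zf zax ∷ [])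
       ((ap₂ ca (E-irr G (proj₁ zbc) ∘ sym) ∷ ap₂ da db ∷ ap₁ da db ∷ ap₂ (E-irr G (proj₁ zax) ∘ sym) xb ∷ [])
        ∷ (ap₂ db (E-irr G (proj₁ zcd) ∘ sym) ∷ ap₁ db (E-irr G (proj₁ zcd) ∘ sym) ∷ ap₁ (E-irr G (proj₁ zab)) (ca ∘ sym) ∷ [])
        ∷ (ap₂ ec (E-irr G (proj₁ zde) ∘ sym) ∷ ap₁ (ca ∘ sym) (da ∘ sym) ∷ []) ∷ (ap₁ (da ∘ sym) (ea ∘ sym) ∷ []) ∷ [] ∷ [])) l))
    ... | yes refl = a , b , c , d , C , facial f bd onC , refl
      where
      C : C4 G a b c d
      C = c4 (proj₁ zab) (proj₁ zbc) (proj₁ zcd) (proj₁ zde) (ca ∘ sym) (db ∘ sym)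
      five : ∀ {u v} → ¬ CE a b c d u v → On-f (u , v) → ⊥
      five {u} {v} n o = ℕₚ.<-irrefl refl (ℕₚ.≤-trans (count-edges (zf zab ∷ zf zbc ∷ zf zcd ∷ zf zde ∷ o ∷ [])
       ((ap₂ ca (E-irr G (proj₁ zbc) ∘ sym) ∷ ap₂ da db ∷ ap₁ da db ∷ ((λ p → n (inj₁ (inj₁ p))) , (λ p → n (inj₁ (inj₂ p)))) ∷ [])
        ∷ (ap₂ db (E-irr G (proj₁ zcd) ∘ sym) ∷ ap₂ (E-irr G (proj₁ zab)) (ca ∘ sym) ∷ ((λ p → n (inj₂ (inj₁ (inj₁ p)))) , (λ p → n (inj₂ (inj₁ (inj₂ p))))) ∷ [])
        ∷ (ap₂ (ca ∘ sym) (da ∘ sym) ∷ ((λ p → n (inj₂ (inj₂ (inj₁ (inj₁ p))))) , (λ p → n (inj₂ (inj₂ (inj₁ (inj₂ p)))))) ∷ [])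
        ∷ (((λ p → n (inj₂ (inj₂ (inj₂ (inj₁ p))))) , (λ p → n (inj₂ (inj₂ (inj₂ (inj₂ p)))))) ∷ []) ∷ [] ∷ [])) l)
      Zi : ∀ {u v} → CE a b c d u v → Z u v
      Zi (inj₁ (inj₁ (refl , refl))) = zab
      Zi (inj₁ (inj₂ (refl , refl))) = Z-sym zab
      Zi (inj₂ (inj₁ (inj₁ (refl , refl)))) = zbc
      Zi (inj₂ (inj₁ (inj₂ (refl , refl)))) = Z-sym zbc
      Zi (inj₂ (inj₂ (inj₁ (inj₁ (refl , refl))))) = zcd
      Zi (inj₂ (inj₂ (inj₁ (inj₂ (refl , refl))))) = Z-sym zcd
      Zi (inj₂ (inj₂ (inj₂ (inj₁ (refl , refl))))) = zde
      Zi (inj₂ (inj₂ (inj₂ (inj₂ (refl , refl))))) = Z-sym zde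
      onC : ∀ u v → E G u v → side u v ≡ f → CE a b c d u v
      onC u v e q with bcase (cyc a b c d u v)
      ... | inj₁ t = cyc-t a b c d u v t
      ... | inj₂ t = ⊥-elim (five {u} {v} (λ p → tf (cyc-i C p) t) (E-irr G e , on e q))
      bd : ∀ u v → E G u v → ∂ (_== f) u v ≡ cyc a b c d u v
      bd u v e = b-ext (λ q → case bcase (cyc a b c d u v) of λ { (inj₁ t) → t ; (inj₂ t) → ⊥-elim (five {u} {v} (λ p → tf (cyc-i C p) t) (zf (e , q))) })
                       (λ q → proj₂ (Zi (cyc-t a b c d u v q)))

    NoC4 : Set
    NoC4 = ∀ {a b c d} → ¬ C4 G a b c d

    record Pentagon : Set where
      field x₁ x₂ x₃ x₄ x₅ : Fin n
            z₁₂ : Z x₁ x₂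
            z₂₃ : Z x₂ x₃
            z₃₄ : Z x₃ x₄
            z₄₅ : Z x₄ x₅
            z₅₁ : Z x₅ x₁
            ne₁₃ : x₁ ≢ x₃
            ne₁₄ : x₁ ≢ x₄
            ne₂₄ : x₂ ≢ x₄
            ne₂₅ : x₂ ≢ x₅
            ne₃₅ : x₃ ≢ x₅

    -- Closing earlier would give a triangle or a 4-cycle, closing later a sixth edge.
    face-5 : NoC4 → ∀ {a b} → Z a b → len ≤ 5 → Pentagon
    face-5 noC z l with start z
    ... | record { a = a ; b = b ; c = c ; d = d ; x = x ; zab = zab ; zbc = zbc ; zcd = zcd ; zax = zax ; ca = ca ; db = db ; da = da ; xb = xb } with next zcd
    ... | e , ec , zde with e ≟ a | e ≟ b
    ... | yes refl | _ = ⊥-elim (noC (c4 (proj₁ zab) (proj₁ zbc) (proj₁ zcd) (proj₁ zde) (ca ∘ sym) (db ∘ sym)))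
    ... | no _ | yes refl = ⊥-elim (tf₃ b c d (proj₁ zbc , proj₁ zcd , E-sym G (proj₁ zde)))
    ... | no ea | no eb with next zde
    ... | g , gd , zeg with g ≟ a
    ... | yes refl = record { x₁ = a ; x₂ = b ; x₃ = c ; x₄ = d ; x₅ = e ; z₁₂ = zab ; z₂₃ = zbc ; z₃₄ = zcd ; z₄₅ = zde ; z₅₁ = zeg ; ne₁₃ = ca ∘ sym ; ne₁₄ = da ∘ sym ; ne₂₄ = db ∘ sym ; ne₂₅ = eb ∘ sym ; ne₃₅ = ec ∘ sym }
    ... | no ga = ⊥-elim (ℕₚ.<-irrefl refl (ℕₚ.≤-trans (count-edges (zf zab ∷ zf zbc ∷ zf zcd ∷ zf zde ∷ zf zeg ∷ zf zax ∷ [])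
       ((ap₂ ca (E-irr G (proj₁ zbc) ∘ sym) ∷ ap₂ da db ∷ ap₁ da db ∷ ap₁ ea eb ∷ ap₂ (E-irr G (proj₁ zax) ∘ sym) xb ∷ [])
        ∷ (ap₂ db (E-irr G (proj₁ zcd) ∘ sym) ∷ ap₁ db (E-irr G (proj₁ zcd) ∘ sym) ∷ ap₁ eb ec ∷ ap₁ (E-irr G (proj₁ zab)) (ca ∘ sym) ∷ [])
        ∷ (ap₂ ec (E-irr G (proj₁ zde) ∘ sym) ∷ ap₁ ec (E-irr G (proj₁ zde) ∘ sym) ∷ ap₁ (ca ∘ sym) (da ∘ sym) ∷ [])
        ∷ (ap₂ gd (E-irr G (proj₁ zeg) ∘ sym) ∷ ap₁ (da ∘ sym) (ea ∘ sym) ∷ [])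
        ∷ (ap₁ (ea ∘ sym) (ga ∘ sym) ∷ []) ∷ [] ∷ [])) l))

module _ {n} {G : Graph n} (P : Planarity G) where
  open Planarity P

  sum-sides : ∀ (w : Fin n → Fin n → ℕ) → ∑ (λ f → ∑₂ λ u v → 𝟙 (adj G u v ∧ (side u v == f)) * w u v) ≡ ∑₂ λ u v → 𝟙 (adj G u v) * w u v
  sum-sides w = trans (∑-swap (λ f u → ∑ λ v → 𝟙 (adj G u v ∧ (side u v == f)) * w u v)) (∑-cong λ u → trans (∑-swap (λ f v → 𝟙 (adj G u v ∧ (side u v == f)) * w u v)) (∑-cong λ v → k u v))
    where
    k : ∀ u v → ∑ (λ f → 𝟙 (adj G u v ∧ (side u v == f)) * w u v) ≡ 𝟙 (adj G u v) * w u v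
    k u v = trans (∑-cong l) (∑-δ (𝟙 (adj G u v) * w u v) (side u v))
      where l : ∀ f → 𝟙 (adj G u v ∧ (side u v == f)) * w u v ≡ (if f == side u v then 𝟙 (adj G u v) * w u v else 0)
            l f rewrite ==-sym (side u v) f with adj G u v | f == side u v
            ... | true | true = refl
            ... | true | false = refl
            ... | false | true = refl
            ... | false | false = refl

  sum-len : ∑ (Face.len P) ≡ e2 G
  sum-len = trans (∑-cong {f = Face.len P} {λ f → ∑₂ λ u v → 𝟙 (adj G u v ∧ (side u v == f)) * 1}
        λ f → ∑₂-cong {f = Face.h P f} {λ u v → 𝟙 (adj G u v ∧ (side u v == f)) * 1} λ u v → sym (ℕₚ.*-identityʳ _))
      (trans (sum-sides (λ _ _ → 1)) (∑₂-cong {f = λ u v → 𝟙 (adj G u v) * 1} {λ u v → 𝟙 (adj G u v)} λ u v → ℕₚ.*-identityʳ _))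

  faces-≤ : ∀ k → (∀ f → used P f ≡ true → k ≤ Face.len P f) → k * ∣ used P ∣ ≤ e2 G
  faces-≤ k h = ℕₚ.≤-trans (ℕₚ.≤-reflexive (sym (∑-* k (𝟙 ∘ used P)))) (ℕₚ.≤-trans (∑-mono l) (ℕₚ.≤-reflexive sum-len))
    where l : ∀ f → k * 𝟙 (used P f) ≤ Face.len P f
          l f with used P f in eq
          ... | true = ℕₚ.≤-trans (ℕₚ.≤-reflexive (ℕₚ.*-identityʳ k)) (h f eq)
          ... | false = ℕₚ.≤-trans (ℕₚ.≤-reflexive (ℕₚ.*-zeroʳ k)) z≤n

  Inside : Sub n → Set
  Inside A = ∀ u v → E G u v → A u ≡ true

  OneFace : Set
  OneFace = ∃ λ f → ∀ u v → E G u v → side u v ≡ f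

  euler-one : ∀ {A u v} → E G u v → Inside A → OneFace → 2 + e2 G ≤ 2 * ∣ A ∣
  euler-one {A} {u} {v} e ia (f , h) = farkas 0 (ℕₚ.+-mono-≤ (euler (e2 G) P A u v e ia ℕₚ.≤-refl) (ℕₚ.*-monoʳ-≤ 2 one)) (len-1 (e2 G) (∣ A ∣) (∣ used P ∣))
    where
    one : ∣ used P ∣ ≤ 1
    one = ℕₚ.≤-trans (card-mono {A = used P} {fromList (f ∷ [])} λ g ug → let (x , y , e , q) = used-t P {g} ug in fromList∈ {xs = f ∷ []} (here (trans (sym q) (h x y e)))) (card-fromList (f ∷ []))

  euler-k : ∀ {A u v} → E G u v → Inside A → 4 + e2 G ≤ 2 * ∣ A ∣ + 2 * ∣ used P ∣
  euler-k {A} {u} {v} e ia = euler (e2 G) P A u v e ia ℕₚ.≤-refl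

  -- Faces of length at least 4 turn Euler's inequality into e ≤ 2v - 4. A single face gives e ≤ v -
  -- 1, which suffices from three vertices on.
  upper : TriFree G → ∀ {A u v} → E G u v → Inside A → 3 ≤ ∣ A ∣ → 8 + e2 G ≤ 4 * ∣ A ∣
  upper t {A} {u} {v} e ia a3 with Finₚ.any? (λ f → (used P f ≟b true) ×-dec ¬? (4 ≤? Face.len P f))
  ... | no h = farkas 0 (ℕₚ.+-mono-≤ (ℕₚ.*-monoʳ-≤ 2 (euler-k e ia)) (faces-≤ 4 λ f uf → decidable-stable (4 ≤? Face.len P f) (λ q → h (f , uf , q)))) (len-2 (e2 G) (∣ A ∣) (∣ used P ∣))
  ... | yes (f , uf , q) with used-t P {f} uf
  ... | x , y , e' , s with Face.one-sided P f e' s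
  ... | inj₂ (a , b , z) = ⊥-elim (q (Face.len≥4 P f t z))
  ... | inj₁ m = farkas 0 (ℕₚ.+-mono-≤ (euler-one e ia (f , m)) (ℕₚ.*-monoʳ-≤ 2 a3)) (len-3 (e2 G) (∣ A ∣))

  face-trichotomy : TriFree G → (∀ f → used P f ≡ true → 5 ≤ Face.len P f) ⊎ (∃ λ a → ∃ λ b → ∃ λ c → ∃ λ d → C4 G a b c d × Facial P a b c d) ⊎ OneFace
  face-trichotomy t with Finₚ.any? (λ f → (used P f ≟b true) ×-dec ¬? (5 ≤? Face.len P f))
  ... | no h = inj₁ λ f uf → decidable-stable (5 ≤? Face.len P f) (λ q → h (f , uf , q))
  ... | yes (f , uf , q) with used-t P {f} uf
  ... | x , y , e' , s with Face.one-sided P f e' s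
  ... | inj₂ (a , b , z) = inj₂ (inj₁ (let (a , b , c , d , C , F , _) = Face.face-4 P f t z (ℕₚ.≤-pred (ℕₚ.≰⇒> q)) in a , b , c , d , C , F))
  ... | inj₁ m = inj₂ (inj₂ (f , m))

  -- Faces of length at least 5 give 3e ≤ 5v - 10: the doubled potential is at least 20.
  girth5 : ∀ {A u v} → E G u v → Inside A → (∀ f → used P f ≡ true → 5 ≤ Face.len P f) → 20 + 3 * e2 G ≤ 10 * ∣ A ∣
  girth5 {A} e ia h = farkas 0 (ℕₚ.+-mono-≤ (ℕₚ.*-monoʳ-≤ 5 (euler-k e ia)) (ℕₚ.*-monoʳ-≤ 2 (faces-≤ 5 h))) (len-4 (e2 G) (∣ A ∣) (∣ used P ∣))

-- Identifications and colourings

module Quotient {n} (G : Graph n) (a c : Fin n) (a≢c : a ≢ c) (nac : ¬ E G a c) where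
  private
    M : Graph n
    M = merge G a c nac

  quo : Fin n → Fin n
  quo u = if u == c then a else u

  quo-c : quo c ≡ a
  quo-c rewrite ==-refl c = refl

  quo-o : ∀ {u} → u ≢ c → quo u ≡ u
  quo-o h rewrite ≢→== h = refl

  quo-E : ∀ {u v} → E G u v → E M (quo u) (quo v)
  quo-E {u} {v} e with u ≟ c | v ≟ c
  ... | yes refl | yes refl = ⊥-elim (E-irr G e refl)
  ... | yes refl | no h rewrite quo-c | quo-o h = merge-new G a c nac a≢c e
  ... | no h | yes refl rewrite quo-c | quo-o h = E-sym M (merge-new G a c nac a≢c (E-sym G e))
  ... | no h | no h' rewrite quo-o h | quo-o h' = merge-old G a c nac h h' e

  quo-proper : ∀ {φ} → Proper M φ → Proper G (φ ∘ quo)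
  quo-proper p u v e = p _ _ (quo-E e)

  -- The edges `ab` and `cb` become one, so deleting `cb` beforehand does not change the quotient.
  merge-smaller : ∀ {b} → E G a b → E G c b → 2 + e2 M ≤ e2 G
  merge-smaller {b} ab cb = ℕₚ.≤-trans (ℕₚ.+-monoʳ-≤ 2 (ℕₚ.≤-trans (e2-mono {H = M} {merge H a c nH} le) (e2-merge H a c nH))) (e2-strict {H = H} {G} (delE-⊑ G c b) c b cb (delE-no G c b))
    where
    H = delE G c b
    nH : ¬ E H a c
    nH e = nac (delE-⊑ G c b a c e)
    new : ∀ {v} → v ≢ c → E G c v → E (merge H a c nH) a v
    new {v} vc f with v ≟ b
    ... | yes refl = merge-old H a c nH a≢c vc (delE-i G ab λ { (inj₁ (z , _)) → a≢c z ; (inj₂ (z , _)) → E-irr G ab z })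
    ... | no vb = merge-new H a c nH a≢c (delE-i G f λ { (inj₁ (_ , z)) → vb z ; (inj₂ (_ , z)) → vc z })
    le : M ⊑ merge H a c nH
    le u v e with merge-t G a c nac e
    ... | p , q , m-old f = merge-old H a c nH p q (delE-i G f λ { (inj₁ (z , _)) → p z ; (inj₂ (_ , z)) → q z })
    ... | p , q , m-left refl f = new q f
    ... | p , q , m-right refl f = E-sym (merge H a c nH) {a} {u} (new p f)

  dg-merge : ∀ v → v ≢ a → v ≢ c → dg M v ≤ dg G v
  dg-merge v va vc = ℕₚ.≤-trans (∑-mono pt) (ℕₚ.≤-reflexive (trans (∑-+ (g ∖ c) (λ w → if w == a then g c else 0)) (trans (cong (∑ (g ∖ c) +_) (∑-δ (g c) a)) (trans (ℕₚ.+-comm (∑ (g ∖ c)) (g c)) (sym (∑-split g c))))))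
    where
    g : Fin n → ℕ
    g = 𝟙 ∘ adj G v
    pt : ∀ w → 𝟙 (adj M v w) ≤ (g ∖ c) w + (if w == a then g c else 0)
    pt w with bcase (adj M v w)
    ... | inj₂ e rewrite e = z≤n
    ... | inj₁ e with merge-t G a c nac e
    ... | p , q , m-old f rewrite e | ≢→== q | f = s≤s z≤n
    ... | p , q , m-left z f = ⊥-elim (va z)
    ... | p , q , m-right refl f rewrite e | ≢→== q | ==-refl w | E-sym G f = ℕₚ.m≤n+m 1 _

  -- A triangle at the identified vertex with one edge from `a` and one from `c` comes from a path
  -- of length 3. As the path is not `Bad`, one of the two missing edges is present, and the
  -- triangle lifts along it.
  tri-at : ¬ Bad G a c → ∀ {y z} → E M a y → E M y z → E M a z → ∃ λ w → Tri G w y z × quo w ≡ a × quo y ≡ y × quo z ≡ z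
  tri-at nb {y} {z} ay yz az with merge-t G a c nac ay | merge-t G a c nac yz | merge-t G a c nac az
  ... | _ , yc , _ | _ , zc , m-left refl f | _ = ⊥-elim (E-irr M ay refl)
  ... | _ , yc , _ | _ , zc , m-right refl f | _ = ⊥-elim (E-irr M az refl)
  ... | _ , yc , m-right refl f | _ | _ = ⊥-elim (E-irr M ay refl)
  ... | _ , yc , _ | _ | _ , zc , m-right refl f = ⊥-elim (E-irr M az refl)
  ... | _ , yc , m-old f | _ , zc , m-old g | _ , _ , m-old h = a , (f , g , h) , quo-o a≢c , quo-o yc , quo-o zc
  ... | _ , yc , m-left _ f | _ , zc , m-old g | _ , _ , m-left _ h = c , (f , g , h) , quo-c , quo-o yc , quo-o zc
  ... | _ , yc , m-old f | _ , zc , m-old g | _ , _ , m-left _ h with E? G a z | E? G y c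
  ... | yes w | _ = a , (f , g , w) , quo-o a≢c , quo-o yc , quo-o zc
  ... | no _ | yes w = c , (E-sym G w , g , h) , quo-c , quo-o yc , quo-o zc
  ... | no p | no q = ⊥-elim (nb (y , z , f , g , E-sym G h , p , q))
  tri-at nb {y} {z} ay yz az | _ , yc , m-left _ f | _ , zc , m-old g | _ , _ , m-old h with E? G a y | E? G z c
  ... | yes w | _ = a , (w , g , h) , quo-o a≢c , quo-o yc , quo-o zc
  ... | no _ | yes w = c , (f , g , E-sym G w) , quo-c , quo-o yc , quo-o zc
  ... | no p | no q = ⊥-elim (nb (z , y , h , E-sym G g , E-sym G f , p , q))

  lift-Tri : ¬ Bad G a c → ∀ {x y z} → Tri M x y z → ∃ λ x₀ → ∃ λ y₀ → ∃ λ z₀ → Tri G x₀ y₀ z₀ × quo x₀ ≡ x × quo y₀ ≡ y × quo z₀ ≡ z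
  lift-Tri nb {x} {y} {z} (xy , yz , xz) with x ≟ a | y ≟ a | z ≟ a
  ... | yes refl | _ | _ = let (w , t , p , q , r) = tri-at nb xy yz xz in w , y , z , t , p , q , r
  ... | no p | yes refl | _ = let (w , (t1 , t2 , t3) , q , r , s) = tri-at nb (E-sym M xy) xz yz in x , w , z , (E-sym G t1 , t3 , t2) , r , q , s
  ... | no p | no q | yes refl = let (w , (t1 , t2 , t3) , q , r , s) = tri-at nb (E-sym M xz) xy (E-sym M yz) in x , y , w , (t2 , E-sym G t3 , E-sym G t1) , r , s , q
  ... | no p | no q | no r with merge-t G a c nac xy | merge-t G a c nac yz | merge-t G a c nac xz
  ... | xc , yc , m-left w _ | _ | _ = ⊥-elim (p w)
  ... | xc , yc , m-right w _ | _ | _ = ⊥-elim (q w)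
  ... | _ | _ , zc , m-left w _ | _ = ⊥-elim (q w)
  ... | _ | _ , zc , m-right w _ | _ = ⊥-elim (r w)
  ... | _ | _ | _ , _ , m-left w _ = ⊥-elim (p w)
  ... | _ | _ | _ , _ , m-right w _ = ⊥-elim (r w)
  ... | xc , yc , m-old f | _ , zc , m-old g | _ , _ , m-old h = x , y , z , (f , g , h) , quo-o xc , quo-o yc , quo-o zc

mono-1 : ∀ e a d → 1 + (3 * e + 4 + 4 * d + 3 * 0 + 10 * a) + (5 + 6 * d) ≡ 0 + (10 * a + 3 * e + 10 * suc d)
mono-1 = solve-∀

mono-2 : ∀ e a d → 1 + (3 * e + 4 + 4 * d + 10 * a + 4 * 3) + 3 ≡ 0 + (10 * a + (20 + 3 * e) + 4 * d)
mono-2 = solve-∀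

mono-3 : ∀ e a d → 1 + (3 * e + 4 + 4 * d + 3 * (2 * a) + 4 * a) + 5 ≡ 0 + (10 * a + 3 * (2 + e) + 4 * suc d)
mono-3 = solve-∀

mono-4 : ∀ r' er r er' e d → 10 * r' + (10 * r + 3 * er' + 3 * e + (3 * er + 10 * suc d)) + 0 ≡ 3 * e + 4 + 4 * d + (10 * r' + 3 * er + 6 + 3 * er' + (3 * (2 * d) + 10 * r))
mono-4 = solve-∀

shrink : ∀ {n} (G : Graph n) R ψ → Proper (G ↾ R) ψ → ¬ Extends G R ψ →
  (∃ λ A → 4 ≤ ∣ A ∣ × 10 * ∣ A ∣ ≤ 3 * e2 (G ↾ A) + 4 × ¬ Col (G ↾ A)) ⊎
  (∃ λ R' → R ⊆ R' × suc ∣ R ∣ ≤ ∣ R' ∣ × ¬ Extends (G ↾ R') R ψ × 10 * ∣ R' ∣ + 3 * e2 (G ↾ R) + 6 ≤ 10 * ∣ R ∣ + 3 * e2 (G ↾ R'))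
shrink {n} G R ψ p ne = go (drop G O R ψ disj p (λ { (φ , q , r) → ne (φ , Proper-⊑ {H = G} {G ↾ (O ∪ R)} whole q , r) }))
  where
  O : Sub n
  O u = not (R u)
  disj : Disjoint O R
  disj u e with R u
  ... | false = refl
  whole : G ⊑ (G ↾ (O ∪ R))
  whole u v e = ↾-i G {O ∪ R} (k u) (k v) e
    where k : ∀ u → (O ∪ R) u ≡ true
          k u with R u
          ... | true = refl
          ... | false = refl
  go : Drop G O R ψ → _
  go (inj₁ (A , _ , a4 , low , nc)) = inj₁ (A , a4 , low , nc)
  go (inj₂ (O' , O'⊆ , nx , g)) = inj₂ (O' ∪ R , (λ u e → ∨-ir {O' u} e) , grows (Finₚ.any? (λ u → O' u ≟b true)) , nx , g)
    where
    grows : Dec (∃ λ u → O' u ≡ true) → suc ∣ R ∣ ≤ ∣ O' ∪ R ∣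
    grows (yes (u , o)) = card-strict {A = R} {O' ∪ R} u (λ w e → ∨-ir {O' w} e) (not-t→f λ r → case trans (sym (O'⊆ u o)) (cong not r) of λ ()) (∨-il o)
    grows (no h) = ⊥-elim (nx (ψ , Proper-↾ G (O' ∪ R) R (λ u e → case ∨-t {O' u} e of λ { (inj₁ z) → ⊥-elim (h (u , z)) ; (inj₂ z) → z }) p , λ u r → refl))

-- Either the induction on edges applies to `G ↾ A`, or `A` covers all edges and Euler's formula can
-- be applied with `A` as vertex set.
inside? : ∀ {n} (G : Graph n) A → (2 + e2 (G ↾ A) ≤ e2 G) ⊎ (∀ u v → E G u v → A u ≡ true)
inside? G A with Finₚ.any? (λ u → Finₚ.any? λ v → E? G u v ×-dec (A u ≟b false))
... | yes (u , v , e , a) = inj₁ (e2-strict {H = G ↾ A} {G} (↾-⊑ G A) u v e (λ f → tf (proj₁ (↾-E {G = G} {A} {u} {v} f)) a))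
... | no h = inj₂ λ u v e → case bcase (A u) of λ { (inj₁ a) → a ; (inj₂ a) → ⊥-elim (h (u , v , e , a)) }

e2-zero : ∀ {n} (G : Graph n) → (∀ u v → ¬ E G u v) → e2 G ≡ 0
e2-zero G h = ∑-z λ u → ∑-z λ v → cong 𝟙 (not-t→f (h u v))

edge? : ∀ {n} (G : Graph n) → Dec (∃ λ u → ∃ λ v → E G u v)
edge? G = Finₚ.any? λ u → Finₚ.any? λ v → E? G u v

-- Monochromatic neighbourhoods in triangle-free planar graphs

Mono : ∀ {n} → Graph n → Fin n → Colouring n → Set
Mono G v φ = ∀ u w → E G v u → E G v w → φ u ≡ φ w

TriFree-⊑ : ∀ {n} {H G : Graph n} → H ⊑ G → TriFree G → TriFree H
TriFree-⊑ h t a b c (p , q , r) = t a b c (h _ _ p , h _ _ q , h _ _ r)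

OneTri-⊑ : ∀ {n} {H G : Graph n} → H ⊑ G → OneTri G → OneTri H
OneTri-⊑ h U (p , q , r) (p' , q' , r') = U (h _ _ p , h _ _ q , h _ _ r) (h _ _ p' , h _ _ q' , h _ _ r')

TriFree-One : ∀ {n} {G : Graph n} → TriFree G → OneTri G
TriFree-One t p _ = ⊥-elim (t _ _ _ p)

delE-proper : ∀ {n} (G : Graph n) {a b φ} → Proper (delE G a b) φ → φ a ≢ φ b → Proper G φ
delE-proper G {a} {b} pr ne u w e with isE a b u w in eq
... | false = pr u w (∧-i e (cong not eq))
... | true with isE-t a b u w eq
... | inj₁ (refl , refl) = ne
... | inj₂ (refl , refl) = ne ∘ sym

module MonoStep {n} (G : Graph n) (P : Planarity G) (t : TriFree G) (v : Fin n) (dv : dg G v ≤ 3)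
  (IH : ∀ (H : Graph n) → Planarity H → TriFree H → 2 + e2 H ≤ e2 G → dg H v ≤ 3 → ∃ λ φ → Proper H φ × Mono H v φ) where

  Good : Set
  Good = ∃ λ φ → Proper G φ × Mono G v φ

  via-sub : ∀ H → H ⊑ G → 2 + e2 H ≤ e2 G → ∃ λ φ → Proper H φ × Mono H v φ
  via-sub H h lt = IH H (sub P H h) (TriFree-⊑ {H = H} {G} h t) lt (ℕₚ.≤-trans (dg-mono {H = H} {G} h v) dv)

  Thru : Fin n → Fin n → Fin n → Set
  Thru x s y = x ≢ y × s ≢ v × E G v x × E G v y × E G s x × E G s y

  -- A 4-cycle v x s y: the edge sy is redundant.
  reduce-thru : ∀ {x s y} → Thru x s y → Good
  reduce-thru {x} {s} {y} (xy , sv , vx , vy , sx , sy) = φ , pr , λ u w a b → mo u w (keep a) (keep b)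
    where
    H = delE G s y
    r = via-sub H (delE-⊑ G s y) (e2-strict {H = H} {G} (delE-⊑ G s y) s y sy (delE-no G s y))
    φ = proj₁ r
    mo = proj₂ (proj₂ r)
    keep : ∀ {u} → E G v u → E H v u
    keep e = delE-i G e λ { (inj₁ (z , _)) → sv (sym z) ; (inj₂ (z , _)) → E-irr G vy z }
    sx' : E H s x
    sx' = delE-i G sx λ { (inj₁ (_ , z)) → xy z ; (inj₂ (z , _)) → E-irr G sy z }
    ne : φ s ≢ φ y
    ne e = proj₁ (proj₂ r) s x sx' (trans e (mo y x (keep vy) (keep vx)))
    pr : Proper G φ
    pr = delE-proper G (proj₁ (proj₂ r)) ne

  via-merge : ∀ {a b c d} → C4 G a b c d → Facial P a b c d → v ≢ a → v ≢ c → ¬ Bad G a c → Good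
  via-merge {a} {b} {c} {d} C F va vc nb = proj₁ r ∘ quo , quo-proper (proj₁ (proj₂ r)) , mo
    where
    module C = C4 C
    nac = proj₁ (chordless (TriFree-One {G = G} t) C)
    open Quotient G a c C.a≢c nac
    r = IH (merge G a c nac) (merge-planar P C F nac)
        (λ x y z T → let (x₀ , y₀ , z₀ , T' , _) = lift-Tri nb T in t x₀ y₀ z₀ T')
        (merge-smaller C.ab (E-sym G C.bc)) (ℕₚ.≤-trans (dg-merge v va vc) dv)
    mo : Mono G v (proj₁ r ∘ quo)
    mo u w e f = proj₂ (proj₂ r) (quo u) (quo w) (qE e) (qE f)
      where qE : ∀ {u} → E G v u → E (merge G a c nac) v (quo u)
            qE {u} e = subst (λ z → E (merge G a c nac) z (quo u)) (quo-o vc) (quo-E {v} {u} e)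

  -- A doubled potential of at most 4 + 4d ≤ 16 is below the 20 of girth 5, so some face is a
  -- 4-cycle; `suc d ≤ ∣ A ∣` takes care of graphs with no edge or one face. The 4-cycle avoids `v`,
  -- and a diagonal can be identified because a fan would contain a triangle.
  finish : (∀ x s y → ¬ Thru x s y) → ∀ A d → (∀ u w → E G u w → A u ≡ true) → d ≤ 3 → suc d ≤ ∣ A ∣ → 10 * ∣ A ∣ ≤ 3 * e2 G + 4 + 4 * d → Good
  finish nt A d ia d3 dA b with edge? G
  ... | no ne = ⊥-elim (ℕₚ.<-irrefl refl (farkas {1} {0} (5 + 6 * d) (ℕₚ.+-mono-≤ (ℕₚ.+-mono-≤ b (ℕₚ.≤-reflexive (cong (3 *_) (e2-zero G λ u w e → ne (u , w , e))))) (ℕₚ.*-monoʳ-≤ 10 dA)) (mono-1 (e2 G) (∣ A ∣) d)))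
  ... | yes (u , w , e) with face-trichotomy P t
  ... | inj₁ h = ⊥-elim (ℕₚ.<-irrefl refl (farkas {1} {0} 3 (ℕₚ.+-mono-≤ (ℕₚ.+-mono-≤ b (girth5 P {A} e ia h)) (ℕₚ.*-monoʳ-≤ 4 d3)) (mono-2 (e2 G) (∣ A ∣) d)))
  ... | inj₂ (inj₂ o) = ⊥-elim (ℕₚ.<-irrefl refl (farkas {1} {0} 5 (ℕₚ.+-mono-≤ (ℕₚ.+-mono-≤ b (ℕₚ.*-monoʳ-≤ 3 (euler-one P {A} e ia o))) (ℕₚ.*-monoʳ-≤ 4 dA)) (mono-3 (e2 G) (∣ A ∣) d)))
  ... | inj₂ (inj₁ (a , b' , c , d' , C , F)) = go (Bad? G a c) (Bad? G b' d')
    where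
    module C = C4 C
    va : v ≢ a
    va refl = nt b' c d' (C.b≢d , C.a≢c ∘ sym , C.ab , E-sym G C.da , E-sym G C.bc , C.cd)
    vb : v ≢ b'
    vb refl = nt c d' a (C.a≢c ∘ sym , C.b≢d ∘ sym , C.bc , E-sym G C.ab , E-sym G C.cd , C.da)
    vc : v ≢ c
    vc refl = nt d' a b' (C.b≢d ∘ sym , C.a≢c , C.cd , E-sym G C.bc , E-sym G C.da , C.ab)
    vd : v ≢ d'
    vd refl = nt a b' c (C.a≢c , C.b≢d , C.da , E-sym G C.cd , E-sym G C.ab , C.bc)
    nofan : ∀ {a b c d} → C4 G a b c d → ¬ Fan G a b c d
    nofan C f = t _ _ _ (T₀ (TriFree-One {G = G} t) C f)
    fans : Fan G a b' c d' ⊎ Fan G b' c d' a ⊎ Fan G c d' a b' ⊎ Fan G d' a b' c → ⊥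
    fans (inj₁ f) = nofan C f
    fans (inj₂ (inj₁ f)) = nofan (C4-rot C) f
    fans (inj₂ (inj₂ (inj₁ f))) = nofan (C4-rot (C4-rot C)) f
    fans (inj₂ (inj₂ (inj₂ f))) = nofan (C4-rot (C4-rot (C4-rot C))) f
    go : Dec (Bad G a c) → Dec (Bad G b' d') → Good
    go (no nb) _ = via-merge C F va vc nb
    go (yes _) (no nb) = via-merge (C4-rot C) (Facial-rot F) vb vd nb
    go (yes p) (yes q) = ⊥-elim (fans (bad-fan P C (chordless (TriFree-One {G = G} t) C) F p q))

  R : Sub n
  R = ins (adj G v) v

  ψ : Colouring n
  ψ u = if u == v then suc zero else zero

  ψ-v : ψ v ≡ suc zero
  ψ-v rewrite ==-refl v = refl

  ψ-o : ∀ {u} → u ≢ v → ψ u ≡ zero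
  ψ-o h rewrite ≢→== h = refl

  R-t : ∀ {u} → R u ≡ true → (u ≡ v) ⊎ E G v u
  R-t {u} e with ∨-t {u == v} e
  ... | inj₁ p = inj₁ (==→≡ {i = u} {v} p)
  ... | inj₂ p = inj₂ p

  ψ-proper : Proper (G ↾ R) ψ
  ψ-proper u w e with ↾-E {G = G} {R} {u} {w} e
  ... | a , b , f with R-t a | R-t b
  ... | inj₁ refl | inj₁ refl = ⊥-elim (E-irr G f refl)
  ... | inj₁ refl | inj₂ q = λ z → case trans (sym ψ-v) (trans z (ψ-o (E-irr G q ∘ sym))) of λ ()
  ... | inj₂ q | inj₁ refl = λ z → case trans (sym ψ-v) (trans (sym z) (ψ-o (E-irr G q ∘ sym))) of λ ()
  ... | inj₂ p | inj₂ q = ⊥-elim (t v u w (p , f , q))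

  e2-R : 2 * dg G v ≤ e2 (G ↾ R)
  e2-R = ℕₚ.≤-trans (ℕₚ.≤-reflexive (cong (2 *_) (trans (sym (deg≡dg G v)) refl)))
     (ℕₚ.≤-trans (ℕₚ.m≤n+m _ (e2 (G ↾ adj G v))) (grow G (adj G v) v {nbrs G v} (adj-irr G v) (nbrs-unique G v) (Allₚ.tabulate λ i → ∈-nbrs G i , ∈-nbrs G i)))

  card-R : ∣ R ∣ ≡ suc (dg G v)
  card-R = card-ins (adj G v) v (adj-irr G v)

  -- A permutation of colours matches the values at `v` and at one neighbour, and the other
  -- neighbours share the latter.
  to-ψ : ∀ {R'} → R ⊆ R' → (∃ λ φ → Proper (G ↾ R') φ × Mono (G ↾ R') v φ) → Extends (G ↾ R') R ψ
  to-ψ {R'} h (φ , p , mo) = go (Finₚ.any? λ u → E? G v u)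
    where
    vR : R v ≡ true
    vR = ∨-il (==-refl v)
    toR' : ∀ {u} → E G v u → E (G ↾ R') v u
    toR' {u} e = ↾-i G {R'} (h v vR) (h u (∨-ir {u == v} e)) e
    go : Dec (∃ λ u → E G v u) → Extends (G ↾ R') R ψ
    go (yes (x , vx)) with perm2 (φ v) (φ x) (suc zero) zero (p v x (toR' vx)) (λ ())
    ... | π , inj , πv , πx = π ∘ φ , Proper-∘ (G ↾ R') {φ} {π} inj p , λ u r → case R-t r of λ
         { (inj₁ refl) → trans πv (sym ψ-v) ; (inj₂ e) → trans (cong π (mo u x (toR' e) (toR' vx))) (trans πx (sym (ψ-o (E-irr G e ∘ sym)))) }
    go (no nn) with avoid2 (φ v) (φ v)
    ... | k , ne , _ with perm2 (φ v) k (suc zero) zero ne (λ ())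
    ... | π , inj , πv , πx = π ∘ φ , Proper-∘ (G ↾ R') {φ} {π} inj p , λ u r → case R-t r of λ
         { (inj₁ refl) → trans πv (sym ψ-v) ; (inj₂ e) → ⊥-elim (nn (u , e)) }

  result : Good
  result with Finₚ.any? (λ x → Finₚ.any? λ s → Finₚ.any? λ y → ¬? (x ≟ y) ×-dec ¬? (s ≟ v) ×-dec E? G v x ×-dec E? G v y ×-dec E? G s x ×-dec E? G s y)
  ... | yes (x , s , y , th) = reduce-thru {x} {s} {y} th
  ... | no nt with Extends? G R ψ
  ... | yes (φ , p , q) = φ , p , λ u w e f → trans (q u (∨-ir {u == v} e)) (trans (ψ-o (E-irr G e ∘ sym)) (sym (trans (q w (∨-ir {w == v} f)) (ψ-o (E-irr G f ∘ sym)))))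
  ... | no nx with shrink G R ψ ψ-proper nx
  ... | inj₁ (A , a4 , low , nc) with inside? G A
  ... | inj₁ lt = let (φ , p , _) = via-sub (G ↾ A) (↾-⊑ G A) lt in ⊥-elim (nc (φ , p))
  ... | inj₂ ia = finish (λ x s y h → nt (x , s , y , h)) A 0 ia z≤n (ℕₚ.≤-trans (s≤s z≤n) a4) (ℕₚ.≤-trans low (ℕₚ.≤-trans (ℕₚ.+-monoˡ-≤ 4 (ℕₚ.*-monoʳ-≤ 3 (e2-mono {H = G ↾ A} {G} (↾-⊑ G A)))) (ℕₚ.≤-reflexive (sym (ℕₚ.+-identityʳ _)))))
  result | no nt | no nx | inj₂ (R' , R⊆ , big , nx' , g) with inside? G R'
  ... | inj₁ lt = ⊥-elim (nx' (to-ψ {R'} R⊆ (via-sub (G ↾ R') (↾-⊑ G R') lt)))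
  -- The star has doubled potential 10(d + 1) - 6d = 10 + 4d, of which the drop takes 6.
  ... | inj₂ ia = finish (λ x s y h → nt (x , s , y , h)) R' (dg G v) ia dv (ℕₚ.≤-trans (ℕₚ.≤-reflexive (sym card-R)) (ℕₚ.≤-trans (ℕₚ.n≤1+n _) big))
        (farkas 0 (ℕₚ.+-mono-≤ (ℕₚ.+-mono-≤ g (ℕₚ.*-monoʳ-≤ 3 (e2-mono {H = G ↾ R'} {G} (↾-⊑ G R')))) (ℕₚ.+-mono-≤ (ℕₚ.*-monoʳ-≤ 3 e2-R) (ℕₚ.≤-reflexive (cong (10 *_) card-R)))) (mono-4 (∣ R' ∣) (e2 (G ↾ R)) (∣ R ∣) (e2 (G ↾ R')) (e2 G) (dg G v)))

mono-nbhd : ∀ k {n} (G : Graph n) → Planarity G → TriFree G → e2 G ≤ k → ∀ v → dg G v ≤ 3 → ∃ λ φ → Proper G φ × Mono G v φ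
mono-nbhd zero G P t h v dv = MonoStep.result G P t v dv (λ H _ _ lt _ → case ℕₚ.≤-trans lt h of λ ())
mono-nbhd (suc k) G P t h v dv = MonoStep.result G P t v dv (λ H PH tH lt dH → mono-nbhd k H PH tH (ℕₚ.≤-pred (ℕₚ.≤-trans (ℕₚ.n≤1+n _) (ℕₚ.≤-trans lt h))) v dH)

-- Density when all 4-cycles have the same corners

quad-1 : ∀ e a → 12 + 3 * e + 6 + (3 * (2 * a) + 4 * a) + 0 ≡ 10 * a + (3 * (2 + e) + 4 * 3)
quad-1 = solve-∀

quad-2 : ∀ e a w → 18 + 3 * e + (5 * (2 * a + 2 * w) + 2 * (e + 1)) + 0 ≡ 10 * a + (5 * (4 + e) + 2 * (5 * w))
quad-2 = solve-∀

quad-3 : ∀ g h a → 12 + 3 * g + (3 * (h + 2) + 10 * a) + 0 ≡ 10 * a + (3 * g + (18 + 3 * h))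
quad-3 = solve-∀

quad-4 : ∀ g h a → 12 + 3 * g + (3 * (h + 2) + 10 * a) + 0 ≡ 10 * a + (3 * g + (12 + 3 * h + 6))
quad-4 = solve-∀

isolate : ∀ {n} → Graph n → Fin n → Graph n
isolate G x = G ↾ (λ u → not (u == x))

isolate-i : ∀ {n} (G : Graph n) {x u v} → u ≢ x → v ≢ x → E G u v → E (isolate G x) u v
isolate-i G {x} p q e = ↾-i G {λ u → not (u == x)} (cong not (≢→== p)) (cong not (≢→== q)) e

isolate-⊑ : ∀ {n} (G : Graph n) x → isolate G x ⊑ G
isolate-⊑ G x = ↾-⊑ G (λ u → not (u == x))

isolate-no : ∀ {n} (G : Graph n) {x} v → ¬ E (isolate G x) x v
isolate-no G {x} v f = case trans (sym (proj₁ (↾-E {G = G} {λ u → not (u == x)} {x} {v} f))) (cong not (==-refl x)) of λ ()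

isolate-smaller : ∀ {n} (G : Graph n) {x y} → E G x y → 2 + e2 (isolate G x) ≤ e2 G
isolate-smaller G {x} {y} e = e2-strict {H = isolate G x} {G} (isolate-⊑ G x) x y e (isolate-no G y)

-- A remaining triangle would by uniqueness have both `a` and `b` as corners, hence contain the
-- deleted edge.
cut-tri : ∀ {n} {G : Graph n} → OneTri G → ∀ {a b c} → Tri G a b c → TriFree (delE G a b)
cut-tri {G = G} U {a} {b} {c} (ab , bc , ac) x y z (xy , yz , xz) = go (U T (ab , bc , ac)) (U T (E-sym G ab , ac , bc))
  where
  T : Tri G x y z
  T = delE-⊑ G a b x y xy , delE-⊑ G a b y z yz , delE-⊑ G a b x z xz
  no₁ : ∀ {u v} → E (delE G a b) u v → ¬ (u ≡ a × v ≡ b)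
  no₁ e p = delE-t G {a} {b} e (inj₁ p)
  no₂ : ∀ {u v} → E (delE G a b) u v → ¬ (u ≡ b × v ≡ a)
  no₂ e p = delE-t G {a} {b} e (inj₂ p)
  irr : ∀ {u} → a ≡ u → b ≡ u → ⊥
  irr p q = E-irr G ab (trans p (sym q))
  go : (a ≡ x) ⊎ (a ≡ y) ⊎ (a ≡ z) → (b ≡ x) ⊎ (b ≡ y) ⊎ (b ≡ z) → ⊥
  go (inj₁ p) (inj₁ q) = irr p q
  go (inj₁ p) (inj₂ (inj₁ q)) = no₁ xy (sym p , sym q)
  go (inj₁ p) (inj₂ (inj₂ q)) = no₁ xz (sym p , sym q)
  go (inj₂ (inj₁ p)) (inj₁ q) = no₂ xy (sym q , sym p)
  go (inj₂ (inj₁ p)) (inj₂ (inj₁ q)) = irr p q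
  go (inj₂ (inj₁ p)) (inj₂ (inj₂ q)) = no₁ yz (sym p , sym q)
  go (inj₂ (inj₂ p)) (inj₁ q) = no₂ xz (sym q , sym p)
  go (inj₂ (inj₂ p)) (inj₂ (inj₁ q)) = no₂ yz (sym q , sym p)
  go (inj₂ (inj₂ p)) (inj₂ (inj₂ q)) = irr p q

tri? : ∀ {n} (G : Graph n) → Dec (∃ λ a → ∃ λ b → ∃ λ c → Tri G a b c)
tri? G = Finₚ.any? λ a → Finₚ.any? λ b → Finₚ.any? λ c → E? G a b ×-dec E? G b c ×-dec E? G a c

untri : ∀ {n} (G : Graph n) → OneTri G → ∃ λ H → H ⊑ G × TriFree H × e2 G ≤ e2 H + 2
untri G U with tri? G
... | no h = G , (λ _ _ e → e) , (λ a b c t → h (a , b , c , t)) , ℕₚ.m≤m+n _ 2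
... | yes (a , b , c , t) = delE G a b , delE-⊑ G a b , cut-tri {G = G} U t , e2-delE G a b

On-rot : ∀ {n} {a b c d u : Fin n} → On a b c d u → On b c d a u
On-rot (inj₁ p) = inj₂ (inj₂ (inj₂ p))
On-rot (inj₂ (inj₁ p)) = inj₁ p
On-rot (inj₂ (inj₂ (inj₁ p))) = inj₂ (inj₁ p)
On-rot (inj₂ (inj₂ (inj₂ p))) = inj₂ (inj₂ (inj₁ p))

On-edge : ∀ {n} {a b c d u : Fin n} → On a b c d u → ∃ λ v → CE a b c d u v
On-edge (inj₁ p) = _ , inj₁ (inj₁ (p , refl))
On-edge (inj₂ (inj₁ p)) = _ , inj₂ (inj₁ (inj₁ (p , refl)))
On-edge (inj₂ (inj₂ (inj₁ p))) = _ , inj₂ (inj₂ (inj₁ (inj₁ (p , refl))))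
On-edge (inj₂ (inj₂ (inj₂ p))) = _ , inj₂ (inj₂ (inj₂ (inj₁ (p , refl))))

CE-swap : ∀ {n} {a b c d u v : Fin n} → CE a b c d u v → CE a b c d v u
CE-swap (inj₁ (inj₁ (p , q))) = inj₁ (inj₂ (q , p))
CE-swap (inj₁ (inj₂ (p , q))) = inj₁ (inj₁ (q , p))
CE-swap (inj₂ (inj₁ (inj₁ (p , q)))) = inj₂ (inj₁ (inj₂ (q , p)))
CE-swap (inj₂ (inj₁ (inj₂ (p , q)))) = inj₂ (inj₁ (inj₁ (q , p)))
CE-swap (inj₂ (inj₂ (inj₁ (inj₁ (p , q))))) = inj₂ (inj₂ (inj₁ (inj₂ (q , p))))
CE-swap (inj₂ (inj₂ (inj₁ (inj₂ (p , q))))) = inj₂ (inj₂ (inj₁ (inj₁ (q , p))))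
CE-swap (inj₂ (inj₂ (inj₂ (inj₁ (p , q))))) = inj₂ (inj₂ (inj₂ (inj₂ (q , p))))
CE-swap (inj₂ (inj₂ (inj₂ (inj₂ (p , q))))) = inj₂ (inj₂ (inj₂ (inj₁ (q , p))))

CE-On₂ : ∀ {n} {a b c d u v : Fin n} → CE a b c d u v → On a b c d v
CE-On₂ p = CE-On (CE-swap p)

C4-of : ∀ {n} {H : Graph n} {G : Graph n} {a b c d} → C4 G a b c d → (∀ {u v} → CE a b c d u v → E H u v) → C4 H a b c d
C4-of (c4 _ _ _ _ p q) h = c4 (h (inj₁ (inj₁ (refl , refl)))) (h (inj₂ (inj₁ (inj₁ (refl , refl))))) (h (inj₂ (inj₂ (inj₁ (inj₁ (refl , refl)))))) (h (inj₂ (inj₂ (inj₂ (inj₁ (refl , refl)))))) p q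

no-tri-at : ∀ {n} {G : Graph n} {a b c d z} → Chordless G a b c d → On a b c d z → E G a z → E G b z → ⊥
no-tri-at {G = G} ch (inj₁ refl) xz yz = E-irr G xz refl
no-tri-at {G = G} ch (inj₂ (inj₁ refl)) xz yz = E-irr G yz refl
no-tri-at ch (inj₂ (inj₂ (inj₁ refl))) xz yz = proj₁ ch xz
no-tri-at ch (inj₂ (inj₂ (inj₂ refl))) xz yz = proj₂ ch yz

no-tri-on : ∀ {n} {G : Graph n} {a b c d x y z} → Chordless G a b c d → CE a b c d x y → On a b c d z → E G x z → E G y z → ⊥
no-tri-on {n} {G} {a} {b} {c} {d} {x} {y} {z} (p , q) ce o xz yz = k ce
  where
  ed : ∀ {a b c d} → Chordless G a b c d → On a b c d z → Ed a b x y → ⊥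
  ed ch o (inj₁ (refl , refl)) = no-tri-at {G = G} ch o xz yz
  ed ch o (inj₂ (refl , refl)) = no-tri-at {G = G} ch o yz xz
  k : CE a b c d x y → ⊥
  k (inj₁ e) = ed (p , q) o e
  k (inj₂ (inj₁ e)) = ed (q , p ∘ E-sym G) (On-rot o) e
  k (inj₂ (inj₂ (inj₁ e))) = ed (p ∘ E-sym G , q ∘ E-sym G) (On-rot (On-rot o)) e
  k (inj₂ (inj₂ (inj₂ e))) = ed (q ∘ E-sym G , p) (On-rot (On-rot (On-rot o))) e

C4-distinct : ∀ {n} {G : Graph n} {a b c d} → C4 G a b c d → Unique (a ∷ b ∷ c ∷ d ∷ [])
C4-distinct {G = G} (c4 ab bc cd da p q) = (E-irr G ab ∷ p ∷ (E-irr G da ∘ sym) ∷ []) ∷ (E-irr G bc ∷ q ∷ []) ∷ (E-irr G cd ∷ []) ∷ [] ∷ []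

fromL-On : ∀ {n} {a b c d u : Fin n} → On a b c d u → fromList (a ∷ b ∷ c ∷ d ∷ []) u ≡ true
fromL-On {a = a} {b} {c} {d} o = fromList∈ {xs = a ∷ b ∷ c ∷ d ∷ []} (k o)
  where k : On a b c d _ → _ ∈ _
        k (inj₁ p) = here p
        k (inj₂ (inj₁ p)) = there (here p)
        k (inj₂ (inj₂ (inj₁ p))) = there (there (here p))
        k (inj₂ (inj₂ (inj₂ p))) = there (there (there (here p)))

On-fromL : ∀ {n} {a b c d u : Fin n} → fromList (a ∷ b ∷ c ∷ d ∷ []) u ≡ true → On a b c d u
On-fromL {a = a} {b} {c} {d} e = k (∈fromList (a ∷ b ∷ c ∷ d ∷ []) e)
  where k : _ ∈ (a ∷ b ∷ c ∷ d ∷ []) → On a b c d _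
        k (here p) = inj₁ p
        k (there (here p)) = inj₂ (inj₁ p)
        k (there (there (here p))) = inj₂ (inj₂ (inj₁ p))
        k (there (there (there (here p)))) = inj₂ (inj₂ (inj₂ p))

same-corners : ∀ {n} {G : Graph n} {a b c d p q r s} → C4 G a b c d → (∀ u → On a b c d u → On p q r s u) → ∀ u → On p q r s u → On a b c d u
same-corners {a = a} {b} {c} {d} {p} {q} {r} {s} C h u o with On? a b c d u
... | yes y = y
... | no no' = ⊥-elim (ℕₚ.<-irrefl refl (ℕₚ.≤-trans (card-list (fromList (p ∷ q ∷ r ∷ s ∷ [])) {u ∷ a ∷ b ∷ c ∷ d ∷ []}
    (((λ { refl → no' (inj₁ refl) }) ∷ (λ { refl → no' (inj₂ (inj₁ refl)) }) ∷ (λ { refl → no' (inj₂ (inj₂ (inj₁ refl))) }) ∷ (λ { refl → no' (inj₂ (inj₂ (inj₂ refl))) }) ∷ []) ∷ C4-distinct C)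
    (fromL-On o ∷ fromL-On (h a (inj₁ refl)) ∷ fromL-On (h b (inj₂ (inj₁ refl))) ∷ fromL-On (h c (inj₂ (inj₂ (inj₁ refl)))) ∷ fromL-On (h d (inj₂ (inj₂ (inj₂ refl)))) ∷ []))
    (card-fromList (p ∷ q ∷ r ∷ s ∷ []))))

both-sides : ∀ {m} (x y f g : Fin m) → f ≢ g → (x == f) xor (y == f) ≡ true → (x == g) xor (y == g) ≡ true → (x ≡ f) ⊎ (x ≡ g)
both-sides x y f g ne p q with bcase (x == f) | bcase (x == g)
... | inj₁ r | _ = inj₁ (==→≡ {i = x} {f} r)
... | _ | inj₁ r = inj₂ (==→≡ {i = x} {g} r)
... | inj₂ r | inj₂ r' rewrite r | r' = ⊥-elim (ne (trans (sym (==→≡ {i = y} {f} p)) (==→≡ {i = y} {g} q)))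

two-of-xor : ∀ {m} (x f g : Fin m) → f ≢ g → (x ≡ f) ⊎ (x ≡ g) → (x == f) xor (x == g) ≡ true
two-of-xor x f g ne (inj₁ refl) rewrite ==-refl x | ≢→== ne = refl
two-of-xor x f g ne (inj₂ refl) rewrite ==-refl x | ≢→== (ne ∘ sym) = refl

xor-two : ∀ {m} (x f g : Fin m) → (x == f) xor (x == g) ≡ true → (x ≡ f) ⊎ (x ≡ g)
xor-two x f g e with bcase (x == f)
... | inj₁ r = inj₁ (==→≡ {i = x} {f} r)
... | inj₂ r rewrite r = inj₂ (==→≡ {i = x} {g} e)

xor-4 : ∀ p q r s → (p xor q) xor (r xor s) ≡ (p xor r) xor (q xor s)
xor-4 true true true s = refl
xor-4 true true false s = sym (Boolₚ.not-involutive s)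
xor-4 true false true s = Boolₚ.not-involutive s
xor-4 true false false s = refl
xor-4 false true true s = refl
xor-4 false true false s = refl
xor-4 false false r s = refl

∑E-≥ : ∀ {n} (G : Graph n) {es} → All (λ e → E G (proj₁ e) (proj₂ e)) es → AllPairs Apart es → 2 * length es ≤ e2 G
∑E-≥ G {es} a p = ℕₚ.≤-trans (k a) (∑-pickE (λ u v → 𝟙 (adj G u v)) (Allₚ.map (λ e → E-irr G e) a) p)
  where k : ∀ {xs} → All (λ e → E G (proj₁ e) (proj₂ e)) xs → 2 * length xs ≤ ∑E (λ u v → 𝟙 (adj G u v)) xs
        k [] = z≤n
        k {(u , v) ∷ xs} (e ∷ es) rewrite e | E-sym G {u} {v} e = ℕₚ.≤-trans (ℕₚ.≤-reflexive (ℕₚ.*-suc 2 (length xs))) (ℕₚ.+-monoʳ-≤ 2 (k es))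

e2-C4 : ∀ {n} (G : Graph n) {a b c d} → C4 G a b c d → 8 ≤ e2 G
e2-C4 G {a} {b} {c} {d} (c4 ab bc cd da p q) = ∑E-≥ G {(a , b) ∷ (b , c) ∷ (c , d) ∷ (d , a) ∷ []} (ab ∷ bc ∷ cd ∷ da ∷ [])
  ((ap₂ (p ∘ sym) (E-irr G bc ∘ sym) ∷ ap₂ (E-irr G da) (q ∘ sym) ∷ ap₁ (E-irr G da) (q ∘ sym) ∷ []) ∷ (ap₂ (q ∘ sym) (E-irr G cd ∘ sym) ∷ ap₁ (q ∘ sym) (E-irr G cd ∘ sym) ∷ []) ∷ (ap₂ p (E-irr G da ∘ sym) ∷ []) ∷ [] ∷ [])

-- All 4-cycles have their corners among four given vertices and no chords, so they all have the
-- same edges.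
module Quads {n} {G : Graph n} (P : Planarity G) (t : TriFree G) {p q r s : Fin n} (on : ∀ {a b c d} → C4 G a b c d → On p q r s a) where
  open Planarity P

  all-on : ∀ {a b c d} → C4 G a b c d → ∀ u → On a b c d u → On p q r s u
  all-on C u (inj₁ refl) = on C
  all-on C u (inj₂ (inj₁ refl)) = on (C4-rot C)
  all-on C u (inj₂ (inj₂ (inj₁ refl))) = on (C4-rot (C4-rot C))
  all-on C u (inj₂ (inj₂ (inj₂ refl))) = on (C4-rot (C4-rot (C4-rot C)))

  same-CE : ∀ {a b c d a' b' c' d'} → C4 G a b c d → C4 G a' b' c' d' → ∀ {u v} → CE a b c d u v → CE a' b' c' d' u v
  same-CE C C' ce = On-CE {G = G} (chordless (TriFree-One {G = G} t) C') (k _ (CE-On ce)) (k _ (CE-On₂ ce)) (CE-E {G = G} C ce)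
    where k = λ u o → same-corners C' (all-on C') u (all-on C u o)

  -- Two faces bounded by the same cycle have a union without boundary. By connectedness of the dual
  -- every edge lies on one of them, hence on the cycle.
  two-short : ∀ {a b c d a' b' c' d'} → C4 G a b c d → C4 G a' b' c' d' → (F : Facial P a b c d) (F' : Facial P a' b' c' d') → Facial.ℓ F ≢ Facial.ℓ F' → e2 G ≤ 8
  two-short {a} {b} {c} {d} {a'} {b'} {c'} {d'} C C' F F' ne = bound
    where
    f = Facial.ℓ F
    f' = Facial.ℓ F'
    bdf : ∀ u v → E G u v → ∂ (_== f') u v ≡ cyc a b c d u v
    bdf u v e = trans (Facial.bd F' u v e) (b-ext (λ z → cyc-i C (same-CE C' C (cyc-t a' b' c' d' u v z))) (λ z → cyc-i C' (same-CE C C' (cyc-t a b c d u v z))))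
    σ : Fin m → Bool
    σ x = (x == f) xor (x == f')
    flat : ∀ u v → E G u v → σ (side u v) ≡ σ (side v u)
    flat u v e = xor-f _ _ (trans (xor-4 (side u v == f) (side u v == f') (side v u == f) (side v u == f')) (trans (cong₂ _xor_ (Facial.bd F u v e) (bdf u v e)) (Boolₚ.xor-same (cyc a b c d u v))))
    cab : cyc a b c d a b ≡ true
    cab = cyc-i C (inj₁ (inj₁ (refl , refl)))
    σab : σ (side a b) ≡ true
    σab = two-of-xor (side a b) f f' ne (both-sides (side a b) (side b a) f f' ne (trans (Facial.bd F a b (C4.ab C)) cab) (trans (bdf a b (C4.ab C)) cab))
    every : ∀ u v → E G u v → CE a b c d u v
    every u v e with xor-two (side u v) f f' (trans (conn σ flat u v a b e (C4.ab C)) σab)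
    ... | inj₁ z = Facial.onC F u v e z
    ... | inj₂ z = same-CE C' C (Facial.onC F' u v e z)
    G₁ = delE G a b
    G₂ = delE G₁ b c
    G₃ = delE G₂ c d
    G₄ = delE G₃ d a
    none : ∀ u v → ¬ E G₄ u v
    none u v e with delE-⊑ G₃ d a u v e
    ... | e₃ with delE-⊑ G₂ c d u v e₃
    ... | e₂' with delE-⊑ G₁ b c u v e₂'
    ... | e₁ with every u v (delE-⊑ G a b u v e₁)
    ... | inj₁ z = delE-t G {a} {b} e₁ z
    ... | inj₂ (inj₁ z) = delE-t G₁ {b} {c} e₂' z
    ... | inj₂ (inj₂ (inj₁ z)) = delE-t G₂ {c} {d} e₃ z
    ... | inj₂ (inj₂ (inj₂ z)) = delE-t G₃ {d} {a} e z
    bound : e2 G ≤ 8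
    bound = ℕₚ.≤-trans (e2-delE G a b) (ℕₚ.+-monoˡ-≤ 2 (ℕₚ.≤-trans (e2-delE G₁ b c) (ℕₚ.+-monoˡ-≤ 2 (ℕₚ.≤-trans (e2-delE G₂ c d) (ℕₚ.+-monoˡ-≤ 2
       (ℕₚ.≤-trans (e2-delE G₃ d a) (ℕₚ.+-monoˡ-≤ 2 (ℕₚ.≤-reflexive (e2-zero G₄ none)))))))))

  Short : Fin m → Set
  Short f = used P f ≡ true × ¬ (5 ≤ Face.len P f)

  short? : ∀ f → Dec (Short f)
  short? f = (used P f ≟b true) ×-dec ¬? (5 ≤? Face.len P f)

  -- At most one face is shorter than 5, and then of length 4, unless `G` is a 4-cycle or has one
  -- face. This weakens the bound for girth 5 from 20 to 18.
  sparse : ∀ {A u v} → E G u v → Inside P A → 3 ≤ ∣ A ∣ → (18 + 3 * e2 G ≤ 10 * ∣ A ∣) ⊎ (e2 G ≤ 8) ⊎ (12 + 3 * e2 G + 6 ≤ 10 * ∣ A ∣)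
  sparse {A} {u} {v} e ia a3 with Finₚ.any? short?
  ... | no h = inj₁ (ℕₚ.≤-trans (ℕₚ.m≤n+m _ 2) (girth5 P {A} e ia λ f uf → decidable-stable (5 ≤? Face.len P f) (λ z → h (f , uf , z))))
  ... | yes (f , uf , sf) with used-t P {f} uf
  ... | x , y , e' , sd with Face.one-sided P f e' sd
  ... | inj₁ mono = inj₂ (inj₂ (farkas 0 (ℕₚ.+-mono-≤ (ℕₚ.*-monoʳ-≤ 3 (euler-one P {A} e ia (f , mono))) (ℕₚ.*-monoʳ-≤ 4 a3)) (quad-1 (e2 G) (∣ A ∣))))
  ... | inj₂ (a , b , z) with Finₚ.any? (λ g → ¬? (g ≟ f) ×-dec short? g)
  ... | yes (g , ne , ug , sg) = inj₂ (inj₁ (go (used-t P {g} ug)))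
    where
    short4 : ∀ {k} → ¬ (5 ≤ k) → k ≤ 4
    short4 h = ℕₚ.≤-pred (ℕₚ.≰⇒> h)
    go : (∃ λ u → ∃ λ v → E G u v × side u v ≡ g) → e2 G ≤ 8
    go (x , y , e'' , sd') with Face.one-sided P g e'' sd'
    ... | inj₁ mono = ⊥-elim (ne (trans (sym (mono _ _ e')) sd))
    ... | inj₂ (a' , b' , z') = let (_ , _ , _ , _ , C , F , p) = Face.face-4 P f t z (short4 sf)
                                    (_ , _ , _ , _ , C' , F' , p') = Face.face-4 P g t z' (short4 sg)
                                in two-short C C' F F' (λ q → ne (trans (sym p') (trans (sym q) p)))
  ... | no h = inj₁ (farkas 0 (ℕₚ.+-mono-≤ (ℕₚ.*-monoʳ-≤ 5 (euler-k P {A} e ia)) (ℕₚ.*-monoʳ-≤ 2 count)) (quad-2 (e2 G) (∣ A ∣) (∣ used P ∣)))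
    where
    pt : ∀ g → 5 * 𝟙 (used P g) ≤ Face.len P g + (if g == f then 1 else 0)
    pt g with bcase (used P g) | g ≟ f
    ... | inj₂ ug | _ rewrite ug = z≤n
    ... | inj₁ ug | yes refl rewrite ug | ==-refl g = ℕₚ.+-monoˡ-≤ 1 (Face.len≥4 P g t z)
    ... | inj₁ ug | no ne rewrite ug | ≢→== ne = ℕₚ.≤-trans (decidable-stable (5 ≤? Face.len P g) (λ q → h (g , ne , ug , q))) (ℕₚ.m≤m+n _ 0)
    count : 5 * ∣ used P ∣ ≤ e2 G + 1
    count = ℕₚ.≤-trans (ℕₚ.≤-reflexive (sym (∑-* 5 (𝟙 ∘ used P)))) (ℕₚ.≤-trans (∑-mono pt)
       (ℕₚ.≤-reflexive (trans (∑-+ (Face.len P) (λ g → if g == f then 1 else 0)) (cong₂ _+_ (sum-len P) (∑-δ 1 f)))))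

-- Compared with Quads.sparse, 6 is lost to the edge deleted to destroy the triangle.
sparse-quads : ∀ {n} {G : Graph n} → Planarity G → OneTri G → ∀ {p q r s} → (∀ {a b c d} → C4 G a b c d → On p q r s a) →
  ∀ A → (∀ u v → E G u v → A u ≡ true) → 3 ≤ ∣ A ∣ → (12 + 3 * e2 G ≤ 10 * ∣ A ∣) ⊎ (e2 G ≤ 10)
sparse-quads {G = G} P U on A ia a3 with untri G U
... | H , H⊑ , t , le with edge? H
... | no h = inj₂ (ℕₚ.≤-trans le (ℕₚ.≤-trans (ℕₚ.+-monoˡ-≤ 2 (ℕₚ.≤-reflexive (e2-zero H λ u v e → h (u , v , e)))) (s≤s (s≤s z≤n))))
... | yes (u , v , e) with Quads.sparse (sub P H H⊑) t (on ∘ C4-⊑ {G = G} {H} H⊑) {A} e (λ u v e → ia u v (H⊑ u v e)) a3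
... | inj₂ (inj₁ b) = inj₂ (ℕₚ.≤-trans le (ℕₚ.+-monoˡ-≤ 2 b))
... | inj₁ b = inj₁ (farkas 0 (ℕₚ.+-mono-≤ (ℕₚ.*-monoʳ-≤ 3 le) b) (quad-3 (e2 G) (e2 H) (∣ A ∣)))
... | inj₂ (inj₂ b) = inj₁ (farkas 0 (ℕₚ.+-mono-≤ (ℕₚ.*-monoʳ-≤ 3 le) b) (quad-4 (e2 G) (e2 H) (∣ A ∣)))

ext-1 : ∀ e a → 1 + (10 * a + (3 * e + 4)) + 7 ≡ 0 + (12 + 3 * e + 10 * a)
ext-1 = solve-∀

ext-2 : ∀ e a → 1 + (3 * 10 + (3 * e + 4) + 10 * a) + 5 ≡ 0 + (3 * e + 10 * a + 10 * 4)
ext-2 = solve-∀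

ext-3 : ∀ a er r e → 10 * a + (10 * r + 3 * e + 10 * 4 + 3 * er) + 0 ≡ 3 * e + 10 + (10 * a + 3 * er + 6 + 10 * r + 3 * 8)
ext-3 = solve-∀

ext-4 : ∀ e a → 1 + (10 * a + (3 * e + 10)) + 1 ≡ 0 + (12 + 3 * e + 10 * a)
ext-4 = solve-∀

ext-5 : ∀ e a → 1 + (3 * 10 + (3 * e + 10) + 10 * a) + 9 ≡ 0 + (3 * e + 10 * a + 10 * 5)
ext-5 = solve-∀

-- Colourings extending a precoloured 4-cycle

-- A vertex with edges in both parts is a corner, where the two colourings agree.
glue-split : ∀ {n} {G : Graph n} {P : Planarity G} {a b c d} (S : Split P a b c d) (φ : Bool → Colouring n) →
  (∀ i → Proper (Split.part S i) (φ i)) → (∀ u → On a b c d u → φ false u ≡ φ true u) →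
  ∃ λ θ → Proper G θ × (∀ i {u v} → E (Split.part S i) u v → θ u ≡ φ i u)
glue-split {n} {G} S φ pr ag = θ , prop , same
  where
  open Split S
  has? : ∀ u → Dec (∃ λ v → E (part false) u v)
  has? u = Finₚ.any? λ v → E? (part false) u v
  θ : Colouring n
  θ u = if does (has? u) then φ false u else φ true u
  same : ∀ i {u v} → E (part i) u v → θ u ≡ φ i u
  same false {u} {v} e with has? u
  ... | yes _ = refl
  ... | no h = ⊥-elim (h (v , e))
  same true {u} {v} e with has? u
  ... | yes (w , f) = ag u (meet true {u} {v} {w} e f)
  ... | no _ = refl
  at : ∀ i {u v} → E (part i) u v → θ u ≢ θ v
  at i {u} {v} f z = pr i u v f (trans (sym (same i f)) (trans z (same i (E-sym (part i) {u} {v} f))))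
  prop : Proper G θ
  prop u v e with cover u v e
  ... | inj₁ f = at false f
  ... | inj₂ f = at true f

Precol : ∀ {n} → (a b c d : Fin n) → Colouring n → Set
Precol a b c d ψ = ∀ {u v} → CE a b c d u v → ψ u ≢ ψ v

Agree : ∀ {n} → Graph n → (a b c d : Fin n) → Colouring n → Set
Agree G a b c d ψ = ∃ λ φ → Proper G φ × (∀ u → On a b c d u → φ u ≡ ψ u)

Ext4 : ∀ {n} → Graph n → Set
Ext4 G = ∀ {a b c d} → C4 G a b c d → ∀ ψ → Precol a b c d ψ → Agree G a b c d ψ

Between : ∀ {n} → Graph n → (p q r s a c : Fin n) → Set
Between G p q r s a c = ∃ λ x → ∃ λ y → x ≢ y × On p q r s x × On p q r s y × E G a x × E G x c × E G c y × E G y a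

opposite : ∀ {n} {G : Graph n} {p q r s a c} → C4 G p q r s → On p q r s a → On p q r s c → a ≢ c → ¬ E G a c → Between G p q r s a c
opposite {G = G} {p} {q} {r} {s} {a} {c} C (inj₁ refl) = k
  where
  open C4 C
  k : On p q r s c → a ≢ c → ¬ E G a c → Between G p q r s a c
  k (inj₁ refl) ne _ = ⊥-elim (ne refl)
  k (inj₂ (inj₁ refl)) _ h = ⊥-elim (h ab)
  k (inj₂ (inj₂ (inj₁ refl))) _ _ = q , s , b≢d , inj₂ (inj₁ refl) , inj₂ (inj₂ (inj₂ refl)) , ab , bc , cd , da
  k (inj₂ (inj₂ (inj₂ refl))) _ h = ⊥-elim (h (E-sym G da))
opposite C (inj₂ (inj₁ refl)) o ne h = let (x , y , xy , ox , oy , e) = opposite (C4-rot C) (inj₁ refl) (On-rot o) ne h in x , y , xy , On-rot (On-rot (On-rot ox)) , On-rot (On-rot (On-rot oy)) , e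
opposite C (inj₂ (inj₂ (inj₁ refl))) o ne h = let (x , y , xy , ox , oy , e) = opposite (C4-rot (C4-rot C)) (inj₁ refl) (On-rot (On-rot o)) ne h in x , y , xy , On-rot (On-rot ox) , On-rot (On-rot oy) , e
opposite C (inj₂ (inj₂ (inj₂ refl))) o ne h = let (x , y , xy , ox , oy , e) = opposite (C4-rot (C4-rot (C4-rot C))) (inj₁ refl) (On-rot (On-rot (On-rot o))) ne h in x , y , xy , On-rot ox , On-rot oy , e

OneTri-quo : ∀ {n} {G : Graph n} → OneTri G → ∀ {a c} (a≢c : a ≢ c) (nac : ¬ E G a c) → ¬ Bad G a c → OneTri (merge G a c nac)
OneTri-quo {G = G} U {a} {c} a≢c nac nb T T' with Quotient.lift-Tri G a c a≢c nac nb T | Quotient.lift-Tri G a c a≢c nac nb T'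
... | _ , _ , _ , T₀ , refl , refl , refl | _ , _ , _ , T₁ , refl , refl , refl with U T₀ T₁
... | inj₁ e = inj₁ (cong (Quotient.quo G a c a≢c nac) e)
... | inj₂ (inj₁ e) = inj₂ (inj₁ (cong (Quotient.quo G a c a≢c nac) e))
... | inj₂ (inj₂ e) = inj₂ (inj₂ (cong (Quotient.quo G a c a≢c nac) e))

Bad-sym : ∀ {n} {G : Graph n} {a c} → Bad G a c → Bad G c a
Bad-sym {G = G} (s , t , as , st' , tc , at , sc) = t , s , E-sym G tc , E-sym G st' , E-sym G as , sc ∘ E-sym G , at ∘ E-sym G

-- At `x` both faces have the boundary edges `xa` and `xc`, so their union is constant around `x`.
-- Every edge at `x` therefore lies on one of the two faces, hence on one of the cycles.
two-quads : ∀ {n} {G : Graph n} (P : Planarity G) {a x c y y'} → C4 G a x c y → C4 G a x c y' → y ≢ y' →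
  Facial P a x c y → Facial P a x c y' → ∀ v → E G x v → (v ≡ a) ⊎ (v ≡ c)
two-quads {n} {G} P {a} {x} {c} {y} {y'} C C' yy' F F' v e = decideV (xor-two (side x v) f f' (trans (local σ x flat v a e xa) σa))
  where
  open Planarity P
  f = Facial.ℓ F
  f' = Facial.ℓ F'
  xa = E-sym G (C4.ab C)
  to-ac : ∀ {y v} → C4 G a x c y → CE a x c y x v → (v ≡ a) ⊎ (v ≡ c)
  to-ac D (inj₁ (inj₁ (z , _))) = ⊥-elim (E-irr G xa z)
  to-ac D (inj₁ (inj₂ (_ , z))) = inj₁ z
  to-ac D (inj₂ (inj₁ (inj₁ (_ , z)))) = inj₂ z
  to-ac D (inj₂ (inj₁ (inj₂ (z , _)))) = ⊥-elim (E-irr G (C4.bc C) z)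
  to-ac D (inj₂ (inj₂ (inj₁ (inj₁ (z , _))))) = ⊥-elim (E-irr G (C4.bc C) z)
  to-ac D (inj₂ (inj₂ (inj₁ (inj₂ (z , _))))) = ⊥-elim (C4.b≢d D z)
  to-ac D (inj₂ (inj₂ (inj₂ (inj₁ (z , _))))) = ⊥-elim (C4.b≢d D z)
  to-ac D (inj₂ (inj₂ (inj₂ (inj₂ (z , _))))) = ⊥-elim (E-irr G xa z)
  from-ac : ∀ {y v} → (v ≡ a) ⊎ (v ≡ c) → CE a x c y x v
  from-ac (inj₁ z) = inj₁ (inj₂ (refl , z))
  from-ac (inj₂ z) = inj₂ (inj₁ (inj₁ (refl , z)))
  bdx : ∀ v → E G x v → ∂ (_== f) x v ≡ ∂ (_== f') x v
  bdx v e = trans (Facial.bd F x v e) (trans (b-ext (λ z → cyc-i C' (from-ac (to-ac C (cyc-t a x c y x v z)))) (λ z → cyc-i C (from-ac (to-ac C' (cyc-t a x c y' x v z))))) (sym (Facial.bd F' x v e)))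
  y∉ : ¬ CE a x c y' a y
  y∉ (inj₁ (inj₁ (_ , z))) = C4.b≢d C (sym z)
  y∉ (inj₁ (inj₂ (z , _))) = E-irr G (C4.ab C) z
  y∉ (inj₂ (inj₁ (inj₁ (z , _)))) = E-irr G (C4.ab C) z
  y∉ (inj₂ (inj₁ (inj₂ (z , _)))) = C4.a≢c C z
  y∉ (inj₂ (inj₂ (inj₁ (inj₁ (z , _))))) = C4.a≢c C z
  y∉ (inj₂ (inj₂ (inj₁ (inj₂ (z , _))))) = E-irr G (C4.da C') (sym z)
  y∉ (inj₂ (inj₂ (inj₂ (inj₁ (z , _))))) = E-irr G (C4.da C') (sym z)
  y∉ (inj₂ (inj₂ (inj₂ (inj₂ (_ , z))))) = yy' z
  f≢f' : f ≢ f'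
  f≢f' q = y∉ (cyc-t a x c y' a y (trans (sym (Facial.bd F' a y (E-sym G (C4.da C)))) (trans (cong (λ z → ∂ (_== z) a y) (sym q)) (trans (Facial.bd F a y (E-sym G (C4.da C))) (cyc-i C (inj₂ (inj₂ (inj₂ (inj₂ (refl , refl))))))))))
  σ : Fin m → Bool
  σ z = (z == f) xor (z == f')
  flat : ∀ v → E G x v → σ (side x v) ≡ σ (side v x)
  flat v e = xor-f _ _ (trans (xor-4 (side x v == f) (side x v == f') (side v x == f) (side v x == f')) (trans (cong (_xor ∂ (_== f') x v) (bdx v e)) (Boolₚ.xor-same (∂ (_== f') x v))))
  ∂a : ∂ (_== f) x a ≡ true
  ∂a = trans (Facial.bd F x a xa) (cyc-i C (from-ac (inj₁ refl)))
  σa : σ (side x a) ≡ true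
  σa = two-of-xor (side x a) f f' f≢f' (both-sides (side x a) (side a x) f f' f≢f' ∂a (trans (sym (bdx a xa)) ∂a))
  decideV : (side x v ≡ f) ⊎ (side x v ≡ f') → (v ≡ a) ⊎ (v ≡ c)
  decideV (inj₁ z) = to-ac C (Facial.onC F x v e z)
  decideV (inj₂ z) = to-ac C' (Facial.onC F' x v e z)

dg-≤2 : ∀ {n} (G : Graph n) {x a c} → (∀ v → E G x v → (v ≡ a) ⊎ (v ≡ c)) → dg G x ≤ 2
dg-≤2 G {x} {a} {c} h = ℕₚ.≤-trans (card-mono {A = adj G x} {fromList (a ∷ c ∷ [])} λ v e → fromList∈ {xs = a ∷ c ∷ []} (case h v e of λ { (inj₁ p) → here p ; (inj₂ p) → there (here p) })) (card-fromList (a ∷ c ∷ []))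

module ExtStep {n} (G : Graph n) (P : Planarity G) (U : OneTri G) (IH : ∀ (H : Graph n) → Planarity H → OneTri H → 2 + e2 H ≤ e2 G → Ext4 H)
  {p q r s} (C : C4 G p q r s) (ψ : Colouring n) (pre : Precol p q r s ψ) where

  Goal : Set
  Goal = Agree G p q r s ψ

  On' : Fin n → Set
  On' = On p q r s

  sub-ext : ∀ H → H ⊑ G → 2 + e2 H ≤ e2 G → Ext4 H
  sub-ext H h lt = IH H (sub P H h) (OneTri-⊑ {H = H} {G} h U) lt

  part-ext : ∀ {a b c d} (S : Split P a b c d) i → Ext4 (Split.part S i)
  part-ext S i = sub-ext (Split.part S i) (Split.part-⊑ S i) (Split.smaller S i)

  split-here : Split P p q r s → Goal
  split-here S = let (θ , pr , same) = glue-split S (λ i → proj₁ (r' i)) (λ i → proj₁ (proj₂ (r' i))) (λ u o → trans (proj₂ (proj₂ (r' false)) u o) (sym (proj₂ (proj₂ (r' true)) u o)))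
    in θ , pr , λ u o → trans (same false (Split.cycle S false (proj₂ (On-edge o)))) (proj₂ (proj₂ (r' false)) u o)
    where
    r' : ∀ i → Agree (Split.part S i) p q r s ψ
    r' i = part-ext S i (C4-of {H = Split.part S i} C (Split.cycle S i)) ψ pre

  -- The part that is home to the face of `pqrs` contains the cycle `pqrs` as well. It is coloured
  -- first, and its colours on `abcd` are then extended into the other part.
  split-there : Facial P p q r s → ∀ {a b c d} → C4 G a b c d → Split P a b c d → Goal
  split-there F {a} {b} {c} {d} D S = go (proj₁ hm) (proj₁ r₁) (proj₁ (proj₂ r₁)) (proj₂ (proj₂ r₁)) inC r₂
    where
    hm = Split.home S (Facial.ℓ F)
    i = proj₁ hm
    inC : ∀ {u v} → CE p q r s u v → E (Split.part S i) u v
    inC {u} {v} ce with xor-any (trans (Facial.bd F u v (CE-E {G = G} C ce)) (cyc-i C ce))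
    ... | inj₁ z = proj₂ hm u v (CE-E {G = G} C ce) (==→≡ {i = Planarity.side P u v} {Facial.ℓ F} z)
    ... | inj₂ z = E-sym (Split.part S i) {v} {u} (proj₂ hm v u (E-sym G (CE-E {G = G} C ce)) (==→≡ {i = Planarity.side P v u} {Facial.ℓ F} z))
    r₁ = part-ext S i (C4-of {H = Split.part S i} C inC) ψ pre
    r₂ = part-ext S (not i) (C4-of {H = Split.part S (not i)} D (Split.cycle S (not i))) (proj₁ r₁) (λ {u} {v} ce → proj₁ (proj₂ r₁) u v (Split.cycle S i ce))
    go : ∀ i φ → Proper (Split.part S i) φ → (∀ u → On' u → φ u ≡ ψ u) → (∀ {u v} → CE p q r s u v → E (Split.part S i) u v) → Agree (Split.part S (not i)) a b c d φ → Goal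
    go false φ pr ag inn (φ' , pr' , ag') = let (θ , prθ , same) = glue-split S (λ { false → φ ; true → φ' }) (λ { false → pr ; true → pr' }) (λ u o → sym (ag' u o))
       in θ , prθ , λ u o → trans (same false (inn (proj₂ (On-edge o)))) (ag u o)
    go true φ pr ag inn (φ' , pr' , ag') = let (θ , prθ , same) = glue-split S (λ { false → φ' ; true → φ }) (λ { false → pr' ; true → pr }) (λ u o → ag' u o)
       in θ , prθ , λ u o → trans (same true (inn (proj₂ (On-edge o)))) (ag u o)

  low-vertex : ∀ {x y} → ¬ On' x → E G x y → dg G x ≤ 2 → Goal
  low-vertex {x} {y} nx e d2 = upd φ x k , extend-vertex G x φ k (λ u v p q e → proj₁ (proj₂ R) u v (isolate-i G p q e)) (proj₂ sm) ,
      λ u o → trans (upd-other φ k (λ { refl → nx o })) (proj₂ (proj₂ R) u o)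
    where
    R = sub-ext (isolate G x) (isolate-⊑ G x) (isolate-smaller G e) (C4-of {H = isolate G x} C (λ ce → isolate-i G (λ { refl → nx (CE-On ce) }) (λ { refl → nx (CE-On₂ ce) }) (CE-E {G = G} C ce))) ψ pre
    φ = proj₁ R
    sm = small-nbrs G x d2 φ
    k = proj₁ sm

  -- `c` disappears into `a`, so `c` must not be precoloured, whereas `a` may be.
  identify : ∀ {a b c d} → C4 G a b c d → Facial P a b c d → ¬ Bad G a c → ¬ On' c → Goal
  identify {a} {b} {c} {d} D F nb nc = proj₁ R ∘ quo , quo-proper (proj₁ (proj₂ R)) , λ u o → trans (cong (proj₁ R) (quo-o (λ { refl → nc o }))) (proj₂ (proj₂ R) u o)
    where
    nac = proj₁ (chordless U D)
    open Quotient G a c (C4.a≢c D) nac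
    R = IH (merge G a c nac) (merge-planar P D F nac) (OneTri-quo {G = G} U (C4.a≢c D) nac nb) (merge-smaller (C4.ab D) (E-sym G (C4.bc D)))
         (C4-of {H = merge G a c nac} C (λ ce → merge-old G a c nac (λ { refl → nc (CE-On ce) }) (λ { refl → nc (CE-On₂ ce) }) (CE-E {G = G} C ce))) ψ pre

  module Faced (F₀ : Facial P p q r s) (no-low : ∀ x y → ¬ On' x → E G x y → ¬ (dg G x ≤ 2)) where

    Off : (a b c d : Fin n) → Set
    Off a b c d = ∃ λ x → On a b c d x × ¬ On' x

    -- `a` and `c` are opposite precoloured corners and may carry different colours, so they cannot
    -- be identified. Instead the corners `y` and `y'` between them give the 4-cycles `a x c y` and
    -- `a x c y'`; if neither separates, `x` has degree at most 2.
    via-inner : ∀ {a c x} → On' a → On' c → a ≢ c → ¬ E G a c → ¬ On' x → E G a x → E G x c → Goal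
    via-inner {a} {c} {x} oa oc ac nac nx ax xc = go (opposite C oa oc ac nac)
      where
      go : Between G p q r s a c → Goal
      go (y , y' , yy' , oy , oy' , ay , yc , cy' , y'a) = fin (separation P D (chordless U D)) (separation P D' (chordless U D'))
        where
        D : C4 G a x c y
        D = c4 ax xc (E-sym G yc) (E-sym G ay) ac (λ { refl → nx oy })
        D' : C4 G a x c y'
        D' = c4 ax xc cy' y'a ac (λ { refl → nx oy' })
        fin : Facial P a x c y ⊎ Split P a x c y → Facial P a x c y' ⊎ Split P a x c y' → Goal
        fin (inj₂ S) _ = split-there F₀ D S
        fin _ (inj₂ S) = split-there F₀ D' S
        fin (inj₁ F) (inj₁ F') = ⊥-elim (no-low x a nx (E-sym G ax) (dg-≤2 G (two-quads P D D' yy' F F')))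

    good-diagonal : ∀ {a b c d} → C4 G a b c d → Facial P a b c d → Off a b c d → ¬ Bad G a c → Goal
    good-diagonal {a} {b} {c} {d} D F (x , ox , nx) nb with On? p q r s c
    ... | no nc = identify D F nb nc
    ... | yes oc with On? p q r s a
    ... | no na = identify (C4-rot (C4-rot D)) (Facial-rot (Facial-rot F)) (nb ∘ Bad-sym {G = G} {c} {a}) na
    ... | yes oa = k ox
      where
      nac = proj₁ (chordless U D)
      k : On a b c d x → Goal
      k (inj₁ refl) = ⊥-elim (nx oa)
      k (inj₂ (inj₁ refl)) = via-inner oa oc (C4.a≢c D) nac nx (C4.ab D) (C4.bc D)
      k (inj₂ (inj₂ (inj₁ refl))) = ⊥-elim (nx oc)
      k (inj₂ (inj₂ (inj₂ refl))) = via-inner oa oc (C4.a≢c D) nac nx (E-sym G (C4.da D)) (E-sym G (C4.cd D))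

    Off-rot : ∀ {a b c d} → Off a b c d → Off b c d a
    Off-rot (x , o , nx) = x , On-rot o , nx

    -- The 4-cycle `a z t' d` next to the fan either separates or, by `fan-good`, has a diagonal
    -- that can be identified.
    beside-fan : ∀ {a b c d} → C4 G a b c d → Facial P a b c d → (f : Fan G a b c d) → Off a (Fan.z f) (Fan.t' f) d → Goal
    beside-fan {a} {b} {c} {d} D F f off = go (separation P (fan-C4 U D f) (chordless U (fan-C4 U D f)))
      where
      face : Facial P a (Fan.z f) (Fan.t' f) d → Dec (Bad G a (Fan.t' f)) → Dec (Bad G (Fan.z f) d) → Goal
      face F₁ (no nb) _ = good-diagonal (fan-C4 U D f) F₁ off nb
      face F₁ (yes _) (no nb) = good-diagonal (C4-rot (fan-C4 U D f)) (Facial-rot F₁) (Off-rot off) nb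
      face F₁ (yes b₁) (yes b₂) = ⊥-elim (fan-good U D f P F F₁ b₁ b₂)
      go : Facial P a (Fan.z f) (Fan.t' f) d ⊎ Split P a (Fan.z f) (Fan.t' f) d → Goal
      go (inj₂ S) = split-there F₀ (fan-C4 U D f) S
      go (inj₁ F₁) = face F₁ (Bad? G a (Fan.t' f)) (Bad? G (Fan.z f) d)

    fanned : ∀ {a b c d} → C4 G a b c d → Facial P a b c d → Fan G a b c d → Goal
    fanned {a} {b} {c} {d} D F f with On? p q r s a | On? p q r s b | On? p q r s (Fan.z f)
    ... | no h | _ | _ = beside-fan D F f (_ , inj₁ refl , h)
    ... | _ | _ | no h = beside-fan D F f (_ , inj₂ (inj₁ refl) , h)
    -- `b` is not a corner of `a z t' d`, but it is one of the cycle beside the reflected fan.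
    ... | _ | no h | _ = beside-fan (C4-refl D) (Facial-refl F) (Fan-refl f) (_ , inj₁ refl , h)
    ... | yes oa | yes ob | yes oz = ⊥-elim (no-tri-on {G = G} (chordless U C) (On-CE {G = G} (chordless U C) oa ob (C4.ab D)) oz (E-sym G (Fan.za f)) (E-sym G (Fan.zb f)))

    quad : ∀ {a b c d} → C4 G a b c d → Off a b c d → Goal
    quad {a} {b} {c} {d} D off = go (separation P D (chordless U D))
      where
      fans : Facial P a b c d → Fan G a b c d ⊎ Fan G b c d a ⊎ Fan G c d a b ⊎ Fan G d a b c → Goal
      fans F (inj₁ f) = fanned D F f
      fans F (inj₂ (inj₁ f)) = fanned (C4-rot D) (Facial-rot F) f
      fans F (inj₂ (inj₂ (inj₁ f))) = fanned (C4-rot (C4-rot D)) (Facial-rot (Facial-rot F)) f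
      fans F (inj₂ (inj₂ (inj₂ f))) = fanned (C4-rot (C4-rot (C4-rot D))) (Facial-rot (Facial-rot (Facial-rot F))) f
      face : Facial P a b c d → Dec (Bad G a c) → Dec (Bad G b d) → Goal
      face F (no nb) _ = good-diagonal D F off nb
      face F (yes _) (no nb) = good-diagonal (C4-rot D) (Facial-rot F) (Off-rot off) nb
      face F (yes b₁) (yes b₂) = fans F (bad-fan P D (chordless U D) F b₁ b₂)
      go : Facial P a b c d ⊎ Split P a b c d → Goal
      go (inj₂ S) = split-there F₀ D S
      go (inj₁ F) = face F (Bad? G a c) (Bad? G b d)

  R : Sub n
  R = fromList (p ∷ q ∷ r ∷ s ∷ [])

  R-on : ∀ u → On' u → R u ≡ true
  R-on u o = fromL-On {a = p} {q} {r} {s} {u} o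

  ψ-R : Proper (G ↾ R) ψ
  ψ-R u v e with ↾-E {G = G} {R} {u} {v} e
  ... | a , b , f = pre (On-CE {G = G} (chordless U C) (On-fromL a) (On-fromL b) f)

  -- The 4-cycle has doubled potential 40 - 24 = 16, so the drop leaves 10, below the 12 of
  -- `sparse-quads`. In its exception `e2 ≤ 10`, five vertices have at least 50 - 30 = 20.
  bare : (∀ {a b c d} → C4 G a b c d → On' a) → Goal
  bare on with Extends? G R ψ
  ... | yes (φ , pr , ag) = φ , pr , λ u o → ag u (fromL-On o)
  ... | no nx with shrink G R ψ ψ-R nx
  ... | inj₁ (A , a4 , low , _) = ⊥-elim (contra (sparse-quads (sub P (G ↾ A) (↾-⊑ G A)) (OneTri-⊑ {H = G ↾ A} {G} (↾-⊑ G A) U) (on ∘ C4-⊑ {G = G} {G ↾ A} (↾-⊑ G A)) A (λ u v e → proj₁ (↾-E {G = G} {A} {u} {v} e)) (ℕₚ.≤-trans (ℕₚ.n≤1+n 3) a4)))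
    where
    contra : (12 + 3 * e2 (G ↾ A) ≤ 10 * ∣ A ∣) ⊎ (e2 (G ↾ A) ≤ 10) → ⊥
    contra (inj₁ b) = ℕₚ.<-irrefl refl (farkas {1} {0} 7 (ℕₚ.+-mono-≤ b low) (ext-1 (e2 (G ↾ A)) (∣ A ∣)))
    contra (inj₂ b) = ℕₚ.<-irrefl refl (farkas {1} {0} 5 (ℕₚ.+-mono-≤ (ℕₚ.+-mono-≤ (ℕₚ.*-monoʳ-≤ 3 b) low) (ℕₚ.*-monoʳ-≤ 10 a4)) (ext-2 (e2 (G ↾ A)) (∣ A ∣)))
  ... | inj₂ (R' , R⊆ , big , _ , g) = ⊥-elim (contra (sparse-quads (sub P (G ↾ R') (↾-⊑ G R')) (OneTri-⊑ {H = G ↾ R'} {G} (↾-⊑ G R') U) (on ∘ C4-⊑ {G = G} {G ↾ R'} (↾-⊑ G R')) R' (λ u v e → proj₁ (↾-E {G = G} {R'} {u} {v} e)) (ℕₚ.≤-trans (s≤s (s≤s (s≤s z≤n))) five)))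
    where
    five : 5 ≤ ∣ R' ∣
    five = ℕₚ.≤-trans (s≤s (card-list R {p ∷ q ∷ r ∷ s ∷ []} (C4-distinct C) (R-on p (inj₁ refl) ∷ R-on q (inj₂ (inj₁ refl)) ∷ R-on r (inj₂ (inj₂ (inj₁ refl))) ∷ R-on s (inj₂ (inj₂ (inj₂ refl))) ∷ []))) big
    low : 10 * ∣ R' ∣ ≤ 3 * e2 (G ↾ R') + 10
    low = farkas 0 (ℕₚ.+-mono-≤ (ℕₚ.+-mono-≤ g (ℕₚ.*-monoʳ-≤ 10 (card-fromList (p ∷ q ∷ r ∷ s ∷ []))))
          (ℕₚ.*-monoʳ-≤ 3 (e2-C4 (G ↾ R) (C4-of {H = G ↾ R} C (λ ce → ↾-i G {R} (fromL-On (CE-On ce)) (fromL-On (CE-On₂ ce)) (CE-E {G = G} C ce))))))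
          (ext-3 (∣ R' ∣) (e2 (G ↾ R)) (∣ R ∣) (e2 (G ↾ R')))
    contra : (12 + 3 * e2 (G ↾ R') ≤ 10 * ∣ R' ∣) ⊎ (e2 (G ↾ R') ≤ 10) → ⊥
    contra (inj₁ b) = ℕₚ.<-irrefl refl (farkas {1} {0} 1 (ℕₚ.+-mono-≤ b low) (ext-4 (e2 (G ↾ R')) (∣ R' ∣)))
    contra (inj₂ b) = ℕₚ.<-irrefl refl (farkas {1} {0} 9 (ℕₚ.+-mono-≤ (ℕₚ.+-mono-≤ (ℕₚ.*-monoʳ-≤ 3 b) low) (ℕₚ.*-monoʳ-≤ 10 five)) (ext-5 (e2 (G ↾ R')) (∣ R' ∣)))

  result : Goal
  result with separation P C (chordless U C)
  ... | inj₂ S = split-here S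
  ... | inj₁ F₀ with Finₚ.any? (λ x → Finₚ.any? λ y → ¬? (On? p q r s x) ×-dec E? G x y ×-dec (dg G x ≤? 2))
  ... | yes (x , y , nx , e , d2) = low-vertex nx e d2
  ... | no nl with Finₚ.any? (λ a → Finₚ.any? λ b → Finₚ.any? λ c → Finₚ.any? λ d → ¬? (On? p q r s a) ×-dec E? G a b ×-dec E? G b c ×-dec E? G c d ×-dec E? G d a ×-dec ¬? (a ≟ c) ×-dec ¬? (b ≟ d))
  ... | yes (a , b , c , d , na , ab , bc , cd , da , ac , bd) = Faced.quad F₀ (λ x y nx e d2 → nl (x , y , nx , e , d2)) (c4 ab bc cd da ac bd) (a , inj₁ refl , na)
  ... | no nq = bare (λ {a} {b} {c} {d} D → decidable-stable (On? p q r s a) (λ na → nq (a , b , c , d , na , C4.ab D , C4.bc D , C4.cd D , C4.da D , C4.a≢c D , C4.b≢d D)))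

extend-quad : ∀ k {n} (G : Graph n) → Planarity G → OneTri G → e2 G ≤ k → Ext4 G
extend-quad zero G P U h C ψ pre = case ℕₚ.≤-trans (e2-C4 G C) h of λ ()
extend-quad (suc k) G P U h C ψ pre = ExtStep.result G P U (λ H PH UH lt → extend-quad k H PH UH (ℕₚ.≤-pred (ℕₚ.≤-trans (ℕₚ.n≤1+n _) (ℕₚ.≤-trans lt h)))) C ψ pre

-- Three-colourability and vertices of small degree

deg-1 : ∀ e a → 1 + (10 * a + (3 * e + 4)) + 7 ≡ 0 + (12 + 3 * e + 10 * a)
deg-1 = solve-∀

deg-2 : ∀ e a → 1 + (3 * 10 + (3 * e + 4) + 10 * a) + 5 ≡ 0 + (3 * e + 10 * a + 10 * 4)
deg-2 = solve-∀

deg-3 : ∀ e a → 1 + (4 * a + e) + 7 ≡ 0 + (8 + e + 4 * a)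
deg-3 = solve-∀

-- Grötzsch's theorem with one triangle allowed. Two alternating colours on a 4-cycle extend to the
-- graph; without 4-cycles, an obstruction of doubled potential at most 4 violates both alternatives
-- of `sparse-quads`.
plain : ∀ {n} (G : Graph n) → Planarity G → OneTri G → Col G
plain {n} G P U with Finₚ.any? (λ a → Finₚ.any? λ b → Finₚ.any? λ c → Finₚ.any? λ d → E? G a b ×-dec E? G b c ×-dec E? G c d ×-dec E? G d a ×-dec ¬? (a ≟ c) ×-dec ¬? (b ≟ d))
... | yes (a , b , c , d , ab , bc , cd , da , ac , bd) = let (φ , pr , _) = extend-quad (e2 G) G P U ℕₚ.≤-refl (c4 ab bc cd da ac bd) ψ pre in φ , pr
  where
  ψ : Colouring n
  ψ u = if (u == a) ∨ (u == c) then zero else suc zero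
  ψ-in : ∀ {u} → (u ≡ a) ⊎ (u ≡ c) → ψ u ≡ zero
  ψ-in (inj₁ refl) rewrite ==-refl a = refl
  ψ-in (inj₂ refl) rewrite ==-refl c | Boolₚ.∨-zeroʳ (c == a) = refl
  ψ-out : ∀ {u} → u ≢ a → u ≢ c → ψ u ≡ suc zero
  ψ-out p q rewrite ≢→== p | ≢→== q = refl
  ψb : ψ b ≡ suc zero
  ψb = ψ-out (E-irr G ab ∘ sym) (E-irr G bc)
  ψd : ψ d ≡ suc zero
  ψd = ψ-out (E-irr G da) (E-irr G cd ∘ sym)
  split : ∀ {i j : Fin 3} → i ≡ zero → j ≡ suc zero → i ≢ j
  split p q e = case trans (sym p) (trans e q) of λ ()
  pre : Precol a b c d ψ
  pre (inj₁ (inj₁ (refl , refl))) = split (ψ-in (inj₁ refl)) ψb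
  pre (inj₁ (inj₂ (refl , refl))) = split (ψ-in (inj₁ refl)) ψb ∘ sym
  pre (inj₂ (inj₁ (inj₁ (refl , refl)))) = split (ψ-in (inj₂ refl)) ψb ∘ sym
  pre (inj₂ (inj₁ (inj₂ (refl , refl)))) = split (ψ-in (inj₂ refl)) ψb
  pre (inj₂ (inj₂ (inj₁ (inj₁ (refl , refl))))) = split (ψ-in (inj₂ refl)) ψd
  pre (inj₂ (inj₂ (inj₁ (inj₂ (refl , refl))))) = split (ψ-in (inj₂ refl)) ψd ∘ sym
  pre (inj₂ (inj₂ (inj₂ (inj₁ (refl , refl))))) = split (ψ-in (inj₁ refl)) ψd ∘ sym
  pre (inj₂ (inj₂ (inj₂ (inj₂ (refl , refl))))) = split (ψ-in (inj₁ refl)) ψd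
... | no nq with Col? G
... | yes c = c
... | no nc with ky n G (λ _ → true) (ℕₚ.≤-reflexive (∑-1 n)) (λ { (φ , pr) → nc (φ , λ u v e → pr u v (↾-i G {λ _ → true} refl refl e)) })
... | A , _ , _ , a4 , low = ⊥-elim (contra (sparse-quads (sub P (G ↾ A) (↾-⊑ G A)) (OneTri-⊑ {H = G ↾ A} {G} (↾-⊑ G A) U) {p} {p} {p} {p} (λ C → ⊥-elim (none (C4-⊑ {G = G} {G ↾ A} (↾-⊑ G A) C))) A (λ u v e → proj₁ (↾-E {G = G} {A} {u} {v} e)) (ℕₚ.≤-trans (ℕₚ.n≤1+n 3) a4)))
  where
  p = proj₁ (card-pos A (ℕₚ.≤-trans (s≤s z≤n) a4))
  none : ∀ {a b c d} → ¬ C4 G a b c d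
  none (c4 ab bc cd da ac bd) = nq (_ , _ , _ , _ , ab , bc , cd , da , ac , bd)
  contra : (12 + 3 * e2 (G ↾ A) ≤ 10 * ∣ A ∣) ⊎ (e2 (G ↾ A) ≤ 10) → ⊥
  contra (inj₁ b) = ℕₚ.<-irrefl refl (farkas {1} {0} 7 (ℕₚ.+-mono-≤ b low) (deg-1 (e2 (G ↾ A)) (∣ A ∣)))
  contra (inj₂ b) = ℕₚ.<-irrefl refl (farkas {1} {0} 5 (ℕₚ.+-mono-≤ (ℕₚ.+-mono-≤ (ℕₚ.*-monoʳ-≤ 3 b) low) (ℕₚ.*-monoʳ-≤ 10 a4)) (deg-2 (e2 (G ↾ A)) (∣ A ∣)))

active? : ∀ {n} (G : Graph n) u → Dec (∃ λ v → E G u v)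
active? G u = Finₚ.any? (E? G u)

active : ∀ {n} → Graph n → Sub n
active G u = does (active? G u)

active-i : ∀ {n} (G : Graph n) {u v} → E G u v → active G u ≡ true
active-i G {u} {v} e with active? G u
... | yes _ = refl
... | no h = ⊥-elim (h (v , e))

active-t : ∀ {n} (G : Graph n) {u} → active G u ≡ true → ∃ λ v → E G u v
active-t G {u} e = decide (active? G u) e

-- Degrees of at least 4 would give 4v ≤ 2e, against e ≤ 2v - 4.
low-degree : ∀ {n} {G : Graph n} → Planarity G → TriFree G → ∀ {x y} → E G x y → ∃ λ v → ∃ λ w → E G v w × dg G v ≤ 3
low-degree {n} {G} P t {x} {y} e with Finₚ.any? (λ v → Finₚ.any? λ w → E? G v w ×-dec (dg G v ≤? 3))
... | yes r = r
... | no h = ⊥-elim (ℕₚ.<-irrefl refl (farkas {1} {0} 7 (ℕₚ.+-mono-≤ (upper P t {A} e (λ u v e → active-i G e) (ℕₚ.≤-trans (ℕₚ.n≤1+n 3) (ℕₚ.≤-trans (four e) (card-mono {A = adj G x} {A} λ v f → active-i G (E-sym G f))))) many) (deg-3 (e2 G) (∣ A ∣))))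
  where
  A = active G
  four : ∀ {u v} → E G u v → 4 ≤ dg G u
  four {u} {v} e = ℕₚ.≰⇒> λ d → h (u , v , e , d)
  pt : ∀ u → 4 * 𝟙 (A u) ≤ dg G u
  pt u with bcase (A u)
  ... | inj₁ a rewrite a = four (proj₂ (active-t G a))
  ... | inj₂ a rewrite a = z≤n
  many : 4 * ∣ A ∣ ≤ e2 G
  many = ℕₚ.≤-trans (ℕₚ.≤-reflexive (sym (∑-* 4 (𝟙 ∘ A)))) (∑-mono pt)

On-two : ∀ {n} {G : Graph n} {a b c d u} → C4 G a b c d → On a b c d u → ∃ λ x → ∃ λ y → x ≢ y × E G u x × E G u y × On a b c d x × On a b c d y
On-two {G = G} {a} {b} {c} {d} (c4 ab bc cd da p q) (inj₁ refl) = b , d , q , ab , E-sym G da , inj₂ (inj₁ refl) , inj₂ (inj₂ (inj₂ refl))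
On-two {G = G} {a} {b} {c} {d} (c4 ab bc cd da p q) (inj₂ (inj₁ refl)) = a , c , p , E-sym G ab , bc , inj₁ refl , inj₂ (inj₂ (inj₁ refl))
On-two {G = G} {a} {b} {c} {d} (c4 ab bc cd da p q) (inj₂ (inj₂ (inj₁ refl))) = b , d , q , E-sym G bc , cd , inj₂ (inj₁ refl) , inj₂ (inj₂ (inj₂ refl))
On-two {G = G} {a} {b} {c} {d} (c4 ab bc cd da p q) (inj₂ (inj₂ (inj₂ refl))) = a , c , p , da , E-sym G cd , inj₁ refl , inj₂ (inj₂ (inj₁ refl))

-- If no edge leaves the cycle, `low-degree` applies to the rest. Otherwise k inner vertices of
-- degree at least 4, four corners of degree at least 2 and one edge leaving the cycle give a degree
-- sum of at least 4k + 9, while Euler's formula allows 4(k + 4) - 8.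
inner-low : ∀ {n} {G : Graph n} → Planarity G → TriFree G → ∀ {a b c d} → C4 G a b c d → ∀ {x y} → ¬ On a b c d x → E G x y →
  ∃ λ v → ∃ λ w → ¬ On a b c d v × E G v w × dg G v ≤ 3
inner-low {n} {G} P t {a} {b} {c} {d} C {x} {y} nx xy with Finₚ.any? (λ v → Finₚ.any? λ w → ¬? (On? a b c d v) ×-dec E? G v w ×-dec (dg G v ≤? 3))
... | yes r = r
... | no h with Finₚ.any? (λ z → Finₚ.any? λ w → On? a b c d z ×-dec ¬? (On? a b c d w) ×-dec E? G z w)
... | no nc = ⊥-elim (h (v , w , nv , proj₂ (proj₂ (↾-E {G = G} {O} {v} {w} vw)) , ℕₚ.≤-trans (∑-mono {f = 𝟙 ∘ adj G v} {𝟙 ∘ adj H v} λ u → 𝟙-mono (λ e → ↾-i G {O} Ov (out nv e) e)) d3))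
  where
  O : Sub n
  O u = not (does (On? a b c d u))
  O-i : ∀ {u} → ¬ On a b c d u → O u ≡ true
  O-i {u} h = k (On? a b c d u)
    where k : ∀ (r : Dec (On a b c d u)) → not (does r) ≡ true
          k (yes o) = ⊥-elim (h o)
          k (no _) = refl
  O-t : ∀ {u} → O u ≡ true → ¬ On a b c d u
  O-t {u} = k (On? a b c d u)
    where k : ∀ (r : Dec (On a b c d u)) → not (does r) ≡ true → ¬ On a b c d u
          k (no h) _ = h
  H = G ↾ O
  out : ∀ {u v} → ¬ On a b c d u → E G u v → O v ≡ true
  out {u} {v} nu e = O-i λ o → nc (v , u , o , nu , E-sym G e)
  ld = low-degree (sub P H (↾-⊑ G O)) (TriFree-⊑ {H = H} {G} (↾-⊑ G O) t) {x} {y} (↾-i G {O} (O-i nx) (out nx xy) xy)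
  v = proj₁ ld
  w = proj₁ (proj₂ ld)
  vw = proj₁ (proj₂ (proj₂ ld))
  d3 = proj₂ (proj₂ (proj₂ ld))
  Ov = proj₁ (↾-E {G = G} {O} {v} {w} vw)
  nv = O-t Ov
... | yes (z , w , oz , nw , zw) = ⊥-elim (ℕₚ.<-irrefl refl (farkas {1} {0} 0 (ℕₚ.+-mono-≤ (ℕₚ.+-mono-≤ (upper P t {A} xy inA a3) (ℕₚ.*-monoʳ-≤ 4 cA)) many) (lem (e2 G) (∣ A ∣) (∣ K ∣) (∣ B ∣) cB)))
  where
  B K A : Sub n
  B = fromList (a ∷ b ∷ c ∷ d ∷ [])
  K u = active G u ∧ not (B u)
  A u = K u ∨ B u
  B-on : ∀ u → On a b c d u → B u ≡ true
  B-on u o = fromL-On {a = a} {b} {c} {d} {u} o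
  B4 : 4 ≤ ∣ B ∣
  B4 = card-list B {a ∷ b ∷ c ∷ d ∷ []} (C4-distinct C) (B-on a (inj₁ refl) ∷ B-on b (inj₂ (inj₁ refl)) ∷ B-on c (inj₂ (inj₂ (inj₁ refl))) ∷ B-on d (inj₂ (inj₂ (inj₂ refl))) ∷ [])
  cB : ∣ B ∣ ≡ 4
  cB = ℕₚ.≤-antisym (card-fromList (a ∷ b ∷ c ∷ d ∷ [])) B4
  a3 : 3 ≤ ∣ A ∣
  a3 = ℕₚ.≤-trans (ℕₚ.n≤1+n 3) (ℕₚ.≤-trans B4 (card-mono {A = B} {A} λ u e → ∨-ir {K u} e))
  cA : ∣ A ∣ ≤ ∣ K ∣ + ∣ B ∣
  cA = ℕₚ.≤-trans (∑-mono {f = 𝟙 ∘ A} {λ u → 𝟙 (K u) + 𝟙 (B u)} λ u → k (K u) (B u)) (ℕₚ.≤-reflexive (∑-+ (𝟙 ∘ K) (𝟙 ∘ B)))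
    where k : ∀ p q → 𝟙 (p ∨ q) ≤ 𝟙 p + 𝟙 q
          k true q = s≤s z≤n
          k false q = ℕₚ.≤-refl
  inA : ∀ u v → E G u v → A u ≡ true
  inA u v e with bcase (B u)
  ... | inj₁ p = ∨-ir {K u} p
  ... | inj₂ p = ∨-il (∧-i (active-i G e) (cong not p))
  pt : ∀ u → 4 * 𝟙 (K u) + 2 * 𝟙 (B u) + (if u == z then 1 else 0) ≤ dg G u
  pt u with bcase (B u)
  ... | inj₁ p rewrite p | Boolₚ.∧-zeroʳ (active G u) with u ≟ z | On-two C (On-fromL {a = a} {b} {c} {d} p)
  ... | yes refl | x' , y' , ne , e , e' , ox , oy rewrite ==-refl u = dg-≥ G u {w ∷ x' ∷ y' ∷ []} (((λ { refl → nw ox }) ∷ (λ { refl → nw oy }) ∷ []) ∷ (ne ∷ []) ∷ [] ∷ []) (zw ∷ e ∷ e' ∷ [])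
  ... | no uz | x' , y' , ne , e , e' , ox , oy rewrite ≢→== uz = dg-≥ G u {x' ∷ y' ∷ []} ((ne ∷ []) ∷ [] ∷ []) (e ∷ e' ∷ [])
  pt u | inj₂ p rewrite p | ≢→== {i = u} {z} (λ { refl → tf (B-on z oz) p }) with bcase (active G u)
  ... | inj₂ q rewrite q = z≤n
  ... | inj₁ q rewrite q = ℕₚ.≰⇒> λ d3 → h (u , proj₁ (active-t G q) , (λ o → tf (B-on u o) p) , proj₂ (active-t G q) , d3)
  many : 4 * ∣ K ∣ + 2 * ∣ B ∣ + 1 ≤ e2 G
  many = ℕₚ.≤-trans (ℕₚ.≤-reflexive (sym (trans (∑-+ (λ u → 4 * 𝟙 (K u) + 2 * 𝟙 (B u)) (λ u → if u == z then 1 else 0)) (cong₂ _+_ (trans (∑-+ (λ u → 4 * 𝟙 (K u)) (λ u → 2 * 𝟙 (B u))) (cong₂ _+_ (∑-* 4 (𝟙 ∘ K)) (∑-* 2 (𝟙 ∘ B)))) (∑-δ 1 z))))) (∑-mono pt)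
  lem : ∀ e a k b → b ≡ 4 → 1 + (4 * a + 4 * (k + b) + e) + 0 ≡ 0 + (8 + e + 4 * a + (4 * k + 2 * b + 1))
  lem e a k .4 refl = l e a k
    where l : ∀ e a k → 1 + (4 * a + 4 * (k + 4) + e) + 0 ≡ 0 + (8 + e + 4 * a + (4 * k + 2 * 4 + 1))
          l = solve-∀

-- Reductions for adynamic colourings

HypAt : ∀ {n} → Graph n → Fin n → Set
HypAt G v = 2 ≤ dg G v × (∀ u w → E G v u → E G v w → ¬ E G u w)

HypAt? : ∀ {n} (G : Graph n) v → Dec (HypAt G v)
HypAt? G v = (2 ≤? dg G v) ×-dec Finₚ.all? (λ u → Finₚ.all? λ w → E? G v u →-dec E? G v w →-dec ¬? (E? G u w))

Adynamic : ∀ {n} → Graph n → Set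
Adynamic G = ∃ λ φ → Proper G φ × ∃ λ v → 2 ≤ dg G v × Mono G v φ

-- A pendant vertex u can be given the colour of the other neighbours of its neighbour.
pendant : ∀ {n} {G : Graph n} → Planarity G → OneTri G → ∀ {u} → dg G u ≡ 1 → ∃ (HypAt G) →
  (∃ (HypAt (isolate G u)) → Adynamic (isolate G u)) → Adynamic G
pendant {n} {G} P U {u} d1 (v , d2 , ind) IH with nbr-of G u (ℕₚ.≤-reflexive (sym d1))
... | p , up = go (2 ≤? dg H v)
  where
  H = isolate G u
  only : ∀ w → E G u w → w ≡ p
  only w e with w ≟ p
  ... | yes q = q
  ... | no ne = ⊥-elim (ℕₚ.<-irrefl refl (ℕₚ.≤-trans (dg-≥ G u {w ∷ p ∷ []} ((ne ∷ []) ∷ [] ∷ []) (e ∷ up ∷ [])) (ℕₚ.≤-reflexive d1)))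
  colour : ∀ {φ} → Proper H φ → ∀ k → φ p ≢ k → Proper G (upd φ u k)
  colour pr k ne = extend-vertex G u _ k (λ x y a b e → pr x y (isolate-i G a b e)) λ w e q → ne (trans (cong _ (sym (only w e))) q)
  go : Dec (2 ≤ dg H v) → Adynamic G
  go (yes h2) with IH (v , h2 , λ x w e f g → ind x w (isolate-⊑ G u v x e) (isolate-⊑ G u v w f) (isolate-⊑ G u x w g))
  ... | φ , pr , v' , e2' , mo = fin (p ≟ v')
    where
    x = proj₁ (two-of H v' e2')
    ex : E H v' x
    ex = proj₁ (proj₂ (proj₂ (proj₂ (two-of H v' e2'))))
    dG : 2 ≤ dg G v'
    dG = ℕₚ.≤-trans e2' (dg-mono {H = H} {G} (isolate-⊑ G u) v')
    v'u : v' ≢ u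
    v'u refl = isolate-no G x ex
    fin : Dec (p ≡ v') → Adynamic G
    fin (yes refl) = upd φ u (φ x) , colour pr (φ x) (pr p x ex) , p , dG , λ a b ea eb → trans (at a ea) (sym (at b eb))
      where at : ∀ a → E G p a → upd φ u (φ x) a ≡ φ x
            at a e with a ≟ u
            ... | yes refl = upd-same φ u (φ x)
            ... | no ne = trans (upd-other φ (φ x) ne) (mo a x (isolate-i G v'u ne e) ex)
    fin (no ne) with avoid2 (φ p) (φ p)
    ... | k , pk , _ = upd φ u k , colour pr k pk , v' , dG , λ a b ea eb → trans (at a ea) (trans (mo a b (isolate-i G v'u (nu ea) ea) (isolate-i G v'u (nu eb) eb)) (sym (at b eb)))
      where nu : ∀ {a} → E G v' a → a ≢ u
            nu e refl = ne (sym (only v' (E-sym G e)))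
            at : ∀ a → E G v' a → upd φ u k a ≡ φ a
            at a e = upd-other φ k (nu e)
  go (no h2) with two-of G v d2
  ... | a , b , ab , va , vb with plain H (sub P H (isolate-⊑ G u)) (OneTri-⊑ {H = H} {G} (isolate-⊑ G u) U)
  ... | φ , pr = fin (a ≟ u) (b ≟ u)
    where
    vu : v ≢ u
    vu refl = ℕₚ.<-irrefl refl (ℕₚ.≤-trans d2 (ℕₚ.≤-reflexive d1))
    with-q : ∀ {q} → E G v u → E G v q → q ≢ u → Adynamic G
    with-q {q} vu' vq qu = upd φ u (φ q) , colour pr (φ q) (λ z → pr v q (isolate-i G vu qu vq) (trans (cong φ (only v (E-sym G vu'))) z)) , v , d2 , λ a b ea eb → trans (at a ea) (sym (at b eb))
      where at : ∀ a → E G v a → upd φ u (φ q) a ≡ φ q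
            at a e with a ≟ u | a ≟ q
            ... | yes refl | _ = upd-same φ u (φ q)
            ... | no ne | yes refl = upd-other φ (φ q) ne
            ... | no ne | no aq = ⊥-elim (h2 (dg-≥ H v {a ∷ q ∷ []} ((aq ∷ []) ∷ [] ∷ []) (isolate-i G vu ne e ∷ isolate-i G vu qu vq ∷ [])))
    fin : Dec (a ≡ u) → Dec (b ≡ u) → Adynamic G
    fin (yes refl) _ = with-q va vb (ab ∘ sym)
    fin (no au) (yes refl) = with-q vb va au
    fin (no au) (no bu) = ⊥-elim (h2 (dg-≥ H v {a ∷ b ∷ []} ((ab ∷ []) ∷ [] ∷ []) (isolate-i G vu au va ∷ isolate-i G vu bu vb ∷ [])))

-- Triangles in both parts would by uniqueness have the same corners. These would lie in both parts,
-- hence on the cycle, which has no chords.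
split-trifree : ∀ {n} {G : Graph n} {P : Planarity G} (U : OneTri G) {a b c d} → C4 G a b c d → (S : Split P a b c d) → ∃ λ i → TriFree (Split.part S i)
split-trifree {n} {G} U {a} {b} {c} {d} C S with tri? (Split.part S false)
... | no h = false , λ x y z t → h (x , y , z , t)
... | yes (x , y , z , xy , yz , xz) = true , clash
  where
  open Split S
  clash : TriFree (part true)
  clash x' y' z' (xy' , yz' , xz') = no-tri-on {G = G} (chordless U C) (On-CE {G = G} (chordless U C) (on T) (on T') (part-⊑ true x' y' xy')) (on T'') (part-⊑ true x' z' xz') (part-⊑ true y' z' yz')
    where
    up : ∀ {p q r} → Tri (part true) p q r → Tri G p q r
    up (e , f , g) = part-⊑ true _ _ e , part-⊑ true _ _ f , part-⊑ true _ _ g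
    on : ∀ {p q r} → Tri (part true) p q r → On a b c d p
    on {p} {q} T@(e , _) with U (part-⊑ false x y xy , part-⊑ false y z yz , part-⊑ false x z xz) (up T)
    ... | inj₁ refl = meet false {p} {y} {q} xy e
    ... | inj₂ (inj₁ refl) = meet false {p} {z} {q} yz e
    ... | inj₂ (inj₂ refl) = meet false {p} {y} {q} (E-sym (part false) {y} {p} yz) e
    sy = λ {u v} → E-sym (part true) {u} {v}
    T = xy' , yz' , xz'
    T' = sy xy' , xz' , yz'
    T'' = sy xz' , xy' , sy yz'

-- In the triangle-free part a vertex of degree at most 3 off the cycle gets a monochromatic
-- neighbourhood. The colours of the cycle extend into the other part, which has no edge at this
-- vertex.
split-adynamic : ∀ {n} {G : Graph n} (P : Planarity G) (U : OneTri G) → (∀ v w → E G v w → 2 ≤ dg G v) → ∀ {a b c d} → C4 G a b c d → Split P a b c d → Adynamic G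
split-adynamic {n} {G} P U d2 {a} {b} {c} {d} C S = go i φ₁ pr₁ v mo₁ w nv vw (proj₁ r₂) (proj₁ (proj₂ r₂)) (proj₂ (proj₂ r₂))
  where
  open Split S
  it = split-trifree {P = P} U C S
  i = proj₁ it
  Ci : ∀ i → C4 (part i) a b c d
  Ci i = C4-of {H = part i} C (cycle i)
  x = inner i
  low = inner-low (sub P (part i) (part-⊑ i)) (proj₂ it) (Ci i) {proj₁ x} {proj₁ (proj₂ x)} (proj₂ (proj₂ (proj₂ x))) (proj₁ (proj₂ (proj₂ x)))
  v = proj₁ low
  w = proj₁ (proj₂ low)
  nv = proj₁ (proj₂ (proj₂ low))
  vw = proj₁ (proj₂ (proj₂ (proj₂ low)))
  r₁ = mono-nbhd (e2 (part i)) (part i) (sub P (part i) (part-⊑ i)) (proj₂ it) ℕₚ.≤-refl v (proj₂ (proj₂ (proj₂ (proj₂ low))))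
  φ₁ = proj₁ r₁
  pr₁ = proj₁ (proj₂ r₁)
  mo₁ = proj₂ (proj₂ r₁)
  r₂ = extend-quad (e2 (part (not i))) (part (not i)) (sub P (part (not i)) (part-⊑ (not i))) (OneTri-⊑ {H = part (not i)} {G} (part-⊑ (not i)) U) ℕₚ.≤-refl (Ci (not i)) φ₁ (λ {u} {v} ce → pr₁ u v (cycle i ce))
  glued : ∀ i φ → Proper (part i) φ → ∀ φ' → Proper (part (not i)) φ' → (∀ u → On a b c d u → φ' u ≡ φ u) → ∃ λ θ → Proper G θ × (∀ {u v} → E (part i) u v → θ u ≡ φ u)
  glued false φ pr φ' pr' ag = let (θ , p , s) = glue-split S (λ { false → φ ; true → φ' }) (λ { false → pr ; true → pr' }) (λ u o → sym (ag u o)) in θ , p , s false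
  glued true φ pr φ' pr' ag = let (θ , p , s) = glue-split S (λ { false → φ' ; true → φ }) (λ { false → pr' ; true → pr }) (λ u o → ag u o) in θ , p , s true
  cover' : ∀ i {u v} → E G u v → E (part i) u v ⊎ E (part (not i)) u v
  cover' false {u} {v} e = cover u v e
  cover' true {u} {v} e with cover u v e
  ... | inj₁ z = inj₂ z
  ... | inj₂ z = inj₁ z
  go : ∀ i φ → Proper (part i) φ → ∀ v → Mono (part i) v φ → ∀ w → ¬ On a b c d v → E (part i) v w → ∀ φ' → Proper (part (not i)) φ' → (∀ u → On a b c d u → φ' u ≡ φ u) → Adynamic G
  go i φ pr v mo w nv vw φ' pr' ag = let (θ , p , s) = glued i φ pr φ' pr' ag in θ , p , v , d2 v w (part-⊑ i v w vw) ,
      λ x y ex ey → trans (s (E-sym (part i) {v} {x} (inn ex))) (trans (mo x y (inn ex) (inn ey)) (sym (s (E-sym (part i) {v} {y} (inn ey)))))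
    where inn : ∀ {x} → E G v x → E (part i) v x
          inn {x} e with cover' i {v} {x} e
          ... | inj₁ z = z
          ... | inj₂ z = ⊥-elim (nv (meet i {v} {w} {x} vw z))

-- If both diagonals of a 4-face are bad there is a fan, and `fan-good` applies to the 4-cycle
-- beside it, which is again a face.
unobstructed : ∀ {n} {G : Graph n} (P : Planarity G) (U : OneTri G) → (∀ {a b c d} → C4 G a b c d → Facial P a b c d) →
  ∀ {a b c d} → C4 G a b c d → ∃ λ a → ∃ λ b → ∃ λ c → ∃ λ d → C4 G a b c d × Facial P a b c d × ¬ Bad G a c
unobstructed {G = G} P U fac {a} {b} {c} {d} D with Bad? G a c | Bad? G b d
... | no nb | _ = _ , _ , _ , _ , D , fac D , nb
... | yes _ | no nb = _ , _ , _ , _ , C4-rot D , fac (C4-rot D) , nb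
... | yes b₁ | yes b₂ = go (bad-fan P D (chordless U D) (fac D) b₁ b₂)
  where
  Result = ∃ λ a → ∃ λ b → ∃ λ c → ∃ λ d → C4 G a b c d × Facial P a b c d × ¬ Bad G a c
  beside : ∀ {a b c d} → C4 G a b c d → Fan G a b c d → Result
  beside {a} {b} {c} {d} D f with Bad? G a (Fan.t' f) | Bad? G (Fan.z f) d
  ... | no nb | _ = _ , _ , _ , _ , fan-C4 U D f , fac (fan-C4 U D f) , nb
  ... | yes _ | no nb = _ , _ , _ , _ , C4-rot (fan-C4 U D f) , fac (C4-rot (fan-C4 U D f)) , nb
  ... | yes b₁ | yes b₂ = ⊥-elim (fan-good U D f P (fac D) (fac (fan-C4 U D f)) b₁ b₂)
  go : Fan G a b c d ⊎ Fan G b c d a ⊎ Fan G c d a b ⊎ Fan G d a b c → Result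
  go (inj₁ f) = beside D f
  go (inj₂ (inj₁ f)) = beside (C4-rot D) f
  go (inj₂ (inj₂ (inj₁ f))) = beside (C4-rot (C4-rot D)) f
  go (inj₂ (inj₂ (inj₂ f))) = beside (C4-rot (C4-rot (C4-rot D))) f

-- If the quotient has no vertex to which the induction applies, then one of the corners b, d has only a and c as neighbours.
merge-adynamic : ∀ {n} {G : Graph n} (P : Planarity G) (U : OneTri G) → ∀ {a b c d} → C4 G a b c d → Facial P a b c d → ¬ Bad G a c →
  (∀ (H : Graph n) → Planarity H → OneTri H → 2 + e2 H ≤ e2 G → ∃ (HypAt H) → Adynamic H) → Adynamic G
merge-adynamic {n} {G} P U {a} {b} {c} {d} D F nb IH = go (Finₚ.any? (HypAt? M))
  where
  module D = C4 D
  nac = proj₁ (chordless U D)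
  M = merge G a c nac
  open Quotient G a c D.a≢c nac
  PM = merge-planar P D F nac
  UM : OneTri M
  UM = OneTri-quo {G = G} U D.a≢c nac nb
  up : ∀ {v u} → v ≢ c → E G v u → E M v (quo u)
  up {v} {u} vc e = subst (λ z → E M z (quo u)) (quo-o vc) (quo-E e)
  lift : ∀ φ → Proper M φ → ∀ v → v ≢ c → 2 ≤ dg G v → Mono M v φ → Adynamic G
  lift φ pr v vc d2 mo = φ ∘ quo , quo-proper pr , v , d2 , λ x y ex ey → mo (quo x) (quo y) (up vc ex) (up vc ey)
  OnT : Fin n → Set
  OnT f = ∃ λ y → ∃ λ z → Tri G f y z
  on-T : ∀ {f} → f ≢ a → f ≢ c → 2 ≤ dg M f → ¬ HypAt M f → OnT f
  on-T {f} fa fc h2 nh with Finₚ.any? (λ u → Finₚ.any? λ w → E? M f u ×-dec E? M f w ×-dec E? M u w)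
  ... | no h = ⊥-elim (nh (h2 , λ u w e e' g → h (u , w , e , e' , g)))
  ... | yes (u , w , e , e' , g) with lift-Tri nb (e , g , e')
  ... | f₀ , y , z , T , q , _ , _ = y , z , subst (λ x → Tri G x y z) (back f₀ q) T
    where back : ∀ f₀ → quo f₀ ≡ f → f₀ ≡ f
          back f₀ q with f₀ ≟ c
          ... | yes refl = ⊥-elim (fa (trans (sym q) quo-c))
          ... | no h = trans (sym (quo-o h)) q
  -- `f` has at most one neighbour in the quotient, so every colouring of the quotient pulls back to
  -- one that is constant around `f`.
  corner : ∀ {f} → E G f a → E G f c → ¬ (2 ≤ dg M f) → Adynamic G
  corner {f} fa fc small = let (φ , pr) = plain M PM UM in lift φ pr f (E-irr G fc) (dg-≥ G f {a ∷ c ∷ []} ((D.a≢c ∷ []) ∷ [] ∷ []) (fa ∷ fc ∷ []))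
      λ x y ex ey → cong φ (decidable-stable (x ≟ y) λ ne → small (dg-≥ M f {x ∷ y ∷ []} ((ne ∷ []) ∷ [] ∷ []) (ex ∷ ey ∷ [])))
  lifted : Adynamic M → Adynamic G
  lifted (φ , pr , v , h2 , mo) = lift φ pr v vc dG mo
    where
    vc : v ≢ c
    vc refl = proj₁ (merge-t G a c nac (proj₁ (proj₂ (proj₂ (proj₂ (two-of M v h2)))))) refl
    dG : 2 ≤ dg G v
    dG with v ≟ a
    ... | yes refl = dg-≥ G a {b ∷ d ∷ []} ((D.b≢d ∷ []) ∷ [] ∷ []) (D.ab ∷ E-sym G D.da ∷ [])
    ... | no va = ℕₚ.≤-trans h2 (dg-merge v va vc)
  -- Both corners would lie on the only triangle of `G` and be adjacent, but the cycle has no chord.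
  both-on : OnT b → OnT d → ⊥
  both-on (y , z , by , yz , bz) (y' , z' , T') with U (by , yz , bz) T'
  ... | inj₁ q = D.b≢d (sym q)
  ... | inj₂ (inj₁ refl) = proj₂ (chordless U D) by
  ... | inj₂ (inj₂ refl) = proj₂ (chordless U D) bz
  corners : ¬ ∃ (HypAt M) → Dec (2 ≤ dg M b) → Dec (2 ≤ dg M d) → Adynamic G
  corners nh (no h) _ = corner (E-sym G D.ab) D.bc h
  corners nh (yes _) (no h) = corner D.da (E-sym G D.cd) h
  corners nh (yes hb) (yes hd) = ⊥-elim (both-on (on-T (E-irr G D.ab ∘ sym) (E-irr G D.bc) hb (λ h → nh (b , h))) (on-T (E-irr G D.da) (E-irr G D.cd ∘ sym) hd (λ h → nh (d , h))))
  go : Dec (∃ (HypAt M)) → Adynamic G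
  go (yes h) = lifted (IH M PM UM (merge-smaller D.ab (E-sym G D.bc)) h)
  go (no nh) = corners nh (2 ≤? dg M b) (2 ≤? dg M d)

dis-1 : ∀ e a → 20 + 3 * e + (3 * (2 * a) + 4 * a) + 2 ≡ 10 * a + (3 * (2 + e) + 4 * 4)
dis-1 = solve-∀

dis-2 : ∀ g h a → 14 + 3 * g + (3 * (h + 2) + 10 * a) + 0 ≡ 10 * a + (3 * g + (20 + 3 * h))
dis-2 = solve-∀

dis-3 : ∀ e a → 1 + (10 * a + (3 * e + 13)) + 0 ≡ 0 + (14 + 3 * e + 10 * a)
dis-3 = solve-∀

dis-4 : ∀ r' er r e → 10 * r' + (10 * r + 3 * e + 3 * er + 10 * 3) + 1 ≡ 3 * e + 13 + (10 * r' + 3 * er + 6 + 3 * 4 + 10 * r)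
dis-4 = solve-∀

dis-5 : ∀ e a t → 1 + (10 * a + 3 * (e + 2 * t) + (2 * a + 6 * 3)) + 3 ≡ 0 + (14 + 3 * e + 3 * (4 * a) + (2 * 4 + 6 * t))
dis-5 = solve-∀

dis-6 : ∀ h g a → 1 + (2 * a + (h + 2) + (g + a)) + 0 ≡ 0 + (2 + h + g + (3 * a + 1))
dis-6 = solve-∀

dis-7 : ∀ h g a f w t → 1 + (12 * (2 * a + 2 * f) + (4 * h + w) + (4 * h + 4 * g + 12 * t + (4 * (h + 2) + 12 * 3))) + 3 ≡ 0 + (12 * (4 + h) + 24 * f + (24 * a + w + (4 * g + 12 * t)))
dis-7 = solve-∀

dis-8 : ∀ a er r e → 10 * a + (10 * r + 3 * e + 10 * 4 + 3 * er) + 0 ≡ 3 * e + 16 + (10 * a + 3 * er + 6 + 10 * r + 3 * (2 * 3))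
dis-8 = solve-∀

dis-9 : ∀ r s e⁺ e e₁ e₂ → 10 * s + (3 * e⁺ + 16 + 10 * (2 + r) + 3 * (e + 2 + (e₁ + e₂))) + 1 ≡ 3 * e₂ + 13 + (10 * r + 10 * s + 3 * (e⁺ + (e + 4 + (e₁ + 6))))
dis-9 = solve-∀

dis-10 : ∀ a e⁺ e → 10 * a + (3 * e⁺ + 4 + 3 * (e + 2)) + 3 ≡ 3 * e + 13 + (10 * a + 3 * e⁺)
dis-10 = solve-∀

dis-11 : ∀ e a → 1 + (10 * a + (3 * e + 16)) + 3 ≡ 0 + (20 + 3 * e + 10 * a)
dis-11 = solve-∀

dis-12 : ∀ a b u i ea eb eu ei → 1 + (10 * u + 10 * i + (3 * ea + 16 + (3 * eb + 16)) + (3 * (eu + ei) + 10 * (a + b))) + 1 ≡ 0 + (14 + 3 * eu + (14 + 3 * ei) + (10 * a + 10 * b) + (3 * (ea + eb + 2) + 10 * (u + i)))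
dis-12 = solve-∀

-- Graphs without 4-cycles

NoQuads : ∀ {n} → Graph n → Set
NoQuads G = ∀ {a b c d} → ¬ C4 G a b c d

NoQuads-⊑ : ∀ {n} {H G : Graph n} → H ⊑ G → NoQuads G → NoQuads H
NoQuads-⊑ {H = H} {G} h q C = q (C4-⊑ {G = G} {H} h C)

-- Without triangles and 4-cycles the bound for girth 5 applies; four vertices suffice for the
-- degenerate cases of no edge or one face.
sparse₀ : ∀ {n} {G : Graph n} (P : Planarity G) → TriFree G → NoQuads G → ∀ A → Inside P A → 4 ≤ ∣ A ∣ → 20 + 3 * e2 G ≤ 10 * ∣ A ∣
sparse₀ {G = G} P t q A ia a4 with edge? G
... | no h = ℕₚ.≤-trans (ℕₚ.≤-reflexive (cong (λ z → 20 + 3 * z) (e2-zero G λ u v e → h (u , v , e)))) (ℕₚ.≤-trans (ℕₚ.m≤m+n 20 20) (ℕₚ.*-monoʳ-≤ 10 a4))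
... | yes (u , v , e) with face-trichotomy P t
... | inj₁ h = girth5 P {A} e ia h
... | inj₂ (inj₁ (_ , _ , _ , _ , C , _)) = ⊥-elim (q C)
... | inj₂ (inj₂ o) = farkas 2 (ℕₚ.+-mono-≤ (ℕₚ.*-monoʳ-≤ 3 (euler-one P {A} e ia o)) (ℕₚ.*-monoʳ-≤ 4 a4)) (dis-1 (e2 G) (∣ A ∣))

-- The edge deleted to destroy the triangle costs 6 of the 20.
sparse₁ : ∀ {n} {G : Graph n} (P : Planarity G) → OneTri G → NoQuads G → ∀ A → Inside P A → 4 ≤ ∣ A ∣ → 14 + 3 * e2 G ≤ 10 * ∣ A ∣
sparse₁ {G = G} P U q A ia a4 with untri G U
... | H , H⊑ , t , le = farkas 0 (ℕₚ.+-mono-≤ (ℕₚ.*-monoʳ-≤ 3 le) (sparse₀ (sub P H H⊑) t (NoQuads-⊑ {H = H} {G} H⊑ q) A (λ u v e → ia u v (H⊑ u v e)) a4)) (dis-2 (e2 G) (e2 H) (∣ A ∣))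

module NoC4Case {n} (G : Graph n) (P : Planarity G) (U : OneTri G) (Q : NoQuads G) (d2 : ∀ v w → E G v w → 2 ≤ dg G v)
  {ta tb tc : Fin n} (tri : Tri G ta tb tc) where

  sparse : ∀ A → 4 ≤ ∣ A ∣ → 14 + 3 * e2 (G ↾ A) ≤ 10 * ∣ A ∣
  sparse A a4 = sparse₁ (sub P (G ↾ A) (↾-⊑ G A)) (OneTri-⊑ {H = G ↾ A} {G} (↾-⊑ G A) U) (NoQuads-⊑ {H = G ↾ A} {G} (↾-⊑ G A) Q) A (λ u v e → proj₁ (↾-E {G = G} {A} {u} {v} e)) a4

  sparser : ∀ A → 4 ≤ ∣ A ∣ → TriFree (G ↾ A) → 20 + 3 * e2 (G ↾ A) ≤ 10 * ∣ A ∣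
  sparser A a4 t = sparse₀ (sub P (G ↾ A) (↾-⊑ G A)) t (NoQuads-⊑ {H = G ↾ A} {G} (↾-⊑ G A) Q) A (λ u v e → proj₁ (↾-E {G = G} {A} {u} {v} e)) a4

  dense : ∀ A → 4 ≤ ∣ A ∣ → 10 * ∣ A ∣ ≤ 3 * e2 (G ↾ A) + 13 → ⊥
  dense A a4 low = ℕₚ.<-irrefl refl (farkas {1} {0} 0 (ℕₚ.+-mono-≤ (sparse A a4) low) (dis-3 (e2 (G ↾ A)) (∣ A ∣)))

  T : List (Fin n)
  T = ta ∷ tb ∷ tc ∷ []

  OffT : Fin n → Set
  OffT u = fromList T u ≡ false

  tri-T : ∀ {x y z} → Tri G x y z → fromList T x ≡ true
  tri-T {x} t with U tri t
  ... | inj₁ p = fromList∈ {xs = T} (here p)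
  ... | inj₂ (inj₁ p) = fromList∈ {xs = T} (there (here p))
  ... | inj₂ (inj₂ p) = fromList∈ {xs = T} (there (there (here p)))

  indep : ∀ {v} → OffT v → ∀ u w → E G v u → E G v w → ¬ E G u w
  indep o u w e f g = tf (tri-T (e , g , f)) o

  star : Fin n → Sub n
  star v = ins (adj G v) v

  paint : Fin n → Colouring n
  paint v u = if u == v then suc zero else zero

  paint-v : ∀ v → paint v v ≡ suc zero
  paint-v v rewrite ==-refl v = refl

  paint-o : ∀ v {u} → u ≢ v → paint v u ≡ zero
  paint-o v h rewrite ≢→== h = refl

  star-t : ∀ v {u} → star v u ≡ true → (u ≡ v) ⊎ E G v u
  star-t v {u} e with ∨-t {u == v} e
  ... | inj₁ p = inj₁ (==→≡ {i = u} {v} p)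
  ... | inj₂ p = inj₂ p

  paint-proper : ∀ v → (∀ u w → E G v u → E G v w → ¬ E G u w) → Proper (G ↾ star v) (paint v)
  paint-proper v ind u w e with ↾-E {G = G} {star v} {u} {w} e
  ... | a , b , f with star-t v a | star-t v b
  ... | inj₁ refl | inj₁ refl = ⊥-elim (E-irr G f refl)
  ... | inj₁ refl | inj₂ q = λ z → case trans (sym (paint-v v)) (trans z (paint-o v (E-irr G q ∘ sym))) of λ ()
  ... | inj₂ q | inj₁ refl = λ z → case trans (sym (paint-v v)) (trans (sym z) (paint-o v (E-irr G q ∘ sym))) of λ ()
  ... | inj₂ p | inj₂ q = ⊥-elim (ind u w p q f)

  star-card : ∀ v → ∣ star v ∣ ≡ suc (dg G v)
  star-card v = card-ins (adj G v) v (adj-irr G v)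

  star-e2 : ∀ v → 2 * dg G v ≤ e2 (G ↾ star v)
  star-e2 v = ℕₚ.≤-trans (ℕₚ.≤-reflexive (cong (2 *_) (sym (deg≡dg G v))))
     (ℕₚ.≤-trans (ℕₚ.m≤n+m _ (e2 (G ↾ adj G v))) (grow G (adj G v) v {nbrs G v} (adj-irr G v) (nbrs-unique G v) (Allₚ.tabulate λ i → ∈-nbrs G i , ∈-nbrs G i)))

  star-mono : ∀ {φ} v → (∀ u → E G v u → φ u ≡ paint v u) → Mono G v φ
  star-mono v h u w e f = trans (h u e) (trans (paint-o v (E-irr G e ∘ sym)) (sym (trans (h w f) (paint-o v (E-irr G f ∘ sym)))))

  -- The star has doubled potential 30 - 12 = 18, and the drop leaves 12, below the 14 of `sparse`.
  degree2 : ∀ v → dg G v ≡ 2 → (∀ u w → E G v u → E G v w → ¬ E G u w) → Adynamic G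
  degree2 v d ind with Extends? G (star v) (paint v)
  ... | yes (φ , pr , ag) = φ , pr , v , ℕₚ.≤-reflexive (sym d) , star-mono v λ u e → ag u (∨-ir {u == v} e)
  ... | no nx with shrink G (star v) (paint v) (paint-proper v ind) nx
  ... | inj₁ (A , a4 , low , _) = ⊥-elim (dense A a4 (ℕₚ.≤-trans low (ℕₚ.+-monoʳ-≤ (3 * e2 (G ↾ A)) (ℕₚ.m≤m+n 4 9))))
  ... | inj₂ (R' , _ , big , _ , g) = ⊥-elim (dense R' (ℕₚ.≤-trans (ℕₚ.≤-reflexive (cong suc (sym c3))) big)
      (farkas 1 (ℕₚ.+-mono-≤ (ℕₚ.+-mono-≤ g (ℕₚ.*-monoʳ-≤ 3 e4)) (ℕₚ.≤-reflexive (cong (10 *_) c3))) (dis-4 (∣ R' ∣) (e2 (G ↾ star v)) (∣ star v ∣) (e2 (G ↾ R')))))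
    where
    c3 : ∣ star v ∣ ≡ 3
    c3 = trans (star-card v) (cong suc d)
    e4 : 4 ≤ e2 (G ↾ star v)
    e4 = ℕₚ.≤-trans (ℕₚ.≤-reflexive (cong (2 *_) (sym d))) (star-e2 v)

  T-unique : Unique T
  T-unique = (E-irr G (proj₁ tri) ∷ E-irr G (proj₂ (proj₂ tri)) ∷ []) ∷ (E-irr G (proj₁ (proj₂ tri)) ∷ []) ∷ [] ∷ []

  on-T : ∀ {u} → fromList T u ≡ true → ∃ λ x → ∃ λ y → x ≢ y × E G u x × E G u y × fromList T x ≡ true × fromList T y ≡ true
  on-T {u} e with ∈fromList T {u} e
  ... | here refl = tb , tc , E-irr G (proj₁ (proj₂ tri)) , proj₁ tri , proj₂ (proj₂ tri) , fromList∈ {xs = T} (there (here refl)) , fromList∈ {xs = T} (there (there (here refl)))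
  ... | there (here refl) = ta , tc , E-irr G (proj₂ (proj₂ tri)) , E-sym G (proj₁ tri) , proj₁ (proj₂ tri) , fromList∈ {xs = T} (here refl) , fromList∈ {xs = T} (there (there (here refl)))
  ... | there (there (here refl)) = ta , tb , E-irr G (proj₁ tri) , E-sym G (proj₂ (proj₂ tri)) , E-sym G (proj₁ (proj₂ tri)) , fromList∈ {xs = T} (here refl) , fromList∈ {xs = T} (there (here refl))

  A₀ : Sub n
  A₀ = active G

  A₀-in : ∀ u v → E G u v → A₀ u ≡ true
  A₀-in u v e = active-i G e

  -- Degrees of at least 4 off the triangle and at least 2 on it give 4v ≤ 2e + 6; together with 14
  -- + 6e ≤ 10v this leaves v ≤ 2.
  low-off : ∀ {v₀ w₀} → OffT v₀ → E G v₀ w₀ → ∃ λ v → ∃ λ w → OffT v × E G v w × dg G v ≤ 3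
  low-off {v₀} {w₀} o e with Finₚ.any? (λ v → Finₚ.any? λ w → (fromList T v ≟b false) ×-dec E? G v w ×-dec (dg G v ≤? 3))
  ... | yes r = r
  ... | no h = ⊥-elim (ℕₚ.<-irrefl refl (farkas {1} {0} 3 (ℕₚ.+-mono-≤ (ℕₚ.+-mono-≤ (sparse₁ P U Q A₀ A₀-in a4) (ℕₚ.*-monoʳ-≤ 3 many)) (ℕₚ.+-mono-≤ (ℕₚ.*-monoʳ-≤ 2 a4) (ℕₚ.*-monoʳ-≤ 6 (card-fromList T)))) (dis-5 (e2 G) (∣ A₀ ∣) (∣ fromList T ∣))))
    where
    four : ∀ {v w} → OffT v → E G v w → 4 ≤ dg G v
    four {v} {w} o e = ℕₚ.≰⇒> λ d → h (v , w , o , e , d)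
    a4 : 4 ≤ ∣ A₀ ∣
    a4 = ℕₚ.≤-trans (four o e) (card-mono {A = adj G v₀} {A₀} λ v f → active-i G (E-sym G f))
    pt : ∀ u → 4 * 𝟙 (A₀ u) ≤ dg G u + 2 * 𝟙 (fromList T u)
    pt u = at (A₀ u) (fromList T u) refl refl
      where
      at : ∀ a t → A₀ u ≡ a → fromList T u ≡ t → 4 * 𝟙 a ≤ dg G u + 2 * 𝟙 t
      at false t a _ = z≤n
      at true true a _ = ℕₚ.+-monoˡ-≤ 2 (d2 u _ (proj₂ (active-t G a)))
      at true false a t = ℕₚ.≤-trans (four t (proj₂ (active-t G a))) (ℕₚ.m≤m+n _ 0)
    many : 4 * ∣ A₀ ∣ ≤ e2 G + 2 * ∣ fromList T ∣
    many = ℕₚ.≤-trans (ℕₚ.≤-reflexive (sym (∑-* 4 (𝟙 ∘ A₀)))) (ℕₚ.≤-trans (∑-mono pt) (ℕₚ.≤-reflexive (trans (∑-+ (dg G) (λ u → 2 * 𝟙 (fromList T u))) (cong (e2 G +_) (∑-* 2 (𝟙 ∘ fromList T))))))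

  isolated-trifree : ∀ {x} → fromList T x ≡ true → TriFree (isolate G x)
  isolated-trifree {x} tx a b c (ab , bc , ac) = go (U (lo ab , lo bc , lo ac) (proj₂ (proj₂ (tri-at tx))))
    where
    lo : ∀ {u v} → E (isolate G x) u v → E G u v
    lo e = isolate-⊑ G x _ _ e
    tri-at : fromList T x ≡ true → ∃ λ y → ∃ λ z → Tri G x y z
    tri-at e with ∈fromList T {x} e
    ... | here refl = tb , tc , tri
    ... | there (here refl) = ta , tc , E-sym G (proj₁ tri) , proj₂ (proj₂ tri) , proj₁ (proj₂ tri)
    ... | there (there (here refl)) = ta , tb , E-sym G (proj₂ (proj₂ tri)) , proj₁ tri , E-sym G (proj₁ (proj₂ tri))
    go : (x ≡ a) ⊎ (x ≡ b) ⊎ (x ≡ c) → ⊥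
    go (inj₁ refl) = isolate-no G b ab
    go (inj₂ (inj₁ refl)) = isolate-no G c bc
    go (inj₂ (inj₂ refl)) = isolate-no G b (E-sym (isolate G x) {b} {x} bc)

  -- Without `x` there is no triangle left, so `mono-nbhd` applies at a vertex of degree at most 3
  -- off `T`. This vertex is not adjacent to `x`, both of whose neighbours are in `T`, so `x` can be
  -- coloured last.
  triangle2 : ∀ x → fromList T x ≡ true → dg G x ≡ 2 → ∀ {v₀ w₀} → OffT v₀ → E G v₀ w₀ → Adynamic G
  triangle2 x tx dx o e with low-off o e
  ... | v , w , vo , vw , d3 = upd φ x k , extend-vertex G x φ k (λ u w p q e → proj₁ (proj₂ r) u w (isolate-i G p q e)) (proj₂ sm) , v , d2 v w vw ,
        λ a b ea eb → trans (upd-other φ k (nx ea)) (trans (proj₂ (proj₂ r) a b (isolate-i G vx (nx ea) ea) (isolate-i G vx (nx eb) eb)) (sym (upd-other φ k (nx eb))))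
    where
    H = isolate G x
    r = mono-nbhd (e2 H) H (sub P H (isolate-⊑ G x)) (isolated-trifree tx) ℕₚ.≤-refl v (ℕₚ.≤-trans (dg-mono {H = H} {G} (isolate-⊑ G x) v) d3)
    φ = proj₁ r
    sm = small-nbrs G x (ℕₚ.≤-reflexive dx) φ
    k = proj₁ sm
    vx : v ≢ x
    vx refl = tf tx vo
    nx : ∀ {u} → E G v u → u ≢ x
    nx ev refl with on-T tx | two-nbrs G x dx
    ... | p , q , pq , xp , xq , tp , tq | nb2 a b a≢b xa xb only with only p xp | only q xq | only v (E-sym G ev)
    ... | inj₁ refl | inj₁ refl | _ = pq refl
    ... | inj₂ refl | inj₂ refl | _ = pq refl
    ... | inj₁ refl | inj₂ refl | inj₁ refl = tf tp vo
    ... | inj₁ refl | inj₂ refl | inj₂ refl = tf tq vo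
    ... | inj₂ refl | inj₁ refl | inj₁ refl = tf tq vo
    ... | inj₂ refl | inj₁ refl | inj₂ refl = tf tp vo

  record Pent (x₁ x₂ x₃ x₄ x₅ : Fin n) : Set where
    constructor pent
    field e₁₂ : E G x₁ x₂
          e₂₃ : E G x₂ x₃
          e₃₄ : E G x₃ x₄
          e₄₅ : E G x₄ x₅
          e₅₁ : E G x₅ x₁
          n₁₃ : x₁ ≢ x₃
          n₁₄ : x₁ ≢ x₄
          n₂₄ : x₂ ≢ x₄
          n₂₅ : x₂ ≢ x₅
          n₃₅ : x₃ ≢ x₅

  Pent-rot : ∀ {x₁ x₂ x₃ x₄ x₅} → Pent x₁ x₂ x₃ x₄ x₅ → Pent x₂ x₃ x₄ x₅ x₁
  Pent-rot (pent e₁₂ e₂₃ e₃₄ e₄₅ e₅₁ n₁₃ n₁₄ n₂₄ n₂₅ n₃₅) = pent e₂₃ e₃₄ e₄₅ e₅₁ e₁₂ n₂₄ n₂₅ n₃₅ (n₁₃ ∘ sym) (n₁₄ ∘ sym)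

  Pent-refl : ∀ {x₁ x₂ x₃ x₄ x₅} → Pent x₁ x₂ x₃ x₄ x₅ → Pent x₄ x₃ x₂ x₁ x₅
  Pent-refl (pent e₁₂ e₂₃ e₃₄ e₄₅ e₅₁ n₁₃ n₁₄ n₂₄ n₂₅ n₃₅) = pent (E-sym G e₃₄) (E-sym G e₂₃) (E-sym G e₁₂) (E-sym G e₅₁) (E-sym G e₄₅) (n₂₄ ∘ sym) (n₁₄ ∘ sym) (n₁₃ ∘ sym) n₃₅ n₂₅

  -- Discharging towards a pentagon with four consecutive cubic vertices

  Cubic : Fin n → Set
  Cubic u = OffT u × dg G u ≡ 3

  Config : Set
  Config = ∃ λ x₁ → ∃ λ x₂ → ∃ λ x₃ → ∃ λ x₄ → ∃ λ x₅ → Pent x₁ x₂ x₃ x₄ x₅ × Cubic x₁ × Cubic x₂ × Cubic x₃ × Cubic x₄ × OffT x₅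

  v-1 : ∀ d g → 24 * 1 + 2 * (2 * d) + 4 * g + 0 ≡ 4 * d + 4 * g + 12 * 1 + 4 * 3
  v-1 = solve-∀

  v-2 : ∀ d g → 0 + 2 * (2 * d) + 0 + (12 + 4 * g) ≡ 4 * d + 4 * g + 12 * 1 + 0
  v-2 = solve-∀

  v-3 : ∀ d g → 24 * 1 + 2 * (0 * d) + 4 * (d + g) + 0 ≡ 4 * d + 4 * g + 0 + 4 * (3 + 3)
  v-3 = solve-∀

  v-4 : ∀ d g → 24 * 1 + 2 * (1 * d) + (2 * d + 4 * g) + 0 ≡ 4 * d + 4 * g + 0 + (2 * 4 + 4 * 4)
  v-4 = solve-∀

  v-5 : ∀ d g → 0 + 2 * (1 * d) + 2 * 0 + (4 * d + 4 * g) ≡ 4 * d + 4 * g + 0 + 2 * d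
  v-5 = solve-∀

  face-sum : ∀ l D a b c d e → 24 + (4 * l + D + 2 * (a + b + c + d + e)) + 0 ≡ 4 * l + D + (4 * 5 + (a + b + (b + c + (c + d + (d + e + (e + a + 0))))) + 2 * 2)
  face-sum = solve-∀

  -- Every dart carries charge 4 for its tail and 4 for its face, and a vertex u passes δ u to the face along each side of its edges.
  -- If every face ends up with 24, so does on average every vertex, which contradicts Euler's formula.
  module Discharge (d3 : ∀ v w → E G v w → 3 ≤ dg G v) where
    H = delE G ta tb
    H⊑ = delE-⊑ G ta tb
    PH = sub P H H⊑
    tH : TriFree H
    tH = cut-tri {G = G} U tri
    qH : NoQuads H
    qH = NoQuads-⊑ {H = H} {G} H⊑ Q

    -- A pentagon starts with 4 · 5 = 20 and receives `2 * δ u` from each vertex, so it stays below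
    -- 24 only if these values sum to at most 1. A vertex of degree d ≥ 4 can afford 1, as 8d - 2d ≥
    -- 24. A triangle vertex gives 2 at the price of a fixed debt of 12.
    δ : Fin n → ℕ
    δ u = if fromList T u then 2 else (if does (dg G u ≤? 3) then 0 else 1)

    δ-off : ∀ u → δ u ≤ 1 → OffT u
    δ-off u h with fromList T u
    ... | true = ⊥-elim (ℕₚ.<-irrefl refl h)
    ... | false = refl

    δ-cubic : ∀ u {w} → E G u w → δ u ≤ 0 → Cubic u
    δ-cubic u {w} e h = off , ℕₚ.≤-antisym (k (dg G u ≤? 3) (ℕₚ.≤-trans (ℕₚ.≤-reflexive (sym (cong (if_then 2 else (if does (dg G u ≤? 3) then 0 else 1)) off))) h)) (d3 u w e)
      where
      off : OffT u
      off = δ-off u (ℕₚ.≤-trans h z≤n)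
      k : ∀ (r : Dec (dg G u ≤ 3)) → (if does r then 0 else 1) ≤ 0 → dg G u ≤ 3
      k (yes p) _ = p
      k (no _) ()

    dgH : ∀ {u} → OffT u → dg G u ≤ dg H u
    dgH {u} o = ∑-mono {f = 𝟙 ∘ adj G u} {𝟙 ∘ adj H u} λ v → 𝟙-mono λ e → delE-i G e λ
      { (inj₁ (refl , _)) → tf (fromList∈ {xs = T} (here refl)) o ; (inj₂ (refl , _)) → tf (fromList∈ {xs = T} (there (here refl))) o }

    vertex : ∀ u → 24 * 𝟙 (A₀ u) + 2 * (δ u * dg H u) ≤ 4 * dg H u + 4 * dg G u + 12 * 𝟙 (fromList T u)
    vertex u = at (fromList T u) refl (dg G u ≤? 3) (A₀ u) refl
      where
      three : A₀ u ≡ true → 3 ≤ dg G u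
      three a = d3 u _ (proj₂ (active-t G a))
      none : A₀ u ≡ false → dg H u ≤ 0
      none a = ℕₚ.≮⇒≥ λ h → tf (active-i G (H⊑ u _ (proj₂ (nbr-of H u h)))) a
      at : ∀ t → fromList T u ≡ t → ∀ (r : Dec (dg G u ≤ 3)) a → A₀ u ≡ a → 24 * 𝟙 a + 2 * ((if t then 2 else (if does r then 0 else 1)) * dg H u) ≤ 4 * dg H u + 4 * dg G u + 12 * 𝟙 t
      at true t r true a = farkas 0 (ℕₚ.*-monoʳ-≤ 4 (three a)) (v-1 (dg H u) (dg G u))
      at true t r false a = farkas (12 + 4 * dg G u) (z≤n {0}) (v-2 (dg H u) (dg G u))
      at false t (yes p) true a = farkas 0 (ℕₚ.*-monoʳ-≤ 4 (ℕₚ.+-mono-≤ (ℕₚ.≤-trans (three a) (dgH t)) (three a))) (v-3 (dg H u) (dg G u))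
      at false t (no p) true a = farkas 0 (ℕₚ.+-mono-≤ (ℕₚ.*-monoʳ-≤ 2 (ℕₚ.≤-trans (ℕₚ.≰⇒> p) (dgH t))) (ℕₚ.*-monoʳ-≤ 4 (ℕₚ.≰⇒> p))) (v-4 (dg H u) (dg G u))
      at false t (yes p) false a = z≤n
      at false t (no p) false a = farkas (4 * dg H u + 4 * dg G u) (ℕₚ.*-monoʳ-≤ 2 (none a)) (v-5 (dg H u) (dg G u))

    D : Fin (Planarity.m PH) → ℕ
    D f = ∑₂ λ u v → Face.h PH f u v * (δ u + δ v)

    W : ℕ
    W = ∑ D

    S : ℕ
    S = ∑ λ u → δ u * dg H u

    W≡ : W ≡ 2 * S
    W≡ = trans (sum-sides PH (λ u v → δ u + δ v)) (trans (∑₂-cong {f = λ u v → 𝟙 (adj H u v) * (δ u + δ v)} {λ u v → δ u * 𝟙 (adj H u v) + δ v * 𝟙 (adj H v u)} λ u v → trans (dist (𝟙 (adj H u v)) (δ u) (δ v)) (cong (λ z → δ u * 𝟙 (adj H u v) + δ v * 𝟙 z) (adj-sym H u v)))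
       (trans (∑₂-+ (λ u v → δ u * 𝟙 (adj H u v)) (λ u v → δ v * 𝟙 (adj H v u))) (trans (cong₂ _+_ half (trans (∑-swap (λ u v → δ v * 𝟙 (adj H v u))) half)) (cong (S +_) (sym (ℕₚ.+-identityʳ S))))))
      where
      dist : ∀ a x y → a * (x + y) ≡ x * a + y * a
      dist = solve-∀
      half : ∑₂ (λ u v → δ u * 𝟙 (adj H u v)) ≡ S
      half = ∑-cong λ u → ∑-* (δ u) (λ v → 𝟙 (adj H u v))

    vertices-bound : 24 * ∣ A₀ ∣ + W ≤ 4 * e2 H + 4 * e2 G + 12 * ∣ fromList T ∣
    vertices-bound = ℕₚ.≤-trans (ℕₚ.≤-reflexive (trans (cong (24 * ∣ A₀ ∣ +_) W≡) (sym (trans (∑-+ (λ u → 24 * 𝟙 (A₀ u)) (λ u → 2 * (δ u * dg H u))) (cong₂ _+_ (∑-* 24 (𝟙 ∘ A₀)) (∑-* 2 (λ u → δ u * dg H u)))))))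
      (ℕₚ.≤-trans (∑-mono vertex) (ℕₚ.≤-reflexive (trans (∑-+ (λ u → 4 * dg H u + 4 * dg G u) (λ u → 12 * 𝟙 (fromList T u))) (cong₂ _+_ (trans (∑-+ (λ u → 4 * dg H u) (λ u → 4 * dg G u)) (cong₂ _+_ (∑-* 4 (dg H)) (∑-* 4 (dg G)))) (∑-* 12 (𝟙 ∘ fromList T))))))

    -- At most one of the five values is nonzero, and a rotation makes it the last.
    light : ∀ {x₁ x₂ x₃ x₄ x₅} → Pent x₁ x₂ x₃ x₄ x₅ → δ x₁ + δ x₂ + δ x₃ + δ x₄ + δ x₅ ≤ 1 → Config
    light {x₁} {x₂} {x₃} {x₄} {x₅} p s = go (δ x₁ ≤? 0) (δ x₂ ≤? 0) (δ x₃ ≤? 0) (δ x₄ ≤? 0)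
      where
      mk : ∀ {x₁ x₂ x₃ x₄ x₅} → Pent x₁ x₂ x₃ x₄ x₅ → δ x₁ ≤ 0 → δ x₂ ≤ 0 → δ x₃ ≤ 0 → δ x₄ ≤ 0 → δ x₅ ≤ 1 → Config
      mk {x₁} {x₂} {x₃} {x₄} {x₅} p a b c d e = _ , _ , _ , _ , _ , p , δ-cubic x₁ (Pent.e₁₂ p) a , δ-cubic x₂ (Pent.e₂₃ p) b , δ-cubic x₃ (Pent.e₃₄ p) c , δ-cubic x₄ (Pent.e₄₅ p) d , δ-off x₅ e
      heavy : ∀ {x₁ x₂ x₃ x₄ x₅} → Pent x₁ x₂ x₃ x₄ x₅ → δ x₁ + δ x₂ + δ x₃ + δ x₄ + δ x₅ ≤ 1 → ¬ (δ x₅ ≤ 0) → Config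
      heavy {x₁} {x₂} {x₃} {x₄} {x₅} p s h = mk p (farkas (b + c + d) le (l1 a b c d e)) (farkas (a + c + d) le (l2 a b c d e)) (farkas (a + b + d) le (l3 a b c d e)) (farkas (a + b + c) le (l4 a b c d e)) (farkas (a + b + c + d) s (l5 a b c d e))
        where
        a = δ x₁
        b = δ x₂
        c = δ x₃
        d = δ x₄
        e = δ x₅
        le : 1 + (a + b + c + d + e) ≤ e + 1
        le = ℕₚ.+-mono-≤ (ℕₚ.≰⇒> h) s
        l1 : ∀ a b c d e → a + (e + 1) + (b + c + d) ≡ 0 + (1 + (a + b + c + d + e))
        l1 = solve-∀
        l2 : ∀ a b c d e → b + (e + 1) + (a + c + d) ≡ 0 + (1 + (a + b + c + d + e))
        l2 = solve-∀
        l3 : ∀ a b c d e → c + (e + 1) + (a + b + d) ≡ 0 + (1 + (a + b + c + d + e))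
        l3 = solve-∀
        l4 : ∀ a b c d e → d + (e + 1) + (a + b + c) ≡ 0 + (1 + (a + b + c + d + e))
        l4 = solve-∀
        l5 : ∀ a b c d e → e + 1 + (a + b + c + d) ≡ 1 + (a + b + c + d + e)
        l5 = solve-∀
      rot : ∀ a b c d e → b + c + d + e + a ≡ a + b + c + d + e
      rot = solve-∀
      s₁ : δ x₂ + δ x₃ + δ x₄ + δ x₅ + δ x₁ ≤ 1
      s₁ = ℕₚ.≤-trans (ℕₚ.≤-reflexive (rot (δ x₁) (δ x₂) (δ x₃) (δ x₄) (δ x₅))) s
      s₂ : δ x₃ + δ x₄ + δ x₅ + δ x₁ + δ x₂ ≤ 1
      s₂ = ℕₚ.≤-trans (ℕₚ.≤-reflexive (rot (δ x₂) (δ x₃) (δ x₄) (δ x₅) (δ x₁))) s₁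
      s₃ : δ x₄ + δ x₅ + δ x₁ + δ x₂ + δ x₃ ≤ 1
      s₃ = ℕₚ.≤-trans (ℕₚ.≤-reflexive (rot (δ x₃) (δ x₄) (δ x₅) (δ x₁) (δ x₂))) s₂
      s₄ : δ x₅ + δ x₁ + δ x₂ + δ x₃ + δ x₄ ≤ 1
      s₄ = ℕₚ.≤-trans (ℕₚ.≤-reflexive (rot (δ x₄) (δ x₅) (δ x₁) (δ x₂) (δ x₃))) s₃
      go : Dec (δ x₁ ≤ 0) → Dec (δ x₂ ≤ 0) → Dec (δ x₃ ≤ 0) → Dec (δ x₄ ≤ 0) → Config
      go (no h) _ _ _ = heavy (Pent-rot p) s₁ h
      go _ (no h) _ _ = heavy (Pent-rot (Pent-rot p)) s₂ h
      go _ _ (no h) _ = heavy (Pent-rot (Pent-rot (Pent-rot p))) s₃ h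
      go _ _ _ (no h) = heavy (Pent-rot (Pent-rot (Pent-rot (Pent-rot p)))) s₄ h
      go (yes a) (yes b) (yes c) (yes d) = mk p a b c d (ℕₚ.≤-trans (ℕₚ.m≤n+m _ (δ x₁ + δ x₂ + δ x₃ + δ x₄)) s)

    pentagon-light : ∀ f → Face.Pentagon PH f tH → ¬ (24 ≤ 4 * Face.len PH f + D f) → Config
    pentagon-light f pn h = light pp (ℕₚ.≤-pred (ℕₚ.≰⇒> λ two → h (farkas 0 (ℕₚ.+-mono-≤ (ℕₚ.+-mono-≤ (ℕₚ.*-monoʳ-≤ 4 five) sums) (ℕₚ.*-monoʳ-≤ 2 two)) (face-sum (Face.len PH f) (D f) (δ x₁) (δ x₂) (δ x₃) (δ x₄) (δ x₅)))))
      where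
      open Face.Pentagon pn
      open Face PH f using (Z; zf; On-f) renaming (h to hf)
      up : ∀ {u v} → Z u v → E G u v
      up z = H⊑ _ _ (proj₁ z)
      irr : ∀ {u v} → Z u v → u ≢ v
      irr z = E-irr H (proj₁ z)
      pp : Pent x₁ x₂ x₃ x₄ x₅
      pp = pent (up z₁₂) (up z₂₃) (up z₃₄) (up z₄₅) (up z₅₁) ne₁₃ ne₁₄ ne₂₄ ne₂₅ ne₃₅
      es : List (Pair n)
      es = (x₁ , x₂) ∷ (x₂ , x₃) ∷ (x₃ , x₄) ∷ (x₄ , x₅) ∷ (x₅ , x₁) ∷ []
      on : All On-f es
      on = zf z₁₂ ∷ zf z₂₃ ∷ zf z₃₄ ∷ zf z₄₅ ∷ zf z₅₁ ∷ []
      apart : AllPairs Apart es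
      apart = (ap₂ (ne₁₃ ∘ sym) (irr z₂₃ ∘ sym) ∷ ap₂ (ne₁₄ ∘ sym) (ne₂₄ ∘ sym) ∷ ap₂ (irr z₅₁) (ne₂₅ ∘ sym) ∷ ap₁ (irr z₅₁) (ne₂₅ ∘ sym) ∷ [])
        ∷ (ap₂ (ne₂₄ ∘ sym) (irr z₃₄ ∘ sym) ∷ ap₂ (ne₂₅ ∘ sym) (ne₃₅ ∘ sym) ∷ ap₂ (irr z₁₂) ne₁₃ ∷ [])
        ∷ (ap₂ (ne₃₅ ∘ sym) (irr z₄₅ ∘ sym) ∷ ap₂ ne₁₃ ne₁₄ ∷ [])
        ∷ (ap₂ ne₁₄ (irr z₅₁ ∘ sym) ∷ []) ∷ [] ∷ []
      five : 5 ≤ Face.len PH f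
      five = Face.count-edges PH f on apart
      k : Fin n → Fin n → ℕ
      k u v = hf u v * (δ u + δ v)
      dart : ∀ {u v} → On-f (u , v) → δ u + δ v ≤ k u v + k v u
      dart {u} {v} (_ , o) = ℕₚ.≤-trans (ℕₚ.≤-reflexive (sym (ℕₚ.*-identityˡ (δ u + δ v)))) (ℕₚ.≤-trans (ℕₚ.*-monoˡ-≤ (δ u + δ v) o) (ℕₚ.≤-reflexive (ar (hf u v) (hf v u) (δ u) (δ v))))
        where ar : ∀ p q x y → (p + q) * (x + y) ≡ p * (x + y) + q * (y + x)
              ar = solve-∀
      sums : (δ x₁ + δ x₂) + ((δ x₂ + δ x₃) + ((δ x₃ + δ x₄) + ((δ x₄ + δ x₅) + ((δ x₅ + δ x₁) + 0)))) ≤ D f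
      sums = ℕₚ.≤-trans (ℕₚ.+-mono-≤ (dart (zf z₁₂)) (ℕₚ.+-mono-≤ (dart (zf z₂₃)) (ℕₚ.+-mono-≤ (dart (zf z₃₄)) (ℕₚ.+-mono-≤ (dart (zf z₄₅)) (ℕₚ.+-mono-≤ (dart (zf z₅₁)) z≤n)))))
         (∑-pickE k (Allₚ.map proj₁ on) apart)

    face-light : ∀ f → used PH f ≡ true → ¬ (24 ≤ 4 * Face.len PH f + D f) → ¬ OneFace PH → Config
    face-light f uf h no1 with used-t PH {f} uf
    ... | x , y , e , sd with Face.one-sided PH f e sd
    ... | inj₁ mono = ⊥-elim (no1 (f , mono))
    ... | inj₂ (a , b , z) with Face.len PH f ≤? 5
    ... | no l = ⊥-elim (h (ℕₚ.≤-trans (ℕₚ.*-monoʳ-≤ 4 (ℕₚ.≰⇒> l)) (ℕₚ.m≤m+n _ (D f))))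
    ... | yes l = pentagon-light f (Face.face-5 PH f tH qH z l) h

    e₀ : E H tb tc
    e₀ = delE-i G (proj₁ (proj₂ tri)) λ { (inj₁ (p , _)) → E-irr G (proj₁ tri) (sym p) ; (inj₂ (_ , p)) → E-irr G (proj₂ (proj₂ tri)) (sym p) }

    inH : Inside PH A₀
    inH u v e = A₀-in u v (H⊑ u v e)

    -- With one face `H` would have at most v - 1 edges and `G` at most v, against minimum degree 3.
    not-one : ¬ OneFace PH
    not-one o = ℕₚ.<-irrefl refl (farkas {1} {0} 0 (ℕₚ.+-mono-≤ (ℕₚ.+-mono-≤ (euler-one PH {A₀} e₀ inH o) (e2-delE G ta tb)) (ℕₚ.+-mono-≤ three one)) (dis-6 (e2 H) (e2 G) (∣ A₀ ∣)))
      where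
      pt : ∀ u → 3 * 𝟙 (A₀ u) ≤ dg G u
      pt u with bcase (A₀ u)
      ... | inj₁ a rewrite a = d3 u _ (proj₂ (active-t G a))
      ... | inj₂ a rewrite a = z≤n
      three : 3 * ∣ A₀ ∣ ≤ e2 G
      three = ℕₚ.≤-trans (ℕₚ.≤-reflexive (sym (∑-* 3 (𝟙 ∘ A₀)))) (∑-mono pt)
      one : 1 ≤ ∣ A₀ ∣
      one = card-list A₀ {tb ∷ []} ([] ∷ []) (active-i G (H⊑ _ _ e₀) ∷ [])

    config : Config
    config with Finₚ.any? (λ f → (used PH f ≟b true) ×-dec ¬? (24 ≤? 4 * Face.len PH f + D f))
    ... | yes (f , uf , h) = face-light f uf h not-one
    -- The triangle vertices owe 3 · 12 = 36 and the deleted edge 4 · 2 = 8. The sum 44 stays below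
    -- the 12 · 4 = 48 that Euler's formula demands.
    ... | no none = ⊥-elim (ℕₚ.<-irrefl refl (farkas {1} {0} 3 (ℕₚ.+-mono-≤ (ℕₚ.+-mono-≤ (ℕₚ.*-monoʳ-≤ 12 (euler-k PH {A₀} e₀ inH)) faces) (ℕₚ.+-mono-≤ vertices-bound (ℕₚ.+-mono-≤ (ℕₚ.*-monoʳ-≤ 4 (e2-delE G ta tb)) (ℕₚ.*-monoʳ-≤ 12 (card-fromList T)))))
          (dis-7 (e2 H) (e2 G) (∣ A₀ ∣) (∣ used PH ∣) W (∣ fromList T ∣))))
      where
      pt : ∀ f → 24 * 𝟙 (used PH f) ≤ 4 * Face.len PH f + D f
      pt f = at (used PH f) λ uf → decidable-stable (24 ≤? 4 * Face.len PH f + D f) (λ h → none (f , uf , h))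
        where at : ∀ b → (b ≡ true → 24 ≤ 4 * Face.len PH f + D f) → 24 * 𝟙 b ≤ 4 * Face.len PH f + D f
              at true h = h refl
              at false h = z≤n
      faces : 24 * ∣ used PH ∣ ≤ 4 * e2 H + W
      faces = ℕₚ.≤-trans (ℕₚ.≤-reflexive (sym (∑-* 24 (𝟙 ∘ used PH)))) (ℕₚ.≤-trans (∑-mono pt) (ℕₚ.≤-reflexive (trans (∑-+ (λ f → 4 * Face.len PH f) D) (cong (_+ W) (trans (∑-* 4 (Face.len PH)) (cong (4 *_) (sum-len PH)))))))

  -- Reducibility of the pentagon

  Dense : (x₁ x₂ x₃ x₄ x₅ : Fin n) → Set
  Dense x₁ x₂ x₃ x₄ x₅ = ∃ λ A → star x₁ ⊆ A × A x₃ ≡ false × A x₄ ≡ false × 10 * ∣ A ∣ ≤ 3 * e2 (G ↾ A) + 16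

  -- Colour x₁ by 1 and its neighbours by 0; then x₃ and x₄ can be coloured last if their third neighbours
  -- y₃ and y₄ have different colours, which an additional edge y₃y₄ guarantees.
  module Centre {x₁ x₂ x₃ x₄ x₅} (pn : Pent x₁ x₂ x₃ x₄ x₅) (c₁ : Cubic x₁) (c₃ : Cubic x₃) (c₄ : Cubic x₄) where
    open Pent pn

    N₃ : Nb3 G x₃ x₂ x₄
    N₃ = third-nbr G x₃ x₂ x₄ (proj₂ c₃) n₂₄ (E-sym G e₂₃) e₃₄

    N₄ : Nb3 G x₄ x₃ x₅
    N₄ = third-nbr G x₄ x₃ x₅ (proj₂ c₄) n₃₅ (E-sym G e₃₄) e₄₅

    open Nb3 N₃ renaming (c to y₃; c≢a to y₃≢x₂; c≢b to y₃≢x₄; uc to x₃y₃; only to only₃)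
    open Nb3 N₄ renaming (c to y₄; c≢a to y₄≢x₃; c≢b to y₄≢x₅; uc to x₄y₄; only to only₄)

    R : Sub n
    R = star x₁

    no₁₃ : ¬ E G x₁ x₃
    no₁₃ e = indep (proj₁ c₁) x₂ x₃ e₁₂ e e₂₃

    no₁₄ : ¬ E G x₁ x₄
    no₁₄ e = indep (proj₁ c₁) x₅ x₄ (E-sym G e₅₁) e (E-sym G e₄₅)

    y₃≢y₄ : y₃ ≢ y₄
    y₃≢y₄ q = indep (proj₁ c₃) x₄ y₃ e₃₄ x₃y₃ (subst (E G x₄) (sym q) x₄y₄)

    outR : ∀ {u} → u ≢ x₁ → ¬ E G x₁ u → R u ≡ false
    outR p q = not-t→f λ r → case star-t x₁ r of λ { (inj₁ z) → p z ; (inj₂ z) → q z }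

    R₃ : R x₃ ≡ false
    R₃ = outR (n₁₃ ∘ sym) no₁₃

    R₄ : R x₄ ≡ false
    R₄ = outR (n₁₄ ∘ sym) no₁₄

    Ry₃ : R y₃ ≡ false
    Ry₃ = outR (λ q → no₁₃ (subst (λ z → E G z x₃) q (E-sym G x₃y₃))) λ e → Q (c4 e₁₂ e₂₃ x₃y₃ (E-sym G e) n₁₃ (y₃≢x₂ ∘ sym))

    Ry₄ : R y₄ ≡ false
    Ry₄ = outR (λ q → no₁₄ (subst (λ z → E G z x₄) q (E-sym G x₄y₄))) λ e → Q (c4 (E-sym G e₅₁) (E-sym G e₄₅) x₄y₄ (E-sym G e) n₁₄ (y₄≢x₅ ∘ sym))

    O : Sub n
    O u = not (R u) ∧ (not (u == x₃) ∧ not (u == x₄))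

    O-i : ∀ {u} → R u ≡ false → u ≢ x₃ → u ≢ x₄ → O u ≡ true
    O-i r p q = ∧-i (cong not r) (∧-i (cong not (≢→== p)) (cong not (≢→== q)))

    O₃ : O x₃ ≡ false
    O₃ = not-t→f λ q → case trans (sym (proj₁ (∧-t (proj₂ (∧-t {not (R x₃)} q))))) (cong not (==-refl x₃)) of λ ()

    O₄ : O x₄ ≡ false
    O₄ = not-t→f λ q → case trans (sym (proj₂ (∧-t {not (x₄ == x₃)} (proj₂ (∧-t {not (R x₄)} q))))) (cong not (==-refl x₄)) of λ ()

    OR : ∀ {u} → u ≢ x₃ → u ≢ x₄ → (O ∪ R) u ≡ true
    OR {u} p q with bcase (R u)
    ... | inj₁ r = ∨-ir {O u} r
    ... | inj₂ r = ∨-il (O-i r p q)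

    disj : Disjoint O R
    disj u e = not-t→f λ r → case trans (sym (proj₁ (∧-t {not (R u)} e))) (cong not r) of λ ()

    G⁺ : Graph n
    G⁺ = addE G y₃ y₄ y₃≢y₄

    G⁺-t : ∀ {u v} → E G⁺ u v → E G u v ⊎ ((u ≡ y₃ × v ≡ y₄) ⊎ (u ≡ y₄ × v ≡ y₃))
    G⁺-t {u} {v} e with ∨-t {adj G u v} e
    ... | inj₁ z = inj₁ z
    ... | inj₂ z = inj₂ (isE-t y₃ y₄ u v z)

    prop : Proper (G⁺ ↾ R) (paint x₁)
    prop u v e with ↾-E {G = G⁺} {R} {u} {v} e
    ... | ru , rv , f with G⁺-t f
    ... | inj₁ z = paint-proper x₁ (indep (proj₁ c₁)) u v (↾-i G {R} ru rv z)
    ... | inj₂ (inj₁ (refl , _)) = tf ru Ry₃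
    ... | inj₂ (inj₂ (refl , _)) = tf ru Ry₄

    zero-at : ∀ {u} → E G x₁ u → paint x₁ u ≡ zero
    zero-at e = paint-o x₁ (E-irr G e ∘ sym)

    -- `x₂` and `x₅` are neighbours of `x₁` and have colour 0, so `x₃` and `x₄` form the adjacent
    -- pair of `avoid-adjacent`.
    extended : Extends (G⁺ ↾ (O ∪ R)) R (paint x₁) → Adynamic G
    extended (φ , pr , ag) = go (avoid-adjacent zero (φ y₃) (φ y₄) (pr y₃ y₄ (↾-i G⁺ {O ∪ R} (OR (E-irr G x₃y₃ ∘ sym) y₃≢x₄) (OR y₄≢x₃ (E-irr G x₄y₄ ∘ sym)) (addE-new G y₃ y₄ y₃≢y₄))))
      where
      base : ∀ u v → u ≢ x₃ → u ≢ x₄ → v ≢ x₃ → v ≢ x₄ → E G u v → φ u ≢ φ v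
      base u v p q r s e = pr u v (↾-i G⁺ {O ∪ R} (OR p q) (OR r s) (addE-i G y₃ y₄ y₃≢y₄ e))
      at : ∀ {u} → E G x₁ u → φ u ≡ zero
      at {u} e = trans (ag u (∨-ir {u == x₁} e)) (zero-at e)
      go : (∃ λ p → ∃ λ q → zero ≢ p × φ y₃ ≢ p × zero ≢ q × φ y₄ ≢ q × p ≢ q) → Adynamic G
      go (p , q , 0p , bp , 0q , bq , pq) = θ , pr₂ , x₁ , ℕₚ.≤-trans (ℕₚ.n≤1+n 2) (ℕₚ.≤-reflexive (sym (proj₂ c₁))) ,
         star-mono x₁ λ u e → trans (upd-other θ₁ {x₄} q (λ { refl → no₁₄ e })) (trans (upd-other φ {x₃} p (λ { refl → no₁₃ e })) (trans (at e) (sym (zero-at e))))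
        where
        θ₁ : Colouring n
        θ₁ = upd φ x₃ p
        θ : Colouring n
        θ = upd θ₁ x₄ q
        pr₁ : Proper (isolate G x₄) θ₁
        pr₁ = extend-vertex (isolate G x₄) x₃ φ p
          (λ u v a b e → base u v a (λ { refl → isolate-no G v e }) b (λ { refl → isolate-no G u (E-sym (isolate G x₄) {u} {v} e) }) (isolate-⊑ G x₄ u v e))
          (λ v e → side v e (only₃ v (isolate-⊑ G x₄ x₃ v e)))
          where side : ∀ v → E (isolate G x₄) x₃ v → (v ≡ x₂) ⊎ (v ≡ x₄) ⊎ (v ≡ y₃) → φ v ≢ p
                side v e (inj₁ refl) z = 0p (trans (sym (at e₁₂)) z)
                side v e (inj₂ (inj₁ refl)) z = isolate-no G x₃ (E-sym (isolate G x₄) {x₃} {x₄} e)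
                side v e (inj₂ (inj₂ refl)) z = bp z
        pr₂ : Proper G θ
        pr₂ = extend-vertex G x₄ θ₁ q (λ u v a b e → pr₁ u v (isolate-i G a b e)) (λ v e → side v (only₄ v e))
          where side : ∀ v → (v ≡ x₃) ⊎ (v ≡ x₅) ⊎ (v ≡ y₄) → θ₁ v ≢ q
                side v (inj₁ refl) z = pq (trans (sym (upd-same φ x₃ p)) z)
                side v (inj₂ (inj₁ refl)) z = 0q (trans (sym (trans (upd-other φ {x₃} p (n₃₅ ∘ sym)) (at (E-sym G e₅₁)))) z)
                side v (inj₂ (inj₂ refl)) z = bq (trans (sym (upd-other φ {x₃} p y₄≢x₃)) z)

    module Rest (O' : Sub n) (O'⊆ : O' ⊆ O) (g : 10 * ∣ O' ∪ R ∣ + 3 * e2 (G⁺ ↾ R) + 6 ≤ 10 * ∣ R ∣ + 3 * e2 (G⁺ ↾ (O' ∪ R))) where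
      R' : Sub n
      R' = O' ∪ R

      R'₃ : R' x₃ ≡ false
      R'₃ = ∨-f (⊆-f {A = O'} {O} O'⊆ O₃) R₃

      R'₄ : R' x₄ ≡ false
      R'₄ = ∨-f (⊆-f {A = O'} {O} O'⊆ O₄) R₄

      R⊆R' : R ⊆ R'
      R⊆R' u e = ∨-ir {O' u} e

      -- The star of a cubic vertex has doubled potential 40 - 18 = 22, of which the drop takes 6.
      low : 10 * ∣ R' ∣ ≤ 3 * e2 (G⁺ ↾ R') + 16
      low = farkas 0 (ℕₚ.+-mono-≤ (ℕₚ.+-mono-≤ g (ℕₚ.≤-reflexive (cong (10 *_) (trans (star-card x₁) (cong suc (proj₂ c₁))))))
           (ℕₚ.*-monoʳ-≤ 3 (ℕₚ.≤-trans (ℕₚ.≤-trans (ℕₚ.≤-reflexive (cong (2 *_) (sym (proj₂ c₁)))) (star-e2 x₁)) (e2-mono {H = G ↾ R} {G⁺ ↾ R} up))))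
           (dis-8 (∣ R' ∣) (e2 (G⁺ ↾ R)) (∣ R ∣) (e2 (G⁺ ↾ R')))
        where
        up : (G ↾ R) ⊑ (G⁺ ↾ R)
        up u v e = let (a , b , f) = ↾-E {G = G} {R} {u} {v} e in ↾-i G⁺ {R} a b (addE-i G y₃ y₄ y₃≢y₄ f)

      keep : (R' y₃ ≡ false) ⊎ (R' y₄ ≡ false) → Dense x₁ x₂ x₃ x₄ x₅
      keep h = R' , R⊆R' , R'₃ , R'₄ , ℕₚ.≤-trans low (ℕₚ.+-monoˡ-≤ 16 (ℕₚ.*-monoʳ-≤ 3 (e2-mono {H = G⁺ ↾ R'} {G ↾ R'} down)))
        where
        no-new : ∀ {u v} → R' u ≡ true → R' v ≡ true → ¬ ((u ≡ y₃ × v ≡ y₄) ⊎ (u ≡ y₄ × v ≡ y₃))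
        no-new a b (inj₁ (refl , refl)) = case h of λ { (inj₁ z) → tf a z ; (inj₂ z) → tf b z }
        no-new a b (inj₂ (refl , refl)) = case h of λ { (inj₁ z) → tf b z ; (inj₂ z) → tf a z }
        down : (G⁺ ↾ R') ⊑ (G ↾ R')
        down u v e with ↾-E {G = G⁺} {R'} {u} {v} e
        ... | a , b , f with G⁺-t f
        ... | inj₁ z = ↾-i G {R'} a b z
        ... | inj₂ z = ⊥-elim (no-new a b z)

      -- Adding `x₃` and `x₄` with five edges makes up for the extra edge `y₃y₄`: in `G` the doubled
      -- potential is at most 16 + 6 + 20 - 30 = 12, below 14.
      full : R' y₃ ≡ true → R' y₄ ≡ true → ⊥
      full a b = dense S₂ four (farkas 1 (ℕₚ.+-mono-≤ (ℕₚ.+-mono-≤ low (ℕₚ.≤-reflexive (cong (10 *_) card))) (ℕₚ.*-monoʳ-≤ 3 (ℕₚ.+-mono-≤ (e2-addE G y₃ y₄ y₃≢y₄ R') (ℕₚ.+-mono-≤ g₁ g₂))))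
            (dis-9 (∣ R' ∣) (∣ S₂ ∣) (e2 (G⁺ ↾ R')) (e2 (G ↾ R')) (e2 (G ↾ S₁)) (e2 (G ↾ S₂))))
        where
        S₁ = ins R' x₃
        S₂ = ins S₁ x₄
        S₁₄ : S₁ x₄ ≡ false
        S₁₄ = ∨-f (≢→== (E-irr G e₃₄ ∘ sym)) R'₄
        card : ∣ S₂ ∣ ≡ 2 + ∣ R' ∣
        card = trans (card-ins S₁ x₄ S₁₄) (cong suc (card-ins R' x₃ R'₃))
        nbr : ∀ {u} → E G x₁ u → R' u ≡ true
        nbr {u} e = R⊆R' u (∨-ir {u == x₁} e)
        up : ∀ {u} → R' u ≡ true → S₁ u ≡ true
        up {u} e = ∨-ir {u == x₃} e
        g₁ : e2 (G ↾ R') + 4 ≤ e2 (G ↾ S₁)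
        g₁ = grow G R' x₃ {x₂ ∷ y₃ ∷ []} R'₃ (((y₃≢x₂ ∘ sym) ∷ []) ∷ [] ∷ []) ((nbr e₁₂ , E-sym G e₂₃) ∷ (a , x₃y₃) ∷ [])
        g₂ : e2 (G ↾ S₁) + 6 ≤ e2 (G ↾ S₂)
        g₂ = grow G S₁ x₄ {x₃ ∷ x₅ ∷ y₄ ∷ []} S₁₄ ((n₃₅ ∷ (y₄≢x₃ ∘ sym) ∷ []) ∷ ((y₄≢x₅ ∘ sym) ∷ []) ∷ [] ∷ [])
            ((∨-il (==-refl x₃) , E-sym G e₃₄) ∷ (up (nbr (E-sym G e₅₁)) , e₄₅) ∷ (up b , x₄y₄) ∷ [])
        four : 4 ≤ ∣ S₂ ∣
        four = ℕₚ.≤-trans (ℕₚ.≤-reflexive (sym (trans (star-card x₁) (cong suc (proj₂ c₁))))) (card-mono {A = R} {S₂} λ u e → ∨-ir {u == x₄} (up (R⊆R' u e)))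

      dense-part : Dense x₁ x₂ x₃ x₄ x₅
      dense-part = go (bcase (R' y₃)) (bcase (R' y₄))
        where
        go : (R' y₃ ≡ true) ⊎ (R' y₃ ≡ false) → (R' y₄ ≡ true) ⊎ (R' y₄ ≡ false) → Dense x₁ x₂ x₃ x₄ x₅
        go (inj₂ z) _ = keep (inj₁ z)
        go (inj₁ _) (inj₂ z) = keep (inj₂ z)
        go (inj₁ a) (inj₁ b) = ⊥-elim (full a b)

    centre : Adynamic G ⊎ Dense x₁ x₂ x₃ x₄ x₅
    centre = go (Extends? (G⁺ ↾ (O ∪ R)) R (paint x₁))
      where
      dropped : Drop G⁺ O R (paint x₁) → Dense x₁ x₂ x₃ x₄ x₅
      dropped (inj₁ (A , _ , a4 , low , _)) = ⊥-elim (dense A a4 (farkas 3 (ℕₚ.+-mono-≤ low (ℕₚ.*-monoʳ-≤ 3 (e2-addE G y₃ y₄ y₃≢y₄ A))) (dis-10 (∣ A ∣) (e2 (G⁺ ↾ A)) (e2 (G ↾ A)))))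
      dropped (inj₂ (O' , O'⊆ , _ , g)) = Rest.dense-part O' O'⊆ g
      go : Dec (Extends (G⁺ ↾ (O ∪ R)) R (paint x₁)) → Adynamic G ⊎ Dense x₁ x₂ x₃ x₄ x₅
      go (yes e) = inj₁ (extended e)
      go (no nx) = inj₂ (dropped (drop G⁺ O R (paint x₁) disj prop nx))

  rotations : ∀ {x} → fromList T x ≡ true → ∃ λ y → ∃ λ z → Tri G x y z
  rotations {x} e with ∈fromList T {x} e
  ... | here refl = tb , tc , tri
  ... | there (here refl) = ta , tc , E-sym G (proj₁ tri) , proj₂ (proj₂ tri) , proj₁ (proj₂ tri)
  ... | there (there (here refl)) = ta , tb , E-sym G (proj₂ (proj₂ tri)) , proj₁ tri , E-sym G (proj₁ (proj₂ tri))

  -- 16 is below the 20 of triangle-free sets, so `A` contains a triangle, and there is only one.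
  T-inside : ∀ A → 4 ≤ ∣ A ∣ → 10 * ∣ A ∣ ≤ 3 * e2 (G ↾ A) + 16 → fromList T ⊆ A
  T-inside A a4 low with tri? (G ↾ A)
  ... | no h = ⊥-elim (ℕₚ.<-irrefl refl (farkas {1} {0} 3 (ℕₚ.+-mono-≤ (sparser A a4 λ x y z t → h (x , y , z , t)) low) (dis-11 (e2 (G ↾ A)) (∣ A ∣))))
  ... | yes (x , y , z , xy , yz , xz) = λ u e → go (rotations e)
    where
    k : ∀ {u v} → E (G ↾ A) u v → A u ≡ true × A v ≡ true × E G u v
    k {u} {v} e = ↾-E {G = G} {A} {u} {v} e
    go : ∀ {u} → (∃ λ p → ∃ λ q → Tri G u p q) → A u ≡ true
    go (_ , _ , t) with U (proj₂ (proj₂ (k xy)) , proj₂ (proj₂ (k yz)) , proj₂ (proj₂ (k xz))) t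
    ... | inj₁ refl = proj₁ (k xy)
    ... | inj₂ (inj₁ refl) = proj₁ (k yz)
    ... | inj₂ (inj₂ refl) = proj₁ (proj₂ (k yz))

  _∩_ : Sub n → Sub n → Sub n
  (A ∩ B) u = A u ∧ B u

  card-∪∩ : ∀ A B → ∣ A ∪ B ∣ + ∣ A ∩ B ∣ ≡ ∣ A ∣ + ∣ B ∣
  card-∪∩ A B = trans (sym (∑-+ (𝟙 ∘ (A ∪ B)) (𝟙 ∘ (A ∩ B)))) (trans (∑-cong {f = λ u → 𝟙 ((A ∪ B) u) + 𝟙 ((A ∩ B) u)} {λ u → 𝟙 (A u) + 𝟙 (B u)} λ u → k (A u) (B u)) (∑-+ (𝟙 ∘ A) (𝟙 ∘ B)))
    where k : ∀ a b → 𝟙 (a ∨ b) + 𝟙 (a ∧ b) ≡ 𝟙 a + 𝟙 b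
          k true true = refl
          k true false = refl
          k false b = ℕₚ.+-identityʳ _

  -- Edge counts are supermodular, and an edge between the two differences is counted by the union
  -- alone.
  e2-∪∩ : ∀ A B {x y} → E G x y → A x ≡ true → B x ≡ false → A y ≡ false → B y ≡ true → e2 (G ↾ A) + e2 (G ↾ B) + 2 ≤ e2 (G ↾ (A ∪ B)) + e2 (G ↾ (A ∩ B))
  e2-∪∩ A B {x} {y} xy ax bx ay by = ℕₚ.≤-trans (ℕₚ.≤-reflexive (sym (trans (∑₂-+ (λ u v → f A u v + f B u v) (λ u v → d x y u v + d y x u v)) (cong₂ _+_ (∑₂-+ (f A) (f B)) (trans (∑₂-+ (d x y) (d y x)) (cong₂ _+_ (∑₂-δ 1 x y) (∑₂-δ 1 y x)))))))
    (ℕₚ.≤-trans (∑₂-mono pt) (ℕₚ.≤-reflexive (∑₂-+ (f (A ∪ B)) (f (A ∩ B)))))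
    where
    f : Sub n → Fin n → Fin n → ℕ
    f A u v = 𝟙 (adj (G ↾ A) u v)
    d : Fin n → Fin n → Fin n → Fin n → ℕ
    d a b u v = if u == a then (if v == b then 1 else 0) else 0
    d-0 : ∀ {a b u v} → ¬ (u ≡ a × v ≡ b) → d a b u v ≡ 0
    d-0 {a} {b} {u} {v} h with u ≟ a | v ≟ b
    ... | yes p | yes q = ⊥-elim (h (p , q))
    ... | yes refl | no q rewrite ==-refl u | ≢→== q = refl
    ... | no p | _ rewrite ≢→== p = refl
    d-1 : ∀ a b → d a b a b ≡ 1
    d-1 a b rewrite ==-refl a | ==-refl b = refl
    sm : ∀ a b c e g → 𝟙 ((a ∧ b) ∧ g) + 𝟙 ((c ∧ e) ∧ g) ≤ 𝟙 (((a ∨ c) ∧ (b ∨ e)) ∧ g) + 𝟙 (((a ∧ c) ∧ (b ∧ e)) ∧ g)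
    sm a b c e false rewrite Boolₚ.∧-zeroʳ (a ∧ b) | Boolₚ.∧-zeroʳ (c ∧ e) = z≤n
    sm true true true true true = ℕₚ.≤-refl
    sm true true true false true = ℕₚ.≤-refl
    sm true true false e true = s≤s z≤n
    sm true false true true true = s≤s z≤n
    sm true false true false true = z≤n
    sm true false false e true = z≤n
    sm false b true true true rewrite Boolₚ.∨-zeroʳ b = s≤s z≤n
    sm false b true false true = z≤n
    sm false b false e true = z≤n
    pt : ∀ u v → f A u v + f B u v + (d x y u v + d y x u v) ≤ f (A ∪ B) u v + f (A ∩ B) u v
    pt u v with u ≟ x | v ≟ y | u ≟ y | v ≟ x
    ... | yes refl | yes refl | _ | _ rewrite d-1 u v | d-0 {v} {u} {u} {v} (λ q → E-irr G xy (proj₁ q)) | ax | bx | ay | by | xy = s≤s z≤n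
    ... | yes p | no q | yes r | _ = ⊥-elim (E-irr G xy (trans (sym p) r))
    ... | no p | _ | yes refl | yes refl rewrite d-1 u v | d-0 {v} {u} {u} {v} (λ q → p (proj₁ q)) | ax | bx | ay | by | E-sym G xy = s≤s z≤n
    ... | no p | _ | no r | _ rewrite d-0 {x} {y} {u} {v} (p ∘ proj₁) | d-0 {y} {x} {u} {v} (r ∘ proj₁) = ℕₚ.≤-trans (ℕₚ.≤-reflexive (ℕₚ.+-identityʳ _)) (sm (A u) (A v) (B u) (B v) (adj G u v))
    ... | no p | _ | yes r | no s rewrite d-0 {x} {y} {u} {v} (p ∘ proj₁) | d-0 {y} {x} {u} {v} (s ∘ proj₂) = ℕₚ.≤-trans (ℕₚ.≤-reflexive (ℕₚ.+-identityʳ _)) (sm (A u) (A v) (B u) (B v) (adj G u v))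
    ... | yes p | no q | no r | _ rewrite d-0 {x} {y} {u} {v} (q ∘ proj₂) | d-0 {y} {x} {u} {v} (r ∘ proj₁) = ℕₚ.≤-trans (ℕₚ.≤-reflexive (ℕₚ.+-identityʳ _)) (sm (A u) (A v) (B u) (B v) (adj G u v))

  reducible : Config → Adynamic G
  reducible (x₁ , x₂ , x₃ , x₄ , x₅ , pn , c₁ , c₂ , c₃ , c₄ , o₅) = go (Centre.centre pn c₁ c₃ c₄) (Centre.centre (Pent-refl pn) c₄ c₂ c₁)
    where
    open Pent pn
    go : Adynamic G ⊎ Dense x₁ x₂ x₃ x₄ x₅ → Adynamic G ⊎ Dense x₄ x₃ x₂ x₁ x₅ → Adynamic G
    go (inj₁ r) _ = r
    go _ (inj₁ r) = r
    -- The edge `x₂x₃` joins the differences, so the doubled potentials of union and intersection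
    -- sum to at most 16 + 16 - 6 = 26, less than 14 + 14. The intersection is large enough for the
    -- lower bound because it contains `x₅` and the triangle.
    go (inj₂ (A , sA , A₃ , A₄ , lA)) (inj₂ (B , sB , B₂ , B₁ , lB)) = ⊥-elim (ℕₚ.<-irrefl refl (farkas {1} {0} 1
        (ℕₚ.+-mono-≤ (ℕₚ.+-mono-≤ (ℕₚ.+-mono-≤ (sparse (A ∪ B) (ℕₚ.≤-trans A4 (card-mono {A = A} {A ∪ B} λ u e → ∨-il e))) (sparse (A ∩ B) I4)) (ℕₚ.+-mono-≤ lA lB))
          (ℕₚ.+-mono-≤ (ℕₚ.*-monoʳ-≤ 3 (e2-∪∩ A B e₂₃ (sA x₂ (∨-ir {x₂ == x₁} e₁₂)) B₂ A₃ (sB x₃ (∨-ir {x₃ == x₄} (E-sym G e₃₄))))) (ℕₚ.*-monoʳ-≤ 10 (ℕₚ.≤-reflexive (card-∪∩ A B)))))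
        (dis-12 (∣ A ∣) (∣ B ∣) (∣ A ∪ B ∣) (∣ A ∩ B ∣) (e2 (G ↾ A)) (e2 (G ↾ B)) (e2 (G ↾ (A ∪ B))) (e2 (G ↾ (A ∩ B))))))
      where
      A4 : 4 ≤ ∣ A ∣
      A4 = ℕₚ.≤-trans (ℕₚ.≤-reflexive (sym (trans (star-card x₁) (cong suc (proj₂ c₁))))) (card-mono {A = star x₁} {A} sA)
      B4 : 4 ≤ ∣ B ∣
      B4 = ℕₚ.≤-trans (ℕₚ.≤-reflexive (sym (trans (star-card x₄) (cong suc (proj₂ c₄))))) (card-mono {A = star x₄} {B} sB)
      TA = T-inside A A4 lA
      TB = T-inside B B4 lB
      off : ∀ {t} → fromList T t ≡ true → x₅ ≢ t
      off h refl = tf h o₅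
      both : ∀ {t} → fromList T t ≡ true → (A ∩ B) t ≡ true
      both {t} h = ∧-i (TA t h) (TB t h)
      ma : fromList T ta ≡ true
      ma = fromList∈ {xs = T} (here refl)
      mb : fromList T tb ≡ true
      mb = fromList∈ {xs = T} (there (here refl))
      mc : fromList T tc ≡ true
      mc = fromList∈ {xs = T} (there (there (here refl)))
      I4 : 4 ≤ ∣ A ∩ B ∣
      I4 = card-list (A ∩ B) {x₅ ∷ T} ((off ma ∷ off mb ∷ off mc ∷ []) ∷ T-unique)
         (∧-i (sA x₅ (∨-ir {x₅ == x₁} (E-sym G e₅₁))) (sB x₅ (∨-ir {x₅ == x₄} e₄₅)) ∷ both ma ∷ both mb ∷ both mc ∷ [])

-- The induction on the number of edges

Adynamic? : ∀ {n} (G : Graph n) → Dec (Adynamic G)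
Adynamic? {n} G = search n (λ φ → Proper? G φ ×-dec Finₚ.any? λ v → (2 ≤? dg G v) ×-dec Finₚ.all? λ u → Finₚ.all? λ w → E? G v u →-dec E? G v w →-dec (φ u ≟ φ w))
  λ { {c} {d} h (pr , v , d2 , mo) → Proper-ext G h pr , v , d2 , λ u w e f → trans (sym (h u)) (trans (mo u w e f) (h w)) }

module MainStep {n} (G : Graph n) (P : Planarity G) (U : OneTri G)
  (IH : ∀ (H : Graph n) → Planarity H → OneTri H → 2 + e2 H ≤ e2 G → ∃ (HypAt H) → Adynamic H) (hyp : ∃ (HypAt G)) where

  v₀ = proj₁ hyp
  w₀ = proj₁ (two-of G v₀ (proj₁ (proj₂ hyp)))

  v₀w₀ : E G v₀ w₀
  v₀w₀ = proj₁ (proj₂ (proj₂ (proj₂ (two-of G v₀ (proj₁ (proj₂ hyp))))))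

  quad-free : (∀ v w → E G v w → 2 ≤ dg G v) → NoQuads G → ∀ {a b c} → Tri G a b c → Adynamic G
  quad-free d2 Q tri = go (Finₚ.any? λ v → dg G v ℕₚ.≟ 2)
    where
    open NoC4Case G P U Q d2 tri
    -- The neighbourhood of a triangle vertex is not independent; thus `v₀` supplies a vertex off
    -- the triangle with an edge.
    off : OffT v₀
    off = not-t→f λ t → let (_ , _ , ab , bc , ac) = rotations t in proj₂ (proj₂ hyp) _ _ ab ac bc
    go : Dec (∃ λ v → dg G v ≡ 2) → Adynamic G
    go (no h) = reducible (Discharge.config λ v w e → ℕₚ.≤∧≢⇒< (d2 v w e) λ q → h (v , sym q))
    go (yes (v , d)) with Finₚ.any? (λ u → Finₚ.any? λ w → E? G v u ×-dec E? G v w ×-dec E? G u w)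
    ... | yes (u , w , e , f , g) = triangle2 v (tri-T (e , g , f)) d off v₀w₀
    ... | no h = degree2 v d λ u w e f g → h (u , w , e , f , g)

  no-pendant : (∀ v w → E G v w → 2 ≤ dg G v) → Adynamic G
  no-pendant d2 with tri? G
  ... | no h with low-degree P (λ a b c t → h (a , b , c , t)) v₀w₀
  ... | v , w , e , d3 = let (φ , pr , mo) = mono-nbhd (e2 G) G P (λ a b c t → h (a , b , c , t)) ℕₚ.≤-refl v d3 in φ , pr , v , d2 v w e , mo
  -- Existence of the colouring is decidable, so it may be assumed to fail. Then no 4-cycle
  -- separates and all of them are faces, as `unobstructed` requires.
  no-pendant d2 | yes (a , b , c , tri) = decidable-stable (Adynamic? G) λ none → none (quad-free d2 (no-quads none) tri)
    where
    module _ (none : ¬ Adynamic G) where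
      fac : ∀ {a b c d} → C4 G a b c d → Facial P a b c d
      fac {a} {b} {c} {d} C = go (separation P C (chordless U C))
        where go : Facial P a b c d ⊎ Split P a b c d → Facial P a b c d
              go (inj₁ F) = F
              go (inj₂ S) = ⊥-elim (none (split-adynamic P U d2 C S))
      no-quads : NoQuads G
      no-quads C = let (_ , _ , _ , _ , D , F , nb) = unobstructed P U fac C in none (merge-adynamic P U D F nb IH)

  result : Adynamic G
  result with Finₚ.any? (λ u → dg G u ℕₚ.≟ 1)
  ... | yes (u , d1) = pendant P U d1 hyp (IH (isolate G u) (sub P _ (isolate-⊑ G u)) (OneTri-⊑ {H = isolate G u} {G} (isolate-⊑ G u) U) (isolate-smaller G (proj₂ (nbr-of G u (ℕₚ.≤-reflexive (sym d1))))))
  ... | no h = no-pendant λ v w e → ℕₚ.≤∧≢⇒< (dg-≥ G v {w ∷ []} ([] ∷ []) (e ∷ [])) λ q → h (v , sym q)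

adynamic : ∀ k {n} (G : Graph n) → Planarity G → OneTri G → e2 G ≤ k → ∃ (HypAt G) → Adynamic G
adynamic zero G P U h (v , d2 , _) = case ℕₚ.≤-trans (e2-strict {H = isolate G v} {G} (isolate-⊑ G v) v _ e (isolate-no G _)) h of λ ()
  where e = proj₁ (proj₂ (proj₂ (proj₂ (two-of G v d2))))
adynamic (suc k) G P U h hyp = MainStep.result G P U (λ H PH UH lt → adynamic k H PH UH (ℕₚ.≤-pred (ℕₚ.≤-trans (ℕₚ.n≤1+n _) (ℕₚ.≤-trans lt h)))) hyp

-- From rotation systems to algebraic planarity

iterate-+ : ∀ {A : Set} a b (f : A → A) x → iterate (a + b) f x ≡ iterate a f (iterate b f x)
iterate-+ zero b f x = refl
iterate-+ (suc a) b f x = cong f (iterate-+ a b f x)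

iterate-period : ∀ {A : Set} p m (f : A → A) x → iterate p f x ≡ x → iterate (m * p) f x ≡ x
iterate-period p zero f x e = refl
iterate-period p (suc m) f x e = trans (iterate-+ p (m * p) f x) (trans (cong (iterate p f) (iterate-period p m f x e)) e)

least : ∀ {n} {P : Fin n → Set} → (∀ u → Dec (P u)) → ∃ P → ∃ λ w → P w × (∀ u → P u → toℕ w ≤ toℕ u)
least {suc n} {P} P? (x , px) with P? zero
... | yes p = zero , p , λ _ _ → z≤n
least {suc n} {P} P? (zero , px) | no h = ⊥-elim (h px)
least {suc n} {P} P? (suc x , px) | no h with least (P? ∘ suc) (x , px)
... | w , pw , mn = suc w , pw , λ { zero p → ⊥-elim (h p) ; (suc u) p → s≤s (mn u p) }

all-i : ∀ {A : Set} (p : A → Bool) xs → (∀ x → p x ≡ true) → allᵇ p xs ≡ true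
all-i p [] h = refl
all-i p (x ∷ xs) h = ∧-i (h x) (all-i p xs h)

all-t : ∀ {A : Set} (p : A → Bool) {xs x} → allᵇ p xs ≡ true → x ∈ xs → p x ≡ true
all-t p {y ∷ xs} e (here refl) = proj₁ (∧-t {p y} e)
all-t p {y ∷ xs} e (there i) = all-t p (proj₂ (∧-t {p y} e)) i

any-t : ∀ {A : Set} (p : A → Bool) xs → anyᵇ p xs ≡ true → ∃ λ x → p x ≡ true
any-t p (x ∷ xs) e with ∨-t {p x} e
... | inj₁ q = x , q
... | inj₂ q = any-t p xs q

≡ᵇ-t : ∀ {a b} → (a ≡ᵇ b) ≡ true → a ≡ b
≡ᵇ-t {a} {b} e = ℕₚ.≡ᵇ⇒≡ a b (subst IsTrue (sym e) tt)

≤ᵇ-t : ∀ {a b} → (a ≤ᵇ b) ≡ true → a ≤ b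
≤ᵇ-t {a} {b} e = ℕₚ.≤ᵇ⇒≤ a b (subst IsTrue (sym e) tt)

t-≤ᵇ : ∀ {a b} → a ≤ b → (a ≤ᵇ b) ≡ true
t-≤ᵇ {a} {b} h with a ≤ᵇ b | ℕₚ.≤⇒≤ᵇ h
... | true | _ = refl

sum-map : ∀ {A : Set} {n} (g : A → ℕ) (f : Fin n → A) → sumᴸ (map g (tabulate f)) ≡ ∑ (g ∘ f)
sum-map {n = zero} g f = refl
sum-map {n = suc n} g f = cong (g (f zero) +_) (sum-map g (f ∘ suc))

list-inj : ∀ {A : Set} {n} (B : Sub n) (f : A → Fin n) {L} → AllPairs _≢_ L → (∀ {x} → x ∈ L → B (f x) ≡ true) →
  (∀ {x y} → x ∈ L → y ∈ L → f x ≡ f y → x ≡ y) → length L ≤ ∣ B ∣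
list-inj B f {L} d h inj = ℕₚ.≤-trans (ℕₚ.≤-reflexive (sym (length-map f L))) (card-list B (uni d (λ i j → inj i j)) (into (λ i → h i)))
  where
  into : ∀ {xs} → (∀ {x} → x ∈ xs → B (f x) ≡ true) → All (λ y → B y ≡ true) (map f xs)
  into {[]} h = []
  into {x ∷ xs} h = h (here refl) ∷ into (h ∘ there)
  uni : ∀ {xs} → AllPairs _≢_ xs → (∀ {x y} → x ∈ xs → y ∈ xs → f x ≡ f y → x ≡ y) → Unique (map f xs)
  uni [] h = []
  uni {x ∷ xs} (d ∷ ds) h = sep d (λ i → h (here refl) (there i)) ∷ uni ds (λ i j → h (there i) (there j))
    where
    sep : ∀ {ys} → All (x ≢_) ys → (∀ {y} → y ∈ ys → f x ≡ f y → x ≡ y) → All (f x ≢_) (map f ys)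
    sep [] h = []
    sep (p ∷ ps) h = (λ e → p (h (here refl) e)) ∷ sep ps (h ∘ there)

card-inj : ∀ {m n} (A : Sub m) (B : Sub n) (f : Fin m → Fin n) → (∀ x → A x ≡ true → B (f x) ≡ true) →
  (∀ x y → A x ≡ true → A y ≡ true → f x ≡ f y → x ≡ y) → ∣ A ∣ ≤ ∣ B ∣
card-inj A B f h inj = ℕₚ.≤-trans (ℕₚ.≤-reflexive (sym (count-tab A id))) (list-inj B f (filt-AllPairs A (tab-unique id (λ _ _ e → e))) (λ i → h _ (∈-filt A (allFin _) i)) (λ i j → inj _ _ (∈-filt A (allFin _) i) (∈-filt A (allFin _) j)))

-- Spanning forests

tree cotree : ∀ {n} → List (Pair n) → List (Pair n)
tree [] = []
tree ((a , b) ∷ es) = if rep es a == rep es b then tree es else (a , b) ∷ tree es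
cotree [] = []
cotree ((a , b) ∷ es) = if rep es a == rep es b then (a , b) ∷ cotree es else cotree es

tree-yes : ∀ {n} {a b : Fin n} (es : List (Pair n)) → rep es a ≡ rep es b → tree ((a , b) ∷ es) ≡ tree es
tree-yes {b = b} es e rewrite e | ==-refl (rep es b) = refl

tree-no : ∀ {n} {a b : Fin n} (es : List (Pair n)) → rep es a ≢ rep es b → tree ((a , b) ∷ es) ≡ (a , b) ∷ tree es
tree-no es ne rewrite ≢→== ne = refl

tree-classes : ∀ {n} (es : List (Pair n)) → classes es + length (tree es) ≡ n
tree-classes {n} [] = trans (ℕₚ.+-identityʳ _) (trans (∑-cong {n} {λ x → 𝟙 (x == x)} {λ _ → 1} λ x → cong 𝟙 (==-refl x)) (∑-1 n))
tree-classes {n} ((a , b) ∷ es) = go (rep es a ≟ rep es b)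
  where
  go : Dec (rep es a ≡ rep es b) → classes ((a , b) ∷ es) + length (tree ((a , b) ∷ es)) ≡ n
  go (yes e) = trans (cong₂ _+_ (classes-same a b es e) (cong length (tree-yes es e))) (tree-classes es)
  go (no ne) = trans (cong (λ t → classes ((a , b) ∷ es) + length t) (tree-no es ne)) (trans (ℕₚ.+-suc _ (length (tree es))) (trans (cong (_+ length (tree es)) (sym (classes-merge a b es ne))) (tree-classes es)))

tree-cotree : ∀ {n} (es : List (Pair n)) → length (tree es) + length (cotree es) ≡ length es
tree-cotree [] = refl
tree-cotree ((a , b) ∷ es) with rep es a == rep es b
... | true = trans (ℕₚ.+-suc _ _) (cong suc (tree-cotree es))
... | false = cong suc (tree-cotree es)

tree-or-cotree : ∀ {n} (es : List (Pair n)) {e} → e ∈ es → (e ∈ tree es) ⊎ (e ∈ cotree es)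
tree-or-cotree ((a , b) ∷ es) i with rep es a == rep es b
tree-or-cotree ((a , b) ∷ es) (here refl) | true = inj₂ (here refl)
tree-or-cotree ((a , b) ∷ es) (here refl) | false = inj₁ (here refl)
tree-or-cotree ((a , b) ∷ es) (there i) | true with tree-or-cotree es i
... | inj₁ j = inj₁ j
... | inj₂ j = inj₂ (there j)
tree-or-cotree ((a , b) ∷ es) (there i) | false with tree-or-cotree es i
... | inj₁ j = inj₁ (there j)
... | inj₂ j = inj₂ j

tree-⊆ : ∀ {n} (es : List (Pair n)) {e} → e ∈ tree es → e ∈ es
tree-⊆ ((a , b) ∷ es) i with rep es a == rep es b
tree-⊆ ((a , b) ∷ es) i | true = there (tree-⊆ es i)
tree-⊆ ((a , b) ∷ es) (here refl) | false = here refl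
tree-⊆ ((a , b) ∷ es) (there i) | false = there (tree-⊆ es i)

cotree-⊆ : ∀ {n} (es : List (Pair n)) {e} → e ∈ cotree es → e ∈ es
cotree-⊆ ((a , b) ∷ es) i with rep es a == rep es b
cotree-⊆ ((a , b) ∷ es) i | false = there (cotree-⊆ es i)
cotree-⊆ ((a , b) ∷ es) (here refl) | true = here refl
cotree-⊆ ((a , b) ∷ es) (there i) | true = there (cotree-⊆ es i)

Supported : ∀ {n} → (Fin n → Fin n → Bool) → List (Pair n) → Set
Supported Z es = ∀ u v → Z u v ≡ true → ((u , v) ∈ es) ⊎ ((v , u) ∈ es)

-- The cut of the component of a in the earlier edges meets Z in an even number of edges, and ab is the only candidate.
forest-even : ∀ {n} (es : List (Pair n)) (Z : Fin n → Fin n → Bool) → (∀ u v → Z u v ≡ Z v u) → (∀ u → Z u u ≡ false) →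
  (∀ u → ⊕ (Z u) ≡ false) → Supported Z (tree es) → ∀ u v → Z u v ≡ false
forest-even [] Z zs zi ze sp u v = not-t→f λ z → case sp u v z of λ { (inj₁ ()) ; (inj₂ ()) }
forest-even {n} ((a , b) ∷ es) Z zs zi ze sp₀ with rep es a ≟ rep es b
... | yes e = forest-even es Z zs zi ze (subst (Supported Z) (tree-yes es e) sp₀)
... | no ne = forest-even es Z zs zi ze sp'
  where
  sp : Supported Z ((a , b) ∷ tree es)
  sp = subst (Supported Z) (tree-no es ne) sp₀
  S : Fin n → Bool
  S u = rep es u == rep es a
  Sa : S a ≡ true
  Sa = ==-refl (rep es a)
  Sb : S b ≡ false
  Sb = ≢→== (ne ∘ sym)
  same : ∀ {u v} → (u , v) ∈ tree es → S u ≡ S v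
  same i = cong (_== rep es a) (rep-∈ es (tree-⊆ es i))
  g g' : Fin n → Fin n → Bool
  g u v = (S u ∧ Z u v) ∧ not (S v)
  g' u v = (S u ∧ Z u v) ∧ S v
  inner : ⊕ (λ u → ⊕ (g' u)) ≡ false
  inner = ⊕-sym g' (λ u v → trans (sw (S u) (Z u v) (S v)) (cong (λ z → (S v ∧ z) ∧ S u) (zs u v))) (λ u → trans (cong (λ z → (S u ∧ z) ∧ S u) (zi u)) (cong (_∧ S u) (Boolₚ.∧-zeroʳ (S u))))
    where sw : ∀ p z q → (p ∧ z) ∧ q ≡ (q ∧ z) ∧ p
          sw true true true = refl
          sw true true false = refl
          sw true false true = refl
          sw true false false = refl
          sw false z true = sym (Boolₚ.∧-zeroʳ z)
          sw false z false = refl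
  whole : ⊕ (λ u → ⊕ (λ v → S u ∧ Z u v)) ≡ false
  whole = ⊕-0 λ u → k (S u) (Z u) (ze u)
    where k : ∀ p (f : Fin n → Bool) → ⊕ f ≡ false → ⊕ (λ v → p ∧ f v) ≡ false
          k true f h = h
          k false f h = ⊕-0 λ _ → refl
  outer : ⊕ (λ u → ⊕ (g u)) ≡ false
  outer = trans (sym (Boolₚ.xor-identityʳ _)) (trans (cong (⊕ (λ u → ⊕ (g u)) xor_) (sym inner)) (trans (sym (⊕-xor (λ u → ⊕ (g u)) (λ u → ⊕ (g' u))))
    (trans (⊕-cong λ u → trans (sym (⊕-xor (g u) (g' u))) (⊕-cong λ v → sp2 (S u ∧ Z u v) (S v))) whole)))
    where sp2 : ∀ p q → (p ∧ not q) xor (p ∧ q) ≡ p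
          sp2 true true = refl
          sp2 true false = refl
          sp2 false q = refl
  only : ∀ u v → g u v ≡ true → u ≡ a × v ≡ b
  only u v e with ∧-t {S u ∧ Z u v} e
  ... | p , q with ∧-t {S u} p
  ... | su , z with sp u v z
  ... | inj₁ (here refl) = refl , refl
  ... | inj₂ (here refl) = tf su Sb
  ... | inj₁ (there i) = ⊥-elim (case trans (sym q) (cong not (trans (sym (same i)) su)) of λ ())
  ... | inj₂ (there i) = ⊥-elim (case trans (sym q) (cong not (trans (same i) su)) of λ ())
  Zab : Z a b ≡ false
  Zab = trans (sym gab) (trans (sym (⊕-1 (g a) b (λ v h → not-t→f λ e → h (proj₂ (only a v e))))) (trans (sym (⊕-1 (λ u → ⊕ (g u)) a (λ u h → ⊕-0 λ v → not-t→f λ e → h (proj₁ (only u v e))))) outer))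
    where gab : g a b ≡ Z a b
          gab rewrite Sa | Sb = Boolₚ.∧-identityʳ (Z a b)
  sp' : Supported Z (tree es)
  sp' u v z with sp u v z
  ... | inj₁ (there i) = inj₁ i
  ... | inj₂ (there i) = inj₂ i
  ... | inj₁ (here refl) = tf z Zab
  ... | inj₂ (here refl) = tf z (trans (zs u v) Zab)

module Rotation {n} (G : Graph n) (ρ : Fin n → Fin n → Fin n)
  (ρ-E : ∀ u v → E G u v → E G u (ρ u v)) (ρ-trans : ∀ u v w → E G u v → E G u w → ∃ λ k → iterate k (ρ u) v ≡ w) where

  -- From `z = ρ v x` one returns to `z` after `k + 1` steps through `x` and after `l + 1` steps
  -- through `y`. Hence `k + l(k + 1)` steps lead to `x` and `l + k(l + 1)` steps to `y`, and these
  -- numbers are equal.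
  ρ-inj : ∀ v {x y} → E G v x → E G v y → ρ v x ≡ ρ v y → x ≡ y
  ρ-inj v {x} {y} vx vy e with ρ-trans v (ρ v x) x (ρ-E v x vx) vx | ρ-trans v (ρ v x) y (ρ-E v x vx) vy
  ... | k , p | l , q = trans (sym (trans (iterate-+ k (l * suc k) f z) (trans (cong (iterate k f) (iterate-period (suc k) l f z (cong f p))) p)))
      (trans (cong (λ i → iterate i f z) (ar k l)) (trans (iterate-+ l (k * suc l) f z) (trans (cong (iterate l f) (iterate-period (suc l) k f z (trans (cong f q) (sym e)))) q)))
    where
    f = ρ v
    z = ρ v x
    ar : ∀ k l → k + l * suc k ≡ l + k * suc l
    ar = solve-∀

  iterate-E : ∀ k {v x} → E G v x → E G v (iterate k (ρ v) x)
  iterate-E zero e = e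
  iterate-E (suc k) {v} {x} e = ρ-E v _ (iterate-E k e)

  ρ-surj : ∀ v {w} → E G v w → ∃ λ u → E G v u × ρ v u ≡ w
  ρ-surj v {w} vw with ρ-trans v (ρ v w) w (ρ-E v w vw) vw
  ... | zero , e = w , vw , e
  ... | suc k , e = iterate k (ρ v) (ρ v w) , iterate-E k (ρ-E v w vw) , e

  dart : Fin n → Fin n → Fin (n * n)
  dart = combine

  ends : Fin (n * n) → Pair n
  ends = remQuot n

  ends-dart : ∀ u v → ends (dart u v) ≡ (u , v)
  ends-dart u v = Finₚ.remQuot-combine u v

  dart-ends : ∀ x → dart (proj₁ (ends x)) (proj₂ (ends x)) ≡ x
  dart-ends x = Finₚ.combine-remQuot {n} n x

  is-dart : Sub (n * n)
  is-dart x = adj G (proj₁ (ends x)) (proj₂ (ends x))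

  is-dart-i : ∀ {u v} → E G u v → is-dart (dart u v) ≡ true
  is-dart-i {u} {v} e = trans (cong (λ p → adj G (proj₁ p) (proj₂ p)) (ends-dart u v)) e

  arcs : List (Pair n)
  arcs = filterᵇ (λ p → adj G (proj₁ p) (proj₂ p)) (all-pairs n)

  ∈-map : ∀ {A B : Set} (f : A → B) {x xs} → x ∈ xs → f x ∈ map f xs
  ∈-map f (here refl) = here refl
  ∈-map f (there i) = there (∈-map f i)

  map-∈ : ∀ {A B : Set} (f : A → B) xs {y} → y ∈ map f xs → ∃ λ x → x ∈ xs × y ≡ f x
  map-∈ f (x ∷ xs) (here e) = x , here refl , e
  map-∈ f (x ∷ xs) (there i) = let (z , j , e) = map-∈ f xs i in z , there j , e

  -- A face is not kept as a walk but as a class of darts generated by these pairs; the pairs of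
  -- `dual` join the two sides of an edge.
  turn : Pair n → Pair (n * n)
  turn (u , v) = dart u v , dart v (ρ v u)

  dual : Pair n → Pair (n * n)
  dual (u , v) = dart u v , dart v u

  fs : List (Pair (n * n))
  fs = map turn arcs

  fs-i : ∀ {u v} → E G u v → (dart u v , dart v (ρ v u)) ∈ fs
  fs-i {u} {v} e = ∈-map turn {u , v} (filt-∈ (λ p → adj G (proj₁ p) (proj₂ p)) (∈-pairs u v) e)

  fs-t : ∀ {x y} → (x , y) ∈ fs → ∃ λ u → ∃ λ v → E G u v × x ≡ dart u v × y ≡ dart v (ρ v u)
  fs-t i with map-∈ turn arcs i
  ... | (u , v) , j , refl = u , v , ∈-filt (λ p → adj G (proj₁ p) (proj₂ p)) (all-pairs n) j , refl , refl

  Turning : (Fin (n * n) → Bool) → Set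
  Turning s = ∀ u v → E G u v → s (dart u v) ≡ s (dart v (ρ v u))

  Flat : (Fin (n * n) → Bool) → Fin n → Set
  Flat s u = ∀ v → E G u v → s (dart u v) ≡ s (dart v u)

  flat-around : ∀ s → Turning s → ∀ u → Flat s u → ∀ v w → E G u v → E G u w → s (dart u v) ≡ s (dart u w)
  flat-around s t u fl v w uv uw with ρ-trans u v w uv uw
  ... | k , refl = go k
    where
    go : ∀ k → s (dart u v) ≡ s (dart u (iterate k (ρ u) v))
    go zero = refl
    go (suc k) = trans (go k) (trans (fl _ (iterate-E k uv)) (t _ u (E-sym G (iterate-E k uv))))

  -- `ρ v` permutes the neighbours of `v`, so only the order of summation changes.
  ⊕-turn : ∀ v (g : Fin n → Bool) → ⊕ (λ u → adj G v u ∧ g (ρ v u)) ≡ ⊕ (λ u → adj G v u ∧ g u)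
  ⊕-turn v g = trans (⊕-cong row) (trans (⊕-swap h) (⊕-cong col))
    where
    h : Fin n → Fin n → Bool
    h u w = adj G v u ∧ ((w == ρ v u) ∧ g w)
    row : ∀ u → adj G v u ∧ g (ρ v u) ≡ ⊕ (h u)
    row u = sym (trans (⊕-1 (h u) (ρ v u) (λ w ne → trans (cong (λ z → adj G v u ∧ (z ∧ g w)) (≢→== ne)) (Boolₚ.∧-zeroʳ (adj G v u)))) (cong (λ z → adj G v u ∧ (z ∧ g (ρ v u))) (==-refl (ρ v u))))
    col : ∀ w → ⊕ (λ u → h u w) ≡ adj G v w ∧ g w
    col w with bcase (adj G v w)
    ... | inj₂ e = trans (⊕-0 λ u → not-t→f λ z → tf (subst (E G v) (sym (==→≡ {i = w} {ρ v u} (proj₁ (∧-t (proj₂ (∧-t {adj G v u} z)))))) (ρ-E v u (proj₁ (∧-t {adj G v u} z)))) e) (sym (cong (_∧ g w) e))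
    ... | inj₁ e with ρ-surj v e
    ... | u₀ , vu₀ , p = trans (⊕-1 (λ u → h u w) u₀ (λ u ne → not-t→f λ z → ne (ρ-inj v (proj₁ (∧-t {adj G v u} z)) vu₀ (trans (sym (==→≡ {i = w} {ρ v u} (proj₁ (∧-t (proj₂ (∧-t {adj G v u} z)))))) (sym p)))))
        (cong₂ _∧_ (trans vu₀ (sym e)) (cong (_∧ g w) (trans (cong (w ==_) p) (==-refl w))))

  -- The dart from `v` to `u` is on the same face as the dart from `u` to `ρ u v`, so the second
  -- summands are a rearrangement of the first.
  even-∂ : ∀ s → Turning s → ∀ u → ⊕ (λ v → adj G u v ∧ (s (dart u v) xor s (dart v u))) ≡ false
  even-∂ s t u = trans (⊕-cong λ v → trans (dist (adj G u v) (s (dart u v)) (s (dart v u))) (cong ((adj G u v ∧ s (dart u v)) xor_) (shift v)))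
     (trans (⊕-xor (λ v → adj G u v ∧ s (dart u v)) (λ v → adj G u v ∧ s (dart u (ρ u v)))) (trans (cong (⊕ (λ v → adj G u v ∧ s (dart u v)) xor_) (⊕-turn u (λ v → s (dart u v)))) (Boolₚ.xor-same (⊕ (λ v → adj G u v ∧ s (dart u v))))))
    where
    dist : ∀ p q r → p ∧ (q xor r) ≡ (p ∧ q) xor (p ∧ r)
    dist true q r = refl
    dist false q r = refl
    shift : ∀ v → adj G u v ∧ s (dart v u) ≡ adj G u v ∧ s (dart u (ρ u v))
    shift v with bcase (adj G u v)
    ... | inj₁ e = cong (adj G u v ∧_) (t v u (E-sym G e))
    ... | inj₂ e rewrite e = refl

  es : List (Pair n)
  es = edges G

  tree-zero : ∀ (Z : Fin n → Fin n → Bool) → (∀ u v → Z u v ≡ Z v u) → (∀ u v → Z u v ≡ true → E G u v) → (∀ u → ⊕ (Z u) ≡ false) →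
    (∀ {u v} → (u , v) ∈ cotree es → Z u v ≡ false) → ∀ u v → Z u v ≡ false
  tree-zero Z zs zp ze zc = forest-even es Z zs (λ u → not-t→f λ z → E-irr G (zp u u z) refl) ze sp
    where
    sp : Supported Z (tree es)
    sp u v z with ℕₚ.<-cmp (toℕ u) (toℕ v)
    ... | tri< l _ _ = case tree-or-cotree es (∈-edges G (zp u v z) l) of λ { (inj₁ i) → inj₁ i ; (inj₂ i) → tf z (zc i) }
    ... | tri≈ _ q _ = ⊥-elim (E-irr G (zp u v z) (Finₚ.toℕ-injective q))
    ... | tri> _ _ l = case tree-or-cotree es (∈-edges G (E-sym G (zp u v z)) l) of λ { (inj₁ i) → inj₂ i ; (inj₂ i) → tf z (trans (zs u v) (zc i)) }

  ∂Z : (Fin (n * n) → Bool) → Fin n → Fin n → Bool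
  ∂Z s u v = adj G u v ∧ (s (dart u v) xor s (dart v u))

  ∂Z-sym : ∀ s u v → ∂Z s u v ≡ ∂Z s v u
  ∂Z-sym s u v = cong₂ _∧_ (adj-sym G u v) (Boolₚ.xor-comm (s (dart u v)) _)

  -- The boundary of a face function is even; if it avoids the cotree, it is supported on the forest
  -- and vanishes.
  flat-everywhere : ∀ s → Turning s → (∀ {u v} → (u , v) ∈ cotree es → s (dart u v) ≡ s (dart v u)) → ∀ u → Flat s u
  flat-everywhere s t h u v e = xor-f _ _ (trans (sym (cong (_∧ (s (dart u v) xor s (dart v u))) e)) (tree-zero (∂Z s) (∂Z-sym s) (λ u v z → proj₁ (∧-t {adj G u v} z)) (even-∂ s t)
    (λ {u} {v} i → trans (cong (adj G u v ∧_) (trans (cong (_xor s (dart v u)) (h i)) (Boolₚ.xor-same (s (dart v u))))) (Boolₚ.∧-zeroʳ (adj G u v))) u v))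

  -- With enough faces, the cotree edges are independent in the dual.  One face of each component becomes the common outer face.
  module Many (enough : classes (map dual (cotree es) ++ fs) + length (cotree es) ≤ classes fs) where
    all-duals : List (Pair (n * n))
    all-duals = map dual arcs

    κ : Fin (n * n) → Fin (n * n)
    κ = rep (all-duals ++ fs)

    κ-fs : ∀ x → κ (rep fs x) ≡ κ x
    κ-fs x = rep-++ all-duals fs (rep-idem fs x)

    in-++ˡ : ∀ {A : Set} {x : A} {xs ys} → x ∈ xs → x ∈ xs ++ ys
    in-++ˡ (here e) = here e
    in-++ˡ (there i) = there (in-++ˡ i)

    ++-t : ∀ {A : Set} {x : A} xs {ys} → x ∈ xs ++ ys → (x ∈ xs) ⊎ (x ∈ ys)
    ++-t [] i = inj₂ i
    ++-t (x ∷ xs) (here e) = inj₁ (here e)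
    ++-t (x ∷ xs) (there i) with ++-t xs i
    ... | inj₁ j = inj₁ (there j)
    ... | inj₂ j = inj₂ j

    κ-dual : ∀ {u v} → E G u v → κ (dart u v) ≡ κ (dart v u)
    κ-dual {u} {v} e = rep-∈ (all-duals ++ fs) (in-++ˡ (∈-map dual {u , v} (filt-∈ (λ p → adj G (proj₁ p) (proj₂ p)) (∈-pairs u v) e)))

    κ-fun : ∀ (s : Fin (n * n) → Bool) → Turning s → (∀ u → Flat s u) → ∀ x → s (κ x) ≡ s x
    κ-fun s t fl = rep-fun s (all-duals ++ fs) λ i → k (++-t all-duals i)
      where
      k : ∀ {a b} → ((a , b) ∈ all-duals) ⊎ ((a , b) ∈ fs) → s a ≡ s b
      k (inj₂ i) = let (u , v , e , p , q) = fs-t i in trans (cong s p) (trans (t u v e) (cong s (sym q)))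
      k (inj₁ i) with map-∈ dual arcs i
      ... | (u , v) , j , refl = fl u v (∈-filt (λ p → adj G (proj₁ p) (proj₂ p)) (all-pairs n) j)

    fixed-++ : ∀ xs x → rep fs (rep (xs ++ fs) x) ≡ rep (xs ++ fs) x
    fixed-++ [] x = rep-idem fs x
    fixed-++ ((a , b) ∷ xs) x with rep (xs ++ fs) x ≟ rep (xs ++ fs) a
    ... | yes e = trans (cong (rep fs) (rep-hit a b (xs ++ fs) x e)) (trans (fixed-++ xs b) (sym (rep-hit a b (xs ++ fs) x e)))
    ... | no ne = trans (cong (rep fs) (rep-miss a b (xs ++ fs) x ne)) (trans (fixed-++ xs x) (sym (rep-miss a b (xs ++ fs) x ne)))

    lab : Fin (n * n) → Fin (suc (n * n))
    lab x = if κ x == x then zero else suc x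

    lab-κ : ∀ x → lab (rep fs (κ x)) ≡ zero
    lab-κ x rewrite fixed-++ all-duals x | rep-idem (all-duals ++ fs) x | ==-refl (κ x) = refl

    side₀ : Fin n → Fin n → Fin (suc (n * n))
    side₀ u v = lab (rep fs (dart u v))

    pull : (Fin (suc (n * n)) → Bool) → Fin (n * n) → Bool
    pull s x = s (lab (rep fs x))

    pull-turning : ∀ s → Turning (pull s)
    pull-turning s u v e = cong (s ∘ lab) (rep-∈ fs (fs-i e))

    -- `coboundary` prescribes the values of `Z` on the cotree. The difference between `Z` and the
    -- resulting boundary is even and supported on the forest, hence zero.
    jordan₀ : ∀ (Z : Fin n → Fin n → Bool) → (∀ u v → Z u v ≡ Z v u) → (∀ u v → Z u v ≡ true → E G u v) →
      (∀ u → ⊕ (Z u) ≡ false) → ∃ λ s → ∀ u v → E G u v → s (side₀ u v) xor s (side₀ v u) ≡ Z u v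
    jordan₀ Z zs zp ze = s' , λ u v e → trans (cong₂ _xor_ (s'-t (dart u v)) (s'-t (dart v u))) (trans (t-∂ e) (exact u v e))
      where
      cb = coboundary dual (λ p → Z (proj₁ p) (proj₂ p)) (cotree es) fs enough
      s = proj₁ cb
      s-turning : Turning s
      s-turning u v e = proj₁ (proj₂ cb) (fs-i e)
      D : Fin n → Fin n → Bool
      D u v = Z u v xor ∂Z s u v
      D-zero : ∀ u v → D u v ≡ false
      D-zero = tree-zero D (λ u v → cong₂ _xor_ (zs u v) (∂Z-sym s u v)) supp (λ u → trans (⊕-xor (Z u) (∂Z s u)) (cong₂ _xor_ (ze u) (even-∂ s s-turning u)))
        λ {u} {v} i → trans (cong (Z u v xor_) (trans (cong (_∧ (s (dart u v) xor s (dart v u))) (proj₁ (edges-∈ G (cotree-⊆ es i)))) (proj₂ (proj₂ cb) i))) (Boolₚ.xor-same (Z u v))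
        where supp : ∀ u v → D u v ≡ true → E G u v
              supp u v z with bcase (Z u v)
              ... | inj₁ q = zp u v q
              ... | inj₂ q rewrite q = proj₁ (∧-t {adj G u v} z)
      exact : ∀ u v → E G u v → s (dart u v) xor s (dart v u) ≡ Z u v
      exact u v e = trans (sym (cong (_∧ (s (dart u v) xor s (dart v u))) e)) (sym (xor-f (Z u v) (∂Z s u v) (D-zero u v)))
      -- Subtracting the value on the representative face of each component makes the function
      -- vanish on the common outer face and leaves all boundaries unchanged.
      t : Fin (n * n) → Bool
      t x = s x xor s (κ x)
      t-fs : ∀ x → t (rep fs x) ≡ t x
      t-fs x = cong₂ _xor_ (rep-fun s fs (proj₁ (proj₂ cb)) x) (cong s (κ-fs x))
      t-∂ : ∀ {u v} → E G u v → t (dart u v) xor t (dart v u) ≡ s (dart u v) xor s (dart v u)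
      t-∂ {u} {v} e rewrite κ-dual e = canc (s (dart u v)) (s (dart v u)) (s (κ (dart v u)))
        where canc : ∀ p q r → (p xor r) xor (q xor r) ≡ p xor q
              canc p q true = trans (cong₂ _xor_ (Boolₚ.xor-comm p true) (Boolₚ.xor-comm q true)) (nn p q)
                where nn : ∀ p q → not p xor not q ≡ p xor q
                      nn true true = refl
                      nn true false = refl
                      nn false true = refl
                      nn false false = refl
              canc p q false = cong₂ _xor_ (Boolₚ.xor-identityʳ p) (Boolₚ.xor-identityʳ q)
      s' : Fin (suc (n * n)) → Bool
      s' zero = false
      s' (suc x) = t x
      s'-lab : ∀ x → s' (lab x) ≡ t x
      s'-lab x with κ x ≟ x
      ... | yes e = trans (cong s' lz) (sym (trans (cong (λ z → s x xor s z) e) (Boolₚ.xor-same (s x))))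
        where lz : lab x ≡ zero
              lz = cong (if_then zero else suc x) (trans (cong (_== x) e) (==-refl x))
      ... | no ne = cong s' ls
        where ls : lab x ≡ suc x
              ls = cong (if_then zero else suc x) (≢→== ne)
      s'-t : ∀ x → s' (lab (rep fs x)) ≡ t x
      s'-t x = trans (s'-lab (rep fs x)) (t-fs x)

    planar : Planarity G
    planar = record
      { m = suc (n * n) ; side = side₀
      ; even = λ s u → even-∂ (pull s) (pull-turning s) u
      ; jordan = jordan₀
      ; conn = λ s h u v u' v' _ _ → trans (to-outer s h (dart u v)) (sym (to-outer s h (dart u' v')))
      ; local = λ s u h v w e f → flat-around (pull s) (pull-turning s) u h v w e f }
      where
      to-outer : ∀ s → (∀ u v → E G u v → s (side₀ u v) ≡ s (side₀ v u)) → ∀ x → pull s x ≡ s zero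
      to-outer s h x = trans (sym (κ-fun (pull s) (pull-turning s) h x)) (cong s (lab-κ x))

-- Counting the faces of a rotation system by Euler's formula

does-i : ∀ {A : Set} (r : Dec A) → A → does r ≡ true
does-i (yes _) _ = refl
does-i (no h) a = ⊥-elim (h a)

pos-≢0 : ∀ {k} → 1 ≤ k → not (k ≡ᵇ 0) ≡ true
pos-≢0 {suc k} _ = refl

module EulerCount {n} (G : Graph n) (ρ : Fin n → Fin n → Fin n)
  (ρ-E : ∀ u v → E G u v → E G u (ρ u v)) (ρ-trans : ∀ u v w → E G u v → E G u w → ∃ λ k → iterate k (ρ u) v ≡ w)
  (euler-eq : n + numFaces G ρ ≡ numEdges G + eulerTarget G) where
  open Rotation G ρ ρ-E ρ-trans

  private
    N : ℕ
    N = n * n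

  Arc : Pair n → Set
  Arc d = E G (proj₁ d) (proj₂ d)

  step : Pair n → Pair n
  step = faceStep G ρ

  step-Arc : ∀ d → Arc d → Arc (step d)
  step-Arc (u , v) e = ρ-E v u (E-sym G e)

  step-inj : ∀ d d' → Arc d → Arc d' → step d ≡ step d' → d ≡ d'
  step-inj (u , v) (u' , v') e e' q = go (cong proj₁ q) (cong proj₂ q)
    where go : v ≡ v' → ρ v u ≡ ρ v' u' → (u , v) ≡ (u' , v')
          go refl r = cong (_, v) (ρ-inj v (E-sym G e) (E-sym G e') r)

  it : ℕ → Pair n → Pair n
  it k d = iterate k step d

  it-Arc : ∀ k d → Arc d → Arc (it k d)
  it-Arc zero d e = e
  it-Arc (suc k) d e = step-Arc (it k d) (it-Arc k d e)

  it-cancel : ∀ i j d → Arc d → it i d ≡ it (i + j) d → d ≡ it j d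
  it-cancel zero j d e q = q
  it-cancel (suc i) j d e q = it-cancel i j d e (step-inj _ _ (it-Arc i d e) (it-Arc (i + j) d e) q)

  code : Pair n → Fin N
  code (u , v) = dart u v

  code-inj : ∀ d d' → code d ≡ code d' → d ≡ d'
  code-inj (u , v) (u' , v') q = trans (sym (ends-dart u v)) (trans (cong ends q) (ends-dart u' v'))

  period : ∀ d → Arc d → ∃ λ p → suc p ≤ N × it (suc p) d ≡ d
  period d e with Finₚ.pigeonhole {N} {suc N} ℕₚ.≤-refl (λ i → code (it (toℕ i) d))
  ... | i , j , lt , q with ℕₚ.m≤n⇒∃[o]m+o≡n lt
  ... | o , r = o , ℕₚ.≤-trans (s≤s (ℕₚ.m≤n+m o (toℕ i))) (ℕₚ.≤-trans (ℕₚ.≤-reflexive r) (ℕₚ.≤-pred (Finₚ.toℕ<n j))) ,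
      sym (it-cancel (toℕ i) (suc o) d e (trans (code-inj _ _ q) (cong (λ k → it k d) (trans (sym r) (sym (ℕₚ.+-suc (toℕ i) o))))))

  -- Two of the first `n * n + 1` iterates coincide and face steps can be cancelled, so the `n * n`
  -- steps inspected by `isOrbitMin` exhaust the orbit.
  reduce : ∀ d → Arc d → ∀ k → ∃ λ k' → k' < N × it k d ≡ it k' d
  reduce d e k with period d e
  ... | p , le , q = k % suc p , ℕₚ.≤-trans (m%n<n k (suc p)) le ,
     trans (cong (λ i → it i d) (m≡m%n+[m/n]*n k (suc p))) (trans (iterate-+ (k % suc p) (k / suc p * suc p) step d) (cong (it (k % suc p)) (iterate-period (suc p) (k / suc p) step d q)))

  module Orbit (d₀ : Pair n) (e₀ : Arc d₀) where
    mem? : ∀ x → Dec (∃ λ (k : Fin N) → code (it (toℕ k) d₀) ≡ x)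
    mem? x = Finₚ.any? λ k → code (it (toℕ k) d₀) ≟ x

    mem : Fin N → Bool
    mem x = does (mem? x)

    mem-i : ∀ k d → it k d₀ ≡ d → mem (code d) ≡ true
    mem-i k d q with reduce d₀ e₀ k
    ... | k' , lt , r = does-i (mem? (code d)) (fromℕ< lt , cong code (trans (cong (λ i → it i d₀) (Finₚ.toℕ-fromℕ< lt)) (trans (sym r) q)))

    mem-t : ∀ d → mem (code d) ≡ true → ∃ λ k → k < N × it k d₀ ≡ d
    mem-t d m with decide (mem? (code d)) m
    ... | k , q = toℕ k , Finₚ.toℕ<n k , code-inj _ d q

    mem-turning : Turning mem
    mem-turning u v e = b-ext (λ m → let (k , _ , q) = mem-t (u , v) m in mem-i (suc k) (step (u , v)) (cong step q)) back
      where
      back : mem (code (step (u , v))) ≡ true → mem (code (u , v)) ≡ true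
      back m with mem-t (step (u , v)) m | period d₀ e₀
      ... | k , _ , q | p , _ , r = mem-i (k + p) (u , v) (step-inj _ _ (it-Arc (k + p) d₀ e₀) e (trans (cong (λ i → it i d₀) (sym (ℕₚ.+-suc k p))) (trans (iterate-+ k (suc p) step d₀) (trans (cong (it k) r) q))))

    same-orbit : ∀ d → rep fs (code d) ≡ rep fs (code d₀) → ∃ λ k → k < N × it k d₀ ≡ d
    same-orbit d q = mem-t d (trans (sym (inv (code d))) (trans (cong mem q) (trans (inv (code d₀)) (mem-i 0 d₀ refl))))
      where inv = rep-fun mem fs λ i → let (u , v , e , p , r) = fs-t i in trans (cong mem p) (trans (mem-turning u v e) (cong mem (sym r)))

  min-≤ : ∀ d k → isOrbitMin G ρ d ≡ true → k < N → dartKey G d ≤ dartKey G (it k d)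
  min-≤ d k m lt = ≤ᵇ-t (all-t (λ k → dartKey G d ≤ᵇ dartKey G (it k d)) {upTo N} m (∈-upTo⁺ lt))

  key-inj : ∀ d d' → dartKey G d ≡ dartKey G d' → d ≡ d'
  key-inj (u , v) (u' , v') q = code-inj _ _ (Finₚ.toℕ-injective (trans (key u v) (trans q (sym (key u' v')))))
    where key : ∀ u v → toℕ (dart u v) ≡ toℕ u * n + toℕ v
          key u v = trans (Finₚ.toℕ-combine u v) (cong (_+ toℕ v) (ℕₚ.*-comm n (toℕ u)))

  key-mono : ∀ d d' → isOrbitMin G ρ d ≡ true → (∃ λ k → k < N × it k d ≡ d') → dartKey G d ≤ dartKey G d'
  key-mono d d' m (k , lt , refl) = min-≤ d k m lt

  min-unique : ∀ d d' → Arc d → Arc d' → isOrbitMin G ρ d ≡ true → isOrbitMin G ρ d' ≡ true → rep fs (code d) ≡ rep fs (code d') → d ≡ d'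
  min-unique d d' e e' m m' q = key-inj d d' (ℕₚ.≤-antisym (key-mono d d' m (Orbit.same-orbit d e d' (sym q))) (key-mono d' d m' (Orbit.same-orbit d' e' d q)))

  dart-class : List (Pair N) → Sub N
  dart-class gs x = is-dart x ∧ fixed gs x

  is-dart-turn : ∀ x → is-dart (rep fs x) ≡ is-dart x
  is-dart-turn = rep-fun is-dart fs λ i → let (u , v , e , p , q) = fs-t i in trans (trans (cong is-dart p) (is-dart-i e)) (sym (trans (cong is-dart q) (is-dart-i (ρ-E v u (E-sym G e)))))

  -- Two minimal darts in the same class lie on each other's orbits, so each has the smaller key and
  -- they are equal.
  faces≤ : numFaces G ρ ≤ ∣ dart-class fs ∣
  faces≤ = ℕₚ.≤-trans (ℕₚ.≤-reflexive (count-cong (λ { (u , v) → refl }) (all-pairs n)))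
     (list-inj (dart-class fs) (λ d → rep fs (code d)) {filterᵇ pf (all-pairs n)} (filt-AllPairs pf (pairs-distinct n))
       (λ {d} i → ∧-i (trans (is-dart-turn (code d)) (is-dart-i (proj₁ (∧-t (∈-filt pf (all-pairs n) {d} i))))) (fixed-rep fs (code d)))
       (λ {d} {d'} i j → let (e , m) = ∧-t (∈-filt pf (all-pairs n) {d} i)
                             (e' , m') = ∧-t (∈-filt pf (all-pairs n) {d'} j) in min-unique d d' e e' m m'))
    where
    pf : Pair n → Bool
    pf d = adj G (proj₁ d) (proj₂ d) ∧ isOrbitMin G ρ d

  leader : ∀ u → ∃ λ w → rep es w ≡ rep es u × (∀ x → rep es x ≡ rep es u → toℕ w ≤ toℕ x)
  leader u = least (λ w → rep es w ≟ rep es u) (u , refl)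

  ld : Fin n → Fin n
  ld u = proj₁ (leader u)

  edge-class : ∀ {u v} → E G u v → rep es u ≡ rep es v
  edge-class {u} {v} e with ℕₚ.<-cmp (toℕ u) (toℕ v)
  ... | tri< l _ _ = rep-∈ es (∈-edges G e l)
  ... | tri≈ _ q _ = cong (rep es) (Finₚ.toℕ-injective q)
  ... | tri> _ _ l = sym (rep-∈ es (∈-edges G (E-sym G e) l))

  reach-class : ∀ k w u → reach G k w u ≡ true → rep es w ≡ rep es u
  reach-class zero w u r = cong (rep es) (Finₚ.toℕ-injective (≡ᵇ-t r))
  reach-class (suc k) w u r with ∨-t {reach G k w u} r
  ... | inj₁ q = reach-class k w u q
  ... | inj₂ q with any-t (λ x → reach G k w x ∧ adj G x u) (allFin n) q
  ... | x , s = trans (reach-class k w x (proj₁ (∧-t {reach G k w x} s))) (edge-class (proj₂ (∧-t {reach G k w x} s)))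

  -- Whatever the least vertex of a class reaches lies in its class and is not smaller.
  ld-rep : ∀ u → isComponentRep G (ld u) ≡ true
  ld-rep u = all-i (λ x → not (reach G n (ld u) x) ∨ (toℕ (ld u) ≤ᵇ toℕ x)) (allFin n) k
    where k : ∀ x → not (reach G n (ld u) x) ∨ (toℕ (ld u) ≤ᵇ toℕ x) ≡ true
          k x with bcase (reach G n (ld u) x)
          ... | inj₂ r rewrite r = refl
          ... | inj₁ r = ∨-ir {not (reach G n (ld u) x)} (t-≤ᵇ (proj₂ (proj₂ (leader u)) x (trans (sym (reach-class n (ld u) x r)) (proj₁ (proj₂ (leader u))))))

  ld-class : ∀ {u u'} → ld u ≡ ld u' → rep es u ≡ rep es u'
  ld-class {u} {u'} q = trans (sym (proj₁ (proj₂ (leader u)))) (trans (cong (rep es) q) (proj₁ (proj₂ (leader u'))))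

  ld-active : ∀ {u v} → E G u v → active G (ld u) ≡ true
  ld-active {u} {v} e = trans (sym (inv (ld u))) (trans (cong (active G) (proj₁ (proj₂ (leader u)))) (trans (inv u) (active-i G e)))
    where inv = rep-fun (active G) es λ i → let f = proj₁ (edges-∈ G i) in trans (active-i G f) (sym (active-i G (E-sym G f)))

  -- The representatives of components with an edge, which contribute 2 instead of 1 to
  -- `eulerTarget`.
  root : Sub n
  root v = isComponentRep G v ∧ not (deg G v ≡ᵇ 0)

  ld-root : ∀ {u v} → E G u v → root (ld u) ≡ true
  ld-root {u} e = ∧-i (ld-rep u) (pos-≢0 (ℕₚ.≤-trans (dg-≥ G (ld u) {proj₁ a ∷ []} ([] ∷ []) (proj₂ a ∷ [])) (ℕₚ.≤-reflexive (sym (deg≡dg G (ld u))))))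
    where a = active-t G (ld-active e)

  gs : List (Pair N)
  gs = map dual (cotree es) ++ fs

  -- The class of a dart under fs and the dual cotree has a boundary contained in the forest, so it is a union of whole components.
  component-class : ∀ {u v u' v'} → E G u v → E G u' v' → rep es u ≡ rep es u' → rep gs (dart u v) ≡ rep gs (dart u' v')
  component-class {u} {v} {u'} {v'} e e' q = sym (==→≡ {i = rep gs (dart u' v')} {rep gs (dart u v)} (trans (sym (h-at e')) (trans (sym (inv u')) (trans (cong h (sym q)) (trans (inv u) (trans (h-at e) (==-refl (rep gs (dart u v)))))))))
    where
    s : Fin N → Bool
    s x = rep gs x == rep gs (dart u v)
    s-turning : Turning s
    s-turning u v e = cong (_== _) (rep-++ (map dual (cotree es)) fs (rep-∈ fs (fs-i e)))
    flat : ∀ u → Flat s u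
    flat = flat-everywhere s s-turning λ i → cong (_== _) (rep-∈ gs (in-++ (∈-map dual i)))
      where in-++ : ∀ {A : Set} {x : A} {xs ys} → x ∈ xs → x ∈ xs ++ ys
            in-++ (here e) = here e
            in-++ (there i) = there (in-++ i)
    h? : ∀ w → Dec (∃ λ x → E G w x × s (dart w x) ≡ true)
    h? w = Finₚ.any? λ x → E? G w x ×-dec (s (dart w x) ≟b true)
    h : Fin n → Bool
    h w = does (h? w)
    h-at : ∀ {w x} → E G w x → h w ≡ s (dart w x)
    h-at {w} {x} f = b-ext (λ t → let (y , g , r) = decide (h? w) t in trans (flat-around s s-turning w (flat w) x y f g) r) (λ r → does-i (h? w) (x , f , r))
    inv : ∀ w → h (rep es w) ≡ h w
    inv = rep-fun h es λ {a} {b} i → let f = proj₁ (edges-∈ G i) in trans (h-at f) (trans (flat a b f) (sym (h-at (E-sym G f))))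

  classes≤ : ∣ dart-class gs ∣ ≤ ∣ root ∣
  classes≤ = card-inj (dart-class gs) root (λ x → ld (proj₁ (ends x))) (λ x t → ld-root (proj₁ (∧-t {is-dart x} t))) inj
    where
    inj : ∀ x y → dart-class gs x ≡ true → dart-class gs y ≡ true → ld (proj₁ (ends x)) ≡ ld (proj₁ (ends y)) → x ≡ y
    inj x y a b q with ∧-t {is-dart x} a | ∧-t {is-dart y} b
    ... | ex , fx | ey , fy = trans (sym (==→≡ {i = rep gs x} {x} fx)) (trans (trans (cong (rep gs) (sym (dart-ends x))) (trans (component-class ex ey (ld-class q)) (cong (rep gs) (dart-ends y)))) (==→≡ {i = rep gs y} {y} fy))

  components≤ : classes es ≤ ∣ isComponentRep G ∣
  components≤ = card-inj (fixed es) (isComponentRep G) ld (λ u _ → ld-rep u)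
    λ u v fu fv q → trans (sym (==→≡ {i = rep es u} {u} fu)) (trans (ld-class q) (==→≡ {i = rep es v} {v} fv))

  target : eulerTarget G ≡ ∣ isComponentRep G ∣ + ∣ root ∣
  target = trans (sum-map (λ v → if isComponentRep G v then (if deg G v ≡ᵇ 0 then 1 else 2) else 0) id)
     (trans (∑-cong {f = λ v → if isComponentRep G v then (if deg G v ≡ᵇ 0 then 1 else 2) else 0} {λ v → 𝟙 (isComponentRep G v) + 𝟙 (root v)} λ v → k (isComponentRep G v) (deg G v ≡ᵇ 0)) (∑-+ (𝟙 ∘ isComponentRep G) (𝟙 ∘ root)))
    where k : ∀ a b → (if a then (if b then 1 else 2) else 0) ≡ 𝟙 a + 𝟙 (a ∧ not b)
          k true true = refl
          k true false = refl
          k false b = refl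

  -- Codes of non-adjacent pairs. No pair of `fs` involves them, and they enter both sides of the
  -- comparison of classes with the same count.
  other : Sub N
  other x = not (is-dart x)

  classes-split : ∀ hs → classes hs ≤ ∣ dart-class hs ∣ + ∣ other ∣
  classes-split hs = ℕₚ.≤-trans (∑-mono {f = 𝟙 ∘ fixed hs} {λ x → 𝟙 (dart-class hs x) + 𝟙 (other x)} λ x → k (is-dart x) (fixed hs x)) (ℕₚ.≤-reflexive (∑-+ (𝟙 ∘ dart-class hs) (𝟙 ∘ other)))
    where k : ∀ d f → 𝟙 f ≤ 𝟙 (d ∧ f) + 𝟙 (not d)
          k true f = ℕₚ.m≤m+n _ 0
          k false true = s≤s z≤n
          k false false = z≤n

  classes-join : ∣ dart-class fs ∣ + ∣ other ∣ ≤ classes fs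
  classes-join = ℕₚ.≤-trans (ℕₚ.≤-reflexive (sym (∑-+ (𝟙 ∘ dart-class fs) (𝟙 ∘ other)))) (∑-mono {f = λ x → 𝟙 (dart-class fs x) + 𝟙 (other x)} {𝟙 ∘ fixed fs} λ x → k (is-dart x) (fixed fs x) (still x))
    where
    k : ∀ d f → (d ≡ false → f ≡ true) → 𝟙 (d ∧ f) + 𝟙 (not d) ≤ 𝟙 f
    k true f h = ℕₚ.≤-reflexive (ℕₚ.+-identityʳ _)
    k false f h rewrite h refl = s≤s z≤n
    Both : Fin N → Fin N → Set
    Both x y = (x ≡ y) ⊎ (is-dart x ≡ true × is-dart y ≡ true)
    both : ∀ x → Both (rep fs x) x
    both = rep-rel Both (λ _ → inj₁ refl) (λ { (inj₁ e) → inj₁ (sym e) ; (inj₂ (a , b)) → inj₂ (b , a) })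
      (λ { (inj₁ refl) q → q ; (inj₂ p) (inj₁ refl) → inj₂ p ; (inj₂ (a , _)) (inj₂ (_ , b)) → inj₂ (a , b) })
      fs (λ i → let (u , v , e , p , q) = fs-t i in inj₂ (trans (cong is-dart p) (is-dart-i e) , trans (cong is-dart q) (is-dart-i (ρ-E v u (E-sym G e)))))
    still : ∀ x → is-dart x ≡ false → fixed fs x ≡ true
    still x d with both x
    ... | inj₁ e = trans (cong (_== x) e) (==-refl x)
    ... | inj₂ (_ , t) = tf t d

  edges≡ : numEdges G ≡ length es
  edges≡ = count-cong (λ { (u , v) → refl }) (all-pairs n)

  enough : classes gs + length (cotree es) ≤ classes fs
  enough = ℕₚ.≤-trans (ℕₚ.+-monoˡ-≤ (length (cotree es)) (ℕₚ.≤-trans (classes-split gs) (ℕₚ.+-monoˡ-≤ (∣ other ∣) classes≤)))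
    (ℕₚ.≤-trans (ℕₚ.≤-trans (ℕₚ.≤-reflexive (ar (∣ root ∣) (∣ other ∣) (length (cotree es)))) (ℕₚ.+-monoˡ-≤ (∣ other ∣) (ℕₚ.≤-trans faces faces≤))) classes-join)
    where
    ar : ∀ r o c → r + o + c ≡ r + c + o
    ar = solve-∀
    -- Since n is the number of components plus the size of the forest, and the edges are forest
    -- plus cotree, Euler's formula leaves a face for every cotree edge and for every component with
    -- an edge.
    faces : ∣ root ∣ + length (cotree es) ≤ numFaces G ρ
    faces = farkas 0 (ℕₚ.+-mono-≤ (ℕₚ.+-mono-≤ components≤ (ℕₚ.≤-reflexive (tree-cotree es))) (ℕₚ.+-mono-≤ (ℕₚ.≤-reflexive (sym (tree-classes es))) (ℕₚ.≤-reflexive (trans (cong₂ _+_ (sym edges≡) (sym target)) (sym euler-eq)))))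
       (lem (∣ root ∣) (length (cotree es)) (∣ isComponentRep G ∣) (length (tree es)) (length es) n (numFaces G ρ) (classes es))
      where lem : ∀ r c k t e n f m → r + c + (k + e + (m + t + (n + f))) + 0 ≡ f + (m + (t + c) + (n + (e + (k + r))))
            lem = solve-∀

planarity : ∀ {n} (G : Graph n) → Planar G → Planarity G
planarity G (ρ , (ρ-E , ρ-trans) , eq) = Rotation.Many.planar G ρ ρ-E ρ-trans (EulerCount.enough G ρ ρ-E ρ-trans eq)

-- Triangles as increasing triples

Among : ∀ {n} → Fin n → Fin n × Fin n × Fin n → Set
Among w (a , b , c) = (w ≡ a) ⊎ (w ≡ b) ⊎ (w ≡ c)

sorted : ∀ {n} (G : Graph n) {a b c} → Tri G a b c → ∃ λ t → IsTriangle G t × Among a t × (∀ w → Among w t → Among w (a , b , c))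
sorted G {a} {b} {c} (ab , bc , ac) with ℕₚ.<-cmp (toℕ a) (toℕ b) | ℕₚ.<-cmp (toℕ b) (toℕ c) | ℕₚ.<-cmp (toℕ a) (toℕ c)
... | tri≈ _ q _ | _ | _ = ⊥-elim (E-irr G ab (Finₚ.toℕ-injective q))
... | _ | tri≈ _ q _ | _ = ⊥-elim (E-irr G bc (Finₚ.toℕ-injective q))
... | _ | _ | tri≈ _ q _ = ⊥-elim (E-irr G ac (Finₚ.toℕ-injective q))
... | tri< p _ _ | tri< q _ _ | _ = (a , b , c) , (p , q , ab , bc , ac) , inj₁ refl , λ w i → i
... | tri< p _ _ | tri> _ _ q | tri< r _ _ = (a , c , b) , (r , q , ac , E-sym G bc , ab) , inj₁ refl ,
  λ { w (inj₁ e) → inj₁ e ; w (inj₂ (inj₁ e)) → inj₂ (inj₂ e) ; w (inj₂ (inj₂ e)) → inj₂ (inj₁ e) }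
... | tri< p _ _ | tri> _ _ q | tri> _ _ r = (c , a , b) , (r , p , E-sym G ac , ab , E-sym G bc) , inj₂ (inj₁ refl) ,
  λ { w (inj₁ e) → inj₂ (inj₂ e) ; w (inj₂ (inj₁ e)) → inj₁ e ; w (inj₂ (inj₂ e)) → inj₂ (inj₁ e) }
... | tri> _ _ p | tri< q _ _ | tri< r _ _ = (b , a , c) , (p , r , E-sym G ab , ac , bc) , inj₂ (inj₁ refl) ,
  λ { w (inj₁ e) → inj₂ (inj₁ e) ; w (inj₂ (inj₁ e)) → inj₁ e ; w (inj₂ (inj₂ e)) → inj₂ (inj₂ e) }
... | tri> _ _ p | tri< q _ _ | tri> _ _ r = (b , c , a) , (q , r , bc , E-sym G ac , E-sym G ab) , inj₂ (inj₂ refl) ,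
  λ { w (inj₁ e) → inj₂ (inj₁ e) ; w (inj₂ (inj₁ e)) → inj₂ (inj₂ e) ; w (inj₂ (inj₂ e)) → inj₁ e }
... | tri> _ _ p | tri> _ _ q | _ = (c , b , a) , (q , p , E-sym G bc , E-sym G ab , E-sym G ac) , inj₂ (inj₂ refl) ,
  λ { w (inj₁ e) → inj₂ (inj₂ e) ; w (inj₂ (inj₁ e)) → inj₂ (inj₁ e) ; w (inj₂ (inj₂ e)) → inj₁ e }

one-triangle : ∀ {n} {G : Graph n} → AtMostOneTriangle G → OneTri G
one-triangle {G = G} u T T' with sorted G T | sorted G T'
... | t , i , _ , back | t' , i' , x∈ , _ = back _ (subst (Among _) (u t' t i' i) x∈)

theorem18 : (n : ℕ) (G : SimpleGraph n) → Planar G → AtMostOneTriangle G →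
            HasIndependentNbhdVertex G → HasAdynamic3Coloring G
theorem18 n G pl one (v , d2 , ind) = recast (adynamic (e2 G) G (planarity G pl) (one-triangle {G = G} one) ℕₚ.≤-refl
    (v , subst (2 ≤_) (deg≡dg G v) d2 , λ u w e f g → tf g (ind u w e f)))
  where
  recast : Adynamic G → HasAdynamic3Coloring G
  recast (φ , pr , w , d , mo) = φ , pr , w , subst (2 ≤_) (sym (deg≡dg G w)) d , mo
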